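{- Let $\sigma$ be a connected skew Young diagram whose topmost row is row $1$, and fix eventually-zero nonnegative integer sequences $\mathbf{c}$ and $\mathbf{e}$. Then $$|\mathrm{SS}_{\mathbf{c},\mathbf{e}}(\sigma)| \;=\; \sum_{\mu\supseteq\sigma} (-1)^{|A(\mu/\sigma)|}\, a_{\sigma,\mu,\mathbf{e}}\, |\mathrm{SS}_{\mathbf{c},\mathbf{0}}(\mu)|,$$ where $a_{\sigma,\mu,\mathbf{e}}$ is the number of pairs $(T',T'')$ such that $T'$ is a row-weakly-bounded semistandard tableau on $A(\mu/\sigma)$, $T''$ is a reverse row-strict, row-bounded tableau on $B(\mu/\sigma)$, and $c(T')+c(T'')=\mathbf{e}$.
   Context: Boxes are pairs $(i,j)$ of positive integers, $i$ the row index (increasing downward), $j$ the column index (increasing to the right); $(i,j)\preceq(i',j')$ iff $i\le i'$, $j\le j'$. A skew Young diagram (skew shape) is a finite set of boxes closed under intervals; connected means its Hasse diagram under $\preceq$ is connected. Rows are numbered so that the top row of $\sigma$ is row 1. Containment convention: $\mu\supseteq\sigma$ means every box of $\sigma$ is in $\mu$ and every box of $\mu$ is in the same column as some box of $\sigma$. Then $\mu\setminus\sigma$ splits into $A(\mu/\sigma)$ (boxes above boxes of $\sigma$ in their column) and $B(\mu/\sigma)$ (boxes below). A tableau assigns a positive integer to each box; semistandard: rows weakly increasing left to right, columns strictly increasing top to bottom; reverse row-strict: rows strictly decreasing left to right, columns weakly decreasing top to bottom; row-bounded: $T(i,j)<i$; row-weakly-bounded: $T(i,j)\le i$. Content $c(T)=(c_1,c_2,\ldots)$,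 $c_i$ = number of occurrences of label $i$. A set-valued tableau assigns a nonempty finite set of positive integers to each box; it is semistandard if along rows $\max$ of each box $\le\min$ of the next box to the right, and down columns $\max$ of each box $<\min$ of the box below. Its excess $e(T)$ has $i$-th entry equal to the number of labels in row $i$ minus the number of boxes in row $i$. $\mathrm{SS}_{\mathbf{c},\mathbf{e}}(\sigma)$ is the set of semistandard set-valued tableaux of shape $\sigma$ with content $\mathbf{c}$ and excess $\mathbf{e}$ (so $\mathrm{SS}_{\mathbf{c},\mathbf{0}}(\mu)$ is in bijection with ordinary semistandard tableaux of shape $\mu$ and content $\mathbf{c}$). -}

module Defs where

open import Data.Nat using (ℕ; zero; suc; _+_; _≤_; _<_; _≟_)
open import Data.Integer using (ℤ; +_; _-_)
open import Data.Product using (Σ; ∃; _×_; _,_; proj₁; proj₂)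
open import Data.Sum using (_⊎_)
open import Data.List using (List; []; _∷_; map; length; filter; concatMap)
open import Data.List.Membership.Propositional using (_∈_; _∉_)
open import Data.Fin using (Fin)
open import Data.Unit using (⊤)
open import Data.Empty using (⊥)
open import Data.Refinement using (Refinement)
open import Function.Bundles using (_↔_)
open import Relation.Binary.PropositionalEquality using (_≡_; _≢_)
open import Relation.Binary.Construct.Closure.Equivalence using (EqClosure)

-- Boxes (i , j): i = row (increasing downward), j = column.

Box : Set
Box = ℕ × ℕ

row : Box → ℕ
row = proj₁

col : Box → ℕ
col = proj₂

_⪯_ : Box → Box → Set
b ⪯ d = row b ≤ row d × col b ≤ col d

-- strict lexicographic order on boxes (only used to make finite sets
-- of boxes canonical, i.e. to represent them by sorted lists)
_<ᴮ_ : Box → Box → Set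
b <ᴮ d = row b < row d ⊎ (row b ≡ row d × col b < col d)

SortedB : List Box → Set
SortedB []           = ⊤
SortedB (b ∷ [])     = ⊤
SortedB (b ∷ d ∷ bs) = b <ᴮ d × SortedB (d ∷ bs)

SortedN : List ℕ → Set
SortedN []           = ⊤
SortedN (x ∷ [])     = ⊤
SortedN (x ∷ y ∷ xs) = x < y × SortedN (y ∷ xs)

IsSkew : List Box → Set
IsSkew S = (∀ b → b ∈ S → 1 ≤ row b × 1 ≤ col b)
         × (∀ b d x → b ∈ S → d ∈ S → b ⪯ x → x ⪯ d → x ∈ S)

Cover : List Box → Box → Box → Set
Cover S b d = b ∈ S × d ∈ S × b ⪯ d × b ≢ d
            × (∀ x → x ∈ S → b ⪯ x → x ⪯ d → x ≡ b ⊎ x ≡ d)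

Connected : List Box → Set
Connected S = ∀ b d → b ∈ S → d ∈ S → EqClosure (Cover S) b d

TopRow1 : List Box → Set
TopRow1 S = ∃ λ j → (1 , j) ∈ S

EventuallyZero : (ℕ → ℕ) → Set
EventuallyZero c = ∃ λ N → ∀ k → N ≤ k → c k ≡ 0

Contains : List Box → List Box → Set
Contains μ σ = (∀ b → b ∈ σ → b ∈ μ)
             × (∀ b → b ∈ μ → ∃ λ d → d ∈ σ × col d ≡ col b)

InA : List Box → List Box → Box → Set
InA μ σ b = b ∈ μ × b ∉ σ × ∃ λ d → d ∈ σ × col d ≡ col b × row b < row d

InB : List Box → List Box → Box → Set
InB μ σ b = b ∈ μ × b ∉ σ × ∃ λ d → d ∈ σ × col d ≡ col b × row d < row b

-- Fillings: a finite map from boxes to values, as a list of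
-- (box , value) pairs sorted strictly by box (canonical representation).

Filling : Set → Set
Filling V = List (Box × V)

keys : ∀ {V} → Filling V → List Box
keys = map proj₁

OnDomain : ∀ {V} → Filling V → (Box → Set) → Set
OnDomain F D = SortedB (keys F)
             × (∀ b → b ∈ keys F → D b) × (∀ b → D b → b ∈ keys F)

PositiveT : Filling ℕ → Set
PositiveT F = ∀ b v → (b , v) ∈ F → 1 ≤ v

SemistandardT : Filling ℕ → Set
SemistandardT F = ∀ b v d w → (b , v) ∈ F → (d , w) ∈ F →
    (row b ≡ row d → col b < col d → v ≤ w)
  × (col b ≡ col d → row b < row d → v < w)

ReverseRowStrictT : Filling ℕ → Set
ReverseRowStrictT F = ∀ b v d w → (b , v) ∈ F → (d , w) ∈ F →
    (row b ≡ row d → col b < col d → w < v)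
  × (col b ≡ col d → row b < row d → w ≤ v)

RowBoundedT : Filling ℕ → Set
RowBoundedT F = ∀ b v → (b , v) ∈ F → v < row b

RowWeaklyBoundedT : Filling ℕ → Set
RowWeaklyBoundedT F = ∀ b v → (b , v) ∈ F → v ≤ row b

contentT : ℕ → Filling ℕ → ℕ
contentT k F = length (filter (λ x → x ≟ k) (map proj₂ F))

-- Set-valued tableaux: each box carries a nonempty finite set of positive
-- integers, represented canonically by a strictly increasing nonempty list.

NonEmpty : List ℕ → Set
NonEmpty []      = ⊥
NonEmpty (_ ∷ _) = ⊤

ValidSetsSV : Filling (List ℕ) → Set
ValidSetsSV F = ∀ b X → (b , X) ∈ F →
  NonEmpty X × SortedN X × (∀ x → x ∈ X → 1 ≤ x)

SemistandardSV : Filling (List ℕ) → Set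
SemistandardSV F = ∀ b X d Y → (b , X) ∈ F → (d , Y) ∈ F →
    (row b ≡ row d → col b < col d → ∀ x y → x ∈ X → y ∈ Y → x ≤ y)
  × (col b ≡ col d → row b < row d → ∀ x y → x ∈ X → y ∈ Y → x < y)

contentSV : ℕ → Filling (List ℕ) → ℕ
contentSV k F = length (filter (λ x → x ≟ k) (concatMap proj₂ F))

rowPart : ∀ {V} → ℕ → Filling V → Filling V
rowPart i F = filter (λ p → row (proj₁ p) ≟ i) F

rowLabels : ℕ → Filling (List ℕ) → ℕ
rowLabels i F = length (concatMap proj₂ (rowPart i F))

rowBoxes : ℕ → Filling (List ℕ) → ℕ
rowBoxes i F = length (rowPart i F)

-- T ∈ SS_{c,e}(σ).  Sequences are indexed from 1 (index 0 is unused).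
IsSS : List Box → (ℕ → ℕ) → (ℕ → ℕ) → Filling (List ℕ) → Set
IsSS σ c e T = OnDomain T (λ b → b ∈ σ) × ValidSetsSV T × SemistandardSV T
             × (∀ k → 1 ≤ k → contentSV k T ≡ c k)
             × (∀ i → 1 ≤ i → rowLabels i T ≡ rowBoxes i T + e i)

SS : List Box → (ℕ → ℕ) → (ℕ → ℕ) → Set
SS σ c e = Refinement (Filling (List ℕ)) (IsSS σ c e)

zeroSeq : ℕ → ℕ
zeroSeq _ = 0

-- Terms of the right-hand side: quadruples (μ , T' , T'' , T) with
-- μ ⊇ σ a skew shape, (T' , T'') a pair counted by a_{σ,μ,e}, and
-- T ∈ SS_{c,0}(μ).  The sign is (-1)^{|A(μ/σ)|} = (-1)^{#boxes of T'}.

IsTerm : List Box → (ℕ → ℕ) → (ℕ → ℕ) →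
         List Box × Filling ℕ × Filling ℕ × Filling (List ℕ) → Set
IsTerm σ c e (μ , T′ , T″ , T) =
    (SortedB μ × IsSkew μ × Contains μ σ)
  × (OnDomain T′ (InA μ σ) × PositiveT T′ × SemistandardT T′ × RowWeaklyBoundedT T′)
  × (OnDomain T″ (InB μ σ) × PositiveT T″ × ReverseRowStrictT T″ × RowBoundedT T″)
  × (∀ k → 1 ≤ k → contentT k T′ + contentT k T″ ≡ e k)
  × IsSS μ c zeroSeq T

data Parity : Set where
  even odd : Parity

parity : ℕ → Parity
parity zero          = even
parity (suc zero)    = odd
parity (suc (suc n)) = parity n

-- terms whose sign (-1)^{|A(μ/σ)|} is +1 (p = even) or -1 (p = odd)
Terms : Parity → List Box → (ℕ → ℕ) → (ℕ → ℕ) → Set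
Terms p σ c e = Refinement (List Box × Filling ℕ × Filling ℕ × Filling (List ℕ))
  (λ q → IsTerm σ c e q × parity (length (proj₁ (proj₂ q))) ≡ p)

HasCard : Set → ℕ → Set
HasCard A n = Fin n ↔ A

{-# OPTIONS --safe #-}

-- A semistandard filling is the chain of its level sets, one horizontal strip per label. In a set-valued
-- tableau the minima form such a chain, and the remaining labels of a row form a set E: the label x of E
-- sits in the last box of the row whose minimum is < x, which is possible iff the box below it has a label > x.
-- T′ and T″ are chains of strips as well: the boxes labelled s form a horizontal strip removed from the inner
-- shape and a vertical strip added to the outer shape, in rows ≥ s and > s respectively.
--
-- It suffices to trade the set E of one row s for the boxes labelled s. Let V be the operator removing a
-- vertical strip below row s. Moving V through the horizontal strip of one label changes V H into (1 + u) H V,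
-- the factor u recording that this label is put into E, and being absent exactly if the label is not allowed
-- there. At the inner end V meets the signed sum over the removed horizontal strips: below row s everything
-- cancels, and in row s a box added to the left of the row with label x cancels against x ∈ E; what survives
-- is the set-valued row. Doing this for all rows, starting from the last one, gives the theorem.

module Submission where

open import Defs
open import Data.Empty using (⊥; ⊥-elim; ⊥-elim-irr)
open import Data.Fin using (Fin)
open import Data.Integer using (ℤ; 0ℤ; 1ℤ) renaming (_+_ to _+ᶻ_; -_ to -ᶻ_)
import Data.Integer.Properties as ℤₚ
open import Data.Irrelevant using ([_])
open import Data.List using (List; []; _∷_; map; concatMap; upTo; applyUpTo; length; filter; _++_; lookup)
open import Data.List.Properties using (upTo-∷ʳ; length-++; length-map)
import Data.List.Properties as Listₚ
import Data.List.Membership.DecPropositional as DecMembership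
open import Data.List.Membership.Propositional using (_∈_; _∉_; find; lose)
open import Data.List.Membership.Propositional.Properties
  using (∈-applyUpTo⁻; ∈-applyUpTo⁺; ∈-upTo⁺; ∈-concatMap⁺; ∈-concatMap⁻; ∈-map⁺; ∈-map⁻; ∈-filter⁺; ∈-filter⁻; ∈-lookup)
import Data.List.Relation.Unary.All as ListAll
open ListAll using ([]; _∷_)
import Data.List.Relation.Unary.All.Properties as ListAllₚ
open import Data.List.Relation.Unary.AllPairs using (AllPairs; []; _∷_)
import Data.List.Relation.Unary.AllPairs as AllPairs
import Data.List.Relation.Unary.AllPairs.Properties as AllPairsₚ
open import Data.List.Relation.Unary.Any using (here; there)
import Data.List.Relation.Unary.Any as Any
import Data.List.Relation.Unary.Any.Properties as Anyₚ
open import Data.List.Relation.Unary.Linked using (Linked; []; [-]; _∷_)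
open import Data.List.Relation.Unary.Linked.Properties using (Linked⇒AllPairs; AllPairs⇒Linked)
open import Data.List.Relation.Unary.Unique.Propositional using (Unique)
import Data.List.Relation.Unary.Unique.Propositional.Properties as Uniqueₚ
open import Data.Nat hiding (parity)
open import Data.Nat.Properties
open import Data.Nat.Tactic.RingSolver using (solve-∀)
open import Data.Product using (Σ; ∃; _×_; _,_; proj₁; proj₂)
import Data.Product.Properties
open import Data.Refinement using (Refinement; _,_; value-injective)
open import Data.Sum using (_⊎_; inj₁; inj₂; [_,_]′)
open import Data.Unit using (⊤; tt)
open import Data.Vec using (Vec; []; _∷_; sum)
import Data.Vec as Vec
open import Data.Vec.Properties using (≡-dec)
open import Data.Vec.Relation.Unary.All using (All; []; _∷_) renaming (map to mapAll)
open import Function using (_∘_; id)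
open import Function.Bundles using (mk↔ₛ′)
open import Relation.Binary.Construct.Closure.Equivalence using (EqClosure)
open import Relation.Binary.Construct.Closure.ReflexiveTransitive using (_◅_) renaming (ε to refl⋆)
open import Relation.Binary.Construct.Closure.Symmetric using (fwd; bwd)
open import Relation.Binary.Definitions using (DecidableEquality; tri<; tri≈; tri>)
open import Relation.Binary.PropositionalEquality
open import Relation.Nullary using (¬_; Dec; yes; no; contradiction)
open import Relation.Nullary.Decidable using (_×-dec_; _⊎-dec_; decidable-stable; ¬?)

-- Finite sums

-- Connectedness makes the columns of σ an interval, from β + 1, the first column of the last row,
-- to W, the last column of the first row. As `Contains` confines μ to these columns, A(μ/σ) and
-- B(μ/σ) are exactly the regions between the left borders and between the right borders of μ and σ,
-- and all row ends lie between β and W. The number of rows is the obstacle: V commutes with a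
-- horizontal strip only if the vector of row ends still has an empty last row, where the carried
-- bit must die. A strip fills at most one new row, so as many spare rows as there are labels
-- suffice; the same number bounds the rows below σ of any μ that admits an ordinary tableau. Signs
-- are summed in ℤ instead of being matched by an involution. Cardinalities come in afterwards,
-- through duplicate-free lists of codes; since an ordinary tableau is a set-valued one without
-- extra labels, the same codes describe both sides.

interchange : ∀ a b c d → (a +ᶻ b) +ᶻ (c +ᶻ d) ≡ (a +ᶻ c) +ᶻ (b +ᶻ d)
interchange a b c d = begin
  (a +ᶻ b) +ᶻ (c +ᶻ d) ≡⟨ ℤₚ.+-assoc a b _ ⟩
  a +ᶻ (b +ᶻ (c +ᶻ d)) ≡⟨ cong (a +ᶻ_) (sym (ℤₚ.+-assoc b c d)) ⟩
  a +ᶻ ((b +ᶻ c) +ᶻ d) ≡⟨ cong (λ z → a +ᶻ (z +ᶻ d)) (ℤₚ.+-comm b c) ⟩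
  a +ᶻ ((c +ᶻ b) +ᶻ d) ≡⟨ cong (a +ᶻ_) (ℤₚ.+-assoc c b d) ⟩
  a +ᶻ (c +ᶻ (b +ᶻ d)) ≡⟨ sym (ℤₚ.+-assoc a c _) ⟩
  (a +ᶻ c) +ᶻ (b +ᶻ d) ∎ where open ≡-Reasoning

-- Opaque, so that sums over explicit lists stay folded and can be matched by unification.
opaque
  ∑ : {A : Set} → List A → (A → ℤ) → ℤ
  ∑ []       f = 0ℤ
  ∑ (x ∷ xs) f = f x +ᶻ ∑ xs f

  ∑-[] : ∀ {A : Set} (f : A → ℤ) → ∑ [] f ≡ 0ℤ
  ∑-[] f = refl

  ∑-∷ : ∀ {A : Set} x (xs : List A) f → ∑ (x ∷ xs) f ≡ f x +ᶻ ∑ xs f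
  ∑-∷ x xs f = refl

  ∑-cong∈ : ∀ {A : Set} (xs : List A) {f g} → (∀ x → x ∈ xs → f x ≡ g x) → ∑ xs f ≡ ∑ xs g
  ∑-cong∈ []       eq = refl
  ∑-cong∈ (x ∷ xs) eq = cong₂ _+ᶻ_ (eq x (here refl)) (∑-cong∈ xs (λ y y∈ → eq y (there y∈)))

  ∑-cong : ∀ {A : Set} (xs : List A) {f g} → (∀ x → f x ≡ g x) → ∑ xs f ≡ ∑ xs g
  ∑-cong xs eq = ∑-cong∈ xs (λ x _ → eq x)

  ∑-0 : ∀ {A : Set} (xs : List A) → ∑ xs (λ _ → 0ℤ) ≡ 0ℤ
  ∑-0 []       = refl
  ∑-0 (x ∷ xs) = trans (ℤₚ.+-identityˡ _) (∑-0 xs)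

  ∑-≡0 : ∀ {A : Set} (xs : List A) {f} → (∀ x → x ∈ xs → f x ≡ 0ℤ) → ∑ xs f ≡ 0ℤ
  ∑-≡0 xs eq = trans (∑-cong∈ xs eq) (∑-0 xs)

  ∑-+ : ∀ {A : Set} (xs : List A) f g → ∑ xs (λ x → f x +ᶻ g x) ≡ ∑ xs f +ᶻ ∑ xs g
  ∑-+ []       f g = refl
  ∑-+ (x ∷ xs) f g = trans (cong (f x +ᶻ g x +ᶻ_) (∑-+ xs f g)) (interchange (f x) (g x) _ _)

  ∑-++ : ∀ {A : Set} (xs ys : List A) f → ∑ (xs ++ ys) f ≡ ∑ xs f +ᶻ ∑ ys f
  ∑-++ []       ys f = sym (ℤₚ.+-identityˡ _)
  ∑-++ (x ∷ xs) ys f = trans (cong (f x +ᶻ_) (∑-++ xs ys f)) (sym (ℤₚ.+-assoc (f x) _ _))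

  ∑-swap : ∀ {A B : Set} (xs : List A) (ys : List B) (f : A → B → ℤ) →
    ∑ xs (λ x → ∑ ys (f x)) ≡ ∑ ys (λ y → ∑ xs (λ x → f x y))
  ∑-swap []       ys f = sym (∑-0 ys)
  ∑-swap (x ∷ xs) ys f = trans (cong (∑ ys (f x) +ᶻ_) (∑-swap xs ys f)) (sym (∑-+ ys (f x) (λ y → ∑ xs (λ z → f z y))))

  ∑-map : ∀ {A B : Set} (g : A → B) xs f → ∑ (map g xs) f ≡ ∑ xs (f ∘ g)
  ∑-map g []       f = refl
  ∑-map g (x ∷ xs) f = cong (f (g x) +ᶻ_) (∑-map g xs f)

  ∑-concatMap : ∀ {A B : Set} (g : A → List B) xs f → ∑ (concatMap g xs) f ≡ ∑ xs (λ x → ∑ (g x) f)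
  ∑-concatMap g []       f = refl
  ∑-concatMap g (x ∷ xs) f = trans (∑-++ (g x) _ f) (cong (∑ (g x) f +ᶻ_) (∑-concatMap g xs f))

when : {P : Set} → Dec P → ℤ → ℤ
when (yes _) x = x
when (no _)  x = 0ℤ

when-yes : ∀ {P : Set} (d : Dec P) {x} → P → when d x ≡ x
when-yes (yes _) p = refl
when-yes (no ¬p) p = contradiction p ¬p

when-no : ∀ {P : Set} (d : Dec P) {x} → ¬ P → when d x ≡ 0ℤ
when-no (yes p) ¬p = contradiction p ¬p
when-no (no _)  ¬p = refl

when-0 : ∀ {P : Set} (d : Dec P) → when d 0ℤ ≡ 0ℤ
when-0 (yes _) = refl
when-0 (no _)  = refl

when-neg : ∀ {P : Set} (d : Dec P) x → when d (-ᶻ x) ≡ -ᶻ when d x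
when-neg (yes _) x = refl
when-neg (no _)  x = refl

when-cong : ∀ {P Q : Set} (d : Dec P) (e : Dec Q) {x y} →
  (P → Q) → (Q → P) → (P → Q → x ≡ y) → when d x ≡ when e y
when-cong (yes p) (yes q) f g h = h p q
when-cong (yes p) (no ¬q) f g h = contradiction (f p) ¬q
when-cong (no ¬p) (yes q) f g h = contradiction (g q) ¬p
when-cong (no _)  (no _)  f g h = refl

when-map : ∀ {P : Set} (d : Dec P) {x y} → (P → x ≡ y) → when d x ≡ when d y
when-map d h = when-cong d d id id (λ p _ → h p)

when-× : ∀ {P Q : Set} (d : Dec P) (e : Dec Q) {x} → when d (when e x) ≡ when (d ×-dec e) x
when-× (yes _) (yes _) = refl
when-× (yes _) (no _)  = refl
when-× (no _)  e       = refl

∑-when : ∀ {A P : Set} (xs : List A) (d : Dec P) f → when d (∑ xs f) ≡ ∑ xs (λ x → when d (f x))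
∑-when xs (yes _) f = refl
∑-when xs (no _)  f = sym (∑-0 xs)

when-split : ∀ {P Q R : Set} (d : Dec P) (e : Dec Q) (r : Dec R) {x} →
  (R → P ⊎ Q) → (P → R) → (Q → R) → (P → Q → ⊥) → when r x ≡ when d x +ᶻ when e x
when-split (yes p) (yes q) r s f g h = ⊥-elim (h p q)
when-split (yes p) (no _) r {x} s f g h = trans (when-yes r (f p)) (sym (ℤₚ.+-identityʳ x))
when-split (no _) (yes q) r {x} s f g h = trans (when-yes r (g q)) (sym (ℤₚ.+-identityˡ x))
when-split (no ¬p) (no ¬q) r s f g h = when-no r (λ z → [ ¬p , ¬q ]′ (s z))

opaque
  unfolding ∑

  ∑-upTo-suc : ∀ n f → ∑ (upTo (suc n)) f ≡ f 0 +ᶻ ∑ (upTo n) (f ∘ suc)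
  ∑-upTo-suc n f = cong (f 0 +ᶻ_) (go id n)
    where
    go : ∀ h m → ∑ (applyUpTo (suc ∘ h) m) f ≡ ∑ (applyUpTo h m) (f ∘ suc)
    go h zero    = refl
    go h (suc m) = cong (f (suc (h 0)) +ᶻ_) (go (h ∘ suc) m)

∑-upTo-snoc : ∀ n f → ∑ (upTo (suc n)) f ≡ ∑ (upTo n) f +ᶻ f n
∑-upTo-snoc n f = begin
  ∑ (upTo (suc n)) f            ≡⟨ cong (λ l → ∑ l f) (sym (upTo-∷ʳ n)) ⟩
  ∑ (upTo n ++ n ∷ []) f        ≡⟨ ∑-++ (upTo n) (n ∷ []) f ⟩
  ∑ (upTo n) f +ᶻ ∑ (n ∷ []) f  ≡⟨ cong (∑ (upTo n) f +ᶻ_) (trans (∑-∷ n [] f) (cong (f n +ᶻ_) (∑-[] f))) ⟩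
  ∑ (upTo n) f +ᶻ (f n +ᶻ 0ℤ)   ≡⟨ cong (∑ (upTo n) f +ᶻ_) (ℤₚ.+-identityʳ (f n)) ⟩
  ∑ (upTo n) f +ᶻ f n           ∎ where open ≡-Reasoning

∑-upTo-one : ∀ n r {P : ℕ → Set} (P? : ∀ x → Dec (P x)) (f : ℕ → ℤ) → r < n → P r →
  (∀ x → x < n → P x → x ≡ r) → ∑ (upTo n) (λ x → when (P? x) (f x)) ≡ f r
∑-upTo-one (suc n) zero P? f r<n p u = begin
  ∑ (upTo (suc n)) F ≡⟨ ∑-upTo-suc n F ⟩
  F 0 +ᶻ ∑ (upTo n) (F ∘ suc) ≡⟨ cong₂ _+ᶻ_ (when-yes (P? 0) p) (go n ≤-refl) ⟩
  f 0 +ᶻ 0ℤ ≡⟨ ℤₚ.+-identityʳ _ ⟩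
  f 0 ∎
  where
  open ≡-Reasoning
  F : ℕ → ℤ
  F x = when (P? x) (f x)
  go : ∀ m → m ≤ n → ∑ (upTo m) (F ∘ suc) ≡ 0ℤ
  go zero    m≤n = ∑-[] _
  go (suc m) m<n = trans (∑-upTo-snoc m (F ∘ suc)) (cong₂ _+ᶻ_ (go m (<⇒≤ m<n))
    (when-no (P? (suc m)) (λ q → contradiction (u (suc m) (s≤s m<n) q) λ ())))
∑-upTo-one (suc n) (suc r) P? f (s≤s r<n) p u = begin
  ∑ (upTo (suc n)) F ≡⟨ ∑-upTo-suc n F ⟩
  F 0 +ᶻ ∑ (upTo n) (F ∘ suc) ≡⟨ cong₂ _+ᶻ_ (when-no (P? 0) (λ q → contradiction (u 0 (s≤s z≤n) q) λ ()))
      (∑-upTo-one n r (P? ∘ suc) (f ∘ suc) r<n p (λ x x<n q → suc-injective (u (suc x) (s≤s x<n) q))) ⟩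
  0ℤ +ᶻ f (suc r) ≡⟨ ℤₚ.+-identityˡ _ ⟩
  f (suc r) ∎
  where
  open ≡-Reasoning
  F : ℕ → ℤ
  F x = when (P? x) (f x)

∈-upTo⁻ : ∀ {n x} → x ∈ upTo n → x < n
∈-upTo⁻ {n} x∈ with ∈-applyUpTo⁻ id x∈
... | i , i<n , refl = i<n

-- Multiplication by (-1)^k, kept as iterated negation so that no products in ℤ occur.
sg : ℕ → ℤ → ℤ
sg zero    x = x
sg (suc k) x = -ᶻ sg k x

sg-0 : ∀ k → sg k 0ℤ ≡ 0ℤ
sg-0 zero    = refl
sg-0 (suc k) = cong -ᶻ_ (sg-0 k)

sg-+ : ∀ k x y → sg k (x +ᶻ y) ≡ sg k x +ᶻ sg k y
sg-+ zero    x y = refl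
sg-+ (suc k) x y = trans (cong -ᶻ_ (sg-+ k x y)) (ℤₚ.neg-distrib-+ (sg k x) _)

sg-sg : ∀ j k x → sg j (sg k x) ≡ sg (j + k) x
sg-sg zero    k x = refl
sg-sg (suc j) k x = cong -ᶻ_ (sg-sg j k x)

opaque
  unfolding ∑

  sg-∑ : ∀ {A : Set} k (xs : List A) f → sg k (∑ xs f) ≡ ∑ xs (λ x → sg k (f x))
  sg-∑ k []       f = sg-0 k
  sg-∑ k (x ∷ xs) f = trans (sg-+ k (f x) _) (cong (sg k (f x) +ᶻ_) (sg-∑ k xs f))

sg-when : ∀ {P : Set} k (d : Dec P) x → sg k (when d x) ≡ when d (sg k x)
sg-when k (yes _) x = refl
sg-when k (no _)  x = sg-0 k

-- After the shift x = z + 1 the second sum removes φ z for every z < M, so only the top term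
-- survives. Both sums run over the full range and are cut off by `when`, the form in which the
-- strip sums arrive.
∑-telescope : ∀ {W M} (φ : ℕ → ℤ) → M ≤ W →
  ∑ (upTo (suc W)) (λ x → when (x ≤? M) (φ x))
  +ᶻ ∑ (upTo (suc W)) (λ x → when (1 ≤? x ×-dec x ≤? M) (-ᶻ φ (x ∸ 1))) ≡ φ M
∑-telescope {W} {M} φ M≤W = begin
  S₁ +ᶻ ∑ (upTo (suc W)) F₂ ≡⟨ cong (S₁ +ᶻ_) (∑-upTo-suc W F₂) ⟩
  S₁ +ᶻ (F₂ 0 +ᶻ ∑ (upTo W) (F₂ ∘ suc)) ≡⟨ cong (S₁ +ᶻ_) (ℤₚ.+-identityˡ _) ⟩
  S₁ +ᶻ ∑ (upTo W) (F₂ ∘ suc) ≡⟨ cong (S₁ +ᶻ_) (∑-cong (upTo W) (λ z → when-cong (1 ≤? suc z ×-dec suc z ≤? M) (suc z ≤? M)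
    proj₂ (s≤s z≤n ,_) (λ _ _ → refl))) ⟩
  S₁ +ᶻ ∑ (upTo W) F₃ ≡⟨ cong (S₁ +ᶻ_)
    (sym (trans (∑-upTo-snoc W F₃) (trans (cong (∑ (upTo W) F₃ +ᶻ_) (when-no (suc W ≤? M) (λ p → <⇒≱ p M≤W)))
      (ℤₚ.+-identityʳ _)))) ⟩
  S₁ +ᶻ ∑ (upTo (suc W)) F₃ ≡⟨ sym (∑-+ (upTo (suc W)) (λ z → when (z ≤? M) (φ z)) F₃) ⟩
  ∑ (upTo (suc W)) (λ z → when (z ≤? M) (φ z) +ᶻ F₃ z) ≡⟨ ∑-cong (upTo (suc W)) eq ⟩
  ∑ (upTo (suc W)) (λ z → when (z ≟ M) (φ z)) ≡⟨ ∑-upTo-one (suc W) M (_≟ M) φ (s≤s M≤W) refl (λ _ _ e → e) ⟩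
  φ M ∎
  where
  open ≡-Reasoning
  S₁ = ∑ (upTo (suc W)) (λ x → when (x ≤? M) (φ x))
  F₂ F₃ : ℕ → ℤ
  F₂ x = when (1 ≤? x ×-dec x ≤? M) (-ᶻ φ (x ∸ 1))
  F₃ z = when (suc z ≤? M) (-ᶻ φ z)
  eq : ∀ z → when (z ≤? M) (φ z) +ᶻ F₃ z ≡ when (z ≟ M) (φ z)
  eq z = begin
    when (z ≤? M) (φ z) +ᶻ F₃ z
      ≡⟨ cong₂ _+ᶻ_ (when-split (z ≟ M) (suc z ≤? M) (z ≤? M) (λ p → [ inj₂ , inj₁ ]′ (m≤n⇒m<n∨m≡n p)) ≤-reflexive <⇒≤
        (λ e l → <⇒≢ l e)) (when-neg (suc z ≤? M) (φ z)) ⟩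
    (when (z ≟ M) (φ z) +ᶻ when (suc z ≤? M) (φ z)) +ᶻ (-ᶻ when (suc z ≤? M) (φ z))
      ≡⟨ ℤₚ.+-assoc (when (z ≟ M) (φ z)) _ _ ⟩
    when (z ≟ M) (φ z) +ᶻ (when (suc z ≤? M) (φ z) +ᶻ (-ᶻ when (suc z ≤? M) (φ z)))
      ≡⟨ cong (when (z ≟ M) (φ z) +ᶻ_) (ℤₚ.+-inverseʳ (when (suc z ≤? M) (φ z))) ⟩
    when (z ≟ M) (φ z) +ᶻ 0ℤ ≡⟨ ℤₚ.+-identityʳ _ ⟩
    when (z ≟ M) (φ z) ∎

-- Strips

bits : List ℕ
bits = 0 ∷ 1 ∷ []

∑-bits : ∀ f → ∑ bits f ≡ f 0 +ᶻ f 1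
∑-bits f = trans (∑-∷ 0 (1 ∷ []) f) (cong (f 0 +ᶻ_) (trans (∑-∷ 1 [] f) (trans (cong (f 1 +ᶻ_) (∑-[] f))
  (ℤₚ.+-identityʳ (f 1)))))

module Shapes (β W : ℕ) where

  range : List ℕ
  range = upTo (suc W)

  ∈range⁻ : ∀ {x} → x ∈ range → x ≤ W
  ∈range⁻ x∈ = ≤-pred (∈-upTo⁻ x∈)

  vecs : ∀ n → List (Vec ℕ n)
  vecs zero    = [] ∷ []
  vecs (suc n) = concatMap (λ x → map (x ∷_) (vecs n)) range

  ∑-vecs : ∀ n (f : Vec ℕ (suc n) → ℤ) →
    ∑ (vecs (suc n)) f ≡ ∑ range (λ x → ∑ (vecs n) (λ v → f (x ∷ v)))
  ∑-vecs n f = trans (∑-concatMap (λ x → map (x ∷_) (vecs n)) range f)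
                     (∑-cong range (λ x → ∑-map (x ∷_) (vecs n) f))

  ∑-vecs0 : ∀ (f : Vec ℕ 0 → ℤ) → ∑ (vecs 0) f ≡ f []
  ∑-vecs0 f = trans (∑-∷ [] [] f) (trans (cong (f [] +ᶻ_) (∑-[] f)) (ℤₚ.+-identityʳ (f [])))

  -- Shapes are given by their row ends; the rows past the end of the vector end at β.
  hd : ∀ {n} → Vec ℕ n → ℕ
  hd []      = β
  hd (x ∷ _) = x

  Part : ∀ {n} → Vec ℕ n → Set
  Part []      = ⊤
  Part (x ∷ v) = hd v ≤ x × Part v

  -- q / p is a horizontal strip.
  Hor : ∀ {n} → Vec ℕ n → Vec ℕ n → Set
  Hor []       []       = ⊤
  Hor (p ∷ ps) (q ∷ qs) = p ≤ q × hd qs ≤ p × Hor ps qs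

  -- q / r is a vertical strip, provided that q and r are partitions.
  Ver : ∀ {n} → Vec ℕ n → Vec ℕ n → Set
  Ver []       []       = ⊤
  Ver (q ∷ qs) (r ∷ rs) = (q ≡ r ⊎ q ≡ suc r) × Ver qs rs

  -- The last row of `x ∷ v` has no box beyond β: there is a spare row at the bottom.
  LastIsβ : ∀ {n} → ℕ → Vec ℕ n → Set
  LastIsβ x []      = x ≡ β
  LastIsβ x (y ∷ v) = LastIsβ y v

  Part? : ∀ {n} (v : Vec ℕ n) → Dec (Part v)
  Part? []      = yes tt
  Part? (x ∷ v) = (hd v ≤? x) ×-dec Part? v

  Hor? : ∀ {n} (p q : Vec ℕ n) → Dec (Hor p q)
  Hor? []       []       = yes tt
  Hor? (p ∷ ps) (q ∷ qs) = (p ≤? q) ×-dec (hd qs ≤? p) ×-dec Hor? ps qs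

  Ver? : ∀ {n} (q r : Vec ℕ n) → Dec (Ver q r)
  Ver? []       []       = yes tt
  Ver? (q ∷ qs) (r ∷ rs) = (q ≟ r ⊎-dec q ≟ suc r) ×-dec Ver? qs rs

  diff : ∀ {n} → Vec ℕ n → Vec ℕ n → ℕ
  diff []       []       = 0
  diff (q ∷ qs) (r ∷ rs) = (q ∸ r) + diff qs rs

  ∑-range-one : ∀ {x} a F → x ≤ W →
    ∑ range (λ q → when (q ≤? x ×-dec q ≟ a) (F q)) ≡ when (a ≤? x) (F a)
  ∑-range-one {x} a F x≤W with a ≤? x
  ... | yes a≤x = ∑-upTo-one (suc W) a (λ q → q ≤? x ×-dec q ≟ a) F (s≤s (≤-trans a≤x x≤W)) (a≤x , refl) (λ _ _ → proj₂)
  ... | no ¬a≤x = ∑-≡0 range (λ q _ → when-no (q ≤? x ×-dec q ≟ a) (λ { (l , refl) → ¬a≤x l }))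

  -- One row of a vertical strip is a single bit δ. Summing over the bit instead of the row end is
  -- what allows strips to be compared row by row.
  ∑-ver-outer : ∀ {x} r F → x ≤ W →
    ∑ range (λ q → when (q ≤? x ×-dec (q ≟ r ⊎-dec q ≟ suc r)) (F q)) ≡ ∑ bits (λ δ → when (r + δ ≤? x) (F (r + δ)))
  ∑-ver-outer {x} r F x≤W = begin
    ∑ range (λ q → when (q ≤? x ×-dec (q ≟ r ⊎-dec q ≟ suc r)) (F q))
      ≡⟨ ∑-cong range (λ q → when-split (q ≤? x ×-dec q ≟ r) (q ≤? x ×-dec q ≟ suc r) (q ≤? x ×-dec (q ≟ r ⊎-dec q ≟ suc r))
          (λ { (l , inj₁ e) → inj₁ (l , e) ; (l , inj₂ e) → inj₂ (l , e) }) (λ { (l , e) → l , inj₁ e })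
            (λ { (l , e) → l , inj₂ e })
          (λ { (_ , refl) (_ , e) → m≢1+m+n q (trans e (cong suc (sym (+-identityʳ r)))) })) ⟩
    ∑ range (λ q → when (q ≤? x ×-dec q ≟ r) (F q) +ᶻ when (q ≤? x ×-dec q ≟ suc r) (F q))
      ≡⟨ ∑-+ range _ _ ⟩
    ∑ range (λ q → when (q ≤? x ×-dec q ≟ r) (F q)) +ᶻ ∑ range (λ q → when (q ≤? x ×-dec q ≟ suc r) (F q))
      ≡⟨ cong₂ _+ᶻ_ (∑-range-one r F x≤W) (∑-range-one (suc r) F x≤W) ⟩
    when (r ≤? x) (F r) +ᶻ when (suc r ≤? x) (F (suc r))
      ≡⟨ cong₂ _+ᶻ_ (cong (λ z → when (z ≤? x) (F z)) (sym (+-identityʳ r)))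
           (cong (λ z → when (z ≤? x) (F z)) (sym (+-comm r 1))) ⟩
    when (r + 0 ≤? x) (F (r + 0)) +ᶻ when (r + 1 ≤? x) (F (r + 1))
      ≡⟨ sym (∑-bits (λ δ → when (r + δ ≤? x) (F (r + δ)))) ⟩
    ∑ bits (λ δ → when (r + δ ≤? x) (F (r + δ))) ∎
    where open ≡-Reasoning

  ∑-ver-inner : ∀ p F → p ≤ W →
    ∑ range (λ s → when (p ≟ s ⊎-dec p ≟ suc s) (F s)) ≡ ∑ bits (λ ε → when (ε ≤? p) (F (p ∸ ε)))
  ∑-ver-inner p F p≤W = begin
    ∑ range (λ s → when (p ≟ s ⊎-dec p ≟ suc s) (F s))
      ≡⟨ ∑-cong range (λ s → when-split (p ≟ s) (p ≟ suc s) (p ≟ s ⊎-dec p ≟ suc s) id inj₁ inj₂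
          (λ { refl e → m≢1+m+n p (trans e (cong suc (sym (+-identityʳ s)))) })) ⟩
    ∑ range (λ s → when (p ≟ s) (F s) +ᶻ when (p ≟ suc s) (F s))
      ≡⟨ ∑-+ range _ _ ⟩
    ∑ range (λ s → when (p ≟ s) (F s)) +ᶻ ∑ range (λ s → when (p ≟ suc s) (F s))
      ≡⟨ cong₂ _+ᶻ_ (trans (∑-upTo-one (suc W) p (p ≟_) F (s≤s p≤W) refl (λ _ _ → sym)) (sym (when-yes (0 ≤? p) z≤n)))
        (second p p≤W) ⟩
    when (0 ≤? p) (F p) +ᶻ when (1 ≤? p) (F (p ∸ 1))
      ≡⟨ sym (∑-bits (λ ε → when (ε ≤? p) (F (p ∸ ε)))) ⟩
    ∑ bits (λ ε → when (ε ≤? p) (F (p ∸ ε))) ∎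
    where
    open ≡-Reasoning
    second : ∀ p → p ≤ W → ∑ range (λ s → when (p ≟ suc s) (F s)) ≡ when (1 ≤? p) (F (p ∸ 1))
    second zero    _   = trans (∑-≡0 range (λ s _ → when-no (0 ≟ suc s) {F s} λ ())) refl
    second (suc p) p<W = trans (∑-upTo-one (suc W) p (λ s → suc p ≟ suc s) F (s≤s (<⇒≤ p<W)) refl
      (λ _ _ e → sym (suc-injective e)))
                               (sym (when-yes (1 ≤? suc p) (s≤s z≤n)))

  -- For p ≤ r the conditions p ≤ r + δ and p ≤ r + ε both hold, for p > r + 1 both fail. Only p = r
  -- + 1 needs an argument: the left side forces δ = 1 and leaves ε free, the right side forces ε =
  -- 1 and leaves δ free, and X sees only δ + ε.
  carry : ∀ {x p r h} (X : ℕ → ℤ) → h ≤ r → p ≤ x →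
    ∑ bits (λ δ → when (r + δ ≤? x) (when (p ≤? r + δ) (∑ bits (λ ε → when (h + ε ≤? p) (X (δ + ε))))))
    ≡ ∑ bits (λ δ → when (r + δ ≤? x) (∑ bits (λ ε → when (p ≤? r + ε ×-dec h + ε ≤? p) (X (δ + ε)))))
  carry {x} {p} {r} {h} X h≤r p≤x with <-cmp p (suc r)
  ... | tri< p<sr _ _ = ∑-cong bits λ δ → when-map (r + δ ≤? x) λ _ →
        trans (when-yes (p ≤? r + δ) (p≤ δ)) (∑-cong bits λ ε → when-cong (h + ε ≤? p) (p ≤? r + ε ×-dec h + ε ≤? p)
          (λ a → p≤ ε , a) proj₂ (λ _ _ → refl))
    where
    p≤ : ∀ δ → p ≤ r + δ
    p≤ δ = ≤-trans (≤-pred p<sr) (m≤m+n r δ)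
  ... | tri> _ _ sr<p = trans (∑-≡0 bits λ δ δ∈ → trans (when-map (r + δ ≤? x) λ _ → when-no (p ≤? r + δ) (no≤ δ δ∈))
    (when-0 (r + δ ≤? x)))
        (sym (∑-≡0 bits λ δ _ → trans (when-map (r + δ ≤? x) λ _ → ∑-≡0 bits λ ε ε∈ → when-no (p ≤? r + ε ×-dec h + ε ≤? p)
          (λ z → no≤ ε ε∈ (proj₁ z))) (when-0 (r + δ ≤? x))))
    where
    no≤ : ∀ δ → δ ∈ bits → ¬ p ≤ r + δ
    no≤ _ (here refl)         q = <⇒≱ sr<p (≤-trans q (≤-trans (≤-reflexive (+-identityʳ r)) (n≤1+n r)))
    no≤ _ (there (here refl)) q = <⇒≱ sr<p (≤-trans q (≤-reflexive (+-comm r 1)))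
  ... | tri≈ _ refl _ = begin
    ∑ bits (λ δ → when (r + δ ≤? x) (when (suc r ≤? r + δ) (Y δ)))
      ≡⟨ ∑-bits _ ⟩
    when (r + 0 ≤? x) (when (suc r ≤? r + 0) (Y 0)) +ᶻ when (r + 1 ≤? x) (when (suc r ≤? r + 1) (Y 1))
      ≡⟨ cong₂ _+ᶻ_
           (trans (when-map (r + 0 ≤? x) λ _ → when-no (suc r ≤? r + 0) ¬0) (when-0 (r + 0 ≤? x)))
           (trans (when-yes (r + 1 ≤? x) r1≤x) (trans (when-yes (suc r ≤? r + 1) 1≤)
             (trans (∑-bits _) (cong₂ _+ᶻ_ (when-yes (h + 0 ≤? suc r) h0) (when-yes (h + 1 ≤? suc r) h1))))) ⟩
    0ℤ +ᶻ (X 1 +ᶻ X 2)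
      ≡⟨ ℤₚ.+-identityˡ _ ⟩
    X 1 +ᶻ X 2
      ≡⟨ cong₂ _+ᶻ_ (sym (trans (when-yes (r + 0 ≤? x) r0≤x) (Z≡ 0))) (sym (trans (when-yes (r + 1 ≤? x) r1≤x) (Z≡ 1))) ⟩
    when (r + 0 ≤? x) (Z 0) +ᶻ when (r + 1 ≤? x) (Z 1)
      ≡⟨ sym (∑-bits (λ δ → when (r + δ ≤? x) (Z δ))) ⟩
    ∑ bits (λ δ → when (r + δ ≤? x) (Z δ)) ∎
    where
    open ≡-Reasoning
    Y Z : ℕ → ℤ
    Y δ = ∑ bits (λ ε → when (h + ε ≤? suc r) (X (δ + ε)))
    Z δ = ∑ bits (λ ε → when (suc r ≤? r + ε ×-dec h + ε ≤? suc r) (X (δ + ε)))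
    ¬0 : ¬ suc r ≤ r + 0
    ¬0 l = <⇒≱ l (≤-reflexive (+-identityʳ r))
    1≤ : suc r ≤ r + 1
    1≤ = ≤-reflexive (+-comm 1 r)
    r1≤x : r + 1 ≤ x
    r1≤x = ≤-trans (≤-reflexive (+-comm r 1)) p≤x
    r0≤x : r + 0 ≤ x
    r0≤x = ≤-trans (+-monoʳ-≤ r z≤n) r1≤x
    h1 : h + 1 ≤ suc r
    h1 = ≤-trans (≤-reflexive (+-comm h 1)) (s≤s h≤r)
    h0 : h + 0 ≤ suc r
    h0 = ≤-trans (+-monoʳ-≤ h z≤n) h1
    Z≡ : ∀ δ → Z δ ≡ X (δ + 1)
    Z≡ δ = trans (∑-bits _) (trans (cong₂ _+ᶻ_ (when-no (suc r ≤? r + 0 ×-dec h + 0 ≤? suc r) (¬0 ∘ proj₁))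
             (when-yes (suc r ≤? r + 1 ×-dec h + 1 ≤? suc r) (1≤ , h1))) (ℤₚ.+-identityˡ (X (δ + 1))))

  -- Both sides carry a bit from row to row: on the left the bit added to row j is read off from q,
  -- on the right it is the bit removed from row j ∸ 1 of p.
  commute-strips : ∀ {n} x (p r : Vec ℕ n) → Part (x ∷ p) → Part r → LastIsβ x p → x ≤ W → (G : ℕ → ℤ) →
    ∑ (vecs n) (λ q → when (hd q ≤? x ×-dec Hor? p q ×-dec Ver? q r) (G (diff q r)))
    ≡ ∑ bits (λ ε → when (hd r + ε ≤? x) (∑ (vecs n) (λ s → when (Ver? p s ×-dec Hor? s r) (G (ε + diff p s)))))
  -- At the bottom x = β, so ε = 1 would require β + 1 ≤ β. The carry ends here; without the empty
  -- last row a term would be left over.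
  commute-strips x [] [] _ _ refl x≤W G = begin
    ∑ (vecs 0) (λ q → when (hd q ≤? β ×-dec Hor? [] q ×-dec Ver? q []) (G (diff q [])))
      ≡⟨ ∑-vecs0 _ ⟩
    when (β ≤? β ×-dec yes tt ×-dec yes tt) (G 0)
      ≡⟨ when-yes (β ≤? β ×-dec yes tt ×-dec yes tt) (≤-refl , tt , tt) ⟩
    G 0
      ≡⟨ sym (trans (cong₂ _+ᶻ_ (trans (when-yes (β + 0 ≤? β) (≤-reflexive (+-identityʳ β))) (∑-vecs0 _))
                 (when-no (β + 1 ≤? β) (λ l → <⇒≱ (≤-reflexive (+-comm 1 β)) l))) (ℤₚ.+-identityʳ (G 0))) ⟩
    when (β + 0 ≤? β) (S 0) +ᶻ when (β + 1 ≤? β) (S 1)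
      ≡⟨ sym (∑-bits (λ ε → when (β + ε ≤? β) (S ε))) ⟩
    ∑ bits (λ ε → when (β + ε ≤? β) (S ε)) ∎
    where
    open ≡-Reasoning
    S : ℕ → ℤ
    S ε = ∑ (vecs 0) (λ s → when (Ver? [] s ×-dec Hor? s []) (G (ε + diff [] s)))
  commute-strips {suc n} x (p ∷ ps) (r ∷ rs) (p≤x , Pp) (h≤r , Pr) lst x≤W G = begin
    ∑ (vecs (suc n)) (λ q → when (hd q ≤? x ×-dec Hor? (p ∷ ps) q ×-dec Ver? q (r ∷ rs)) (G (diff q (r ∷ rs))))
      ≡⟨ ∑-vecs n _ ⟩
    ∑ range (λ q → ∑ (vecs n) (λ qs → when (q ≤? x ×-dec ((p ≤? q) ×-dec (hd qs ≤? p) ×-dec Hor? ps qs) ×-dec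
      ((q ≟ r ⊎-dec q ≟ suc r) ×-dec Ver? qs rs)) (G ((q ∸ r) + diff qs rs))))
      ≡⟨ ∑-cong range (λ q → trans (∑-cong (vecs n) (λ qs → trans
            (when-cong (q ≤? x ×-dec ((p ≤? q) ×-dec (hd qs ≤? p) ×-dec Hor? ps qs) ×-dec ((q ≟ r ⊎-dec q ≟ suc r) ×-dec
              Ver? qs rs))
                       ((A? q ×-dec p ≤? q) ×-dec ((hd qs ≤? p) ×-dec Hor? ps qs ×-dec Ver? qs rs))
                       (λ { (a , (b , c , d) , (e , f)) → ((a , e) , b) , (c , d , f) })
                       (λ { (((a , e) , b) , (c , d , f)) → a , (b , c , d) , (e , f) }) (λ _ _ → refl))
            (sym (trans (when-× (A? q) (p ≤? q)) (when-× (A? q ×-dec p ≤? q) ((hd qs ≤? p) ×-dec Hor? ps qs ×-dec Ver? qs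
              rs))))))
          (sym (trans (when-map (A? q) (λ _ → ∑-when (vecs n) (p ≤? q) _)) (∑-when (vecs n) (A? q) _)))) ⟩
    ∑ range (λ q → when (A? q) (when (p ≤? q) (∑ (vecs n) (λ qs → when ((hd qs ≤? p) ×-dec Hor? ps qs ×-dec Ver? qs rs)
      (G ((q ∸ r) + diff qs rs))))))
      -- In the rows below, p bounds the next row of q just as x bounds this one, so the statement
      -- recurs with p in place of x.
      ≡⟨ ∑-cong range (λ q → when-map (A? q) λ _ → when-map (p ≤? q) λ _ → commute-strips p ps rs Pp Pr lst
        (≤-trans p≤x x≤W) (λ k → G ((q ∸ r) + k))) ⟩
    ∑ range (λ q → when (A? q) (when (p ≤? q) (I (q ∸ r))))
      ≡⟨ ∑-ver-outer r (λ q → when (p ≤? q) (I (q ∸ r))) x≤W ⟩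
    ∑ bits (λ δ → when (r + δ ≤? x) (when (p ≤? r + δ) (I (r + δ ∸ r))))
      ≡⟨ ∑-cong bits (λ δ → when-map (r + δ ≤? x) λ _ → when-map (p ≤? r + δ) λ _ →
           trans (cong I (m+n∸m≡n r δ)) (∑-cong bits λ ε → when-map (hd rs + ε ≤? p) λ _ → ∑-cong (vecs n) λ ss →
             cong (λ z → when (Ver? ps ss ×-dec Hor? ss rs) (G z)) (sym (+-assoc δ ε (diff ps ss))))) ⟩
    ∑ bits (λ δ → when (r + δ ≤? x) (when (p ≤? r + δ) (∑ bits (λ ε → when (hd rs + ε ≤? p) (X (δ + ε))))))
      ≡⟨ carry X h≤r p≤x ⟩
    ∑ bits (λ δ → when (r + δ ≤? x) (∑ bits (λ ε → when (p ≤? r + ε ×-dec hd rs + ε ≤? p) (X (δ + ε)))))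
      ≡⟨ ∑-cong bits (λ δ → when-map (r + δ ≤? x) λ _ → sym (right δ)) ⟩
    ∑ bits (λ ε → when (r + ε ≤? x) (∑ (vecs (suc n)) (λ s → when (Ver? (p ∷ ps) s ×-dec Hor? s (r ∷ rs))
      (G (ε + diff (p ∷ ps) s))))) ∎
    where
    open ≡-Reasoning
    A? : ∀ q → Dec (q ≤ x × (q ≡ r ⊎ q ≡ suc r))
    A? q = q ≤? x ×-dec (q ≟ r ⊎-dec q ≟ suc r)
    X I : ℕ → ℤ
    X k = ∑ (vecs n) (λ ss → when (Ver? ps ss ×-dec Hor? ss rs) (G (k + diff ps ss)))
    I k = ∑ bits (λ ε → when (hd rs + ε ≤? p) (∑ (vecs n) (λ ss → when (Ver? ps ss ×-dec Hor? ss rs)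
      (G (k + (ε + diff ps ss))))))
    V? : ∀ s → Dec (p ≡ s ⊎ p ≡ suc s)
    V? s = p ≟ s ⊎-dec p ≟ suc s
    H? : ∀ s → Dec (s ≤ r × hd rs ≤ s)
    H? s = s ≤? r ×-dec hd rs ≤? s
    right : ∀ δ → ∑ (vecs (suc n)) (λ s → when (Ver? (p ∷ ps) s ×-dec Hor? s (r ∷ rs)) (G (δ + diff (p ∷ ps) s)))
          ≡ ∑ bits (λ ε → when (p ≤? r + ε ×-dec hd rs + ε ≤? p) (X (δ + ε)))
    right δ = begin
      ∑ (vecs (suc n)) (λ s → when (Ver? (p ∷ ps) s ×-dec Hor? s (r ∷ rs)) (G (δ + diff (p ∷ ps) s)))
        ≡⟨ ∑-vecs n _ ⟩
      ∑ range (λ s → ∑ (vecs n) (λ ss → when ((V? s ×-dec Ver? ps ss) ×-dec ((s ≤? r) ×-dec (hd rs ≤? s) ×-dec Hor? ss rs))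
        (G (δ + ((p ∸ s) + diff ps ss)))))
        ≡⟨ ∑-cong range (λ s → trans (∑-cong (vecs n) (λ ss → trans
             (when-cong ((V? s ×-dec Ver? ps ss) ×-dec ((s ≤? r) ×-dec (hd rs ≤? s) ×-dec Hor? ss rs)) ((V? s ×-dec H? s)
               ×-dec (Ver? ps ss ×-dec Hor? ss rs))
               (λ { ((a , b) , (c , d , e)) → (a , (c , d)) , (b , e) }) (λ { ((a , (c , d)) , (b , e)) → (a , b) ,
                 (c , d , e) })
               (λ _ _ → cong G (sym (+-assoc δ _ _))))
             (sym (trans (when-× (V? s) (H? s)) (when-× (V? s ×-dec H? s) (Ver? ps ss ×-dec Hor? ss rs))))))
           (sym (trans (when-map (V? s) (λ _ → ∑-when (vecs n) (H? s) _)) (∑-when (vecs n) (V? s) _)))) ⟩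
      ∑ range (λ s → when (V? s) (when (H? s) (X (δ + (p ∸ s)))))
        ≡⟨ ∑-ver-inner p (λ s → when (H? s) (X (δ + (p ∸ s)))) (≤-trans p≤x x≤W) ⟩
      ∑ bits (λ ε → when (ε ≤? p) (when (H? (p ∸ ε)) (X (δ + (p ∸ (p ∸ ε))))))
        ≡⟨ ∑-cong bits (λ ε → trans (when-× (ε ≤? p) (H? (p ∸ ε))) (when-cong (ε ≤? p ×-dec H? (p ∸ ε)) (p ≤? r + ε ×-dec hd
          rs + ε ≤? p)
             (λ { (a , b , c) → ≤-trans (≤-reflexive (sym (m∸n+n≡m a))) (+-monoˡ-≤ ε b) , ≤-trans (+-monoˡ-≤ ε c)
               (≤-reflexive (m∸n+n≡m a)) })
             (λ { (a , b) → m+n≤o⇒n≤o (hd rs) b , m≤n+o⇒m∸n≤o p ε (≤-trans a (≤-reflexive (+-comm r ε))) , m+n≤o⇒m≤o∸n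
               (hd rs) b })
             (λ { (a , _) _ → cong (λ z → X (δ + z)) (m∸[m∸n]≡n a) }))) ⟩
      ∑ bits (λ ε → when (p ≤? r + ε ×-dec hd rs + ε ≤? p) (X (δ + ε))) ∎

module _ {A : Set} (xs : List A) where

  push₁ : ∀ {P : Set} {Q : A → Set} (d : Dec P) (e : ∀ x → Dec (Q x)) (f : A → ℤ) →
    when d (∑ xs (λ x → when (e x) (f x))) ≡ ∑ xs (λ x → when (d ×-dec e x) (f x))
  push₁ d e f = trans (∑-when xs d _) (∑-cong xs λ x → when-× d (e x))

  push₂ : ∀ {B P : Set} {Q : A → B → Set} (ys : List B) (d : Dec P) (e : ∀ x y → Dec (Q x y)) (f : A → B → ℤ) →
    when d (∑ xs (λ x → ∑ ys (λ y → when (e x y) (f x y)))) ≡ ∑ xs (λ x → ∑ ys (λ y → when (d ×-dec e x y) (f x y)))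
  push₂ ys d e f = trans (∑-when xs d _) (∑-cong xs λ x → trans (∑-when ys d _) (∑-cong ys λ y → when-× d (e x y)))

  push₃ : ∀ {B C P : Set} {Q : A → B → C → Set} (ys : List B) (zs : List C) (d : Dec P)
    (e : ∀ x y z → Dec (Q x y z)) (f : A → B → C → ℤ) →
    when d (∑ xs (λ x → ∑ ys (λ y → ∑ zs (λ z → when (e x y z) (f x y z)))))
    ≡ ∑ xs (λ x → ∑ ys (λ y → ∑ zs (λ z → when (d ×-dec e x y z) (f x y z))))
  push₃ ys zs d e f = trans (∑-when xs d _) (∑-cong xs λ x → trans (∑-when ys d _)
    (∑-cong ys λ y → trans (∑-when zs d _) (∑-cong zs λ z → when-× d (e x y z))))

-- For one label: (upper bound for the end of the first row, occurrences in the rows above, total number of occurrences).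
Level : Set
Level = ℕ × ℕ × ℕ

module Paths (β W : ℕ) where
  open Shapes β W

  VerP : ∀ {n} → Vec ℕ n → Vec ℕ n → Set
  VerP q r = Ver q r × Part r

  VerP? : ∀ {n} (q r : Vec ℕ n) → Dec (VerP q r)
  VerP? q r = Ver? q r ×-dec Part? r

  -- The last condition says, without subtraction, that the strip r / v has c - w boxes: w
  -- occurrences of the label have already been placed in the rows above.
  Step : ∀ {n} → Level → Vec ℕ n → Vec ℕ n → Set
  Step (u , w , c) v r = hd r ≤ u × Hor v r × sum r + w ≡ sum v + c

  Step? : ∀ {n} l (v r : Vec ℕ n) → Dec (Step l v r)
  Step? (u , w , c) v r = hd r ≤? u ×-dec Hor? v r ×-dec sum r + w ≟ sum v + c

  -- An arbitrary functional f at the outer end, instead of a fixed outer shape, so that a vertical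
  -- strip can be attached there and moved inwards.
  paths : ∀ {L n} → Vec Level L → Vec ℕ n → (Vec ℕ n → ℤ) → ℤ
  paths         []       v f = f v
  paths {n = n} (l ∷ ls) v f = ∑ (vecs n) (λ r → when (Step? l v r) (paths ls r f))

  BStep : ∀ {n} → ℕ → Level → ℕ → Vec ℕ n → ℕ → ℕ → Vec ℕ n → Set
  BStep α (u , w , c) x p ε y r =
    (x ≤ y × y ≤ u × α + ε ≤ x) × (hd r + ε ≤ x × Hor p r) × y + sum r + ε + w ≡ x + sum p + c

  BStep? : ∀ {n} α l x (p : Vec ℕ n) ε y r → Dec (BStep α l x p ε y r)
  BStep? α (u , w , c) x p ε y r =
    (x ≤? y ×-dec y ≤? u ×-dec α + ε ≤? x) ×-dec (hd r + ε ≤? x ×-dec Hor? p r) ×-dec y + sum r + ε + w ≟ x + sum p + c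

  -- The first row, with successive ends x ≤ y ≤ …, may carry each label once more (ε = 1) as a non-minimal
  -- element of its last box x; this requires x > α and that the box below x receives a larger label.
  -- m counts the extra labels.
  bpaths : ∀ {L n} → ℕ → Vec Level L → ℕ → Vec ℕ n → ℕ → (ℕ → Vec ℕ n → ℕ → ℤ) → ℤ
  bpaths         α []       x p m f = f x p m
  bpaths {n = n} α (l ∷ ls) x p m f =
    ∑ bits (λ ε → ∑ range (λ y → ∑ (vecs n) (λ r → when (BStep? α l x p ε y r) (bpaths α ls y r (m + ε) f))))

  -- Measures the rows in use: none of index k or more reaches beyond β. A horizontal strip raises k
  -- by at most one (`flat-hor`).
  Flat : ∀ {n} → ℕ → Vec ℕ n → Set
  Flat k       []      = ⊤
  Flat zero    (x ∷ v) = x ≡ β × Flat zero v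
  Flat (suc k) (x ∷ v) = Flat k v

  flat-last : ∀ {n} k x (v : Vec ℕ n) → Flat k (x ∷ v) → k ≤ n → LastIsβ x v
  flat-last zero    x []      (e , _) _ = e
  flat-last zero    x (y ∷ v) (_ , F) _ = flat-last zero y v F z≤n
  flat-last (suc k) x (y ∷ v) F (s≤s k≤n) = flat-last k y v F k≤n

  hor-part : ∀ {n} (v r : Vec ℕ n) → Hor v r → Part r
  hor-part []      []       _           = tt
  hor-part (v ∷ vs) (r ∷ rs) (a , b , c) = ≤-trans b a , hor-part vs rs c

  hor-hd : ∀ {n} (v r : Vec ℕ n) → Hor v r → hd v ≤ hd r
  hor-hd []       []       _       = ≤-refl
  hor-hd (v ∷ vs) (r ∷ rs) (a , _) = a

  hor-part′ : ∀ {n} (v r : Vec ℕ n) → Hor v r → Part v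
  hor-part′ []      []       _           = tt
  hor-part′ (v ∷ vs) (r ∷ rs) (a , b , c) = ≤-trans (hor-hd vs rs c) b , hor-part′ vs rs c

  part-β : ∀ {n} (v : Vec ℕ n) → Part v → β ≤ hd v
  part-β []      _       = ≤-refl
  part-β (x ∷ v) (a , P) = ≤-trans (part-β v P) a

  flat-hor : ∀ {n} k (v r : Vec ℕ n) → Hor v r → Flat k v → Flat (suc k) r
  flat-hor k       []       []       _           _       = tt
  flat-hor zero    (v ∷ vs) (r ∷ rs) (_ , b , c) (e , F) = go vs rs c F (≤-trans b (≤-reflexive e))
    where
    go : ∀ {n} (v r : Vec ℕ n) → Hor v r → Flat 0 v → hd r ≤ β → Flat 0 r
    go []       []       _           _       _ = tt
    go (v ∷ vs) (r ∷ rs) (a , b , c) (e , F) l = ≤-antisym l (≤-trans (≤-reflexive (sym e)) a) , go vs rs c F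
      (≤-trans b (≤-reflexive e))
  flat-hor (suc k) (v ∷ vs) (r ∷ rs) (_ , _ , c) F = flat-hor k vs rs c F

  ver-sum : ∀ {n} (q r : Vec ℕ n) → Ver q r → sum q ≡ sum r + diff q r
  ver-sum []       []       _               = refl
  ver-sum (q ∷ qs) (r ∷ rs) (e , v) = trans (cong₂ _+_ (go e) (ver-sum qs rs v)) (lemma r (q ∸ r) (sum rs) (diff qs rs))
    where
    go : q ≡ r ⊎ q ≡ suc r → q ≡ r + (q ∸ r)
    go (inj₁ refl) = sym (m+[n∸m]≡n {r} {q} ≤-refl)
    go (inj₂ refl) = sym (m+[n∸m]≡n {r} {q} (n≤1+n r))
    lemma : ∀ a b c d → (a + b) + (c + d) ≡ (a + c) + (b + d)
    lemma = solve-∀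

  -- The operator V at the outer end: it removes a vertical strip from all rows but the first and
  -- adds the size of the strip to the counter m.
  appendVer : ∀ {n} → ℕ → (ℕ → Vec ℕ n → ℕ → ℤ) → Vec ℕ (suc n) → ℤ
  appendVer {n} m f (y ∷ q) = ∑ (vecs n) (λ s → when (VerP? q s) (f y s (m + diff q s)))

  -- V is carried from the outer end to the inner end, past one strip at a time, the outermost
  -- first. Each passage leaves a bit ε, which `bpaths` records as an extra label of the first row.
  -- The bound on k + L keeps the last row empty at every passage, as `commute-strips` requires.
  commute-paths : ∀ {L n} k (ls : Vec Level L) x (p : Vec ℕ n) m f → Part (x ∷ p) → Flat k (x ∷ p) → k + L ≤ suc n → x ≤ W →
    paths ls (x ∷ p) (appendVer m f) ≡ ∑ (vecs n) (λ s → when (VerP? p s) (bpaths 0 ls x s (m + diff p s) f))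
  commute-paths k [] x p m f _ _ _ _ = refl
  commute-paths {suc L} {n} k (l@(u , w , c) ∷ ls) x p m f P F k≤ x≤W = begin
    ∑ (vecs (suc n)) (λ v → when (Step? l (x ∷ p) v) (paths ls v (appendVer m f)))
      ≡⟨ ∑-vecs n _ ⟩
    ∑ range (λ y → ∑ (vecs n) (λ q → when (Step? l (x ∷ p) (y ∷ q)) (paths ls (y ∷ q) (appendVer m f))))
      ≡⟨ (∑-cong∈ range λ y y∈ → ∑-cong (vecs n) λ q → when-map (Step? l (x ∷ p) (y ∷ q)) λ { (a , h , e) →
           commute-paths (suc k) ls y q m f (hor-part (x ∷ p) (y ∷ q) h) (flat-hor k (x ∷ p) (y ∷ q) h F)
             (≤-trans (≤-reflexive (sym (+-suc k L))) k≤) (∈range⁻ y∈) }) ⟩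
    ∑ range (λ y → ∑ (vecs n) (λ q → when (Step? l (x ∷ p) (y ∷ q))
      (∑ (vecs n) (λ r → when (VerP? q r) (b y r (m + diff q r))))))
      ≡⟨ (∑-cong range λ y → trans (∑-cong (vecs n) λ q → push₁ (vecs n) (Step? l (x ∷ p) (y ∷ q)) (VerP? q)
        (λ r → b y r (m + diff q r))) (∑-swap (vecs n) (vecs n) _)) ⟩
    ∑ range (λ y → ∑ (vecs n) (λ r → ∑ (vecs n) (λ q → when (Step? l (x ∷ p) (y ∷ q) ×-dec VerP? q r)
      (b y r (m + diff q r)))))
      ≡⟨ (∑-cong range λ y → ∑-cong (vecs n) λ r → trans (∑-cong (vecs n) λ q → gather y r q)
        (sym (push₁ (vecs n) (C? y r) (HV? r) (λ q → G y r (diff q r))))) ⟩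
    ∑ range (λ y → ∑ (vecs n) (λ r → when (C? y r) (∑ (vecs n) (λ q → when (HV? r q) (G y r (diff q r))))))
      ≡⟨ (∑-cong range λ y → ∑-cong (vecs n) λ r → when-map (C? y r) λ { (_ , _ , Pr) → commute-strips x p r P Pr
        (flat-last k x p F (≤-pred (≤-trans (≤-trans (≤-reflexive (cong suc (sym (+-identityʳ k))))
          (≤-trans (≤-reflexive (sym (+-suc k 0))) (+-monoʳ-≤ k (s≤s z≤n)))) k≤))) x≤W (G y r) }) ⟩
    ∑ range (λ y → ∑ (vecs n) (λ r → when (C? y r)
      (∑ bits (λ ε → when (hd r + ε ≤? x) (∑ (vecs n) (λ s → when (VH? r s) (G y r (ε + diff p s))))))))
      ≡⟨ (∑-cong range λ y → ∑-cong (vecs n) λ r → left y r) ⟩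
    ∑ range (λ y → ∑ (vecs n) (λ r → ∑ bits (λ ε → ∑ (vecs n) (λ s → T s ε y r))))
      ≡⟨ (∑-cong range λ y → ∑-swap (vecs n) bits _) ⟩
    ∑ range (λ y → ∑ bits (λ ε → ∑ (vecs n) (λ r → ∑ (vecs n) (λ s → T s ε y r))))
      ≡⟨ ∑-swap range bits _ ⟩
    ∑ bits (λ ε → ∑ range (λ y → ∑ (vecs n) (λ r → ∑ (vecs n) (λ s → T s ε y r))))
      ≡⟨ (∑-cong bits λ ε → ∑-cong range λ y → ∑-swap (vecs n) (vecs n) _) ⟩
    ∑ bits (λ ε → ∑ range (λ y → ∑ (vecs n) (λ s → ∑ (vecs n) (λ r → T s ε y r))))
      ≡⟨ (∑-cong bits λ ε → ∑-swap range (vecs n) _) ⟩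
    ∑ bits (λ ε → ∑ (vecs n) (λ s → ∑ range (λ y → ∑ (vecs n) (λ r → T s ε y r))))
      ≡⟨ ∑-swap bits (vecs n) _ ⟩
    ∑ (vecs n) (λ s → ∑ bits (λ ε → ∑ range (λ y → ∑ (vecs n) (λ r → T s ε y r))))
      ≡⟨ (∑-cong (vecs n) λ s → sym (push₃ bits range (vecs n) (VerP? p s) (λ ε y r → BStep? 0 l x s ε y r)
        (λ ε y r → b y r (m + diff p s + ε)))) ⟩
    ∑ (vecs n) (λ s → when (VerP? p s) (bpaths 0 (l ∷ ls) x s (m + diff p s) f)) ∎
    where
    open ≡-Reasoning
    b : ℕ → Vec ℕ n → ℕ → ℤ
    b y r m = bpaths 0 ls y r m f
    C? : ∀ y r → Dec (x ≤ y × y ≤ u × Part r)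
    C? y r = x ≤? y ×-dec y ≤? u ×-dec Part? r
    HV? : ∀ (r q : Vec ℕ n) → Dec (hd q ≤ x × Hor p q × Ver q r)
    HV? r q = hd q ≤? x ×-dec Hor? p q ×-dec Ver? q r
    VH? : ∀ (r s : Vec ℕ n) → Dec (Ver p s × Hor s r)
    VH? r s = Ver? p s ×-dec Hor? s r
    S? : ∀ y (r : Vec ℕ n) k → Dec (y + (sum r + k) + w ≡ x + sum p + c)
    S? y r k = y + (sum r + k) + w ≟ x + sum p + c
    G : ℕ → Vec ℕ n → ℕ → ℤ
    G y r k = when (S? y r k) (b y r (m + k))
    T : Vec ℕ n → ℕ → ℕ → Vec ℕ n → ℤ
    T s ε y r = when (VerP? p s ×-dec BStep? 0 l x s ε y r) (b y r (m + diff p s + ε))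
    gather : ∀ y r q → when (Step? l (x ∷ p) (y ∷ q) ×-dec VerP? q r) (b y r (m + diff q r))
      ≡ when (C? y r ×-dec HV? r q) (G y r (diff q r))
    gather y r q = trans
      (when-cong (Step? l (x ∷ p) (y ∷ q) ×-dec VerP? q r) ((C? y r ×-dec HV? r q) ×-dec S? y r (diff q r))
        (λ { ((a , (d , e , h) , z) , v , Pr) → ((d , a , Pr) , e , h , v) , trans (cong (λ k → y + k + w)
          (sym (ver-sum q r v))) z })
        (λ { (((d , a , Pr) , e , h , v) , z) → (a , (d , e , h) , trans (cong (λ k → y + k + w) (ver-sum q r v)) z) , v ,
          Pr })
        (λ _ _ → refl))
      (sym (when-× (C? y r ×-dec HV? r q) (S? y r (diff q r))))
    left : ∀ y r → when (C? y r) (∑ bits (λ ε → when (hd r + ε ≤? x)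
      (∑ (vecs n) (λ s → when (VH? r s) (G y r (ε + diff p s))))))
      ≡ ∑ bits (λ ε → ∑ (vecs n) (λ s → T s ε y r))
    left y r = begin
      when (C? y r) (∑ bits (λ ε → when (hd r + ε ≤? x) (∑ (vecs n) (λ s → when (VH? r s) (G y r (ε + diff p s))))))
        ≡⟨ (when-map (C? y r) λ _ → ∑-cong bits λ ε → trans (when-map (hd r + ε ≤? x) λ _ → ∑-cong (vecs n) λ s → when-×
          (VH? r s) (S? y r (ε + diff p s)))
             (push₁ (vecs n) (hd r + ε ≤? x) (λ s → VH? r s ×-dec S? y r (ε + diff p s))
               (λ s → b y r (m + (ε + diff p s))))) ⟩
      when (C? y r) (∑ bits (λ ε → ∑ (vecs n) (λ s → when (hd r + ε ≤? x ×-dec VH? r s ×-dec S? y r (ε + diff p s))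
        (b y r (m + (ε + diff p s))))))
        ≡⟨ push₂ bits (vecs n) (C? y r) (λ ε s → hd r + ε ≤? x ×-dec VH? r s ×-dec S? y r (ε + diff p s))
          (λ ε s → b y r (m + (ε + diff p s))) ⟩
      ∑ bits (λ ε → ∑ (vecs n) (λ s → when (C? y r ×-dec hd r + ε ≤? x ×-dec VH? r s ×-dec S? y r (ε + diff p s))
        (b y r (m + (ε + diff p s)))))
        ≡⟨ (∑-cong bits λ ε → ∑-cong (vecs n) λ s → when-cong (C? y r ×-dec hd r + ε ≤? x ×-dec VH? r s ×-dec S? y r
          (ε + diff p s)) (VerP? p s ×-dec BStep? 0 l x s ε y r)
             (λ { ((a , d , Pr) , e , (v , h) , z) → (v , hor-part′ s r h) , (a , d , m+n≤o⇒n≤o (hd r) e) , (e , h) ,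
                    +-cancelʳ-≡ (diff p s) _ _ (trans (l₁ y (sum r) ε (diff p s) w)
                      (trans z (trans (cong (λ k → x + k + c) (ver-sum p s v)) (l₂ x (sum s) (diff p s) c)))) })
             (λ { ((v , Ps) , (a , d , _) , (e , h) , z) → (a , d , hor-part s r h) , e , (v , h) ,
                    trans (sym (l₁ y (sum r) ε (diff p s) w)) (trans (cong (_+ diff p s) z)
                      (trans (sym (l₂ x (sum s) (diff p s) c)) (cong (λ k → x + k + c) (sym (ver-sum p s v))))) })
             (λ _ _ → cong (b y r) (l₃ m ε (diff p s)))) ⟩
      ∑ bits (λ ε → ∑ (vecs n) (λ s → T s ε y r)) ∎
      where
      l₁ : ∀ y r ε d w → y + r + ε + w + d ≡ y + (r + (ε + d)) + w
      l₁ = solve-∀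
      l₂ : ∀ x s d c → x + (s + d) + c ≡ x + s + c + d
      l₂ = solve-∀
      l₃ : ∀ m ε d → m + (ε + d) ≡ m + d + ε
      l₃ = solve-∀

  -- This is the relation Σ (-1)^i h_i e_(m-i) = 0 for m > 0, written for strips. Suppose the lower
  -- rows of s and a agree. If s < a in the top row, p = s and p = s + 1 are both admissible there
  -- and have opposite signs; if s = a only p = s is, and if s > a neither. When the lower rows
  -- differ, they already contribute 0.
  cancel-strips : ∀ {n} (a s : Vec ℕ n) → Part a → Part s → hd a ≤ W → ∀ z →
    ∑ (vecs n) (λ p → when (Hor? p a ×-dec Ver? p s) (sg (diff a p) z)) ≡ when (≡-dec _≟_ s a) z
  cancel-strips [] [] _ _ _ z = trans (∑-vecs0 _) (sym (when-yes (≡-dec _≟_ [] []) refl))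
  cancel-strips {suc n} (a ∷ as) (s ∷ ss) (ha , Pa) (hs , Ps) a≤W z = begin
    ∑ (vecs (suc n)) (λ p → when (Hor? p (a ∷ as) ×-dec Ver? p (s ∷ ss)) (sg (diff (a ∷ as) p) z))
      ≡⟨ ∑-vecs n _ ⟩
    ∑ range (λ p → ∑ (vecs n) (λ ps → when (((p ≤? a) ×-dec (hd as ≤? p) ×-dec Hor? ps as) ×-dec ((p ≟ s ⊎-dec p ≟ suc s)
      ×-dec Ver? ps ss)) (sg (a ∸ p + diff as ps) z)))
      ≡⟨ (∑-cong range λ p → trans (∑-cong (vecs n) λ ps → trans
           (when-cong (((p ≤? a) ×-dec (hd as ≤? p) ×-dec Hor? ps as) ×-dec ((p ≟ s ⊎-dec p ≟ suc s) ×-dec Ver? ps ss))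
             ((A? p ×-dec hd as ≤? p) ×-dec (Hor? ps as ×-dec Ver? ps ss))
             (λ { ((x , y , h) , e , v) → ((x , e) , y) , h , v }) (λ { (((x , e) , y) , h , v) → (x , y , h) , e , v })
             (λ _ _ → sym (sg-sg (a ∸ p) (diff as ps) z)))
           (trans (sym (when-× (A? p ×-dec hd as ≤? p) (Hor? ps as ×-dec Ver? ps ss))) (cong (when (A? p ×-dec hd as ≤? p))
             (sym (sg-when (a ∸ p) (Hor? ps as ×-dec Ver? ps ss) _)))))
           (trans (sym (∑-when (vecs n) (A? p ×-dec hd as ≤? p) _)) (trans (cong (when (A? p ×-dec hd as ≤? p))
             (sym (sg-∑ (a ∸ p) (vecs n) _))) (sym (when-× (A? p) (hd as ≤? p)))))) ⟩
    ∑ range (λ p → when (A? p) (when (hd as ≤? p) (sg (a ∸ p) (∑ (vecs n) (λ ps → when (Hor? ps as ×-dec Ver? ps ss)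
      (sg (diff as ps) z))))))
      ≡⟨ (∑-cong range λ p → cong (λ k → when (A? p) (when (hd as ≤? p) (sg (a ∸ p) k))) (cancel-strips as ss Pa Ps
        (≤-trans ha a≤W) z)) ⟩
    ∑ range (λ p → when (A? p) (when (hd as ≤? p) (sg (a ∸ p) (when (≡-dec _≟_ ss as) z))))
      ≡⟨ ∑-ver-outer s (λ p → when (hd as ≤? p) (sg (a ∸ p) (when (≡-dec _≟_ ss as) z))) a≤W ⟩
    ∑ bits (λ δ → when (s + δ ≤? a) (when (hd as ≤? s + δ) (sg (a ∸ (s + δ)) (when (≡-dec _≟_ ss as) z))))
      ≡⟨ ∑-bits _ ⟩
    E 0 +ᶻ E 1
      ≡⟨ final (≡-dec _≟_ ss as) ⟩
    when (≡-dec _≟_ (s ∷ ss) (a ∷ as)) z ∎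
    where
    open ≡-Reasoning
    A? : ∀ p → Dec (p ≤ a × (p ≡ s ⊎ p ≡ suc s))
    A? p = p ≤? a ×-dec (p ≟ s ⊎-dec p ≟ suc s)
    E′ : Dec (ss ≡ as) → ℕ → ℤ
    E′ d δ = when (s + δ ≤? a) (when (hd as ≤? s + δ) (sg (a ∸ (s + δ)) (when d z)))
    E : ℕ → ℤ
    E = E′ (≡-dec _≟_ ss as)
    final : ∀ d → E′ d 0 +ᶻ E′ d 1 ≡ when (≡-dec _≟_ (s ∷ ss) (a ∷ as)) z
    final (no ne) = trans (cong₂ _+ᶻ_ (E0 0) (E0 1)) (sym (when-no (≡-dec _≟_ (s ∷ ss) (a ∷ as)) λ { refl → ne refl }))
      where
      E0 : ∀ δ → when (s + δ ≤? a) (when (hd as ≤? s + δ) (sg (a ∸ (s + δ)) 0ℤ)) ≡ 0ℤ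
      E0 δ = trans (when-map (s + δ ≤? a) λ _ → trans (when-map (hd as ≤? s + δ) λ _ → sg-0 (a ∸ (s + δ)))
        (when-0 (hd as ≤? s + δ))) (when-0 (s + δ ≤? a))
    final (yes refl) with <-cmp s a
    ... | tri> ¬s<a s≢a a<s = trans (cong₂ _+ᶻ_ (when-no (s + 0 ≤? a) (λ l → <⇒≱ a<s (m+n≤o⇒m≤o s l))) (when-no (s + 1 ≤? a)
      (λ l → <⇒≱ a<s (m+n≤o⇒m≤o s l))))
        (sym (when-no (≡-dec _≟_ (s ∷ as) (a ∷ as)) λ { refl → s≢a refl }))
    ... | tri≈ _ refl _ = trans (cong₂ _+ᶻ_ (trans (when-yes (s + 0 ≤? s) (≤-reflexive (+-identityʳ s)))
      (trans (when-yes (hd as ≤? s + 0) (≤-trans hs (m≤m+n s 0)))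
               (cong (λ k → sg k z) (trans (cong (s ∸_) (+-identityʳ s)) (n∸n≡0 s)))))
            (when-no (s + 1 ≤? s) (λ l → <⇒≱ (≤-reflexive (+-comm 1 s)) l)))
          (trans (ℤₚ.+-identityʳ z) (sym (when-yes (≡-dec _≟_ (s ∷ as) (s ∷ as)) refl)))
    ... | tri< s<a s≢a _ = trans (cong₂ _+ᶻ_ (trans (when-yes (s + 0 ≤? a) (≤-trans (≤-reflexive (+-identityʳ s))
      (<⇒≤ s<a))) (trans (when-yes (hd as ≤? s + 0) (≤-trans hs (m≤m+n s 0)))
               (cong (λ k → sg k z) (trans (cong (a ∸_) (+-identityʳ s)) (+-∸-assoc 1 s<a)))))
            (trans (when-yes (s + 1 ≤? a) (≤-trans (≤-reflexive (+-comm s 1)) s<a))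
              (trans (when-yes (hd as ≤? s + 1) (≤-trans hs (m≤m+n s 1)))
               (cong (λ k → sg (a ∸ k) z) (+-comm s 1)))))
          (trans (ℤₚ.+-inverseˡ (sg (a ∸ suc s) z)) (sym (when-no (≡-dec _≟_ (s ∷ as) (a ∷ as)) λ { refl → s≢a refl })))

-- The signed Pieri rule

module StartCancel (β W : ℕ) where
  open Shapes β W
  open Paths β W

  ∈bits⁻ : ∀ {ε} → ε ∈ bits → ε ≤ 1
  ∈bits⁻ (here refl)         = z≤n
  ∈bits⁻ (there (here refl)) = ≤-refl

  -- Once the row end has passed α, α + ε ≤ x holds for either bit, and row ends only grow along the
  -- chain.
  bpaths-past : ∀ {L n} α (ls : Vec Level L) x (p : Vec ℕ n) m f → α < x → bpaths α ls x p m f ≡ bpaths 0 ls x p m f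
  bpaths-past α [] x p m f α<x = refl
  bpaths-past {n = n} α (l@(u , w , c) ∷ ls) x p m f α<x =
    ∑-cong∈ bits λ ε ε∈ → ∑-cong range λ y → ∑-cong (vecs n) λ r →
      when-cong (BStep? α l x p ε y r) (BStep? 0 l x p ε y r)
        (λ { ((a , b , d) , rest) → (a , b , m+n≤o⇒n≤o α d) , rest })
        (λ { ((a , b , d) , rest) → (a , b , ≤-trans (+-monoʳ-≤ α (∈bits⁻ ε∈)) (≤-trans (≤-reflexive (+-comm α 1)) α<x)) ,
          rest })
        (λ { ((a , _) , _) _ → bpaths-past α ls y r (m + ε) f (<-≤-trans α<x a) })

  -- A start x = z with no extra label cancels against a start x = z + 1 with the extra label.
  start-cancel : ∀ {L n} (ls : Vec Level L) α (p : Vec ℕ n) m f → All (λ l → α ≤ proj₁ l) ls → α ≤ W →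
    (∀ x p m → x ≤ α → f x p m ≡ 0ℤ) →
    ∑ range (λ x → when (hd p ≤? x ×-dec x ≤? α) (sg (α ∸ x) (bpaths 0 ls x p (m + (α ∸ x)) f))) ≡ bpaths α ls α p m f
  -- Without labels the row stays at some x ≤ α, an end that f rejects, so both sides are 0.
  start-cancel [] α p m f [] α≤W f0 = trans (∑-≡0 range λ x _ → trans (when-map (hd p ≤? x ×-dec x ≤? α) λ
    { (_ , x≤α) → trans (cong (sg (α ∸ x)) (f0 x p _ x≤α)) (sg-0 (α ∸ x)) }) (when-0 (hd p ≤? x ×-dec x ≤? α)))
    (sym (f0 α p m ≤-refl))
  start-cancel {suc L} {n} (l@(u , w , c) ∷ ls) α p m f (α≤u ∷ α≤) α≤W f0 = begin
    ∑ range (λ x → when (D? x) (sg (α ∸ x) (bpaths 0 (l ∷ ls) x p (m + (α ∸ x)) f)))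
      ≡⟨ (∑-cong range λ x → trans (cong (when (D? x)) (trans (sg-∑ (α ∸ x) bits _) (∑-cong bits λ ε → trans
        (sg-∑ (α ∸ x) range _) (∑-cong range λ y →
            trans (sg-∑ (α ∸ x) (vecs n) _) (∑-cong (vecs n) λ r → sg-when (α ∸ x) (BStep? 0 l x p ε y r) _)))))
            (push₃ bits range (vecs n) (D? x) (λ ε y r → BStep? 0 l x p ε y r) (λ ε y r → v x ε y r))) ⟩
    ∑ range (λ x → ∑ bits (λ ε → ∑ range (λ y → ∑ (vecs n) (λ r → T x ε y r))))
      ≡⟨ (∑-cong range λ x → ∑-swap bits range _) ⟩
    ∑ range (λ x → ∑ range (λ y → ∑ bits (λ ε → ∑ (vecs n) (λ r → T x ε y r))))
      ≡⟨ (∑-cong range λ x → ∑-cong range λ y → ∑-swap bits (vecs n) _) ⟩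
    ∑ range (λ x → ∑ range (λ y → ∑ (vecs n) (λ r → ∑ bits (λ ε → T x ε y r))))
      ≡⟨ ∑-swap range range _ ⟩
    ∑ range (λ y → ∑ range (λ x → ∑ (vecs n) (λ r → ∑ bits (λ ε → T x ε y r))))
      ≡⟨ (∑-cong range λ y → ∑-swap range (vecs n) _) ⟩
    ∑ range (λ y → ∑ (vecs n) (λ r → ∑ range (λ x → ∑ bits (λ ε → T x ε y r))))
      -- For fixed y and r, passing from (x , 0) to (x + 1 , 1) keeps the size equation, the bound
      -- on hd r and the counter, and reverses the sign. The sum over x and ε therefore telescopes
      -- to the value at x = α ⊓ y.
      ≡⟨ (∑-cong range λ y → ∑-cong (vecs n) λ r → telescoped y r) ⟩
    ∑ range (λ y → ∑ (vecs n) (λ r → when (K? y r) (φ y r (α ⊓ y))))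
      ≡⟨ ∑-swap range (vecs n) _ ⟩
    ∑ (vecs n) (λ r → ∑ range (λ y → when (K? y r) (φ y r (α ⊓ y))))
      -- If y > α, what remains is the start x = α with sign +1. If y ≤ α, it is the start x = y:
      -- the label adds no box to the first row, and the sum over y is the same sum for the
      -- remaining labels.
      ≡⟨ (∑-cong (vecs n) λ r → trans (∑-cong range λ y → split y r) (∑-+ range _ _)) ⟩
    ∑ (vecs n) (λ r → ∑ range (λ y → when (E? r) (when (hd r ≤? y ×-dec y ≤? α) (sg (α ∸ y) (b y r (m + (α ∸ y)))))) +ᶻ ∑
      range (λ y → when (Up? y r) (b y r m)))
      ≡⟨ (∑-cong (vecs n) λ r → cong₂ _+ᶻ_ (trans (sym (∑-when range (E? r) _)) (cong (when (E? r)) (start-cancel ls α r m f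
        α≤ α≤W f0))) refl) ⟩
    ∑ (vecs n) (λ r → when (E? r) (bα α r m) +ᶻ ∑ range (λ y → when (Up? y r) (b y r m)))
      ≡⟨ (∑-cong (vecs n) λ r → cong₂ _+ᶻ_ (lowpart r)
            (∑-cong range λ y → when-map (Up? y r) λ { (α<y , _) → sym (bpaths-past α ls y r m f α<y) })) ⟩
    ∑ (vecs n) (λ r → ∑ range (λ y → when (y ≤? α ×-dec y ≟ α) (when (E? r ×-dec hd r ≤? α) (bα y r m))) +ᶻ ∑ range
      (λ y → when (Up? y r) (bα y r m)))
      ≡⟨ (∑-cong (vecs n) λ r → trans (sym (∑-+ range _ _)) (∑-cong range λ y → sym (merge y r))) ⟩
    ∑ (vecs n) (λ r → ∑ range (λ y → when (BStep? α l α p 0 y r) (bα y r (m + 0))))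
      ≡⟨ ∑-swap (vecs n) range _ ⟩
    ∑ range (λ y → ∑ (vecs n) (λ r → when (BStep? α l α p 0 y r) (bα y r (m + 0))))
      ≡⟨ sym (trans (cong (B 0 +ᶻ_) B1≡0) (ℤₚ.+-identityʳ (B 0))) ⟩
    B 0 +ᶻ B 1
      ≡⟨ sym (∑-bits B) ⟩
    bpaths α (l ∷ ls) α p m f ∎
    where
    open ≡-Reasoning
    b bα : ℕ → Vec ℕ n → ℕ → ℤ
    b y r m = bpaths 0 ls y r m f
    bα y r m = bpaths α ls y r m f
    B : ℕ → ℤ
    B ε = ∑ range (λ y → ∑ (vecs n) (λ r → when (BStep? α l α p ε y r) (bα y r (m + ε))))
    -- At x = α the row has no box yet that could take an extra label.
    B1≡0 : B 1 ≡ 0ℤ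
    B1≡0 = ∑-≡0 range λ y _ → ∑-≡0 (vecs n) λ r _ → when-no (BStep? α l α p 1 y r) λ { ((_ , _ , z) , _) → <⇒≱
      (≤-reflexive (+-comm 1 α)) z }
    D? : ∀ x → Dec (hd p ≤ x × x ≤ α)
    D? x = hd p ≤? x ×-dec x ≤? α
    v T : ℕ → ℕ → ℕ → Vec ℕ n → ℤ
    v x ε y r = sg (α ∸ x) (b y r (m + (α ∸ x) + ε))
    T x ε y r = when (D? x ×-dec BStep? 0 l x p ε y r) (v x ε y r)
    K? : ∀ y (r : Vec ℕ n) → Dec (y ≤ u × Hor p r)
    K? y r = y ≤? u ×-dec Hor? p r
    Q? : ∀ y (r : Vec ℕ n) z → Dec (hd r ≤ z × y + sum r + w ≡ z + sum p + c)
    Q? y r z = hd r ≤? z ×-dec y + sum r + w ≟ z + sum p + c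
    φ : ℕ → Vec ℕ n → ℕ → ℤ
    φ y r z = when (Q? y r z) (sg (α ∸ z) (b y r (m + (α ∸ z))))
    E? : ∀ (r : Vec ℕ n) → Dec (Hor p r × sum r + w ≡ sum p + c)
    E? r = Hor? p r ×-dec sum r + w ≟ sum p + c
    Up? : ∀ y (r : Vec ℕ n) → Dec (α < y × (y ≤ u × Hor p r) × hd r ≤ α × y + sum r + w ≡ α + sum p + c)
    Up? y r = suc α ≤? y ×-dec K? y r ×-dec Q? y r α
    telescoped : ∀ y r → ∑ range (λ x → ∑ bits (λ ε → T x ε y r)) ≡ when (K? y r) (φ y r (α ⊓ y))
    telescoped y r = begin
      ∑ range (λ x → ∑ bits (λ ε → T x ε y r))
        ≡⟨ (∑-cong range λ x → trans (∑-bits _) (cong₂ _+ᶻ_ (t₀ x) (t₁ x))) ⟩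
      ∑ range (λ x → when (K? y r) (when (x ≤? α ⊓ y) (φ y r x)) +ᶻ when (K? y r) (when (1 ≤? x ×-dec x ≤? α ⊓ y)
        (-ᶻ φ y r (x ∸ 1))))
        ≡⟨ ∑-+ range _ _ ⟩
      ∑ range (λ x → when (K? y r) (when (x ≤? α ⊓ y) (φ y r x))) +ᶻ ∑ range (λ x → when (K? y r)
        (when (1 ≤? x ×-dec x ≤? α ⊓ y) (-ᶻ φ y r (x ∸ 1))))
        ≡⟨ cong₂ _+ᶻ_ (sym (∑-when range (K? y r) _)) (sym (∑-when range (K? y r) _)) ⟩
      when (K? y r) (∑ range (λ x → when (x ≤? α ⊓ y) (φ y r x))) +ᶻ when (K? y r)
        (∑ range (λ x → when (1 ≤? x ×-dec x ≤? α ⊓ y) (-ᶻ φ y r (x ∸ 1))))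
        ≡⟨ when-+ (K? y r) _ _ ⟩
      when (K? y r) (∑ range (λ x → when (x ≤? α ⊓ y) (φ y r x)) +ᶻ ∑ range (λ x → when (1 ≤? x ×-dec x ≤? α ⊓ y)
        (-ᶻ φ y r (x ∸ 1))))
        ≡⟨ cong (when (K? y r)) (∑-telescope (φ y r) (≤-trans (m⊓n≤m α y) α≤W)) ⟩
      when (K? y r) (φ y r (α ⊓ y)) ∎
      where
      when-+ : ∀ {P : Set} (d : Dec P) a b → when d a +ᶻ when d b ≡ when d (a +ᶻ b)
      when-+ (yes _) a b = refl
      when-+ (no _)  a b = refl
      flat₃ : ∀ {P Q R : Set} (d : Dec P) (e : Dec Q) (g : Dec R) z → when d (when e (when g z)) ≡ when (d ×-dec e ×-dec g) z
      flat₃ d e g z = trans (cong (when d) (when-× e g)) (when-× d (e ×-dec g))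
      t₀ : ∀ x → T x 0 y r ≡ when (K? y r) (when (x ≤? α ⊓ y) (φ y r x))
      t₀ x = trans (when-cong (D? x ×-dec BStep? 0 l x p 0 y r) (K? y r ×-dec x ≤? α ⊓ y ×-dec Q? y r x)
        (λ { ((_ , x≤α) , (x≤y , y≤u , _) , (h , H) , e) → (y≤u , H) , ⊓-glb x≤α x≤y , m+n≤o⇒m≤o (hd r) h , trans
          (cong (_+ w) (sym (+-identityʳ _))) e })
        (λ { ((y≤u , H) , x≤ , h , e) → (≤-trans (hor-hd p r H) h , m≤n⊓o⇒m≤n α y x≤) , (m≤n⊓o⇒m≤o α y x≤ , y≤u , z≤n) ,
          (≤-trans (≤-reflexive (+-identityʳ _)) h , H) , trans (cong (_+ w) (+-identityʳ _)) e })
        (λ _ _ → cong (λ k → sg (α ∸ x) (b y r k)) (+-identityʳ _)))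
        (sym (flat₃ (K? y r) (x ≤? α ⊓ y) (Q? y r x) _))
      t₁ : ∀ x → T x 1 y r ≡ when (K? y r) (when (1 ≤? x ×-dec x ≤? α ⊓ y) (-ᶻ φ y r (x ∸ 1)))
      t₁ x = trans (when-cong (D? x ×-dec BStep? 0 l x p 1 y r) (K? y r ×-dec (1 ≤? x ×-dec x ≤? α ⊓ y) ×-dec Q? y r (x ∸ 1))
        (λ { ((_ , x≤α) , (x≤y , y≤u , 1≤x) , (h , H) , e) → (y≤u , H) , (1≤x , ⊓-glb x≤α x≤y) , m+n≤o⇒m≤o∸n (hd r) h ,
          shift⁻ x 1≤x e })
        (λ { ((y≤u , H) , (1≤x , x≤) , h , e) → (≤-trans (hor-hd p r H) (≤-trans h (m∸n≤m x 1)) , m≤n⊓o⇒m≤n α y x≤) ,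
          (m≤n⊓o⇒m≤o α y x≤ , y≤u , 1≤x) , (≤-trans (+-monoˡ-≤ 1 h) (≤-reflexive (m∸n+n≡m 1≤x)) , H) , shift x 1≤x e })
        (λ { _ (_ , (1≤x , x≤) , _) → val x 1≤x (m≤n⊓o⇒m≤n α y x≤) }))
        (sym (trans (cong (λ z → when (K? y r) (when (1 ≤? x ×-dec x ≤? α ⊓ y) z)) (sym (when-neg (Q? y r (x ∸ 1)) _)))
          (flat₃ (K? y r) (1 ≤? x ×-dec x ≤? α ⊓ y) (Q? y r (x ∸ 1)) _)))
        where
        l₁ : ∀ y s w → y + s + 1 + w ≡ suc (y + s + w)
        l₁ = solve-∀
        shift⁻ : ∀ x → 1 ≤ x → y + sum r + 1 + w ≡ x + sum p + c → y + sum r + w ≡ (x ∸ 1) + sum p + c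
        shift⁻ (suc x) _ e = suc-injective (trans (sym (l₁ y (sum r) w)) e)
        shift : ∀ x → 1 ≤ x → y + sum r + w ≡ (x ∸ 1) + sum p + c → y + sum r + 1 + w ≡ x + sum p + c
        shift (suc x) _ e = trans (l₁ y (sum r) w) (cong suc e)
        val : ∀ x → 1 ≤ x → x ≤ α → v x 1 y r ≡ -ᶻ sg (α ∸ (x ∸ 1)) (b y r (m + (α ∸ (x ∸ 1))))
        val (suc x) _ x<α = trans (sym (ℤₚ.neg-involutive _)) (cong₂ (λ i j → -ᶻ sg i (b y r j)) (sym (+-∸-assoc 1 x<α))
          (trans (+-comm _ 1) (trans (sym (+-suc m _)) (cong (m +_) (sym (+-∸-assoc 1 x<α))))))
    split : ∀ y r → when (K? y r) (φ y r (α ⊓ y)) ≡ when (E? r) (when (hd r ≤? y ×-dec y ≤? α)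
      (sg (α ∸ y) (b y r (m + (α ∸ y))))) +ᶻ when (Up? y r) (b y r m)
    split y r with suc α ≤? y
    ... | yes α<y = trans (trans (cong (λ z → when (K? y r) (φ y r z)) (m≤n⇒m⊓n≡m (<⇒≤ α<y)))
            (trans (when-× (K? y r) (Q? y r α)) (when-cong (K? y r ×-dec Q? y r α) (yes α<y ×-dec K? y r ×-dec Q? y r α)
              (α<y ,_) proj₂
               (λ _ _ → trans (cong (λ k → sg k (b y r (m + k))) (n∸n≡0 α)) (cong (b y r) (+-identityʳ m))))))
          (sym (trans (cong₂ _+ᶻ_ (trans (cong (when (E? r)) (when-no (hd r ≤? y ×-dec y ≤? α) (λ z → <⇒≱ α<y (proj₂ z))))
            (when-0 (E? r))) refl) (ℤₚ.+-identityˡ _)))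
    ... | no ¬α<y = trans (trans (cong (λ z → when (K? y r) (φ y r z)) (m≥n⇒m⊓n≡n y≤α))
            (trans (when-× (K? y r) (Q? y r y)) (trans (when-cong (K? y r ×-dec Q? y r y)
              (E? r ×-dec (hd r ≤? y ×-dec y ≤? α))
               (λ { ((_ , H) , h , e) → (H , +-cancelˡ-≡ y _ _ (trans (sym (+-assoc y _ w)) (trans e (+-assoc y _ c)))) , h
                 , y≤α })
               (λ { ((H , e) , h , _) → (≤-trans y≤α α≤u , H) , h , trans (+-assoc y _ w) (trans (cong (λ k → y + k) e)
                 (sym (+-assoc y _ c))) })
               (λ _ _ → refl)) (sym (when-× (E? r) (hd r ≤? y ×-dec y ≤? α))))))
          (sym (ℤₚ.+-identityʳ _))
      where
      y≤α : y ≤ α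
      y≤α = ≮⇒≥ ¬α<y
    lowpart : ∀ r → when (E? r) (bα α r m) ≡ ∑ range (λ y → when (y ≤? α ×-dec y ≟ α) (when (E? r ×-dec hd r ≤? α)
      (bα y r m)))
    lowpart r = trans h≤ (sym (trans (∑-range-one α (λ y → when (E? r ×-dec hd r ≤? α) (bα y r m)) α≤W) (when-yes (α ≤? α)
      ≤-refl)))
      where
      -- For hd r > α the induction hypothesis reads 0 = `bα α r m`, because its sum over x is
      -- empty.
      h≤ : when (E? r) (bα α r m) ≡ when (E? r ×-dec hd r ≤? α) (bα α r m)
      h≤ with hd r ≤? α
      ... | yes h = when-cong (E? r) (E? r ×-dec yes h) (_, h) proj₁ (λ _ _ → refl)
      ... | no ¬h = trans (trans (cong (when (E? r)) (trans (sym (start-cancel ls α r m f α≤ α≤W f0)) (∑-≡0 range λ x _ →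
        when-no (hd r ≤? x ×-dec x ≤? α) (λ { (h , x≤α) → ¬h (≤-trans h x≤α) })))) (when-0 (E? r)))
                          (sym (when-no (E? r ×-dec no ¬h) (¬h ∘ proj₂)))
    merge : ∀ y r → when (BStep? α l α p 0 y r) (bα y r (m + 0)) ≡
      when (y ≤? α ×-dec y ≟ α) (when (E? r ×-dec hd r ≤? α) (bα y r m)) +ᶻ when (Up? y r) (bα y r m)
    merge y r = trans (trans (cong (λ k → when (BStep? α l α p 0 y r) (bα y r k)) (+-identityʳ m))
      (when-split (((y ≤? α ×-dec y ≟ α) ×-dec (E? r ×-dec hd r ≤? α))) (Up? y r) (BStep? α l α p 0 y r)
        (λ { ((a , b , d) , (h , H) , e) → [ (λ α<y → inj₂ (α<y , (b , H) , m+n≤o⇒m≤o (hd r) h , trans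
          (cong (_+ w) (sym (+-identityʳ _))) e)) ,
               (λ { refl → inj₁ ((≤-refl , refl) , (H , +-cancelˡ-≡ α _ _ (trans (sym (+-assoc α _ w))
                 (trans (cong (_+ w) (sym (+-identityʳ _))) (trans e (+-assoc α _ c))))) , m+n≤o⇒m≤o (hd r) h) }) ]′
                   (m≤n⇒m<n∨m≡n a) })
        (λ { ((_ , refl) , (H , e) , h) → (≤-refl , α≤u , ≤-reflexive (+-identityʳ α)) ,
          (≤-trans (≤-reflexive (+-identityʳ _)) h , H) , trans (cong (_+ w) (+-identityʳ _)) (trans (+-assoc α _ w)
            (trans (cong (λ k → α + k) e) (sym (+-assoc α _ c)))) })
        (λ { (α<y , (b , H) , h , e) → (<⇒≤ α<y , b , ≤-reflexive (+-identityʳ α)) , (≤-trans (≤-reflexive (+-identityʳ _))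
          h , H) , trans (cong (_+ w) (+-identityʳ _)) e })
        (λ { ((_ , refl) , _) (α<α , _) → <-irrefl refl α<α })))
      (cong₂ _+ᶻ_ (sym (when-× (y ≤? α ×-dec y ≟ α) (E? r ×-dec hd r ≤? α))) refl)

module Pieri (β W : ℕ) (β≤W : β ≤ W) where
  open Shapes β W
  open Paths β W
  open StartCancel β W

  _≟ⱽ_ : ∀ {n} (v w : Vec ℕ n) → Dec (v ≡ w)
  _≟ⱽ_ = ≡-dec _≟_

  ∑-vecs-one : ∀ {n} (v : Vec ℕ n) F → Part v → hd v ≤ W → ∑ (vecs n) (λ b → when (v ≟ⱽ b) (F b)) ≡ F v
  ∑-vecs-one [] F _ _ = trans (∑-vecs0 _) (when-yes ([] ≟ⱽ []) refl)
  ∑-vecs-one {suc n} (x ∷ v) F (h , P) x≤W = begin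
    ∑ (vecs (suc n)) (λ b → when ((x ∷ v) ≟ⱽ b) (F b)) ≡⟨ ∑-vecs n _ ⟩
    ∑ range (λ y → ∑ (vecs n) (λ w → when ((x ∷ v) ≟ⱽ (y ∷ w)) (F (y ∷ w))))
      ≡⟨ (∑-cong range λ y → trans (∑-cong (vecs n) λ w → trans (when-cong ((x ∷ v) ≟ⱽ (y ∷ w)) (x ≟ y ×-dec v ≟ⱽ w)
        (λ { refl → refl , refl }) (λ { (refl , refl) → refl }) (λ _ _ → refl))
             (sym (when-× (x ≟ y) (v ≟ⱽ w)))) (sym (∑-when (vecs n) (x ≟ y) _))) ⟩
    ∑ range (λ y → when (x ≟ y) (∑ (vecs n) (λ w → when (v ≟ⱽ w) (F (y ∷ w)))))
      ≡⟨ (∑-cong range λ y → cong (when (x ≟ y)) (∑-vecs-one v (λ w → F (y ∷ w)) P (≤-trans h x≤W))) ⟩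
    ∑ range (λ y → when (x ≟ y) (F (y ∷ v)))
      ≡⟨ ∑-upTo-one (suc W) x (x ≟_) (λ y → F (y ∷ v)) (s≤s x≤W) refl (λ _ _ → sym) ⟩
    F (x ∷ v) ∎
    where open ≡-Reasoning

  ∑-vecs-cong : ∀ n {f g : Vec ℕ n → ℤ} → (∀ v → hd v ≤ W → f v ≡ g v) → ∑ (vecs n) f ≡ ∑ (vecs n) g
  ∑-vecs-cong zero    eq = ∑-cong (vecs 0) λ { [] → eq [] β≤W }
  ∑-vecs-cong (suc n) eq = trans (∑-vecs n _) (trans (∑-cong∈ range λ x x∈ → ∑-cong (vecs n) λ v → eq (x ∷ v) (∈range⁻ x∈))
    (sym (∑-vecs n _)))

  paths-cong : ∀ {L n} (ls : Vec Level L) (v : Vec ℕ n) {f g} → (∀ v → Part v → hd v ≤ W → f v ≡ g v) →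
    Part v → hd v ≤ W → paths ls v f ≡ paths ls v g
  paths-cong []       v eq P h = eq v P h
  paths-cong {n = n} (l ∷ ls) v eq _ _ = ∑-vecs-cong n λ r hr → when-map (Step? l v r) λ { (_ , H , _) → paths-cong ls r eq
    (hor-part v r H) hr }

  paths-∑ : ∀ {A : Set} {L n} (xs : List A) (ls : Vec Level L) (v : Vec ℕ n) (g : A → Vec ℕ n → ℤ) →
    paths ls v (λ w → ∑ xs (λ a → g a w)) ≡ ∑ xs (λ a → paths ls v (g a))
  paths-∑ xs [] v g = refl
  paths-∑ {n = n} xs (l ∷ ls) v g = trans (∑-cong (vecs n) λ r → trans (cong (when (Step? l v r)) (paths-∑ xs ls r g))
    (∑-when xs (Step? l v r) _)) (∑-swap (vecs n) xs _)

  paths-when : ∀ {P : Set} {L n} (d : Dec P) (ls : Vec Level L) (v : Vec ℕ n) (g : Vec ℕ n → ℤ) →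
    paths ls v (λ w → when d (g w)) ≡ when d (paths ls v g)
  paths-when (yes _) ls v g = refl
  paths-when (no _)  [] v g = refl
  paths-when {n = n} (no ¬p) (l ∷ ls) v g = ∑-≡0 (vecs n) λ r _ → trans (cong (when (Step? l v r)) (paths-when (no ¬p) ls r
    g)) (when-0 (Step? l v r))

  -- Counts the semistandard fillings of b / a that obey the constraints in `ls`, as chains of
  -- horizontal strips.
  pathsTo : ∀ {L n} → Vec Level L → Vec ℕ n → Vec ℕ n → ℤ
  pathsTo ls a b = paths ls a (λ v → when (v ≟ⱽ b) 1ℤ)

  -- The first row of `b` is the row whose number is the label being placed; row-boundedness keeps
  -- this label of T″ out of it, so it stays at ν.
  Grow : ∀ {n} → Vec ℕ (suc n) → ℕ → Vec ℕ n → Set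
  Grow (y ∷ q) ν O = y ≡ ν × Ver q O × Part (y ∷ q)

  Grow? : ∀ {n} (b : Vec ℕ (suc n)) ν O → Dec (Grow b ν O)
  Grow? (y ∷ q) ν O = y ≟ ν ×-dec Ver? q O ×-dec Part? (y ∷ q)

  -- Remove a horizontal strip from the inner shape α ∷ K, add a vertical strip to the outer
  -- shape ν ∷ O below its first row, k boxes in total.
  Pair : ∀ {n} → ℕ → Vec ℕ n → ℕ → Vec ℕ n → ℕ → Vec ℕ (suc n) → Vec ℕ (suc n) → Set
  Pair α K ν O k a b = Hor a (α ∷ K) × Grow b ν O × diff (α ∷ K) a + diff b (ν ∷ O) ≡ k

  Pair? : ∀ {n} α (K : Vec ℕ n) ν O k a b → Dec (Pair α K ν O k a b)
  Pair? α K ν O k a b = Hor? a (α ∷ K) ×-dec Grow? b ν O ×-dec diff (α ∷ K) a + diff b (ν ∷ O) ≟ k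

  ends : ∀ {n} → ℕ → Vec ℕ n → ℕ → ℕ → Vec ℕ n → ℕ → ℤ
  ends ν O k y s m = when (y ≟ ν ×-dec s ≟ⱽ O ×-dec m ≟ k) 1ℤ

  flat-sub : ∀ {n} k (a A : Vec ℕ n) → Hor a A → Flat k A → Flat k a
  flat-sub k       []      []      _ _ = tt
  flat-sub zero    (a ∷ as) (A ∷ As) h@(a≤ , _ , H) (e , F) = ≤-antisym (≤-trans a≤ (≤-reflexive e))
    (part-β (a ∷ as) (hor-part′ (a ∷ as) (A ∷ As) h)) , flat-sub zero as As H F
  flat-sub (suc k) (a ∷ as) (A ∷ As) (_ , _ , H) F = flat-sub k as As H F

  diff-self : ∀ {n} (v : Vec ℕ n) → diff v v ≡ 0
  diff-self []      = refl
  diff-self (x ∷ v) = cong₂ _+_ (n∸n≡0 x) (diff-self v)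

  diff-trans : ∀ {n} (K p s : Vec ℕ n) → Hor p K → Ver p s → diff K p + diff p s ≡ diff K s
  diff-trans []       []       []       _ _ = refl
  diff-trans (K ∷ Ks) (p ∷ ps) (s ∷ ss) (p≤K , _ , H) (e , v) = trans (l (K ∸ p) _ (p ∸ s) _) (cong₂ _+_ (go (s≤p e))
    (diff-trans Ks ps ss H v))
    where
    l : ∀ a b c d → (a + b) + (c + d) ≡ (a + c) + (b + d)
    l = solve-∀
    s≤p : p ≡ s ⊎ p ≡ suc s → s ≤ p
    s≤p (inj₁ refl) = ≤-refl
    s≤p (inj₂ refl) = n≤1+n s
    go : s ≤ p → (K ∸ p) + (p ∸ s) ≡ K ∸ s
    go s≤p = trans (sym (+-∸-assoc (K ∸ p) s≤p)) (cong (_∸ s) (m∸n+n≡m p≤K))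

  -- Summing over the enlarged outer shape b turns the strip removed by V at the end of a path into
  -- a vertical strip b / (ν ∷ O) that is added.
  appendVer-pathsTo : ∀ {L n} (ls : Vec Level L) (a : Vec ℕ (suc n)) d ν O k → Part a → hd a ≤ W → Part O → hd O ≤ W →
    paths ls a (appendVer d (ends ν O k)) ≡ ∑ (vecs (suc n)) (λ b → when (Grow? b ν O ×-dec d + diff b (ν ∷ O) ≟ k)
      (pathsTo ls a b))
  appendVer-pathsTo {n = n} ls a d ν O k Pa ha PO hO = begin
    paths ls a (appendVer d (ends ν O k))
      ≡⟨ paths-cong ls a (λ { (y ∷ q) P h → pointwise y q P h }) Pa ha ⟩
    paths ls a (λ v → ∑ (vecs (suc n)) (λ b → when (E? b) (when (v ≟ⱽ b) 1ℤ)))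
      ≡⟨ paths-∑ (vecs (suc n)) ls a _ ⟩
    ∑ (vecs (suc n)) (λ b → paths ls a (λ v → when (E? b) (when (v ≟ⱽ b) 1ℤ)))
      ≡⟨ (∑-cong (vecs (suc n)) λ b → paths-when (E? b) ls a _) ⟩
    ∑ (vecs (suc n)) (λ b → when (E? b) (pathsTo ls a b)) ∎
    where
    open ≡-Reasoning
    E? : ∀ b → Dec (Grow b ν O × d + diff b (ν ∷ O) ≡ k)
    E? b = Grow? b ν O ×-dec d + diff b (ν ∷ O) ≟ k
    when-comm : ∀ {P Q : Set} (d : Dec P) (e : Dec Q) z → when d (when e z) ≡ when e (when d z)
    when-comm (yes _) (yes _) z = refl
    when-comm (yes _) (no _)  z = refl
    when-comm (no _)  (yes _) z = refl
    when-comm (no _)  (no _)  z = refl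
    dhd : ∀ y (q : Vec ℕ n) → y ≡ ν → diff (y ∷ q) (ν ∷ O) ≡ diff q O
    dhd y q refl = cong (_+ diff q O) (n∸n≡0 y)
    pointwise : ∀ y q → Part (y ∷ q) → y ≤ W → appendVer d (ends ν O k) (y ∷ q) ≡ ∑ (vecs (suc n)) (λ b → when (E? b)
      (when ((y ∷ q) ≟ⱽ b) 1ℤ))
    pointwise y q P h = begin
      ∑ (vecs n) (λ s → when (VerP? q s) (when (y ≟ ν ×-dec s ≟ⱽ O ×-dec d + diff q s ≟ k) 1ℤ))
        ≡⟨ (∑-cong (vecs n) λ s → trans (when-× (VerP? q s) _) (trans (when-cong (VerP? q s ×-dec y ≟ ν ×-dec s ≟ⱽ O ×-dec d
          + diff q s ≟ k) (O ≟ⱽ s ×-dec E? (y ∷ q))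
             (λ { ((v , _) , e , refl , z) → refl , (e , v , P) , trans (cong (d +_) (dhd y q e)) z })
             (λ { (refl , (e , v , _) , z) → (v , PO) , e , refl , trans (cong (d +_) (sym (dhd y q e))) z }) (λ _ _ → refl))
             (sym (when-× (O ≟ⱽ s) (E? (y ∷ q)))))) ⟩
      ∑ (vecs n) (λ s → when (O ≟ⱽ s) (when (E? (y ∷ q)) 1ℤ))
        ≡⟨ ∑-vecs-one O (λ _ → when (E? (y ∷ q)) 1ℤ) PO hO ⟩
      when (E? (y ∷ q)) 1ℤ
        ≡⟨ sym (∑-vecs-one (y ∷ q) (λ b → when (E? b) 1ℤ) P h) ⟩
      ∑ (vecs (suc n)) (λ b → when ((y ∷ q) ≟ⱽ b) (when (E? b) 1ℤ))
        ≡⟨ (∑-cong (vecs (suc n)) λ b → when-comm ((y ∷ q) ≟ⱽ b) (E? b) 1ℤ) ⟩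
      ∑ (vecs (suc n)) (λ b → when (E? b) (when ((y ∷ q) ≟ⱽ b) 1ℤ)) ∎

  -- Read from right to left. For each inner shape a = x ∷ p the strip b / (ν ∷ O) is moved inwards
  -- by `commute-paths` and arrives as p / s. The signed sum over p leaves only s = K by
  -- `cancel-strips`, and the signed sum over x is `start-cancel`, whose condition on the end
  -- functional holds because α < ν.
  pieri : ∀ {L n} k₀ (ls : Vec Level L) α (K : Vec ℕ n) ν O k → Part (α ∷ K) → Part O → hd O ≤ W → α ≤ W → α < ν →
    All (λ l → α ≤ proj₁ l) ls → Flat k₀ (α ∷ K) → k₀ + L ≤ suc n →
    bpaths α ls α K 0 (ends ν O k) ≡
    ∑ (vecs (suc n)) (λ a → ∑ (vecs (suc n)) (λ b → when (Pair? α K ν O k a b) (sg (diff (α ∷ K) a) (pathsTo ls a b))))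
  pieri {L} {n} k₀ ls α K ν O k P PO hO α≤W α<ν α≤ F kL = sym (begin
    ∑ (vecs (suc n)) (λ a → ∑ (vecs (suc n)) (λ b → when (Pair? α K ν O k a b) (sg (diff A a) (pathsTo ls a b))))
      ≡⟨ (∑-vecs-cong (suc n) λ a ha → trans (∑-cong (vecs (suc n)) λ b → trans (sym (when-× (Hor? a A) (E? a b)))
        (cong (when (Hor? a A)) (sym (sg-when (diff A a) (E? a b) _))))
            (trans (sym (∑-when (vecs (suc n)) (Hor? a A) _)) (when-map (Hor? a A) λ H → trans
              (sym (sg-∑ (diff A a) (vecs (suc n)) _))
              (cong (sg (diff A a)) (sym (appendVer-pathsTo ls a (diff A a) ν O k (hor-part′ a A H) ha PO hO)))))) ⟩
    ∑ (vecs (suc n)) (λ a → when (Hor? a A) (sg (diff A a) (paths ls a (appendVer (diff A a) f))))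
      ≡⟨ ∑-vecs n _ ⟩
    ∑ range (λ x → ∑ (vecs n) (λ p → when (Hor? (x ∷ p) A) (sg (diff A (x ∷ p))
      (paths ls (x ∷ p) (appendVer (diff A (x ∷ p)) f)))))
      ≡⟨ (∑-cong∈ range λ x x∈ → ∑-cong (vecs n) λ p → when-map (Hor? (x ∷ p) A) λ H → cong (sg (diff A (x ∷ p)))
            (commute-paths k₀ ls x p (diff A (x ∷ p)) f (hor-part′ (x ∷ p) A H) (flat-sub k₀ (x ∷ p) A H F) kL
              (∈range⁻ x∈))) ⟩
    ∑ range (λ x → ∑ (vecs n) (λ p → when (Hor? (x ∷ p) A) (sg (diff A (x ∷ p))
      (∑ (vecs n) (λ s → when (VerP? p s) (bpaths 0 ls x s (diff A (x ∷ p) + diff p s) f))))))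
      ≡⟨ (∑-cong range λ x → trans (∑-cong (vecs n) λ p → trans (cong (when (Hor? (x ∷ p) A))
        (trans (sg-∑ (diff A (x ∷ p)) (vecs n) _) (∑-cong (vecs n) λ s → sg-when (diff A (x ∷ p)) (VerP? p s) _)))
            (trans (push₁ (vecs n) (Hor? (x ∷ p) A) (VerP? p) _) (∑-cong (vecs n) λ s → regroup x p s)))
              (∑-swap (vecs n) (vecs n) _)) ⟩
    ∑ range (λ x → ∑ (vecs n) (λ s → ∑ (vecs n) (λ p → when (D? x s) (when (Hor? p K ×-dec Ver? p s)
      (sg (diff K p) (Z x s))))))
      ≡⟨ (∑-cong range λ x → ∑-cong (vecs n) λ s → trans (sym (∑-when (vecs n) (D? x s) _)) (when-map (D? x s) λ { (_ , Ps) →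
            cancel-strips K s (proj₂ P) Ps (≤-trans (proj₁ P) α≤W) (Z x s) })) ⟩
    ∑ range (λ x → ∑ (vecs n) (λ s → when (D? x s) (when (s ≟ⱽ K) (Z x s))))
      ≡⟨ (∑-cong range λ x → trans (∑-cong (vecs n) λ s → trans (when-× (D? x s) (s ≟ⱽ K))
        (trans (when-cong (D? x s ×-dec s ≟ⱽ K) (C? x ×-dec K ≟ⱽ s)
             (λ { (((a , b) , _) , refl) → (b , a) , refl }) (λ { ((b , a) , refl) → ((a , b) , proj₂ P) , refl })
               (λ _ _ → refl)) (sym (when-× (C? x) (K ≟ⱽ s)))))
           (trans (sym (∑-when (vecs n) (C? x) _)) (cong (when (C? x)) (∑-vecs-one K (Z x) (proj₂ P) (≤-trans (proj₁ P)
             α≤W))))) ⟩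
    ∑ range (λ x → when (C? x) (sg (α ∸ x) (bpaths 0 ls x K ((α ∸ x) + diff K K) f)))
      ≡⟨ (∑-cong range λ x → cong (λ z → when (C? x) (sg (α ∸ x) (bpaths 0 ls x K z f)))
        (trans (cong ((α ∸ x) +_) (diff-self K)) (+-identityʳ _))) ⟩
    ∑ range (λ x → when (C? x) (sg (α ∸ x) (bpaths 0 ls x K (0 + (α ∸ x)) f)))
      ≡⟨ start-cancel ls α K 0 f α≤ α≤W (λ x p m x≤α → when-no (x ≟ ν ×-dec p ≟ⱽ O ×-dec m ≟ k) λ { (refl , _) → <⇒≱ α<ν x≤α
        }) ⟩
    bpaths α ls α K 0 f ∎)
    where
    open ≡-Reasoning
    A : Vec ℕ (suc n)
    A = α ∷ K
    f : ℕ → Vec ℕ n → ℕ → ℤ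
    f = ends ν O k
    E? : ∀ a b → Dec (Grow b ν O × diff A a + diff b (ν ∷ O) ≡ k)
    E? a b = Grow? b ν O ×-dec diff A a + diff b (ν ∷ O) ≟ k
    C? : ∀ x → Dec (hd K ≤ x × x ≤ α)
    C? x = hd K ≤? x ×-dec x ≤? α
    D? : ∀ x (s : Vec ℕ n) → Dec ((x ≤ α × hd K ≤ x) × Part s)
    D? x s = (x ≤? α ×-dec hd K ≤? x) ×-dec Part? s
    Z : ℕ → Vec ℕ n → ℤ
    Z x s = sg (α ∸ x) (bpaths 0 ls x s ((α ∸ x) + diff K s) f)
    regroup : ∀ x p s → when (Hor? (x ∷ p) A ×-dec VerP? p s) (sg (diff A (x ∷ p)) (bpaths 0 ls x s (diff A (x ∷ p) + diff p
      s) f))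
      ≡ when (D? x s) (when (Hor? p K ×-dec Ver? p s) (sg (diff K p) (Z x s)))
    regroup x p s = trans (when-cong (Hor? (x ∷ p) A ×-dec VerP? p s) (D? x s ×-dec (Hor? p K ×-dec Ver? p s))
      (λ { ((a , b , H) , v , Ps) → ((a , b) , Ps) , H , v }) (λ { (((a , b) , Ps) , H , v) → (a , b , H) , v , Ps })
      (λ { ((_ , _ , H) , v , _) _ → trans (cong₂ (λ i j → sg i (bpaths 0 ls x s j f)) (+-comm (α ∸ x) (diff K p))
        (trans (+-assoc (α ∸ x) _ _) (cong ((α ∸ x) +_) (diff-trans K p s H v))))
             (sym (sg-sg (diff K p) (α ∸ x) _)) }))
      (sym (when-× (D? x s) (Hor? p K ×-dec Ver? p s)))

-- Expansion row by row

Row : Set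
Row = ℕ × ℕ × ℕ

module Rows (β W : ℕ) (β≤W : β ≤ W) where
  open Shapes β W
  open Paths β W
  open StartCancel β W
  open Pieri β W β≤W

  -- (y , ε) for each label: y is the end of the row once the label is placed, ε = 1 if it also occurs as an extra label.
  RowCode : ℕ → Set
  RowCode L = Vec (ℕ × ℕ) L

  consBit : ∀ {L} → List (RowCode L) → ℕ → ℕ → List (RowCode (suc L))
  consBit R y ε = map ((y , ε) ∷_) R

  consBits : ∀ {L} → List (RowCode L) → ℕ → List (RowCode (suc L))
  consBits R y = concatMap (consBit R y) bits

  rowCodes : ∀ L → List (RowCode L)
  rowCodes zero    = [] ∷ []
  rowCodes (suc L) = concatMap (consBits (rowCodes L)) range

  ∑-rowCodes : ∀ L (f : RowCode (suc L) → ℤ) → ∑ (rowCodes (suc L)) f ≡ ∑ range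
    (λ y → ∑ bits (λ ε → ∑ (rowCodes L) (λ ρ → f ((y , ε) ∷ ρ))))
  ∑-rowCodes L f = trans (∑-concatMap (consBits (rowCodes L)) range f) (∑-cong range λ y →
    trans (∑-concatMap (consBit (rowCodes L) y) bits f) (∑-cong bits λ ε → ∑-map ((y , ε) ∷_) (rowCodes L) f))

  RowOK : ∀ {L} → ℕ → ℕ → ℕ → ℕ → Vec Level L → RowCode L → ℕ → Set
  RowOK α ν k x []               []            m = x ≡ ν × m ≡ k
  RowOK α ν k x ((u , _ , _) ∷ ls) ((y , ε) ∷ ρ) m = (x ≤ y × y ≤ u × α + ε ≤ x) × RowOK α ν k y ls ρ (m + ε)

  RowOK? : ∀ {L} α ν k x (ls : Vec Level L) ρ m → Dec (RowOK α ν k x ls ρ m)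
  RowOK? α ν k x []               []            m = x ≟ ν ×-dec m ≟ k
  RowOK? α ν k x ((u , _ , _) ∷ ls) ((y , ε) ∷ ρ) m = (x ≤? y ×-dec y ≤? u ×-dec α + ε ≤? x) ×-dec RowOK? α ν k y ls ρ
    (m + ε)

  -- The constraints left for the rows below a row coded by ρ.
  next : ∀ {L} → ℕ → Vec Level L → RowCode L → Vec Level L
  next x []                 []            = []
  next x ((u , w , c) ∷ ls) ((y , ε) ∷ ρ) = (x ∸ ε , w + (y ∸ x) + ε , c) ∷ next y ls ρ

  -- The rows below see a row only through the bound x ∸ ε, which keeps the boxes under it strictly
  -- larger, and through the occurrences it uses up. Once its code is fixed, they form a `pathsTo`
  -- with the updated levels.
  peel : ∀ {L n} α ν k (ls : Vec Level L) x (p O : Vec ℕ n) m →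
    bpaths α ls x p m (ends ν O k) ≡ ∑ (rowCodes L) (λ ρ → when (RowOK? α ν k x ls ρ m) (pathsTo (next x ls ρ) p O))
  peel α ν k [] x p O m = sym (trans (trans (∑-∷ [] [] _) (trans (cong (g [] +ᶻ_) (∑-[] _)) (ℤₚ.+-identityʳ (g []))))
      (trans (when-× (x ≟ ν ×-dec m ≟ k) (p ≟ⱽ O)) (when-cong ((x ≟ ν ×-dec m ≟ k) ×-dec p ≟ⱽ O) (x ≟ ν ×-dec p ≟ⱽ O ×-dec m
        ≟ k) (λ { ((a , b) , c) → a , c , b }) (λ { (a , c , b) → (a , b) , c }) (λ _ _ → refl))))
    where
    g : RowCode 0 → ℤ
    g ρ = when (RowOK? α ν k x [] ρ m) (pathsTo (next x [] ρ) p O)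
  peel {suc L} {n} α ν k (l@(u , w , c) ∷ ls) x p O m = begin
    ∑ bits (λ ε → ∑ range (λ y → ∑ (vecs n) (λ r → when (BStep? α l x p ε y r) (bpaths α ls y r (m + ε) (ends ν O k)))))
      ≡⟨ (∑-cong bits λ ε → ∑-cong range λ y → trans (∑-cong (vecs n) λ r → trans (cong (when (BStep? α l x p ε y r))
        (peel α ν k ls y r O (m + ε)))
            (push₁ (rowCodes L) (BStep? α l x p ε y r) (λ ρ → RowOK? α ν k y ls ρ (m + ε)) (λ ρ → pathsTo (next y ls ρ) r
              O))) (∑-swap (vecs n) (rowCodes L) _)) ⟩
    ∑ bits (λ ε → ∑ range (λ y → ∑ (rowCodes L) (λ ρ → ∑ (vecs n) (λ r → when (BStep? α l x p ε y r ×-dec RowOK? α ν k y ls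
      ρ (m + ε)) (pathsTo (next y ls ρ) r O)))))
      ≡⟨ (∑-cong bits λ ε → ∑-cong range λ y → ∑-cong (rowCodes L) λ ρ → trans (∑-cong (vecs n) λ r →
            when-cong (BStep? α l x p ε y r ×-dec RowOK? α ν k y ls ρ (m + ε)) (RowOK? α ν k x (l ∷ ls) ((y , ε) ∷ ρ) m
              ×-dec Step? (x ∸ ε , w + (y ∸ x) + ε , c) p r)
              (λ { ((A , (h , H) , e) , R) → (A , R) , m+n≤o⇒m≤o∸n (hd r) h , H , +-cancelˡ-≡ x _ _
                (trans (sym (size x y ε w (sum r) (proj₁ A))) (trans e (+-assoc x _ c))) })
              (λ { ((A , R) , h , H , e) → (A , (≤-trans (+-monoˡ-≤ ε h)
                (≤-reflexive (m∸n+n≡m (m+n≤o⇒n≤o α (proj₂ (proj₂ A))))) , H) , trans (size x y ε w (sum r) (proj₁ A))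
                  (trans (cong (x +_) e) (sym (+-assoc x _ c)))) , R })
              (λ _ _ → refl))
            (sym (push₁ (vecs n) (RowOK? α ν k x (l ∷ ls) ((y , ε) ∷ ρ) m) (λ r → Step? (x ∸ ε , w + (y ∸ x) + ε , c) p r)
              (λ r → pathsTo (next y ls ρ) r O)))) ⟩
    ∑ bits (λ ε → ∑ range (λ y → ∑ (rowCodes L) (λ ρ → g ((y , ε) ∷ ρ))))
      ≡⟨ ∑-swap bits range _ ⟩
    ∑ range (λ y → ∑ bits (λ ε → ∑ (rowCodes L) (λ ρ → g ((y , ε) ∷ ρ))))
      ≡⟨ sym (∑-rowCodes L g) ⟩
    ∑ (rowCodes (suc L)) g ∎
    where
    open ≡-Reasoning
    g : RowCode (suc L) → ℤ
    g ρ = when (RowOK? α ν k x (l ∷ ls) ρ m) (pathsTo (next x (l ∷ ls) ρ) p O)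
    size : ∀ x y ε w s → x ≤ y → y + s + ε + w ≡ x + (s + (w + (y ∸ x) + ε))
    size x y ε w s x≤y = trans (cong (λ z → z + s + ε + w) (sym (m+[n∸m]≡n x≤y))) (lem x (y ∸ x) s ε w)
      where
      lem : ∀ x d s ε w → x + d + s + ε + w ≡ x + (s + (w + d + ε))
      lem = solve-∀

  next-≥ : ∀ {L} α ν k x (ls : Vec Level L) ρ m → RowOK α ν k x ls ρ m → All (λ l → α ≤ proj₁ l) (next x ls ρ)
  next-≥ α ν k x [] [] m _ = []
  next-≥ α ν k x ((u , _ , _) ∷ ls) ((y , ε) ∷ ρ) m ((_ , _ , a) , R) = m+n≤o⇒m≤o∸n α a ∷ next-≥ α ν k y ls ρ (m + ε) R

  -- Counts set-valued tableaux from the top row down: (α , ν , k) is a row with columns α < j ≤ ν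
  -- and k extra labels, and M empty rows follow.
  cnt : ∀ {n L} (M : ℕ) → Vec Row n → Vec Level L → ℤ
  cnt         M []                   ls = pathsTo ls (Vec.replicate M β) (Vec.replicate M β)
  cnt {L = L} M ((α , ν , k) ∷ rows) ls = ∑ (rowCodes L) (λ ρ → when (RowOK? α ν k α ls ρ 0) (cnt M rows (next α ls ρ)))

  -- Built from the last row upwards: each row contributes one Pair, labelled by that row.
  strips : ∀ {n} M → Vec Row n → (Vec ℕ (n + M) → Vec ℕ (n + M) → ℤ) → ℤ
  strips         M []                   F = F (Vec.replicate M β) (Vec.replicate M β)
  strips {suc n} M ((α , ν , k) ∷ rows) F = strips M rows (λ K O →
    ∑ (vecs (suc n + M)) (λ a → ∑ (vecs (suc n + M)) (λ b → when (Pair? α K ν O k a b) (sg (diff (α ∷ K) a) (F a b)))))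

  hdα hdν : ∀ {n} → Vec Row n → ℕ
  hdα []                = β
  hdα ((α , _ , _) ∷ _) = α
  hdν []                = β
  hdν ((_ , ν , _) ∷ _) = ν

  GoodRows : ∀ {n} → Vec Row n → Set
  GoodRows []                   = ⊤
  GoodRows ((α , ν , _) ∷ rows) = (hdα rows ≤ α × hdν rows ≤ ν × α < ν × ν ≤ W) × GoodRows rows

  -- What `pieri` has to know about the shapes left by the strips of the rows below. Horizontal
  -- strips may shorten the first row of K, hence an inequality for it; no vertical strip touches
  -- the first row of O, hence an equation.
  record Inner (n M a₁ b₁ : ℕ) (K O : Vec ℕ (n + M)) : Set where
    field
      part-K : Part K
      part-O : Part O
      hd-K   : hd K ≤ a₁
      hd-O   : hd O ≡ b₁
      flat-K : Flat n K

  part-β⃗ : ∀ M → Part (Vec.replicate M β)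
  part-β⃗ zero          = tt
  part-β⃗ (suc zero)    = ≤-refl , tt
  part-β⃗ (suc (suc M)) = ≤-refl , part-β⃗ (suc M)

  hd-β⃗ : ∀ M → hd (Vec.replicate M β) ≡ β
  hd-β⃗ zero    = refl
  hd-β⃗ (suc M) = refl

  flat-β⃗ : ∀ M → Flat 0 (Vec.replicate M β)
  flat-β⃗ zero    = tt
  flat-β⃗ (suc M) = refl , flat-β⃗ M

  strips-cong : ∀ {n} M (rows : Vec Row n) {F G} → (∀ K O → Inner n M (hdα rows) (hdν rows) K O → F K O ≡ G K O) → strips M
    rows F ≡ strips M rows G
  strips-cong M [] eq = eq _ _ record { part-K = part-β⃗ M ; part-O = part-β⃗ M ; hd-K = ≤-reflexive (hd-β⃗ M) ; hd-O =
    hd-β⃗ M ; flat-K = flat-β⃗ M }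
  strips-cong {suc n} M ((α , ν , k) ∷ rows) eq = strips-cong M rows λ K O inn → ∑-cong (vecs (suc n + M)) λ
    { a@(x ∷ p) → ∑-cong (vecs (suc n + M)) λ { b@(y ∷ q) →
    when-map (Pair? α K ν O k a b) λ { (H@(x≤α , _) , (refl , _ , Pb) , _) → cong (sg (diff (α ∷ K) a)) (eq a b record
      { part-K = hor-part′ a (α ∷ K) H ; part-O = Pb ; hd-K = x≤α ; hd-O = refl ; flat-K = flat-sub (suc n) a (α ∷ K) H
        (Inner.flat-K inn) }) } } }

  strips-≡ : ∀ {n} M (rows : Vec Row n) {F G} → (∀ K O → F K O ≡ G K O) → strips M rows F ≡ strips M rows G
  strips-≡ M rows eq = strips-cong M rows λ K O _ → eq K O

  strips-∑ : ∀ {A : Set} {n} M (rows : Vec Row n) (xs : List A) (g : A → Vec ℕ (n + M) → Vec ℕ (n + M) → ℤ) →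
    strips M rows (λ K O → ∑ xs (λ z → g z K O)) ≡ ∑ xs (λ z → strips M rows (g z))
  strips-∑ M [] xs g = refl
  strips-∑ {n = suc n} M ((α , ν , k) ∷ rows) xs g = trans
    (strips-≡ M rows λ K O → trans (∑-cong V λ a → trans (∑-cong V λ b → trans (cong (when (Pair? α K ν O k a b))
      (sg-∑ (diff (α ∷ K) a) xs _)) (∑-when xs (Pair? α K ν O k a b) _)) (∑-swap V xs _)) (∑-swap V xs _))
    (strips-∑ M rows xs _)
    where
    V : List (Vec ℕ (suc n + M))
    V = vecs (suc n + M)

  strips-0 : ∀ {n} M (rows : Vec Row n) → strips M rows (λ _ _ → 0ℤ) ≡ 0ℤ
  strips-0 M [] = refl
  strips-0 {suc n} M ((α , ν , k) ∷ rows) = trans (strips-≡ M rows λ K O → ∑-≡0 (vecs (suc n + M)) λ a _ → ∑-≡0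
    (vecs (suc n + M)) λ b _ →
    trans (cong (when (Pair? α K ν O k a b)) (sg-0 (diff (α ∷ K) a))) (when-0 (Pair? α K ν O k a b))) (strips-0 M rows)

  strips-when : ∀ {P : Set} {n} M (rows : Vec Row n) (d : Dec P) F → strips M rows (λ K O → when d (F K O)) ≡ when d
    (strips M rows F)
  strips-when M rows (yes _) F = refl
  strips-when M rows (no _)  F = strips-0 M rows

  -- With the code of the first row fixed, the rows below are expanded first, under the levels left
  -- by that code. The code is then summed out again by `peel`, now over chains from K to O, and
  -- `pieri` trades the first row. `next-≥` is what hands the bound α ≤ u on to the rows below.
  cnt≡strips : ∀ {n L} M (rows : Vec Row n) (ls : Vec Level L) → L ≤ M → GoodRows rows → All (λ l → hdα rows ≤ proj₁ l) ls →
    cnt M rows ls ≡ strips M rows (pathsTo ls)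
  cnt≡strips M [] ls L≤M _ _ = refl
  cnt≡strips {suc n} {L} M ((α , ν , k) ∷ rows) ls L≤M ((hα , hν , α<ν , ν≤W) , good) α≤ = begin
    ∑ (rowCodes L) (λ ρ → when (RowOK? α ν k α ls ρ 0) (cnt M rows (next α ls ρ)))
      ≡⟨ (∑-cong (rowCodes L) λ ρ → trans (when-map (RowOK? α ν k α ls ρ 0) λ R → cnt≡strips M rows (next α ls ρ) L≤M good
        (mapAll (≤-trans hα) (next-≥ α ν k α ls ρ 0 R)))
            (sym (strips-when M rows (RowOK? α ν k α ls ρ 0) _))) ⟩
    ∑ (rowCodes L) (λ ρ → strips M rows (λ K O → when (RowOK? α ν k α ls ρ 0) (pathsTo (next α ls ρ) K O)))
      ≡⟨ sym (strips-∑ M rows (rowCodes L) _) ⟩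
    strips M rows (λ K O → ∑ (rowCodes L) (λ ρ → when (RowOK? α ν k α ls ρ 0) (pathsTo (next α ls ρ) K O)))
      ≡⟨ (strips-cong M rows λ K O inn → let open Inner inn in trans (sym (peel α ν k ls α K O 0))
            (pieri (suc n) ls α K ν O k (≤-trans hd-K hα , part-K) part-O (≤-trans (≤-reflexive hd-O) (≤-trans hν ν≤W))
              (≤-trans (<⇒≤ α<ν) ν≤W) α<ν α≤ flat-K (+-monoʳ-≤ (suc n) L≤M))) ⟩
    strips M ((α , ν , k) ∷ rows) (pathsTo ls) ∎
    where
    open ≡-Reasoning

  bpaths-pos : ∀ {L n} α (ls : Vec Level L) x (p : Vec ℕ n) m ν O → bpaths α ls x p (suc m) (ends ν O 0) ≡ 0ℤ
  bpaths-pos α [] x p m ν O = when-no (x ≟ ν ×-dec p ≟ⱽ O ×-dec suc m ≟ 0) λ { (_ , _ , ()) }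
  bpaths-pos {n = n} α (l ∷ ls) x p m ν O = ∑-≡0 bits λ ε _ → ∑-≡0 range λ y _ → ∑-≡0 (vecs n) λ r _ →
    trans (cong (when (BStep? α l x p ε y r)) (bpaths-pos α ls y r (m + ε) ν O)) (when-0 (BStep? α l x p ε y r))

  pathsTo-bpaths : ∀ {L n} α (ls : Vec Level L) x (p : Vec ℕ n) ν O → α ≤ x → pathsTo ls (x ∷ p) (ν ∷ O) ≡ bpaths α ls x p 0
    (ends ν O 0)
  pathsTo-bpaths α [] x p ν O _ = when-cong ((x ∷ p) ≟ⱽ (ν ∷ O)) (x ≟ ν ×-dec p ≟ⱽ O ×-dec 0 ≟ 0)
    (λ { refl → refl , refl , refl }) (λ { (refl , refl , _) → refl }) (λ _ _ → refl)
  pathsTo-bpaths {n = n} α (l@(u , w , c) ∷ ls) x p ν O α≤x = begin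
    pathsTo (l ∷ ls) (x ∷ p) (ν ∷ O) ≡⟨ ∑-vecs n _ ⟩
    ∑ range (λ y → ∑ (vecs n) (λ r → when (Step? l (x ∷ p) (y ∷ r)) (pathsTo ls (y ∷ r) (ν ∷ O))))
      ≡⟨ (∑-cong range λ y → ∑-cong (vecs n) λ r → when-cong (Step? l (x ∷ p) (y ∷ r)) (BStep? α l x p 0 y r)
            (λ { (y≤u , (x≤y , h , H) , e) → (x≤y , y≤u , ≤-trans (≤-reflexive (+-identityʳ α)) α≤x) ,
              (≤-trans (≤-reflexive (+-identityʳ _)) h , H) , trans (cong (_+ w) (+-identityʳ (y + sum r))) e })
            (λ { ((x≤y , y≤u , _) , (h , H) , e) → y≤u , (x≤y , m+n≤o⇒m≤o (hd r) h , H) , trans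
              (cong (_+ w) (sym (+-identityʳ (y + sum r)))) e })
            (λ { (_ , (x≤y , _) , _) _ → pathsTo-bpaths α ls y r ν O (≤-trans α≤x x≤y) })) ⟩
    B 0 ≡⟨ sym (trans (cong (B 0 +ᶻ_) (∑-≡0 range λ y _ → ∑-≡0 (vecs n) λ r _ → trans (cong (when (BStep? α l x p 1 y r))
      (bpaths-pos α ls y r 0 ν O)) (when-0 (BStep? α l x p 1 y r)))) (ℤₚ.+-identityʳ (B 0))) ⟩
    B 0 +ᶻ B 1 ≡⟨ sym (∑-bits B) ⟩
    bpaths α (l ∷ ls) x p 0 (ends ν O 0) ∎
    where
    open ≡-Reasoning
    B : ℕ → ℤ
    B ε = ∑ range (λ y → ∑ (vecs n) (λ r → when (BStep? α l x p ε y r) (bpaths α ls y r ε (ends ν O 0))))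

  plain : ∀ {n} → Vec ℕ n → Vec ℕ n → Vec Row n
  plain []      []      = []
  plain (x ∷ a) (y ∷ b) = (x , y , 0) ∷ plain a b

  -- An ordinary tableau is a set-valued one with k = 0 in every row, so one enumeration of codes
  -- serves both sides of the theorem.
  pathsTo≡cnt : ∀ {n L} (ls : Vec Level L) (a b : Vec ℕ n) → pathsTo ls a b ≡ cnt 0 (plain a b) ls
  pathsTo≡cnt ls [] [] = refl
  pathsTo≡cnt {L = L} ls (x ∷ a) (y ∷ b) = trans (pathsTo-bpaths x ls x a y b ≤-refl) (trans (peel x y 0 ls x a b 0)
    (∑-cong (rowCodes L) λ ρ → cong (when (RowOK? x y 0 x ls ρ 0)) (pathsTo≡cnt (next x ls ρ) a b)))

  padded : ∀ {n} M → Vec Row n → Vec Row (n + M)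
  padded M rows = rows Vec.++ plain (Vec.replicate M β) (Vec.replicate M β)

  cnt-padded : ∀ {n L} M (rows : Vec Row n) (ls : Vec Level L) → cnt 0 (padded M rows) ls ≡ cnt M rows ls
  cnt-padded M [] ls = sym (pathsTo≡cnt ls (Vec.replicate M β) (Vec.replicate M β))
  cnt-padded {L = L} M ((α , ν , k) ∷ rows) ls = ∑-cong (rowCodes L) λ ρ → cong (when (RowOK? α ν k α ls ρ 0))
    (cnt-padded M rows (next α ls ρ))

  -- The theorem as an identity of numbers. On the left M empty rows are appended to σ, so that both
  -- sides count tableaux with n + M rows.
  expansion : ∀ {n L} M (rows : Vec Row n) (ls : Vec Level L) → L ≤ M → GoodRows rows → All (λ l → hdα rows ≤ proj₁ l) ls →
    cnt 0 (padded M rows) ls ≡ strips M rows (λ a b → cnt 0 (plain a b) ls)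
  expansion M rows ls L≤M good α≤ = trans (cnt-padded M rows ls) (trans (cnt≡strips M rows ls L≤M good α≤)
    (strips-≡ M rows (pathsTo≡cnt ls)))

-- Enumerations

module _ {A B : Set} (f : A → List B) where

  concatMap⁺ : ∀ {xs x y} → x ∈ xs → y ∈ f x → y ∈ concatMap f xs
  concatMap⁺ x∈ y∈ = ∈-concatMap⁺ f (Any.map (λ { refl → y∈ }) x∈)

  concatMap⁻ : ∀ xs {y} → y ∈ concatMap f xs → ∃ λ x → x ∈ xs × y ∈ f x
  concatMap⁻ xs y∈ = find (∈-concatMap⁻ f {xs = xs} y∈)

  pairs-concatMap : ∀ {R : A → A → Set} {S : B → B → Set} {xs} → AllPairs R xs → (∀ x → x ∈ xs → AllPairs S (f x)) →
    (∀ {x y} → R x y → ∀ u v → u ∈ f x → v ∈ f y → S u v) → AllPairs S (concatMap f xs)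
  pairs-concatMap []             _ _ = []
  pairs-concatMap {xs = x ∷ xs} (Rx ∷ Rxs) S RS = AllPairsₚ.++⁺ (S x (here refl)) (pairs-concatMap Rxs
    (λ y y∈ → S y (there y∈)) RS)
    (ListAll.tabulate λ {u} u∈ → ListAll.tabulate λ {v} v∈ → let y , y∈ , v∈y = concatMap⁻ xs v∈ in RS (ListAll.lookup Rx
      y∈) u v u∈ v∈y)

unique-map : ∀ {A B : Set} (f : A → B) {xs} → Unique xs → (∀ x y → x ∈ xs → y ∈ xs → f x ≡ f y → x ≡ y) → Unique (map f xs)
unique-map f []        _   = []
unique-map f (x∉ ∷ u) inj = ListAllₚ.map⁺ (ListAll.tabulate λ {y} y∈ e → ListAll.lookup x∉ y∈ (inj _ y (here refl)
  (there y∈) e))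
  ∷ unique-map f u (λ x y x∈ y∈ → inj x y (there x∈) (there y∈))

-- Sortedness makes finite sets canonical: shapes, fillings and label sets are all identified
-- through their members by this lemma.
sorted-unique : ∀ {A : Set} {_≺_ : A → A → Set} → (∀ {x y} → x ≺ y → y ≺ x → ⊥) → ∀ {xs ys} →
  AllPairs _≺_ xs → AllPairs _≺_ ys → (∀ x → x ∈ xs → x ∈ ys) → (∀ x → x ∈ ys → x ∈ xs) → xs ≡ ys
sorted-unique asym {[]}     {[]}     _ _ _ _ = refl
sorted-unique asym {[]}     {y ∷ ys} _ _ _ g with () ← g y (here refl)
sorted-unique asym {x ∷ xs} {[]}     _ _ f _ with () ← f x (here refl)
sorted-unique {_≺_ = _≺_} asym {x ∷ xs} {y ∷ ys} (x≺ ∷ sx) (y≺ ∷ sy) f g = go (f x (here refl)) (g y (here refl))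
  where
  rest : x ≡ y → x ∷ xs ≡ y ∷ ys
  rest refl = cong (x ∷_) (sorted-unique asym sx sy
    (λ z z∈ → tail⁻ (ListAll.lookup x≺ z∈) (f z (there z∈))) (λ z z∈ → tail⁻ (ListAll.lookup y≺ z∈) (g z (there z∈))))
    where
    tail⁻ : ∀ {z zs} → x ≺ z → z ∈ x ∷ zs → z ∈ zs
    tail⁻ p (here refl) = ⊥-elim (asym p p)
    tail⁻ p (there z∈)  = z∈
  go : x ∈ y ∷ ys → y ∈ x ∷ xs → x ∷ xs ≡ y ∷ ys
  go (here e)   _          = rest e
  go (there _)  (here e)   = rest (sym e)
  go (there x∈) (there y∈) = ⊥-elim (asym (ListAll.lookup x≺ y∈) (ListAll.lookup y≺ x∈))

guardL : ∀ {A P : Set} → Dec P → List A → List A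
guardL (yes _) xs = xs
guardL (no _)  xs = []

∑-guardL : ∀ {A P : Set} (d : Dec P) (xs : List A) f → ∑ (guardL d xs) f ≡ when d (∑ xs f)
∑-guardL (yes _) xs f = refl
∑-guardL (no _)  xs f = ∑-[] f

guardL⁺ : ∀ {A P : Set} (d : Dec P) {xs : List A} {x} → P → x ∈ xs → x ∈ guardL d xs
guardL⁺ (yes _) p x∈ = x∈
guardL⁺ (no ¬p) p x∈ = contradiction p ¬p

guardL⁻ : ∀ {A P : Set} (d : Dec P) {xs : List A} {x} → x ∈ guardL d xs → P × x ∈ xs
guardL⁻ (yes p) x∈ = p , x∈

guardL-unique : ∀ {A P : Set} (d : Dec P) {xs : List A} → Unique xs → Unique (guardL d xs)
guardL-unique (yes _) u = u
guardL-unique (no _)  u = []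

index-lookup : ∀ {A : Set} {xs : List A} → Unique xs → ∀ i (m : lookup xs i ∈ xs) → Any.index m ≡ i
index-lookup {xs = x ∷ xs} _        Fin.zero    (here _)  = refl
index-lookup {xs = x ∷ xs} (x∉ ∷ _) Fin.zero    (there m) = ⊥-elim (ListAll.lookup x∉ m refl)
index-lookup {xs = x ∷ xs} (x∉ ∷ _) (Fin.suc i) (here e)  = ⊥-elim (ListAll.lookup x∉ (∈-lookup i) (sym e))
index-lookup {xs = x ∷ xs} (_ ∷ u)  (Fin.suc i) (there m) = cong Fin.suc (index-lookup u i m)

-- The proof inside a `Refinement` is irrelevant, so the position of x cannot be computed from
-- `complete`; it is found by deciding membership, and `complete` only refutes the negative answer.
hasCard : ∀ {A : Set} {P : A → Set} → DecidableEquality A → (xs : List A) → Unique xs →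
  (∀ x → x ∈ xs → P x) → (∀ x → P x → x ∈ xs) → HasCard (Refinement A P) (length xs)
hasCard {A} {P} _≟ᴬ_ xs u sound complete = mk↔ₛ′ to from to-from from-to
  where
  open DecMembership _≟ᴬ_ using (_∈?_)
  to : Fin (length xs) → Refinement A P
  to i = lookup xs i , [ sound _ (∈-lookup i) ]
  member : ∀ x → .(P x) → x ∈ xs
  member x p with x ∈? xs
  ... | yes m = m
  ... | no ¬m = ⊥-elim-irr (¬m (complete x p))
  from : Refinement A P → Fin (length xs)
  from (x , [ p ]) = Any.index (member x p)
  to-from : ∀ r → to (from r) ≡ r
  to-from (x , [ p ]) = value-injective (sym (Anyₚ.lookup-index (member x p)))
  from-to : ∀ i → from (to i) ≡ i
  from-to i = index-lookup u i (member (lookup xs i) _)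

∑-length : ∀ {A : Set} (xs : List A) → ∑ xs (λ _ → 1ℤ) ≡ ℤ.pos (length xs)
∑-length []       = ∑-[] _
∑-length (x ∷ xs) = trans (∑-∷ x xs _) (cong (1ℤ +ᶻ_) (∑-length xs))

module Codes (β W : ℕ) (β≤W : β ≤ W) where
  open Shapes β W
  open Paths β W
  open StartCancel β W
  open Pieri β W β≤W
  open Rows β W β≤W

  bits-unique : Unique bits
  bits-unique = ((λ ()) ∷ []) ∷ [] ∷ []

  range-unique : Unique range
  range-unique = Uniqueₚ.upTo⁺ (suc W)

  vecs-unique : ∀ n → Unique (vecs n)
  vecs-unique zero    = [] ∷ []
  vecs-unique (suc n) = pairs-concatMap (λ x → map (x ∷_) (vecs n)) range-unique (λ x _ → Uniqueₚ.map⁺ (λ { refl → refl })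
    (vecs-unique n))
    λ { x≢y u v u∈ v∈ refl → x≢y (trans (sym (head-map u∈)) (head-map v∈)) }
    where
    head-map : ∀ {x u} → u ∈ map (x ∷_) (vecs n) → Vec.head u ≡ x
    head-map {x} m with ∈-map⁻ (x ∷_) m
    ... | _ , _ , refl = refl

  vecs⁺ : ∀ {n} (v : Vec ℕ n) → Part v → hd v ≤ W → v ∈ vecs n
  vecs⁺ []      _       _   = here refl
  vecs⁺ (x ∷ v) (h , P) x≤W = concatMap⁺ (λ x → map (x ∷_) (vecs _)) (∈-upTo⁺ (s≤s x≤W))
    (∈-map⁺ (x ∷_) (vecs⁺ v P (≤-trans h x≤W)))

  head-consBit : ∀ {L} (R : List (RowCode L)) y ε {u} → u ∈ consBit R y ε → Vec.head u ≡ (y , ε)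
  head-consBit R y ε m with ∈-map⁻ ((y , ε) ∷_) m
  ... | _ , _ , refl = refl

  head-consBits : ∀ {L} (R : List (RowCode L)) y {u} → u ∈ consBits R y → proj₁ (Vec.head u) ≡ y
  head-consBits R y m = let ε , _ , m′ = concatMap⁻ (consBit R y) bits m in cong proj₁ (head-consBit R y ε m′)

  rowCodes-unique : ∀ L → Unique (rowCodes L)
  rowCodes-unique zero    = [] ∷ []
  rowCodes-unique (suc L) = pairs-concatMap (consBits R) range-unique
    (λ y _ → pairs-concatMap (consBit R y) bits-unique (λ ε _ → Uniqueₚ.map⁺ (λ { refl → refl }) (rowCodes-unique L))
      λ { ε≢ u v u∈ v∈ refl → ε≢ (cong proj₂ (trans (sym (head-consBit R y _ u∈)) (head-consBit R y _ v∈))) })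
    λ { y≢ u v u∈ v∈ refl → y≢ (trans (sym (head-consBits R _ u∈)) (head-consBits R _ v∈)) }
    where
    R : List (RowCode L)
    R = rowCodes L

  IsCode : ∀ {L} → RowCode L → Set
  IsCode []            = ⊤
  IsCode ((y , ε) ∷ ρ) = (y ≤ W × ε ≤ 1) × IsCode ρ

  rowCodes⁺ : ∀ {L} (ρ : RowCode L) → IsCode ρ → ρ ∈ rowCodes L
  rowCodes⁺ []            _               = here refl
  rowCodes⁺ ((y , ε) ∷ ρ) ((y≤ , ε≤) , c) = concatMap⁺ (consBits (rowCodes _)) (∈-upTo⁺ (s≤s y≤))
    (concatMap⁺ (consBit (rowCodes _) y) (bit ε≤) (∈-map⁺ _ (rowCodes⁺ ρ c)))
    where
    bit : ∀ {ε} → ε ≤ 1 → ε ∈ bits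
    bit z≤n       = here refl
    bit (s≤s z≤n) = there (here refl)

  rowCodes⁻ : ∀ {L} (ρ : RowCode L) → ρ ∈ rowCodes L → IsCode ρ
  rowCodes⁻ []            _ = tt
  rowCodes⁻ {suc L} ((y , ε) ∷ ρ) m with concatMap⁻ (consBits (rowCodes L)) range m
  ... | y′ , y∈ , m with concatMap⁻ (consBit (rowCodes L) y′) bits m
  ... | ε′ , ε∈ , m with ∈-map⁻ ((y′ , ε′) ∷_) m
  ... | ρ′ , ρ∈ , refl = (∈range⁻ y∈ , ∈bits⁻ ε∈) , rowCodes⁻ ρ ρ∈

  -- Below the last row all occurrences must have been placed, w = c, and an empty row at β must
  -- still fit under every bound u.
  EndOK : ∀ {L} → Vec Level L → Set
  EndOK []                 = ⊤
  EndOK ((u , w , c) ∷ ls) = (β ≤ u × w ≡ c) × EndOK ls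

  EndOK? : ∀ {L} (ls : Vec Level L) → Dec (EndOK ls)
  EndOK? []                 = yes tt
  EndOK? ((u , w , c) ∷ ls) = (β ≤? u ×-dec w ≟ c) ×-dec EndOK? ls

  pathsTo-[] : ∀ {L} (ls : Vec Level L) → pathsTo ls [] [] ≡ when (EndOK? ls) 1ℤ
  pathsTo-[] [] = when-yes ([] ≟ⱽ []) refl
  pathsTo-[] (l@(u , w , c) ∷ ls) = trans (∑-vecs0 _) (trans (cong (when (Step? l [] [])) (pathsTo-[] ls))
    (trans (when-× (Step? l [] []) (EndOK? ls)) (when-cong (Step? l [] [] ×-dec EndOK? ls) (EndOK? (l ∷ ls))
      (λ { ((a , _ , b) , c) → (a , b) , c }) (λ { ((a , b) , c) → (a , tt , b) , c }) (λ _ _ → refl))))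

  CodeOK : ∀ {n L} → Vec Row n → Vec Level L → Vec (RowCode L) n → Set
  CodeOK []                   ls []       = EndOK ls
  CodeOK ((α , ν , k) ∷ rows) ls (ρ ∷ ρs) = (IsCode ρ × RowOK α ν k α ls ρ 0) × CodeOK rows (next α ls ρ) ρs

  module _ {n L} (rows : Vec Row n) (ls : Vec Level L) (α ν k : ℕ) (tails : Vec Level L → List (Vec (RowCode L) n)) where

    codesFrom : RowCode L → List (Vec (RowCode L) (suc n))
    codesFrom ρ = guardL (RowOK? α ν k α ls ρ 0) (map (ρ ∷_) (tails (next α ls ρ)))

    codesFrom⁻ : ∀ ρ {u} → u ∈ codesFrom ρ → Vec.head u ≡ ρ × RowOK α ν k α ls ρ 0 × Vec.tail u ∈ tails (next α ls ρ)
    codesFrom⁻ ρ m with guardL⁻ (RowOK? α ν k α ls ρ 0) m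
    ... | R , m with ∈-map⁻ (ρ ∷_) m
    ... | _ , m , refl = refl , R , m

  codeList : ∀ {n L} → Vec Row n → Vec Level L → List (Vec (RowCode L) n)
  codeList         []                   ls = guardL (EndOK? ls) ([] ∷ [])
  codeList {L = L} ((α , ν , k) ∷ rows) ls = concatMap (codesFrom rows ls α ν k (codeList rows)) (rowCodes L)

  codeList-count : ∀ {n L} (rows : Vec Row n) (ls : Vec Level L) → ∑ (codeList rows ls) (λ _ → 1ℤ) ≡ cnt 0 rows ls
  codeList-count [] ls = trans (∑-guardL (EndOK? ls) ([] ∷ []) _) (trans (cong (when (EndOK? ls)) (∑-length ([] ∷ [])))
    (sym (pathsTo-[] ls)))
  codeList-count {L = L} ((α , ν , k) ∷ rows) ls = trans (∑-concatMap (codesFrom rows ls α ν k (codeList rows)) (rowCodes L)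
    _) (∑-cong (rowCodes L) λ ρ →
    trans (∑-guardL (RowOK? α ν k α ls ρ 0) (map (ρ ∷_) (codeList rows (next α ls ρ))) _)
      (cong (when (RowOK? α ν k α ls ρ 0)) (trans (∑-map (ρ ∷_) (codeList rows (next α ls ρ)) _) (codeList-count rows
        (next α ls ρ)))))

  codeList⁺ : ∀ {n L} (rows : Vec Row n) (ls : Vec Level L) ρs → CodeOK rows ls ρs → ρs ∈ codeList rows ls
  codeList⁺ [] ls [] ok = guardL⁺ (EndOK? ls) ok (here refl)
  codeList⁺ ((α , ν , k) ∷ rows) ls (ρ ∷ ρs) ((c , R) , ok) =
    concatMap⁺ (codesFrom rows ls α ν k (codeList rows)) (rowCodes⁺ ρ c) (guardL⁺ (RowOK? α ν k α ls ρ 0) R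
      (∈-map⁺ (ρ ∷_) (codeList⁺ rows _ ρs ok)))

  codeList⁻ : ∀ {n L} (rows : Vec Row n) (ls : Vec Level L) ρs → ρs ∈ codeList rows ls → CodeOK rows ls ρs
  codeList⁻ [] ls [] m = proj₁ (guardL⁻ (EndOK? ls) m)
  codeList⁻ {L = L} ((α , ν , k) ∷ rows) ls (ρ ∷ ρs) m with concatMap⁻ (codesFrom rows ls α ν k (codeList rows))
    (rowCodes L) m
  ... | ρ′ , ρ∈ , m with codesFrom⁻ rows ls α ν k (codeList rows) ρ′ m
  ... | refl , R , m = (rowCodes⁻ ρ ρ∈ , R) , codeList⁻ rows _ ρs m

  codeList-unique : ∀ {n L} (rows : Vec Row n) (ls : Vec Level L) → Unique (codeList rows ls)
  codeList-unique [] ls = guardL-unique (EndOK? ls) ([] ∷ [])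
  codeList-unique {L = L} ((α , ν , k) ∷ rows) ls = pairs-concatMap (codesFrom rows ls α ν k (codeList rows))
    (rowCodes-unique L)
    (λ ρ _ → guardL-unique (RowOK? α ν k α ls ρ 0) (Uniqueₚ.map⁺ (λ { refl → refl }) (codeList-unique rows _)))
    λ { ρ≢ u v u∈ v∈ refl → ρ≢ (trans (sym (proj₁ (codesFrom⁻ rows ls α ν k (codeList rows) _ u∈)))
      (proj₁ (codesFrom⁻ rows ls α ν k (codeList rows) _ v∈))) }

  -- The summation index of `strips`: one pair of inner and outer row ends per row of σ. The
  -- outermost pair belongs to the first row and covers all rows, the nested ones cover only the
  -- rows below.
  Strips : ℕ → ℕ → Set
  Strips zero    M = ⊤
  Strips (suc n) M = Strips n M × Vec ℕ (suc n + M) × Vec ℕ (suc n + M)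

  inner outer : ∀ n M → Strips n M → Vec ℕ (n + M)
  inner zero    M _           = Vec.replicate M β
  inner (suc n) M (_ , a , _) = a
  outer zero    M _           = Vec.replicate M β
  outer (suc n) M (_ , _ , b) = b

  -- All horizontal strips together fill A(μ/σ), so this is the exponent of the sign.
  removed : ∀ {n} M → Vec Row n → Strips n M → ℕ
  removed         M []                   _           = 0
  removed {suc n} M ((α , _ , _) ∷ rows) (s , a , _) = removed M rows s + diff (α ∷ inner n M s) a

  StripsOK : ∀ {n} M → Vec Row n → Strips n M → Set
  StripsOK         M []                   _           = ⊤
  StripsOK {suc n} M ((α , ν , k) ∷ rows) (s , a , b) = StripsOK M rows s × (hd a ≤ W × hd b ≤ W) × Pair α (inner n M s) ν
    (outer n M s) k a b

  module _ {n : ℕ} (M α ν k : ℕ) where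

    private
      V : List (Vec ℕ (suc n + M))
      V = vecs (suc n + M)

    addPair : Strips n M → Vec ℕ (suc n + M) → Vec ℕ (suc n + M) → List (Strips (suc n) M)
    addPair s a b = guardL (Pair? α (inner n M s) ν (outer n M s) k a b) ((s , a , b) ∷ [])

    addInner : Strips n M → Vec ℕ (suc n + M) → List (Strips (suc n) M)
    addInner s a = concatMap (addPair s a) V

    addStrips : Strips n M → List (Strips (suc n) M)
    addStrips s = concatMap (addInner s) V

    addPair⁻ : ∀ s a b {u} → u ∈ addPair s a b → u ≡ (s , a , b) × Pair α (inner n M s) ν (outer n M s) k a b
    addPair⁻ s a b m with guardL⁻ (Pair? α (inner n M s) ν (outer n M s) k a b) m
    ... | P , here e = e , P

    addInner⁻ : ∀ s a {u} → u ∈ addInner s a → proj₁ (proj₂ u) ≡ a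
    addInner⁻ s a m = let b , _ , m′ = concatMap⁻ (addPair s a) V m in cong (proj₁ ∘ proj₂) (proj₁ (addPair⁻ s a b m′))

    addStrips⁻ : ∀ s {u} → u ∈ addStrips s → proj₁ u ≡ s
    addStrips⁻ s m = let a , _ , m′ = concatMap⁻ (addInner s) V m ; b , _ , m″ = concatMap⁻ (addPair s a) V m′ in cong proj₁
      (proj₁ (addPair⁻ s a b m″))

  stripsList : ∀ {n} M → Vec Row n → List (Strips n M)
  stripsList M []                   = tt ∷ []
  stripsList M ((α , ν , k) ∷ rows) = concatMap (addStrips M α ν k) (stripsList M rows)

  stripsList-sum : ∀ {n} M (rows : Vec Row n) F → ∑ (stripsList M rows) (λ s → sg (removed M rows s)
    (F (inner n M s) (outer n M s))) ≡ strips M rows F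
  stripsList-sum M [] F = trans (∑-∷ tt [] _) (trans (cong (F _ _ +ᶻ_) (∑-[] _)) (ℤₚ.+-identityʳ _))
  stripsList-sum {suc n} M ((α , ν , k) ∷ rows) F = begin
    ∑ (stripsList M ((α , ν , k) ∷ rows)) G
      ≡⟨ trans (∑-concatMap (addStrips M α ν k) (stripsList M rows) G) (∑-cong (stripsList M rows) λ s → trans
        (∑-concatMap (addInner M α ν k s) V G) (trans (∑-cong V λ a → trans (∑-concatMap (addPair M α ν k s a) V G)
            (trans (∑-cong V λ b → trans (∑-guardL (P? s a b) _ G) (trans (cong (when (P? s a b)) (one s a b))
              (sym (sg-when (removed M rows s) (P? s a b) _)))) (sym (sg-∑ (removed M rows s) V _))))
            (sym (sg-∑ (removed M rows s) V _)))) ⟩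
    ∑ (stripsList M rows) (λ s → sg (removed M rows s)
      (∑ V (λ a → ∑ V (λ b → when (P? s a b) (sg (diff (α ∷ inner n M s) a) (F a b))))))
      ≡⟨ stripsList-sum M rows (λ K O → ∑ V (λ a → ∑ V (λ b → when (Pair? α K ν O k a b) (sg (diff (α ∷ K) a) (F a b))))) ⟩
    strips M ((α , ν , k) ∷ rows) F ∎
    where
    open ≡-Reasoning
    V : List (Vec ℕ (suc n + M))
    V = vecs (suc n + M)
    P? : ∀ s a b → Dec (Pair α (inner n M s) ν (outer n M s) k a b)
    P? s = Pair? α (inner n M s) ν (outer n M s) k
    G : Strips (suc n) M → ℤ
    G s = sg (removed M ((α , ν , k) ∷ rows) s) (F (inner (suc n) M s) (outer (suc n) M s))
    one : ∀ s a b → ∑ ((s , a , b) ∷ []) G ≡ sg (removed M rows s) (sg (diff (α ∷ inner n M s) a) (F a b))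
    one s a b = trans (∑-∷ (s , a , b) [] G) (trans (cong (G (s , a , b) +ᶻ_) (∑-[] G))
      (trans (ℤₚ.+-identityʳ (G (s , a , b))) (sym (sg-sg (removed M rows s) (diff (α ∷ inner n M s) a) (F a b)))))

  stripsList⁺ : ∀ {n} M (rows : Vec Row n) s → StripsOK M rows s → s ∈ stripsList M rows
  stripsList⁺ M [] tt _ = here refl
  stripsList⁺ {suc n} M ((α , ν , k) ∷ rows) (s , a , b@(_ ∷ _)) (ok , (ha , hb) , P@(H , (_ , _ , Pb) , _)) =
    concatMap⁺ (addStrips M α ν k) (stripsList⁺ M rows s ok) (concatMap⁺ (addInner M α ν k s)
      (vecs⁺ a (hor-part′ a (α ∷ inner n M s) H) ha) (concatMap⁺ (addPair M α ν k s a) (vecs⁺ b Pb hb)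
      (guardL⁺ (Pair? α (inner n M s) ν (outer n M s) k a b) P (here refl))))

  hd-vecs : ∀ {n} (v : Vec ℕ (suc n)) → v ∈ vecs (suc n) → hd v ≤ W
  hd-vecs {n} (x ∷ v) m with concatMap⁻ (λ x → map (x ∷_) (vecs n)) range m
  ... | y , y∈ , m with ∈-map⁻ (y ∷_) m
  ... | _ , _ , refl = ∈range⁻ y∈

  stripsList⁻ : ∀ {n} M (rows : Vec Row n) s → s ∈ stripsList M rows → StripsOK M rows s
  stripsList⁻ M [] tt _ = tt
  stripsList⁻ {suc n} M ((α , ν , k) ∷ rows) s m with concatMap⁻ (addStrips M α ν k) (stripsList M rows) m
  ... | s′ , s∈ , m with concatMap⁻ (addInner M α ν k s′) (vecs (suc n + M)) m
  ... | a , a∈ , m with concatMap⁻ (addPair M α ν k s′ a) (vecs (suc n + M)) m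
  ... | b , b∈ , m with addPair⁻ M α ν k s′ a b m
  ... | refl , P = stripsList⁻ M rows s′ s∈ , (hd-vecs a a∈ , hd-vecs b b∈) , P

  stripsList-unique : ∀ {n} M (rows : Vec Row n) → Unique (stripsList M rows)
  stripsList-unique M [] = [] ∷ []
  stripsList-unique {suc n} M ((α , ν , k) ∷ rows) = pairs-concatMap (addStrips M α ν k) (stripsList-unique M rows)
    (λ s _ → pairs-concatMap (addInner M α ν k s) (vecs-unique (suc n + M))
      (λ a _ → pairs-concatMap (addPair M α ν k s a) (vecs-unique (suc n + M)) (λ b _ → guardL-unique (Pair? α (inner n M s)
        ν (outer n M s) k a b) ([] ∷ []))
        λ { b≢ u v u∈ v∈ refl → b≢ (cong (proj₂ ∘ proj₂) (trans (sym (proj₁ (addPair⁻ M α ν k s a _ u∈)))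
          (proj₁ (addPair⁻ M α ν k s a _ v∈)))) })
      λ { a≢ u v u∈ v∈ refl → a≢ (trans (sym (addInner⁻ M α ν k s _ u∈)) (addInner⁻ M α ν k s _ v∈)) })
    λ { s≢ u v u∈ v∈ refl → s≢ (trans (sym (addStrips⁻ M α ν k _ u∈)) (addStrips⁻ M α ν k _ v∈)) }

-- Codes as chains of row ends

sum< : ℕ → (ℕ → ℕ) → ℕ
sum< zero    f = 0
sum< (suc n) f = f 0 + sum< n (f ∘ suc)

sum<-cong : ∀ n {f g} → (∀ i → i < n → f i ≡ g i) → sum< n f ≡ sum< n g
sum<-cong zero    eq = refl
sum<-cong (suc n) eq = cong₂ _+_ (eq 0 (s≤s z≤n)) (sum<-cong n (λ i i<n → eq (suc i) (s≤s i<n)))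

sum<-0 : ∀ n → sum< n (λ _ → 0) ≡ 0
sum<-0 zero    = refl
sum<-0 (suc n) = sum<-0 n

sum<-+ : ∀ n f g → sum< n (λ i → f i + g i) ≡ sum< n f + sum< n g
sum<-+ zero    f g = refl
sum<-+ (suc n) f g = trans (cong (f 0 + g 0 +_) (sum<-+ n (f ∘ suc) (g ∘ suc))) (lem (f 0) (g 0) _ _)
  where
  lem : ∀ a b c d → a + b + (c + d) ≡ a + c + (b + d)
  lem = solve-∀

sum<-swap : ∀ m n (f : ℕ → ℕ → ℕ) → sum< m (λ i → sum< n (f i)) ≡ sum< n (λ j → sum< m (λ i → f i j))
sum<-swap zero    n f = sym (sum<-0 n)
sum<-swap (suc m) n f = trans (cong (sum< n (f 0) +_) (sum<-swap m n (f ∘ suc)))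
  (sym (sum<-+ n (f 0) (λ j → sum< m (λ i → f (suc i) j))))

sum<-1 : ∀ n → sum< n (λ _ → 1) ≡ n
sum<-1 zero    = refl
sum<-1 (suc n) = cong suc (sum<-1 n)

stepwise-mono : ∀ {n} (f : ℕ → ℕ) → (∀ t → t < n → f t ≤ f (suc t)) → ∀ {t t′} → t ≤ t′ → t′ ≤ n → f t ≤ f t′
stepwise-mono f mono {t} {zero}   z≤n _   = ≤-refl
stepwise-mono f mono {t} {suc t′} t≤  t′< =
  [ (λ l → ≤-trans (stepwise-mono f mono (≤-pred l) (<⇒≤ t′<)) (mono t′ t′<)) , (λ { refl → ≤-refl }) ]′ (m≤n⇒m<n∨m≡n t≤)

stepwise-anti : ∀ {n} (f : ℕ → ℕ) → (∀ t → t < n → f (suc t) ≤ f t) → ∀ {t t′} → t ≤ t′ → t′ ≤ n → f t′ ≤ f t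
stepwise-anti f anti {t} {zero}   z≤n _   = ≤-refl
stepwise-anti f anti {t} {suc t′} t≤  t′< =
  [ (λ l → ≤-trans (anti t′ t′<) (stepwise-anti f anti (≤-pred l) (<⇒≤ t′<))) , (λ { refl → ≤-refl }) ]′ (m≤n⇒m<n∨m≡n t≤)

levels : ∀ L → (u w c : ℕ → ℕ) → Vec Level L
levels zero    u w c = []
levels (suc L) u w c = (u 0 , w 0 , c 0) ∷ levels L (u ∘ suc) (w ∘ suc) (c ∘ suc)

rowsOf : ∀ n → (a b k : ℕ → ℕ) → Vec Row n
rowsOf zero    a b k = []
rowsOf (suc n) a b k = (a 0 , b 0 , k 0) ∷ rowsOf n (a ∘ suc) (b ∘ suc) (k ∘ suc)

module Semantics (β W : ℕ) (β≤W : β ≤ W) where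
  open Shapes β W
  open Paths β W
  open Rows β W β≤W
  open Codes β W β≤W

  endAt : ∀ {L} → ℕ → RowCode L → ℕ → ℕ
  endAt x ρ             zero    = x
  endAt x []            (suc t) = x
  endAt x ((y , _) ∷ ρ) (suc t) = endAt y ρ t

  extra : ∀ {L} → RowCode L → ℕ → ℕ
  extra []            t       = 0
  extra ((_ , ε) ∷ ρ) zero    = ε
  extra (_ ∷ ρ)       (suc t) = extra ρ t

  rowCode : ∀ L → (g e : ℕ → ℕ) → RowCode L
  rowCode zero    g e = []
  rowCode (suc L) g e = (g 1 , e 0) ∷ rowCode L (g ∘ suc) (e ∘ suc)

  endAt-rowCode : ∀ L g e t → t ≤ L → endAt (g 0) (rowCode L g e) t ≡ g t
  endAt-rowCode L       g e zero    _         = refl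
  endAt-rowCode (suc L) g e (suc t) (s≤s t≤L) = endAt-rowCode L (g ∘ suc) (e ∘ suc) t t≤L

  extra-rowCode : ∀ L g e t → t < L → extra (rowCode L g e) t ≡ e t
  extra-rowCode (suc L) g e zero    _         = refl
  extra-rowCode (suc L) g e (suc t) (s≤s t<L) = extra-rowCode L (g ∘ suc) (e ∘ suc) t t<L

  rowCode-ext : ∀ {L} x (ρ σ : RowCode L) → (∀ t → t ≤ L → endAt x ρ t ≡ endAt x σ t) → (∀ t → t < L → extra ρ t ≡ extra σ
    t) → ρ ≡ σ
  rowCode-ext x [] [] _ _ = refl
  rowCode-ext x ((y , ε) ∷ ρ) ((y′ , ε′) ∷ σ) eq eq′ with eq 1 (s≤s z≤n) | eq′ 0 (s≤s z≤n)
  ... | refl | refl = cong ((y , ε) ∷_) (rowCode-ext y ρ σ (λ t t≤ → eq (suc t) (s≤s t≤)) (λ t t< → eq′ (suc t) (s≤s t<)))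

  next-levels : ∀ {L} x u w c (ρ : RowCode L) → next x (levels L u w c) ρ ≡
    levels L (λ t → endAt x ρ t ∸ extra ρ t) (λ t → w t + (endAt x ρ (suc t) ∸ endAt x ρ t) + extra ρ t) c
  next-levels x u w c []            = refl
  next-levels x u w c ((y , ε) ∷ ρ) = cong (_ ∷_) (next-levels y (u ∘ suc) (w ∘ suc) (c ∘ suc) ρ)

  RowFacts : ℕ → ℕ → (g e : ℕ → ℕ) → (ℕ → ℕ) → Set
  RowFacts L α g e u = ∀ t → t < L → g t ≤ g (suc t) × g (suc t) ≤ u t × α + e t ≤ g t

  rowOK⁻ : ∀ {L} α ν k x u w c (ρ : RowCode L) m → RowOK α ν k x (levels L u w c) ρ m →
    RowFacts L α (endAt x ρ) (extra ρ) u × endAt x ρ L ≡ ν × m + sum< L (extra ρ) ≡ k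
  rowOK⁻ α ν k x u w c [] m (x≡ , m≡) = (λ _ ()) , x≡ , trans (+-identityʳ m) m≡
  rowOK⁻ {suc L} α ν k x u w c ((y , ε) ∷ ρ) m (h , R) with rowOK⁻ α ν k y (u ∘ suc) (w ∘ suc) (c ∘ suc) ρ (m + ε) R
  ... | F , e , s = (λ { zero _ → h ; (suc t) (s≤s t<) → F t t< }) , e , trans (sym (+-assoc m ε _)) s

  rowOK⁺ : ∀ {L} α ν k x u w c (ρ : RowCode L) m →
    RowFacts L α (endAt x ρ) (extra ρ) u → endAt x ρ L ≡ ν → m + sum< L (extra ρ) ≡ k → RowOK α ν k x (levels L u w c) ρ m
  rowOK⁺ α ν k x u w c [] m _ e s = e , trans (sym (+-identityʳ m)) s
  rowOK⁺ α ν k x u w c ((y , ε) ∷ ρ) m F e s = F 0 (s≤s z≤n) ,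
    rowOK⁺ α ν k y (u ∘ suc) (w ∘ suc) (c ∘ suc) ρ (m + ε) (λ t t< → F (suc t) (s≤s t<)) e (trans (+-assoc m ε _) s)

  isCode⁻ : ∀ {L} x (ρ : RowCode L) → IsCode ρ → ∀ t → t < L → endAt x ρ (suc t) ≤ W × extra ρ t ≤ 1
  isCode⁻ x ((y , ε) ∷ ρ) (h , _) zero    _        = h
  isCode⁻ x ((y , ε) ∷ ρ) (_ , c) (suc t) (s≤s t<) = isCode⁻ y ρ c t t<

  isCode⁺ : ∀ {L} x (ρ : RowCode L) → (∀ t → t < L → endAt x ρ (suc t) ≤ W × extra ρ t ≤ 1) → IsCode ρ
  isCode⁺ x []            _ = tt
  isCode⁺ x ((y , ε) ∷ ρ) h = h 0 (s≤s z≤n) , isCode⁺ y ρ (λ t t< → h (suc t) (s≤s t<))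

  rowEnds : ∀ {n L} → (ℕ → ℕ) → Vec (RowCode L) n → ℕ → ℕ → ℕ
  rowEnds a []       i       t = β
  rowEnds a (ρ ∷ ρs) zero    t = endAt (a 0) ρ t
  rowEnds a (ρ ∷ ρs) (suc i) t = rowEnds (a ∘ suc) ρs i t

  extras : ∀ {n L} → Vec (RowCode L) n → ℕ → ℕ → ℕ
  extras []       i       t = 0
  extras (ρ ∷ ρs) zero    t = extra ρ t
  extras (ρ ∷ ρs) (suc i) t = extras ρs i t

  -- Here g i t is the end of row i once the labels up to t are placed, and e i t = 1 if t + 1 is an
  -- extra label of that row. `below` is column strictness: labels up to t + 1 in row i + 1 stay
  -- under boxes of row i with minimum at most t, and off the last of these if it also carries t +
  -- 1. General u and w serve the induction on rows; a whole tableau has u = W and w = 0.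
  record CodeFacts (n L : ℕ) (a b k u w c : ℕ → ℕ) (g e : ℕ → ℕ → ℕ) : Set where
    field
      start   : ∀ i → i < n → g i 0 ≡ a i
      stop    : ∀ i → i < n → g i L ≡ b i
      past    : ∀ t → g n t ≡ β
      small   : ∀ i t → i < n → t < L → g i (suc t) ≤ W
      bit     : ∀ i t → i < n → t < L → e i t ≤ 1
      mono    : ∀ i t → i < n → t < L → g i t ≤ g i (suc t)
      inside  : ∀ i t → i < n → t < L → a i + e i t ≤ g i t
      first   : ∀ t → t < L → g 0 (suc t) ≤ u t
      below   : ∀ i t → i < n → t < L → g (suc i) (suc t) + e i t ≤ g i t
      total   : ∀ i → i < n → sum< L (e i) ≡ k i
      content : ∀ t → t < L → w t + sum< n (λ i → g i (suc t) ∸ g i t + e i t) ≡ c t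

  endOK⁻ : ∀ L u w c → EndOK (levels L u w c) → ∀ t → t < L → β ≤ u t × w t ≡ c t
  endOK⁻ (suc L) u w c (h , _) zero    _        = h
  endOK⁻ (suc L) u w c (_ , r) (suc t) (s≤s t<) = endOK⁻ L (u ∘ suc) (w ∘ suc) (c ∘ suc) r t t<

  endOK⁺ : ∀ L u w c → (∀ t → t < L → β ≤ u t × w t ≡ c t) → EndOK (levels L u w c)
  endOK⁺ zero    u w c _ = tt
  endOK⁺ (suc L) u w c h = h 0 (s≤s z≤n) , endOK⁺ L (u ∘ suc) (w ∘ suc) (c ∘ suc) (λ t t< → h (suc t) (s≤s t<))

  codeFacts : ∀ {n} L a b k u w c (ρs : Vec (RowCode L) n) → CodeOK (rowsOf n a b k) (levels L u w c) ρs → CodeFacts n L a b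
    k u w c (rowEnds a ρs) (extras ρs)
  codeFacts L a b k u w c [] ok = record
    { start = λ _ () ; stop = λ _ () ; past = λ _ → refl ; small = λ _ _ () ; bit = λ _ _ () ; mono = λ _ _ () ; inside = λ
      _ _ ()
    ; first = λ t t< → proj₁ (endOK⁻ L u w c ok t t<) ; below = λ _ _ () ; total = λ _ () ; content = λ t t< → trans
      (+-identityʳ (w t)) (proj₂ (endOK⁻ L u w c ok t t<)) }
  codeFacts {suc n} L a b k u w c (ρ ∷ ρs) ((isC , R) , ok)
    with rowOK⁻ (a 0) (b 0) (k 0) (a 0) u w c ρ 0 R
       | codeFacts L (a ∘ suc) (b ∘ suc) (k ∘ suc) _ _ c ρs (subst (λ ls → CodeOK (rowsOf n (a ∘ suc) (b ∘ suc) (k ∘ suc))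
         ls ρs) (next-levels (a 0) u w c ρ) ok)
  ... | F , e , s | Fs = record
    { start   = λ { zero _ → refl ; (suc i) (s≤s i<) → start i i< }
    ; stop    = λ { zero _ → e ; (suc i) (s≤s i<) → stop i i< }
    ; past    = past
    ; small   = λ { zero t _ t< → proj₁ (isCode⁻ (a 0) ρ isC t t<) ; (suc i) t (s≤s i<) t< → small i t i< t< }
    ; bit     = λ { zero t _ t< → proj₂ (isCode⁻ (a 0) ρ isC t t<) ; (suc i) t (s≤s i<) t< → bit i t i< t< }
    ; mono    = λ { zero t _ t< → proj₁ (F t t<) ; (suc i) t (s≤s i<) t< → mono i t i< t< }
    ; inside  = λ { zero t _ t< → proj₂ (proj₂ (F t t<)) ; (suc i) t (s≤s i<) t< → inside i t i< t< }
    ; first   = λ t t< → proj₁ (proj₂ (F t t<))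
    -- `first` for the rows below speaks of the levels left by `next`, whose bound is the row end
    -- minus the bit; adding the bit back gives `below` for the first row.
    ; below   = λ { zero t _ t< → ≤-trans (+-monoˡ-≤ (extra ρ t) (first t t<))
      (≤-reflexive (m∸n+n≡m (m+n≤o⇒n≤o (a 0) (proj₂ (proj₂ (F t t<)))))) ; (suc i) t (s≤s i<) t< → below i t i< t< }
    ; total   = λ { zero _ → s ; (suc i) (s≤s i<) → total i i< }
    ; content = λ t t< → trans (lem (w t) _ _ _) (content t t<) }
    where
    open CodeFacts Fs
    lem : ∀ w x y z → w + (x + y + z) ≡ w + x + y + z
    lem = solve-∀

  codeOK : ∀ {n} L a b k u w c (ρs : Vec (RowCode L) n) → CodeFacts n L a b k u w c (rowEnds a ρs) (extras ρs) → CodeOK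
    (rowsOf n a b k) (levels L u w c) ρs
  codeOK L a b k u w c [] Fs = endOK⁺ L u w c (λ t t< → CodeFacts.first Fs t t< , trans (sym (+-identityʳ (w t)))
    (CodeFacts.content Fs t t<))
  codeOK {suc n} L a b k u w c (ρ ∷ ρs) Fs =
    (isCode⁺ (a 0) ρ (λ t t< → small 0 t (s≤s z≤n) t< , bit 0 t (s≤s z≤n) t<) ,
     rowOK⁺ (a 0) (b 0) (k 0) (a 0) u w c ρ 0 (λ t t< → mono 0 t (s≤s z≤n) t< , first t t< , inside 0 t (s≤s z≤n) t<)
       (stop 0 (s≤s z≤n)) (total 0 (s≤s z≤n))) ,
    subst (λ ls → CodeOK (rowsOf n (a ∘ suc) (b ∘ suc) (k ∘ suc)) ls ρs) (sym (next-levels (a 0) u w c ρ))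
      (codeOK L (a ∘ suc) (b ∘ suc) (k ∘ suc) _ _ c ρs record
      { start = λ i i< → start (suc i) (s≤s i<) ; stop = λ i i< → stop (suc i) (s≤s i<) ; past = past
      ; small = λ i t i< → small (suc i) t (s≤s i<) ; bit = λ i t i< → bit (suc i) t (s≤s i<) ; mono = λ i t i< → mono
        (suc i) t (s≤s i<)
      ; inside = λ i t i< → inside (suc i) t (s≤s i<) ; first = λ t t< → m+n≤o⇒m≤o∸n _ (below 0 t (s≤s z≤n) t<)
      ; below = λ i t i< → below (suc i) t (s≤s i<) ; total = λ i i< → total (suc i) (s≤s i<)
      ; content = λ t t< → trans (sym (lem (w t) _ _ _)) (content t t<) })
    where
    open CodeFacts Fs
    lem : ∀ w x y z → w + (x + y + z) ≡ w + x + y + z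
    lem = solve-∀

  codesOf : ∀ n L → (g e : ℕ → ℕ → ℕ) → Vec (RowCode L) n
  codesOf zero    L g e = []
  codesOf (suc n) L g e = rowCode L (g 0) (e 0) ∷ codesOf n L (g ∘ suc) (e ∘ suc)

  rowEnds-codesOf : ∀ n L a g e i t → i < n → t ≤ L → (∀ i → i < n → g i 0 ≡ a i) → rowEnds a (codesOf n L g e) i t ≡ g i t
  rowEnds-codesOf (suc n) L a g e zero t _ t≤ s = trans (cong (λ x → endAt x (rowCode L (g 0) (e 0)) t)
    (sym (s 0 (s≤s z≤n)))) (endAt-rowCode L (g 0) (e 0) t t≤)
  rowEnds-codesOf (suc n) L a g e (suc i) t (s≤s i<) t≤ s = rowEnds-codesOf n L (a ∘ suc) (g ∘ suc) (e ∘ suc) i t i< t≤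
    (λ i i< → s (suc i) (s≤s i<))

  rowEnds-past : ∀ {n L} a (ρs : Vec (RowCode L) n) t → rowEnds a ρs n t ≡ β
  rowEnds-past a []       t = refl
  rowEnds-past a (ρ ∷ ρs) t = rowEnds-past (a ∘ suc) ρs t

  extras-codesOf : ∀ n L g e i t → i < n → t < L → extras (codesOf n L g e) i t ≡ e i t
  extras-codesOf (suc n) L g e zero    t _        t< = extra-rowCode L (g 0) (e 0) t t<
  extras-codesOf (suc n) L g e (suc i) t (s≤s i<) t< = extras-codesOf n L (g ∘ suc) (e ∘ suc) i t i< t<

  codes-ext : ∀ {n L} a (ρs σs : Vec (RowCode L) n) → (∀ i t → i < n → t ≤ L → rowEnds a ρs i t ≡ rowEnds a σs i t) →
    (∀ i t → i < n → t < L → extras ρs i t ≡ extras σs i t) → ρs ≡ σs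
  codes-ext a []       []       _ _ = refl
  codes-ext a (ρ ∷ ρs) (σ ∷ σs) eq eq′ = cong₂ _∷_ (rowCode-ext (a 0) ρ σ (λ t → eq 0 t (s≤s z≤n)) (λ t → eq′ 0 t (s≤s z≤n)))
    (codes-ext (a ∘ suc) ρs σs (λ i t i< → eq (suc i) t (s≤s i<)) (λ i t i< → eq′ (suc i) t (s≤s i<)))

  -- Codes built from g and e reproduce them only in the range of rows and labels, so the facts are
  -- transported along pointwise equality there.
  CodeFacts-resp : ∀ {n L a b k u w c g g′ e e′} → (∀ i t → i < n → t ≤ L → g i t ≡ g′ i t) → (∀ t → g n t ≡ g′ n t) →
    (∀ i t → i < n → t < L → e i t ≡ e′ i t) →
    CodeFacts n L a b k u w c g e → CodeFacts n L a b k u w c g′ e′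
  CodeFacts-resp {n} {L} {a} {u = u} {w} {c} {g} {g′} {e} {e′} eg egn ee Fs = record
    { start   = λ i i< → trans (sym (eg i 0 i< z≤n)) (start i i<)
    ; stop    = λ i i< → trans (sym (eg i L i< ≤-refl)) (stop i i<)
    ; past    = λ t → trans (sym (egn t)) (past t)
    ; small   = λ i t i< t< → subst (_≤ W) (eg i (suc t) i< t<) (small i t i< t<)
    ; bit     = λ i t i< t< → subst (_≤ 1) (ee i t i< t<) (bit i t i< t<)
    ; mono    = λ i t i< t< → subst₂ _≤_ (eg i t i< (<⇒≤ t<)) (eg i (suc t) i< t<) (mono i t i< t<)
    ; inside  = λ i t i< t< → subst₂ (λ x y → a i + x ≤ y) (ee i t i< t<) (eg i t i< (<⇒≤ t<)) (inside i t i< t<)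
    ; first   = λ t t< → subst (_≤ u t) (upto 0 t z≤n t<) (first t t<)
    ; below   = λ i t i< t< → subst₂ _≤_ (cong₂ _+_ (upto (suc i) t i< t<) (ee i t i< t<)) (eg i t i< (<⇒≤ t<))
      (below i t i< t<)
    ; total   = λ i i< → trans (sum<-cong L (λ t t< → sym (ee i t i< t<))) (total i i<)
    ; content = λ t t< → trans (cong (w t +_) (sum<-cong n λ i i< → sym (cong₂ _+_ (cong₂ _∸_ (eg i (suc t) i< t<)
      (eg i t i< (<⇒≤ t<))) (ee i t i< t<)))) (content t t<) }
    where
    open CodeFacts Fs
    upto : ∀ i t → i ≤ n → t < L → g i (suc t) ≡ g′ i (suc t)
    upto i t i≤n t< = [ (λ i<n → eg i (suc t) i<n t<) , (λ { refl → egn (suc t) }) ]′ (m≤n⇒m<n∨m≡n i≤n)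

  codeOK-codesOf : ∀ n L a b k u w c g e → CodeFacts n L a b k u w c g e → CodeOK (rowsOf n a b k) (levels L u w c)
    (codesOf n L g e)
  codeOK-codesOf n L a b k u w c g e Fs = codeOK L a b k u w c (codesOf n L g e) (CodeFacts-resp
    (λ i t i< t≤ → sym (rowEnds-codesOf n L a g e i t i< t≤ (CodeFacts.start Fs)))
    (λ t → trans (CodeFacts.past Fs t) (sym (rowEnds-past a (codesOf n L g e) t)))
    (λ i t i< t< → sym (extras-codesOf n L g e i t i< t<)) Fs)

-- Fillings of regions

sumL : {A : Set} → List A → (A → ℕ) → ℕ
sumL []       φ = 0
sumL (x ∷ xs) φ = φ x + sumL xs φ

ind : {P : Set} → Dec P → ℕ
ind (yes _) = 1
ind (no _)  = 0

ind≤1 : {P : Set} (d : Dec P) → ind d ≤ 1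
ind≤1 (yes _) = ≤-refl
ind≤1 (no _)  = z≤n

ind-cong : ∀ {P Q : Set} (d : Dec P) (e : Dec Q) → (P → Q) → (Q → P) → ind d ≡ ind e
ind-cong (yes p) (yes q) f g = refl
ind-cong (yes p) (no ¬q) f g = contradiction (f p) ¬q
ind-cong (no ¬p) (yes q) f g = contradiction (g q) ¬p
ind-cong (no _)  (no _)  f g = refl

sumL-cong : ∀ {A : Set} (xs : List A) {φ ψ} → (∀ x → x ∈ xs → φ x ≡ ψ x) → sumL xs φ ≡ sumL xs ψ
sumL-cong []       eq = refl
sumL-cong (x ∷ xs) eq = cong₂ _+_ (eq x (here refl)) (sumL-cong xs (λ y y∈ → eq y (there y∈)))

sumL-++ : ∀ {A : Set} (xs ys : List A) φ → sumL (xs ++ ys) φ ≡ sumL xs φ + sumL ys φ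
sumL-++ []       ys φ = refl
sumL-++ (x ∷ xs) ys φ = trans (cong (φ x +_) (sumL-++ xs ys φ)) (sym (+-assoc (φ x) _ _))

sumL-map : ∀ {A B : Set} (f : A → B) xs φ → sumL (map f xs) φ ≡ sumL xs (φ ∘ f)
sumL-map f []       φ = refl
sumL-map f (x ∷ xs) φ = cong (φ (f x) +_) (sumL-map f xs φ)

sumL-concatMap : ∀ {A B : Set} (f : A → List B) xs φ → sumL (concatMap f xs) φ ≡ sumL xs (λ x → sumL (f x) φ)
sumL-concatMap f []       φ = refl
sumL-concatMap f (x ∷ xs) φ = trans (sumL-++ (f x) _ φ) (cong (sumL (f x) φ +_) (sumL-concatMap f xs φ))

sumL-applyUpTo : ∀ {A : Set} (f : ℕ → A) n φ → sumL (applyUpTo f n) φ ≡ sum< n (φ ∘ f)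
sumL-applyUpTo f zero    φ = refl
sumL-applyUpTo f (suc n) φ = cong (φ (f 0) +_) (sumL-applyUpTo (f ∘ suc) n φ)

length-sumL : ∀ {A : Set} (xs : List A) → length xs ≡ sumL xs (λ _ → 1)
length-sumL []       = refl
length-sumL (x ∷ xs) = cong suc (length-sumL xs)

length≡0 : ∀ {A : Set} {x : A} {xs} → length xs ≡ 0 → x ∉ xs
length≡0 {xs = []} _ ()

no-member : ∀ {A : Set} {xs : List A} → (∀ x → x ∉ xs) → xs ≡ []
no-member {xs = []}    _ = refl
no-member {xs = x ∷ _} h = contradiction (here refl) (h x)

length-concatMap : ∀ {A B : Set} (f : A → List B) xs → length (concatMap f xs) ≡ sumL xs (length ∘ f)
length-concatMap f []       = refl
length-concatMap f (x ∷ xs) = trans (length-++ (f x)) (cong (length (f x) +_) (length-concatMap f xs))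

module _ {A : Set} {P : A → Set} (P? : ∀ x → Dec (P x)) where

  length-filter : ∀ xs → length (filter P? xs) ≡ sumL xs (λ x → ind (P? x))
  length-filter []       = refl
  length-filter (x ∷ xs) with P? x
  ... | yes _ = cong suc (length-filter xs)
  ... | no _  = length-filter xs

  sumL-filter : ∀ xs φ → sumL (filter P? xs) φ ≡ sumL xs (λ x → ind (P? x) * φ x)
  sumL-filter []       φ = refl
  sumL-filter (x ∷ xs) φ with P? x
  ... | yes _ = cong₂ _+_ (sym (+-identityʳ (φ x))) (sumL-filter xs φ)
  ... | no _  = sumL-filter xs φ

count-unique : ∀ {xs : List ℕ} k → Unique xs → length (filter (_≟ k) xs) ≡ ind (DecMembership._∈?_ _≟_ k xs)
count-unique {xs} k u = trans (length-filter (_≟ k) xs) (go xs u (DecMembership._∈?_ _≟_ k xs))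
  where
  go : ∀ xs → Unique xs → (d : Dec (k ∈ xs)) → sumL xs (λ x → ind (x ≟ k)) ≡ ind d
  none : ∀ xs → ¬ k ∈ xs → sumL xs (λ x → ind (x ≟ k)) ≡ 0
  none []       _ = refl
  none (x ∷ xs) k∉ with x ≟ k
  ... | yes refl = contradiction (here refl) k∉
  ... | no _     = none xs (k∉ ∘ there)
  go xs       u        (no k∉)       = none xs k∉
  go (x ∷ xs) (x∉ ∷ u) (yes (here refl)) with k ≟ k
  ... | yes _ = cong suc (none xs (λ k∈ → ListAll.lookup x∉ k∈ refl))
  ... | no ne = contradiction refl ne
  go (x ∷ xs) (x∉ ∷ u) (yes (there m)) with x ≟ k
  ... | yes refl = ⊥-elim (ListAll.lookup x∉ m refl)
  ... | no _     = go xs u (yes m)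

sum<-single : ∀ n i (f : ℕ → ℕ) → i < n → (∀ k → k < n → k ≢ i → f k ≡ 0) → sum< n f ≡ f i
sum<-single (suc n) zero    f _        z = trans (cong (f 0 +_) (trans (sum<-cong n (λ k k< → z (suc k) (s≤s k<) λ ()))
  (sum<-0 n))) (+-identityʳ (f 0))
sum<-single (suc n) (suc i) f (s≤s i<) z = trans (cong (_+ sum< n (f ∘ suc)) (z 0 (s≤s z≤n) λ ()))
  (sum<-single n i (f ∘ suc) i< (λ k k< ne → z (suc k) (s≤s k<) (ne ∘ suc-injective)))

sumI : ℕ → ℕ → (ℕ → ℕ) → ℕ
sumI a b φ = sum< (b ∸ a) (λ k → φ (suc (a + k)))

column : ∀ {a b k} → k < b ∸ a → a < suc (a + k) × suc (a + k) ≤ b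
column {a} {b} {k} k< = s≤s (m≤m+n a k) , ≤-trans (≤-reflexive (sym (+-suc a k))) (≤-trans (+-monoʳ-≤ a k<)
  (≤-reflexive (m+[n∸m]≡n a≤b)))
  where
  a≤b : a ≤ b
  a≤b = [ id , (λ b≤a → contradiction (subst (k <_) (m≤n⇒m∸n≡0 b≤a) k<) λ ()) ]′ (≤-total a b)

sumI-cong : ∀ a b {φ ψ} → (∀ j → a < j → j ≤ b → φ j ≡ ψ j) → sumI a b φ ≡ sumI a b ψ
sumI-cong a b eq = sum<-cong (b ∸ a) λ k k< → let l , r = column {a} {b} k< in eq _ l r

sumI-count : ∀ {a b g h} {P : ℕ → Set} (P? : ∀ j → Dec (P j)) → a ≤ g → h ≤ b → g ≤ h →
  (∀ j → a < j → j ≤ b → P j → g < j × j ≤ h) → (∀ j → a < j → j ≤ b → g < j → j ≤ h → P j) → sumI a b (λ j → ind (P? j)) ≡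
    h ∸ g
sumI-count {a} {b} {g} {h} P? a≤g h≤b g≤h f f′ = trans
  (go (b ∸ a) (g ∸ a) (h ∸ a) (λ k → P? (suc (a + k))) (∸-monoˡ-≤ a g≤h) (∸-monoˡ-≤ a h≤b)
    (λ k k< p → let l , r = column {a} {b} k< ; x , y = f _ l r p in
       ≤-trans (∸-monoˡ-≤ a (≤-pred x)) (≤-reflexive (m+n∸m≡n a k)) , m+n≤o⇒m≤o∸n (suc k)
         (≤-trans (≤-reflexive (cong suc (+-comm k a))) y))
    (λ k k< x y → let l , r = column {a} {b} k< in f′ _ l r
       (s≤s (≤-trans (m≤n+m∸n g a) (+-monoʳ-≤ a x))) (≤-trans (≤-reflexive (cong suc (+-comm a k))) (≤-trans (+-monoˡ-≤ a y)
         (≤-reflexive (m∸n+n≡m (≤-trans a≤g g≤h)))))))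
  (trans (∸-+-assoc h a (g ∸ a)) (cong (h ∸_) (m+[n∸m]≡n a≤g)))
  where
  go : ∀ n lo hi {Q : ℕ → Set} (Q? : ∀ k → Dec (Q k)) → lo ≤ hi → hi ≤ n →
    (∀ k → k < n → Q k → lo ≤ k × k < hi) → (∀ k → k < n → lo ≤ k → k < hi → Q k) → sum< n (λ k → ind (Q? k)) ≡ hi ∸ lo
  go zero    zero    zero    Q? _ _ _ _ = refl
  go (suc n) zero    zero    Q? _ _ q q′ with Q? 0
  ... | yes p = contradiction (proj₂ (q 0 (s≤s z≤n) p)) λ ()
  ... | no _  = go n zero zero (Q? ∘ suc) z≤n z≤n (λ k k< p → contradiction (proj₂ (q (suc k) (s≤s k<) p)) λ ()) (λ _ _ _ ())
  go (suc n) zero    (suc hi) Q? _ (s≤s hi≤) q q′ with Q? 0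
  ... | no ¬p = contradiction (q′ 0 (s≤s z≤n) z≤n (s≤s z≤n)) ¬p
  ... | yes _ = cong suc (go n zero hi (Q? ∘ suc) z≤n hi≤ (λ k k< p → z≤n , ≤-pred (proj₂ (q (suc k) (s≤s k<) p)))
    (λ k k< _ l → q′ (suc k) (s≤s k<) z≤n (s≤s l)))
  go (suc n) (suc lo) (suc hi) Q? (s≤s l≤) (s≤s hi≤) q q′ with Q? 0
  ... | yes p = contradiction (proj₁ (q 0 (s≤s z≤n) p)) λ ()
  ... | no _  = go n lo hi (Q? ∘ suc) l≤ hi≤ (λ k k< p → let x , y = q (suc k) (s≤s k<) p in ≤-pred x , ≤-pred y)
    (λ k k< x y → q′ (suc k) (s≤s k<) (s≤s x) (s≤s y))

interval : ℕ → ℕ → List ℕ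
interval a b = applyUpTo (λ k → suc (a + k)) (b ∸ a)

interval⁺ : ∀ {a b j} → a < j → j ≤ b → j ∈ interval a b
interval⁺ {a} {b} {j} a<j j≤b = subst (_∈ interval a b) (m+[n∸m]≡n a<j) (∈-applyUpTo⁺ (λ k → suc (a + k))
  (m+n≤o⇒m≤o∸n (suc (j ∸ suc a)) (≤-trans (≤-reflexive (trans (sym (+-suc _ a)) (m∸n+n≡m a<j))) j≤b)))

interval⁻ : ∀ {a b j} → j ∈ interval a b → a < j × j ≤ b
interval⁻ {a} {b} j∈ with ∈-applyUpTo⁻ (λ k → suc (a + k)) j∈
... | k , k< , refl = column {a} {b} k<

Region : ℕ → (ℕ → ℕ) → (ℕ → ℕ) → Box → Set
Region R a b (r , j) = ∃ λ i → i < R × r ≡ suc i × a i < j × j ≤ b i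

<ᴮ-trans : ∀ {x y z} → x <ᴮ y → y <ᴮ z → x <ᴮ z
<ᴮ-trans (inj₁ p)          (inj₁ q)          = inj₁ (<-trans p q)
<ᴮ-trans (inj₁ p)          (inj₂ (refl , _)) = inj₁ p
<ᴮ-trans (inj₂ (refl , _)) (inj₁ q)          = inj₁ q
<ᴮ-trans (inj₂ (refl , p)) (inj₂ (refl , q)) = inj₂ (refl , <-trans p q)

<ᴮ-irrefl : ∀ {x} → ¬ x <ᴮ x
<ᴮ-irrefl (inj₁ p)       = <-irrefl refl p
<ᴮ-irrefl (inj₂ (_ , p)) = <-irrefl refl p

<ᴮ-asym : ∀ {x y} → x <ᴮ y → y <ᴮ x → ⊥
<ᴮ-asym {x} {y} p q = <ᴮ-irrefl {x} (<ᴮ-trans {x} {y} {x} p q)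

sortedB⁻ : ∀ {xs} → SortedB xs → AllPairs _<ᴮ_ xs
sortedB⁻ s = Linked⇒AllPairs (λ {x} {y} {z} → <ᴮ-trans {x} {y} {z}) (go _ s)
  where
  go : ∀ xs → SortedB xs → Linked _<ᴮ_ xs
  go []           _       = []
  go (x ∷ [])     _       = [-]
  go (x ∷ y ∷ xs) (p , s) = p ∷ go (y ∷ xs) s

sortedB⁺ : ∀ {xs} → AllPairs _<ᴮ_ xs → SortedB xs
sortedB⁺ s = go (AllPairs⇒Linked s)
  where
  go : ∀ {xs} → Linked _<ᴮ_ xs → SortedB xs
  go []      = tt
  go [-]     = tt
  go (p ∷ l) = p , go l

sortedN⁻ : ∀ {xs} → SortedN xs → AllPairs _<_ xs
sortedN⁻ s = Linked⇒AllPairs <-trans (go _ s)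
  where
  go : ∀ xs → SortedN xs → Linked _<_ xs
  go []           _       = []
  go (x ∷ [])     _       = [-]
  go (x ∷ y ∷ xs) (p , s) = p ∷ go (y ∷ xs) s

sortedN⁺ : ∀ {xs} → AllPairs _<_ xs → SortedN xs
sortedN⁺ s = go (AllPairs⇒Linked s)
  where
  go : ∀ {xs} → Linked _<_ xs → SortedN xs
  go []      = tt
  go [-]     = tt
  go (p ∷ l) = p , go l

applyUpTo-sorted : ∀ (f : ℕ → ℕ) n → (∀ {i j} → i < j → f i < f j) → AllPairs _<_ (applyUpTo f n)
applyUpTo-sorted f n mono = AllPairsₚ.applyUpTo⁺₁ f n (λ i<j _ → mono i<j)

module _ {V : Set} where

  _≺_ : Box × V → Box × V → Set
  p ≺ q = proj₁ p <ᴮ proj₁ q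

  ≺-functional : ∀ {F : Filling V} → AllPairs _≺_ F → ∀ {b v w} → (b , v) ∈ F → (b , w) ∈ F → v ≡ w
  ≺-functional _         (here refl) (here refl) = refl
  ≺-functional (x≺ ∷ _) {b} (here refl) (there m)   = ⊥-elim (<ᴮ-irrefl {b} (ListAll.lookup x≺ m))
  ≺-functional (x≺ ∷ _) {b} (there m)   (here refl) = ⊥-elim (<ᴮ-irrefl {b} (ListAll.lookup x≺ m))
  ≺-functional (_ ∷ s)  (there m)   (there m′)  = ≺-functional s m m′

  onDomain-sorted : ∀ {F : Filling V} {D} → OnDomain F D → AllPairs _≺_ F
  onDomain-sorted (s , _) = AllPairsₚ.map⁻ (sortedB⁻ s)

  functional : ∀ {F : Filling V} {D} → OnDomain F D → ∀ {b v w} → (b , v) ∈ F → (b , w) ∈ F → v ≡ w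
  functional dom = ≺-functional (onDomain-sorted dom)

  fillRow : (ℕ → ℕ) → (ℕ → ℕ) → (ℕ → ℕ → V) → ℕ → Filling V
  fillRow a b val i = map (λ j → ((suc i , j) , val i j)) (interval (a i) (b i))

  fill : ℕ → (ℕ → ℕ) → (ℕ → ℕ) → (ℕ → ℕ → V) → Filling V
  fill R a b val = concatMap (fillRow a b val) (upTo R)

  fill⁺ : ∀ {R a b} val {i j} → i < R → a i < j → j ≤ b i → ((suc i , j) , val i j) ∈ fill R a b val
  fill⁺ {R} {a} {b} val {i} i< l r = concatMap⁺ (fillRow a b val) (∈-upTo⁺ i<) (∈-map⁺ (λ j → ((suc i , j) , val i j))
    (interval⁺ l r))

  fillRow⁻ : ∀ {a b} val i {r j v} → ((r , j) , v) ∈ fillRow a b val i → r ≡ suc i × a i < j × j ≤ b i × v ≡ val i j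
  fillRow⁻ val i m with ∈-map⁻ (λ j → ((suc i , j) , val i j)) m
  ... | j , j∈ , refl = let l , r = interval⁻ j∈ in refl , l , r , refl

  fill⁻ : ∀ {R a b} val {r j v} → ((r , j) , v) ∈ fill R a b val → ∃ λ i → i < R × r ≡ suc i × a i < j × j ≤ b i × v ≡ val i
    j
  fill⁻ {R} {a} {b} val m = let i , i∈ , m′ = concatMap⁻ (fillRow a b val) (upTo R) m in i , ∈-upTo⁻ i∈ , fillRow⁻ {a} {b}
    val i m′

  fill-sorted : ∀ R a b val → AllPairs _≺_ (fill R a b val)
  fill-sorted R a b val = pairs-concatMap (fillRow a b val) (applyUpTo-sorted id R id)
    (λ i _ → AllPairsₚ.map⁺ (AllPairs.map (λ l → inj₂ (refl , l)) (applyUpTo-sorted (λ k → suc (a i + k)) (b i ∸ a i)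
      (λ l → s≤s (+-monoʳ-< (a i) l)))))
    λ { {i} {i′} i<i′ ((r , j) , v) ((r′ , j′) , v′) m m′ → lem (fillRow⁻ {a} {b} val i m) (fillRow⁻ {a} {b} val i′ m′) i<i′
      }
    where
    lem : ∀ {i i′ r r′ j j′} {P Q : Set} → r ≡ suc i × P → r′ ≡ suc i′ × Q → i < i′ → (r , j) <ᴮ (r′ , j′)
    lem (refl , _) (refl , _) l = inj₁ (s≤s l)

  fill-domain : ∀ R a b val {D : Box → Set} → (∀ x → D x → Region R a b x) → (∀ x → Region R a b x → D x) → OnDomain
    (fill R a b val) D
  fill-domain R a b val {D} D⇒ ⇒D = sortedB⁺ (AllPairsₚ.map⁺ (fill-sorted R a b val)) ,
    (λ x x∈ → let (_ , v) , m , e = ∈-map⁻ proj₁ x∈ in subst D (sym e)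
      (⇒D _ (let i , i< , r , l , u , _ = fill⁻ {R} {a} {b} val m in i , i< , r , l , u))) ,
    (λ { (r , j) d → let i , i< , e , l , u = D⇒ (r , j) d in subst (λ z → (z , j) ∈ keys (fill R a b val)) (sym e)
      (∈-map⁺ proj₁ (fill⁺ {R} {a} {b} val i< l u)) })

  fill-canonical : ∀ R a b val {F : Filling V} {D} → OnDomain F D → (∀ x → D x → Region R a b x) →
    (∀ i j → i < R → a i < j → j ≤ b i → ((suc i , j) , val i j) ∈ F) → F ≡ fill R a b val
  fill-canonical R a b val {F} dom D⇒ vals = sorted-unique (λ {x} {y} → <ᴮ-asym {proj₁ x} {proj₁ y}) (onDomain-sorted dom)
    (fill-sorted R a b val)
    (λ { ((r , j) , v) m → let i , i< , e , l , u = D⇒ _ (proj₁ (proj₂ dom) _ (∈-map⁺ proj₁ m)) in lem m e (vals i j i< l u)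
      (fill⁺ {R} {a} {b} val i< l u) })
    (λ { ((r , j) , v) m → let i , i< , e , l , u , e′ = fill⁻ {R} {a} {b} val m in subst₂ (λ x y → ((x , j) , y) ∈ F)
      (sym e) (sym e′) (vals i j i< l u) })
    where
    lem : ∀ {r i j v} → ((r , j) , v) ∈ F → r ≡ suc i → ((suc i , j) , val i j) ∈ F → ((suc i , j) , val i j) ∈ fill R a b
      val → ((r , j) , v) ∈ fill R a b val
    lem m refl m′ m″ rewrite functional dom m m′ = m″

  fill-injective : ∀ R a b val val′ → fill R a b val ≡ fill R a b val′ → ∀ i j → i < R → a i < j → j ≤ b i → val i j ≡ val′
    i j
  fill-injective R a b val val′ e i j i< l u = ≺-functional (fill-sorted R a b val′) (subst (((suc i , j) , val i j) ∈_) e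
    (fill⁺ {R} {a} {b} val i< l u)) (fill⁺ {R} {a} {b} val′ i< l u)

  fill-cong : ∀ R a b val val′ → (∀ i j → i < R → a i < j → j ≤ b i → val i j ≡ val′ i j) → fill R a b val ≡ fill R a b val′
  fill-cong R a b val val′ eq = fill-canonical R a b val′ {D = Region R a b} (fill-domain R a b val (λ _ x → x) (λ _ x → x))
    (λ _ x → x)
    λ i j i< l u → subst (λ v → ((suc i , j) , v) ∈ fill R a b val) (eq i j i< l u) (fill⁺ {R} {a} {b} val i< l u)

  sum-fill : ∀ R a b val φ → sumL (fill R a b val) φ ≡ sum< R (λ i → sumI (a i) (b i) (λ j → φ ((suc i , j) , val i j)))
  sum-fill R a b val φ = trans (sumL-concatMap (fillRow a b val) (upTo R) φ) (trans (sumL-applyUpTo id R _)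
    (sum<-cong R λ i _ → trans (sumL-map _ (interval (a i) (b i)) φ) (sumL-applyUpTo (λ k → suc (a i + k)) (b i ∸ a i) _)))

  lookupF : V → Filling V → Box → V
  lookupF d []            x = d
  lookupF d ((b , v) ∷ F) x with Data.Product.Properties.≡-dec _≟_ _≟_ b x
  ... | yes _ = v
  ... | no _  = lookupF d F x

  lookupF-∈ : ∀ d F x → x ∈ keys F → (x , lookupF d F x) ∈ F
  lookupF-∈ d ((b , v) ∷ F) x x∈ with Data.Product.Properties.≡-dec _≟_ _≟_ b x
  lookupF-∈ d ((b , v) ∷ F) x x∈         | yes refl = here refl
  lookupF-∈ d ((b , v) ∷ F) x (here e)   | no b≢x   = contradiction (sym e) b≢x
  lookupF-∈ d ((b , v) ∷ F) x (there x∈) | no b≢x   = there (lookupF-∈ d F x x∈)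

-- Set-valued tableaux as chains of shapes

⊥? : Dec ⊥
⊥? = no id

⊤? : Dec ⊤
⊤? = yes tt

-- For P downward closed on (a , a + n], cut is the last column satisfying P (or a).
choose : {P : Set} → Dec P → ℕ → ℕ → ℕ
choose (yes _) x y = x
choose (no _)  x y = y

cut : {P : ℕ → Set} → (∀ j → Dec (P j)) → ℕ → ℕ → ℕ
cut P? a zero    = a
cut P? a (suc n) = choose (P? (suc a)) (cut P? (suc a) n) a

module _ {P : ℕ → Set} (P? : ∀ j → Dec (P j)) where

  cut-≥ : ∀ a n → a ≤ cut P? a n
  cut-≥ a zero    = ≤-refl
  cut-≥ a (suc n) with P? (suc a)
  ... | yes _ = ≤-trans (n≤1+n a) (cut-≥ (suc a) n)
  ... | no _  = ≤-refl

  cut-≤ : ∀ a n → cut P? a n ≤ a + n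
  cut-≤ a zero    = m≤m+n a 0
  cut-≤ a (suc n) with P? (suc a)
  ... | yes _ = ≤-trans (cut-≤ (suc a) n) (≤-reflexive (sym (+-suc a n)))
  ... | no _  = m≤m+n a (suc n)

  cut⁻ : ∀ a n j → a < j → j ≤ cut P? a n → P j
  cut⁻ a zero    j a<j j≤ = contradiction (<-≤-trans a<j j≤) (<-irrefl refl)
  cut⁻ a (suc n) j a<j j≤ with P? (suc a)
  ... | no _  = contradiction (<-≤-trans a<j j≤) (<-irrefl refl)
  ... | yes p = [ (λ l → cut⁻ (suc a) n j l j≤) , (λ { refl → p }) ]′ (m≤n⇒m<n∨m≡n a<j)

  cut⁺ : ∀ a n → (∀ j j′ → a < j → j ≤ j′ → j′ ≤ a + n → P j′ → P j) → ∀ j → a < j → j ≤ a + n → P j → j ≤ cut P? a n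
  cut⁺ a zero    down j a<j j≤ _ = ≤-trans j≤ (≤-reflexive (+-identityʳ a))
  cut⁺ a (suc n) down j a<j j≤ p with P? (suc a)
  ... | no ¬p = contradiction (down (suc a) j ≤-refl a<j j≤ p) ¬p
  ... | yes _ = [ (λ l → cut⁺ (suc a) n (λ i i′ l i≤ i′≤ → down i i′ (<⇒≤ l) i≤
    (≤-trans i′≤ (≤-reflexive (sym (+-suc a n))))) j l (≤-trans j≤ (≤-reflexive (+-suc a n))) p)
                , (λ { refl → cut-≥ (suc a) n }) ]′ (m≤n⇒m<n∨m≡n a<j)

-- A discrete intermediate value. For an increasing g the t found is the level at which column j is
-- first covered, so t + 1 is the least label of its box.
crossing : ∀ (g : ℕ → ℕ) j T → g 0 < j → j ≤ g T → ∃ λ t → t < T × g t < j × j ≤ g (suc t)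
crossing g j zero    l u = contradiction (<-≤-trans l u) (<-irrefl refl)
crossing g j (suc T) l u with j ≤? g T
... | yes j≤ = let t , t< , p = crossing g j T l j≤ in t , m≤n⇒m≤1+n t< , p
... | no ¬j≤ = T , ≤-refl , ≰⇒> ¬j≤ , u

nonEmpty⁺ : ∀ {X : List ℕ} {x} → x ∈ X → NonEmpty X
nonEmpty⁺ (here _)  = tt
nonEmpty⁺ (there _) = tt

nonEmpty⁻ : ∀ (X : List ℕ) → NonEmpty X → ∃ λ x → x ∈ X
nonEmpty⁻ (x ∷ X) _ = x , here refl

Has : (g e : ℕ → ℕ) → ℕ → ℕ → Set
Has g e j t = g t < j + e t × j ≤ g (suc t)

Has? : ∀ g e j t → Dec (Has g e j t)
Has? g e j t = g t <? j + e t ×-dec j ≤? g (suc t)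

-- Label t + 1 is the minimum of the boxes j with g t < j ≤ g (t + 1),
-- and an extra label of box g t when e t = 1.
labels : ℕ → (g e : ℕ → ℕ) → ℕ → List ℕ
labels L g e j = map suc (filter (Has? g e j) (upTo L))

labels⁺ : ∀ {L g e j t} → t < L → Has g e j t → suc t ∈ labels L g e j
labels⁺ {L} {g} {e} {j} t< h = ∈-map⁺ suc (∈-filter⁺ (Has? g e j) (∈-upTo⁺ t<) h)

labels⁻ : ∀ {L g e j x} → x ∈ labels L g e j → ∃ λ t → x ≡ suc t × t < L × Has g e j t
labels⁻ {L} {g} {e} {j} x∈ with ∈-map⁻ suc x∈
... | t , t∈ , refl = let t∈′ , h = ∈-filter⁻ (Has? g e j) {xs = upTo L} t∈ in t , refl , ∈-upTo⁻ t∈′ , h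

labels-sorted : ∀ L g e j → AllPairs _<_ (labels L g e j)
labels-sorted L g e j = AllPairsₚ.map⁺ (AllPairs.map s≤s (AllPairsₚ.filter⁺ (Has? g e j) (applyUpTo-sorted id L id)))

sorted-ext : ∀ {xs ys : List ℕ} → AllPairs _<_ xs → AllPairs _<_ ys → (∀ x → x ∈ xs → x ∈ ys) → (∀ x → x ∈ ys → x ∈ xs) → xs
  ≡ ys
sorted-ext = sorted-unique (λ p q → <-asym p q)

labels-cong : ∀ L {g g′ e e′} j → (∀ t → t ≤ L → g t ≡ g′ t) → (∀ t → t < L → e t ≡ e′ t) → labels L g e j ≡ labels L g′ e′ j
labels-cong L {g} {g′} {e} {e′} j eg ee = sorted-ext (labels-sorted L g e j) (labels-sorted L g′ e′ j) (half eg ee)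
  (half (λ t t≤ → sym (eg t t≤)) (λ t t< → sym (ee t t<)))
  where
  half : ∀ {g g′ e e′} → (∀ t → t ≤ L → g t ≡ g′ t) → (∀ t → t < L → e t ≡ e′ t) → ∀ x → x ∈ labels L g e j → x ∈ labels L
    g′ e′ j
  half {g} {g′} {e} {e′} eg ee x x∈ with labels⁻ {L} {g} {e} x∈
  ... | t , refl , t< , l , u = labels⁺ {L} {g′} {e′} t< (subst₂ (λ a b → a < j + b) (eg t (<⇒≤ t<)) (ee t t<) l , subst
    (j ≤_) (eg (suc t) t<) u)

length-labels : ∀ L g e j → length (labels L g e j) ≡ sum< L (λ t → ind (Has? g e j t))
length-labels L g e j = trans (length-map suc (filter (Has? g e j) (upTo L))) (trans (length-filter (Has? g e j) (upTo L))
  (sumL-applyUpTo id L _))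

sorted⇒unique : ∀ {xs} → AllPairs _<_ xs → Unique xs
sorted⇒unique = AllPairs.map <⇒≢

module SetValued (β W : ℕ) (β≤W : β ≤ W) (R L : ℕ) (a b : ℕ → ℕ) where
  open Shapes β W
  open Rows β W β≤W
  open Codes β W β≤W
  open Semantics β W β≤W

  decode : (g e : ℕ → ℕ → ℕ) → Filling (List ℕ)
  decode g e = fill R a b (λ i → labels L (g i) (e i))

  record Chains (g e : ℕ → ℕ → ℕ) : Set where
    field
      start  : ∀ i → i < R → g i 0 ≡ a i
      stop   : ∀ i → i < R → g i L ≡ b i
      bit    : ∀ i t → i < R → t < L → e i t ≤ 1
      mono   : ∀ i t → i < R → t < L → g i t ≤ g i (suc t)
      inside : ∀ i t → i < R → t < L → a i + e i t ≤ g i t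

    mono* : ∀ i {t t′} → i < R → t ≤ t′ → t′ ≤ L → g i t ≤ g i t′
    mono* i i< = stepwise-mono (g i) (λ t → mono i t i<)

    above : ∀ i t → i < R → t ≤ L → a i ≤ g i t
    above i t i< t≤ = ≤-trans (≤-reflexive (sym (start i i<))) (mono* i i< z≤n t≤)

    within : ∀ i t → i < R → t ≤ L → g i t ≤ b i
    within i t i< t≤ = ≤-trans (mono* i i< t≤ ≤-refl) (≤-reflexive (stop i i<))

    present : ∀ i j t → i < R → a i < j → t ≤ L → j ≤ g i t → ∃ λ x → x ∈ labels L (g i) (e i) j × x ≤ t
    present i j t i< a<j t≤ j≤ = let s , s< , l , u = crossing (g i) j t (≤-<-trans (≤-reflexive (start i i<)) a<j) j≤
      in suc s , labels⁺ {L} {g i} {e i} (<-≤-trans s< t≤) (<-≤-trans l (m≤m+n j _) , u) , s<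

    -- Label t + 1 fills the columns g i t ∸ e i t < j ≤ g i (t + 1). `inside` keeps the possible
    -- extra column within the row and the subtraction exact.
    ind-count : ∀ i t → i < R → t < L → sumI (a i) (b i) (λ j → ind (Has? (g i) (e i) j t)) ≡ g i (suc t) ∸ g i t + e i t
    ind-count i t i< t< = trans (sumI-count (λ j → Has? (g i) (e i) j t) (m+n≤o⇒m≤o∸n (a i) (inside i t i< t<))
      (within i (suc t) i< t<) (≤-trans (m∸n≤m _ (e i t)) (mono i t i< t<))
        (λ j _ _ (l , u) → lt⁻ (bit i t i< t<) l (≤-trans (m≤n+m _ (a i)) (inside i t i< t<)) , u) (λ j _ _ l u → lt⁺ l , u))
      (sym (+-∸-assoc′ (mono i t i< t<) (≤-trans (m≤n+m _ (a i)) (inside i t i< t<))))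
      where
      lt⁻ : ∀ {g j e} → e ≤ 1 → g < j + e → e ≤ g → g ∸ e < j
      lt⁻ {g} {j} {e} _ l e≤ = +-cancelʳ-< e _ _ (≤-<-trans (≤-reflexive (m∸n+n≡m e≤)) l)
      lt⁺ : ∀ {g j e} → g ∸ e < j → g < j + e
      lt⁺ {g} {j} {e} l = ≤-<-trans (m≤n+m∸n g e) (<-≤-trans (+-monoʳ-< e l) (≤-reflexive (+-comm e j)))
      +-∸-assoc′ : ∀ {g h e} → g ≤ h → e ≤ g → h ∸ g + e ≡ h ∸ (g ∸ e)
      +-∸-assoc′ {g} {h} {e} g≤h e≤g = sym (+-cancelʳ-≡ (g ∸ e) _ _ (trans (m∸n+n≡m (≤-trans (m∸n≤m g e) g≤h))
        (sym (trans (+-assoc (h ∸ g) e _) (trans (cong (h ∸ g +_) (m+[n∸m]≡n e≤g)) (m∸n+n≡m g≤h))))))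

    content-decode : ∀ t → t < L → contentSV (suc t) (decode g e) ≡ sum< R (λ i → g i (suc t) ∸ g i t + e i t)
    content-decode t t< = begin
      length (filter (_≟ suc t) (concatMap proj₂ (decode g e)))
        ≡⟨ length-filter (_≟ suc t) (concatMap proj₂ (decode g e)) ⟩
      sumL (concatMap proj₂ (decode g e)) (λ x → ind (x ≟ suc t))
        ≡⟨ sumL-concatMap proj₂ (decode g e) _ ⟩
      sumL (decode g e) (λ p → sumL (proj₂ p) (λ x → ind (x ≟ suc t)))
        ≡⟨ sum-fill R a b _ _ ⟩
      sum< R (λ i → sumI (a i) (b i) (λ j → sumL (labels L (g i) (e i) j) (λ x → ind (x ≟ suc t))))
        ≡⟨ (sum<-cong R λ i i< → trans (sumI-cong (a i) (b i) λ j _ _ → trans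
          (sym (length-filter (_≟ suc t) (labels L (g i) (e i) j)))
            (trans (count-unique (suc t) (sorted⇒unique (labels-sorted L (g i) (e i) j)))
             (ind-cong (DecMembership._∈?_ _≟_ (suc t) (labels L (g i) (e i) j)) (Has? (g i) (e i) j t)
               (λ m → lem (labels⁻ {L} {g i} {e i} m)) (labels⁺ {L} {g i} {e i} t<)))) (ind-count i t i< t<)) ⟩
      sum< R (λ i → g i (suc t) ∸ g i t + e i t) ∎
      where
      open ≡-Reasoning
      lem : ∀ {i j} → (∃ λ s → suc t ≡ suc s × s < L × Has (g i) (e i) j s) → Has (g i) (e i) j t
      lem (_ , refl , _ , h) = h

    -- Exchanging the sums over columns and labels lets the row ends telescope to the number of
    -- boxes; the bits are the excess.
    rowLabels-decode : ∀ i → i < R → rowLabels (suc i) (decode g e) ≡ (b i ∸ a i) + sum< L (e i)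
    rowLabels-decode i i< = begin
      length (concatMap proj₂ (rowPart (suc i) (decode g e)))
        ≡⟨ length-concatMap proj₂ (rowPart (suc i) (decode g e)) ⟩
      sumL (rowPart (suc i) (decode g e)) (λ p → length (proj₂ p))
        ≡⟨ sumL-filter (λ p → row (proj₁ p) ≟ suc i) (decode g e) _ ⟩
      sumL (decode g e) (λ p → ind (row (proj₁ p) ≟ suc i) * length (proj₂ p))
        ≡⟨ sum-fill R a b _ _ ⟩
      sum< R (λ i′ → sumI (a i′) (b i′) (λ j → ind (suc i′ ≟ suc i) * length (labels L (g i′) (e i′) j)))
        ≡⟨ sum<-single R i _ i< (λ k k< k≢ → trans (sumI-cong (a k) (b k) λ j _ _ → cong
          (_* length (labels L (g k) (e k) j)) (ind-cong (suc k ≟ suc i) ⊥? (k≢ ∘ suc-injective) λ ()))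
            (sum<-0 (b k ∸ a k))) ⟩
      sumI (a i) (b i) (λ j → ind (suc i ≟ suc i) * length (labels L (g i) (e i) j))
        ≡⟨ sumI-cong (a i) (b i) (λ j _ _ → trans (cong (_* length (labels L (g i) (e i) j)) (ind-cong (suc i ≟ suc i) ⊤?
          (λ _ → tt) (λ _ → refl))) (trans (+-identityʳ _) (length-labels L (g i) (e i) j))) ⟩
      sumI (a i) (b i) (λ j → sum< L (λ t → ind (Has? (g i) (e i) j t)))
        ≡⟨ sum<-swap (b i ∸ a i) L _ ⟩
      sum< L (λ t → sumI (a i) (b i) (λ j → ind (Has? (g i) (e i) j t)))
        ≡⟨ sum<-cong L (λ t t< → ind-count i t i< t<) ⟩
      sum< L (λ t → g i (suc t) ∸ g i t + e i t)
        ≡⟨ sum<-+ L _ (e i) ⟩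
      sum< L (λ t → g i (suc t) ∸ g i t) + sum< L (e i)
        ≡⟨ cong (_+ sum< L (e i)) (trans (telescope L (g i) (λ t t< → mono i t i< t<)) (cong₂ _∸_ (stop i i<) (start i i<)))
          ⟩
      (b i ∸ a i) + sum< L (e i) ∎
      where
      open ≡-Reasoning
      telescope : ∀ L (f : ℕ → ℕ) → (∀ t → t < L → f t ≤ f (suc t)) → sum< L (λ t → f (suc t) ∸ f t) ≡ f L ∸ f 0
      telescope zero    f m = sym (n∸n≡0 (f 0))
      telescope (suc L) f m = trans (cong (f 1 ∸ f 0 +_) (telescope L (f ∘ suc) (λ t t< → m (suc t) (s≤s t<))))
        (trans (+-comm _ (f (suc L) ∸ f 1)) (trans (sym (+-∸-assoc _ (m 0 (s≤s z≤n))))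
          (cong (_∸ f 0) (m∸n+n≡m (stepwise-mono f m (s≤s z≤n) ≤-refl)))))

  rowBoxes-fill : ∀ i → i < R → (val : ℕ → ℕ → List ℕ) → rowBoxes (suc i) (fill R a b val) ≡ b i ∸ a i
  rowBoxes-fill i i< val = begin
    length (rowPart (suc i) (fill R a b val))
      ≡⟨ length-filter (λ p → row (proj₁ p) ≟ suc i) (fill R a b val) ⟩
    sumL (fill R a b val) (λ p → ind (row (proj₁ p) ≟ suc i))
      ≡⟨ sum-fill R a b val _ ⟩
    sum< R (λ i′ → sumI (a i′) (b i′) (λ _ → ind (suc i′ ≟ suc i)))
      ≡⟨ sum<-single R i _ i< (λ k k< k≢ → trans (sumI-cong (a k) (b k) λ _ _ _ → ind-cong (suc k ≟ suc i) ⊥?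
        (k≢ ∘ suc-injective) λ ()) (sum<-0 (b k ∸ a k))) ⟩
    sumI (a i) (b i) (λ _ → ind (suc i ≟ suc i))
      ≡⟨ sumI-cong (a i) (b i) (λ _ _ _ → ind-cong (suc i ≟ suc i) ⊤? (λ _ → tt) (λ _ → refl)) ⟩
    sumI (a i) (b i) (λ _ → 1)
      ≡⟨ sum<-1 (b i ∸ a i) ⟩
    b i ∸ a i ∎
    where
    open ≡-Reasoning

  facts⇒chains : ∀ {k u w c g e} → CodeFacts R L a b k u w c g e → Chains g e
  facts⇒chains Fs = record { start = start ; stop = stop ; bit = bit ; mono = mono ; inside = inside }
    where open CodeFacts Fs

  -- g i t is recovered as the last column with a label at most t, and e i t from whether the box in
  -- column g i t contains t + 1.
  decode-injective : ∀ {g e g′ e′} → Chains g e → Chains g′ e′ → decode g e ≡ decode g′ e′ →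
    (∀ i t → i < R → t ≤ L → g i t ≡ g′ i t) × (∀ i t → i < R → t < L → e i t ≡ e′ i t)
  decode-injective {g} {e} {g′} {e′} C C′ eq = ends≡ , λ i t i< t< → ≤-antisym (e≤ C C′ same ends≡ i t i< t<)
    (e≤ C′ C (λ i j i< l u → sym (same i j i< l u)) (λ i t i< t≤ → sym (ends≡ i t i< t≤)) i t i< t<)
    where
    same : ∀ i j → i < R → a i < j → j ≤ b i → labels L (g i) (e i) j ≡ labels L (g′ i) (e′ i) j
    same = fill-injective R a b _ _ eq
    g≤ : ∀ {g e g′ e′} → Chains g e → Chains g′ e′ → (∀ i j → i < R → a i < j → j ≤ b i → labels L (g i) (e i) j ≡ labels L
      (g′ i) (e′ i) j) →
      ∀ i t → i < R → t ≤ L → g i t ≤ g′ i t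
    g≤ {g} {e} {g′} {e′} C C′ same i t i< t≤ with a i <? g i t
    ... | no ¬l = ≤-trans (≮⇒≥ ¬l) (Chains.above C′ i t i< t≤)
    ... | yes l = let x , x∈ , x≤ = Chains.present C i (g i t) t i< l t≤ ≤-refl
                      s , x≡ , s< , _ , u = labels⁻ {L} {g′ i} {e′ i}
                        (subst (x ∈_) (same i (g i t) i< l (Chains.within C i t i< t≤)) x∈)
                  in ≤-trans u (Chains.mono* C′ i i< (subst (_≤ t) x≡ x≤) t≤)
    ends≡ : ∀ i t → i < R → t ≤ L → g i t ≡ g′ i t
    ends≡ i t i< t≤ = ≤-antisym (g≤ C C′ same i t i< t≤) (g≤ C′ C (λ i j i< l u → sym (same i j i< l u)) i t i< t≤)
    e≤ : ∀ {g e g′ e′} → Chains g e → Chains g′ e′ → (∀ i j → i < R → a i < j → j ≤ b i → labels L (g i) (e i) j ≡ labels L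
      (g′ i) (e′ i) j) →
      (∀ i t → i < R → t ≤ L → g i t ≡ g′ i t) → ∀ i t → i < R → t < L → e i t ≤ e′ i t
    e≤ {g} {e} {g′} {e′} C C′ same ends≡ i t i< t< with e i t in eq
    ... | zero  = z≤n
    ... | suc k = ≤-trans (subst (_≤ 1) eq (Chains.bit C i t i< t<))
      (lem (labels⁻ {L} {g′ i} {e′ i} (subst (suc t ∈_) (same i (g i t) i< a<g (Chains.within C i t i< (<⇒≤ t<)))
        (labels⁺ {L} {g i} {e i} t< (subst (λ z → g i t < g i t + z) (sym eq) (m<m+n (g i t) (s≤s z≤n)) , Chains.mono C i t
          i< t<)))))
      where
      a<g : a i < g i t
      a<g = <-≤-trans (m<m+n (a i) (s≤s z≤n)) (subst (λ z → a i + z ≤ g i t) eq (Chains.inside C i t i< t<))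
      lem : (∃ λ s → suc t ≡ suc s × s < L × Has (g′ i) (e′ i) (g i t) s) → 1 ≤ e′ i t
      lem (_ , refl , _ , l , _) = +-cancelˡ-< (g i t) 0 (e′ i t) (subst (_< g i t + e′ i t)
        (trans (sym (ends≡ i t i< (<⇒≤ t<))) (sym (+-identityʳ (g i t)))) l)

  module Tableaux (S : List Box) (c e₀ : ℕ → ℕ)
    (S⇒ : ∀ x → x ∈ S → Region R a b x) (⇒S : ∀ x → Region R a b x → x ∈ S)
    (c-zero : ∀ k → L < k → c k ≡ 0) (e-zero : ∀ k → R < k → e₀ k ≡ 0) where

    Facts : (g e : ℕ → ℕ → ℕ) → Set
    Facts = CodeFacts R L a b (e₀ ∘ suc) (λ _ → W) (λ _ → 0) (c ∘ suc)

    no-row : ∀ {T : Filling (List ℕ)} i → OnDomain T (_∈ S) → R < i → rowPart i T ≡ []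
    no-row {T} i (_ , dom , _) R<i = no-member λ { ((r , j) , v) m →
      let m′ , e = ∈-filter⁻ (λ p → row (proj₁ p) ≟ i) {xs = T} m ; k , k< , e′ , _ = S⇒ (r , j) (dom _ (∈-map⁺ proj₁ m′))
        in <⇒≱ R<i (≤-trans (≤-reflexive (trans (sym e) e′)) k<) }

    -- A label t + 1 in column j gives g i t < j + e i t. Along a row, e i t ≤ 1 yields g i t < j′
    -- for every j′ > j, so no label below t + 1 occurs there. Down a column, this e i t cancels
    -- against the one in `below`, so the rows below reach column j only with labels beyond t + 1.
    decode-sound : ∀ {g e} → Facts g e → IsSS S c e₀ (decode g e)
    decode-sound {g} {e} Fs = dom , valid , semistandard , contents , rows
      where
      open CodeFacts Fs using (below; content; total)
      C : Chains g e
      C = facts⇒chains Fs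
      open Chains C
      dom : OnDomain (decode g e) (_∈ S)
      dom = fill-domain R a b _ S⇒ ⇒S
      antitone : ∀ t → t < L → ∀ i i′ → i ≤ i′ → i′ < R → g i′ (suc t) ≤ g i (suc t)
      antitone t t< i zero     z≤n _ = ≤-refl
      antitone t t< i (suc i′) i≤ i′< = [ (λ l → ≤-trans (≤-trans (m+n≤o⇒m≤o _ (below i′ t (<⇒≤ i′<) t<))
        (mono i′ t (<⇒≤ i′<) t<)) (antitone t t< i i′ (≤-pred l) (<⇒≤ i′<))) , (λ { refl → ≤-refl }) ]′ (m≤n⇒m<n∨m≡n i≤)
      valid : ValidSetsSV (decode g e)
      valid (r , j) X m with fill⁻ {R = R} {a} {b} (λ i → labels L (g i) (e i)) m
      ... | i , i< , refl , l , u , refl = nonEmpty⁺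
        (proj₁ (proj₂ (present i j L i< l ≤-refl (≤-trans u (≤-reflexive (sym (stop i i<))))))) ,
        sortedN⁺ (labels-sorted L (g i) (e i) j) , λ x x∈ → let t , x≡ , _ = labels⁻ {L} {g i} {e i} x∈ in subst (1 ≤_)
          (sym x≡) (s≤s z≤n)
      semistandard : SemistandardSV (decode g e)
      semistandard (r , j) X (r′ , j′) Y m m′ with fill⁻ {R = R} {a} {b} (λ i → labels L (g i) (e i)) m | fill⁻ {R = R} {a}
        {b} (λ i → labels L (g i) (e i)) m′
      ... | i , i< , refl , _ , _ , refl | i′ , i′< , refl , _ , _ , refl =
        (λ { refl j<j′ x y x∈ y∈ → rowcase j<j′ (labels⁻ {L} {g i} {e i} x∈) (labels⁻ {L} {g i} {e i} y∈) }) ,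
        (λ { refl (s≤s i<i′) x y x∈ y∈ → colcase i<i′ (labels⁻ {L} {g i} {e i} x∈) (labels⁻ {L} {g i′} {e i′} y∈) })
        where
        rowcase : ∀ {x y j j′} → j < j′ → (∃ λ t → x ≡ suc t × t < L × Has (g i) (e i) j t) → (∃ λ t → y ≡ suc t × t < L ×
          Has (g i) (e i) j′ t) → x ≤ y
        rowcase j<j′ (t , refl , t< , l , _) (t′ , refl , t′< , _ , u′) = s≤s (≮⇒≥ λ t′<t → <⇒≱
          (<-≤-trans (≤-<-trans (mono* i i< t′<t (<⇒≤ t<)) l) (≤-trans (+-monoʳ-≤ _ (bit i t i< t<))
            (≤-trans (≤-reflexive (+-comm _ 1)) j<j′))) u′)
        colcase : ∀ {x y j} → i < i′ → (∃ λ t → x ≡ suc t × t < L × Has (g i) (e i) j t) → (∃ λ t → y ≡ suc t × t < L × Has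
          (g i′) (e i′) j t) → x < y
        colcase {j = j} i<i′ (t , refl , t< , l , _) (t′ , refl , t′< , _ , u′) = s≤s (≰⇒> λ t′≤t → <⇒≱
          (+-cancelʳ-< (e i t) _ _ (≤-<-trans (below i t i< t<) l)) (≤-trans u′ (≤-trans (mono* i′ i′< (s≤s t′≤t) t<)
            (antitone t t< (suc i) i′ i<i′ i′<))))
      contents : ∀ k → 1 ≤ k → contentSV k (decode g e) ≡ c k
      contents (suc t) _ with suc t ≤? L
      ... | yes t< = trans (content-decode t t<) (content t t<)
      ... | no ¬t< = trans (trans (length-filter (_≟ suc t) (concatMap proj₂ (decode g e)))
        (trans (sumL-cong (concatMap proj₂ (decode g e)) λ x x∈ → ind-cong (x ≟ suc t) ⊥? (λ { refl → big x∈ }) λ ())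
          (zeros (concatMap proj₂ (decode g e))))) (sym (c-zero (suc t) (≰⇒> ¬t<)))
        where
        zeros : ∀ {A : Set} (xs : List A) → sumL xs (λ _ → 0) ≡ 0
        zeros []       = refl
        zeros (x ∷ xs) = zeros xs
        big : suc t ∈ concatMap proj₂ (decode g e) → ⊥
        big m with concatMap⁻ proj₂ (decode g e) m
        ... | ((r , j) , X) , m , x∈ with fill⁻ {R = R} {a} {b} (λ i → labels L (g i) (e i)) m
        ... | i , i< , refl , _ , _ , refl with labels⁻ {L} {g i} {e i} x∈
        ... | s , refl , s< , _ = ¬t< s<
      rows : ∀ i → 1 ≤ i → rowLabels i (decode g e) ≡ rowBoxes i (decode g e) + e₀ i
      rows (suc i) _ with suc i ≤? R
      ... | yes i< = trans (rowLabels-decode i i<) (cong₂ _+_ (sym (rowBoxes-fill i i< _)) (total i i<))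
      ... | no ¬i< rewrite no-row (suc i) dom (≰⇒> ¬i<) = sym (e-zero (suc i) (≰⇒> ¬i<))

-- Every set-valued tableau comes from a code

module TableauCount (β W : ℕ) (β≤W : β ≤ W) (R L : ℕ) (a b : ℕ → ℕ) (S : List Box) (c e₀ : ℕ → ℕ)
  (S⇒ : ∀ x → x ∈ S → Region R a b x) (⇒S : ∀ x → Region R a b x → x ∈ S)
  (c-zero : ∀ k → L < k → c k ≡ 0) (e-zero : ∀ k → R < k → e₀ k ≡ 0)
  (a-dec : ∀ i → suc i < R → a (suc i) ≤ a i) (b-dec : ∀ i → suc i < R → b (suc i) ≤ b i)
  (a≤b : ∀ i → i < R → a i ≤ b i) (b≤W : ∀ i → i < R → b i ≤ W) (β≤a : ∀ i → i < R → β ≤ a i) where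
  open Shapes β W
  open Rows β W β≤W
  open Codes β W β≤W
  open Semantics β W β≤W
  open SetValued β W β≤W R L a b
  open Tableaux S c e₀ S⇒ ⇒S c-zero e-zero

  open DecMembership _≟_ using () renaming (_∈?_ to _∈ᴺ?_)

  module Encode (T : Filling (List ℕ)) (ss : IsSS S c e₀ T) where

    X : ℕ → ℕ → List ℕ
    X i j = lookupF [] T (suc i , j)

    UpTo : ℕ → ℕ → ℕ → Set
    UpTo i t j = Any.Any (_≤ t) (X i j)

    UpTo? : ∀ i t j → Dec (UpTo i t j)
    UpTo? i t j = Any.any? (_≤? t) (X i j)

    orβ : {P : Set} → Dec P → ℕ → ℕ
    orβ (yes _) x = x
    orβ (no _)  x = β

    -- A column counts for g i t as soon as its set has some label at most t, and e i t asks whether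
    -- t + 1 lies in the last such box. Rows out of range end at β, which is also what the row under
    -- the last one has to be.
    g e : ℕ → ℕ → ℕ
    g i t = orβ (i <? R) (cut (UpTo? i t) (a i) (b i ∸ a i))
    e i t = ind (a i <? g i t ×-dec suc t ∈ᴺ? X i (g i t))

    dom : OnDomain T (_∈ S)
    dom = proj₁ ss

    valid : ValidSetsSV T
    valid = proj₁ (proj₂ ss)

    semi : SemistandardSV T
    semi = proj₁ (proj₂ (proj₂ ss))

    X∈ : ∀ i j → i < R → a i < j → j ≤ b i → ((suc i , j) , X i j) ∈ T
    X∈ i j i< l u = lookupF-∈ [] T (suc i , j) (proj₂ (proj₂ dom) (suc i , j) (⇒S _ (i , i< , refl , l , u)))

    g≡ : ∀ i t → i < R → g i t ≡ cut (UpTo? i t) (a i) (b i ∸ a i)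
    g≡ i t i< with i <? R
    ... | yes _ = refl
    ... | no ¬i< = contradiction i< ¬i<

    -- A label beyond L would have content 0 by `c-zero` and yet occur.
    upto-≤L : ∀ i j x → i < R → a i < j → j ≤ b i → x ∈ X i j → x ≤ L
    upto-≤L i j x i< l u x∈ = ≮⇒≥ λ L<x → length≡0 (trans (proj₁ (proj₂ (proj₂ (proj₂ ss))) x
      (proj₂ (proj₂ (valid _ _ (X∈ i j i< l u))) x x∈)) (c-zero x L<x))
        (∈-filter⁺ (_≟ x) {xs = concatMap proj₂ T} (concatMap⁺ proj₂ (X∈ i j i< l u) x∈) refl)

    some : ∀ i j → i < R → a i < j → j ≤ b i → ∃ λ x → x ∈ X i j
    some i j i< l u = nonEmpty⁻ (X i j) (proj₁ (valid _ _ (X∈ i j i< l u)))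

    row-≤ : ∀ i j j′ x y → i < R → a i < j → j < j′ → j′ ≤ b i → x ∈ X i j → y ∈ X i j′ → x ≤ y
    row-≤ i j j′ x y i< l j<j′ u x∈ y∈ = proj₁ (semi _ _ _ _ (X∈ i j i< l (≤-trans (<⇒≤ j<j′) u))
      (X∈ i j′ i< (<-trans l j<j′) u)) refl j<j′ x y x∈ y∈

    down : ∀ i t → i < R → ∀ j j′ → a i < j → j ≤ j′ → j′ ≤ a i + (b i ∸ a i) → UpTo i t j′ → UpTo i t j
    down i t i< j j′ l j≤j′ u up with m≤n⇒m<n∨m≡n j≤j′
    ... | inj₂ refl = up
    ... | inj₁ j<j′ = let y , y∈ , y≤ = find up ; u′ = ≤-trans u (≤-reflexive (m+[n∸m]≡n (a≤b i i<))) ; x , x∈ = some i j i< l (≤-trans j≤j′ u′)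
                      in lose x∈ (≤-trans (row-≤ i j j′ x y i< l j<j′ u′ x∈ y∈) y≤)

    g⁻ : ∀ i t j → i < R → a i < j → j ≤ g i t → UpTo i t j
    g⁻ i t j i< l j≤ = cut⁻ (UpTo? i t) (a i) (b i ∸ a i) j l (≤-trans j≤ (≤-reflexive (g≡ i t i<)))

    g⁺ : ∀ i t j → i < R → a i < j → j ≤ b i → UpTo i t j → j ≤ g i t
    g⁺ i t j i< l u up = ≤-trans (cut⁺ (UpTo? i t) (a i) (b i ∸ a i) (down i t i<) j l
      (≤-trans u (≤-reflexive (sym (m+[n∸m]≡n (a≤b i i<))))) up) (≤-reflexive (sym (g≡ i t i<)))

    a≤g : ∀ i t → i < R → a i ≤ g i t
    a≤g i t i< = ≤-trans (cut-≥ (UpTo? i t) (a i) (b i ∸ a i)) (≤-reflexive (sym (g≡ i t i<)))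

    g≤b : ∀ i t → i < R → g i t ≤ b i
    g≤b i t i< = ≤-trans (≤-reflexive (g≡ i t i<)) (≤-trans (cut-≤ (UpTo? i t) (a i) (b i ∸ a i))
      (≤-reflexive (m+[n∸m]≡n (a≤b i i<))))

    e-cases : ∀ i t → (e i t ≡ 0) ⊎ (e i t ≡ 1 × a i < g i t × suc t ∈ X i (g i t))
    e-cases i t with a i <? g i t ×-dec suc t ∈ᴺ? X i (g i t)
    ... | yes (l , m) = inj₂ (refl , l , m)
    ... | no _        = inj₁ refl

    e-one : ∀ i t → a i < g i t → suc t ∈ X i (g i t) → e i t ≡ 1
    e-one i t l m = ind-cong (a i <? g i t ×-dec suc t ∈ᴺ? X i (g i t)) ⊤? (λ _ → tt) (λ _ → l , m)

    chains : Chains g e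
    chains = record
      { start  = λ i i< → ≤-antisym (≮⇒≥ λ l → let x , x∈ , x≤ = find (g⁻ i 0 (g i 0) i< l ≤-refl) in
                   <⇒≱ (proj₂ (proj₂ (valid _ _ (X∈ i (g i 0) i< l (g≤b i 0 i<)))) x x∈) x≤) (a≤g i 0 i<)
      ; stop   = λ i i< → ≤-antisym (g≤b i L i<) ([ (λ a<b → let x , x∈ = some i (b i) i< a<b ≤-refl in g⁺ i L (b i) i< a<b
        ≤-refl (lose x∈ (upto-≤L i (b i) x i< a<b ≤-refl x∈)))
                   , (λ a≡b → ≤-trans (≤-reflexive (sym a≡b)) (a≤g i L i<)) ]′ (m≤n⇒m<n∨m≡n (a≤b i i<)))
      ; bit    = λ i t _ _ → [ (λ z → ≤-trans (≤-reflexive z) z≤n) , (λ z → ≤-reflexive (proj₁ z)) ]′ (e-cases i t)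
      ; mono   = λ i t i< _ → [ (λ l → g⁺ i (suc t) (g i t) i< l (g≤b i t i<) (Any.map m≤n⇒m≤1+n (g⁻ i t (g i t) i< l
        ≤-refl)))
                   , (λ z → ≤-trans (≤-reflexive (sym z)) (a≤g i (suc t) i<)) ]′ (m≤n⇒m<n∨m≡n (a≤g i t i<))
      ; inside = λ i t i< _ → inside i t i< }
      where
      inside : ∀ i t → i < R → a i + e i t ≤ g i t
      inside i t i< with e-cases i t
      ... | inj₁ z = ≤-trans (≤-reflexive (trans (cong (a i +_) z) (+-identityʳ (a i)))) (a≤g i t i<)
      ... | inj₂ (z , l , _) = ≤-trans (≤-reflexive (trans (cong (a i +_) z) (+-comm (a i) 1))) l

    open Chains chains using (inside; bit; mono; start; stop)

    -- Let j be the end of row i + 1 under labels at most t + 1. If row i has a box in column j, its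
    -- labels are at most t by column strictness, so j ≤ g i t, and j = g i t is excluded when that
    -- box contains t + 1. If it has none, `inside` suffices.
    below : ∀ i t → i < R → t < L → g (suc i) (suc t) + e i t ≤ g i t
    below i t i< t< with suc i <? R
    ... | no _ = ≤-trans (+-monoˡ-≤ (e i t) (β≤a i i<)) (inside i t i< t<)
    ... | yes i′< with a i <? cut (UpTo? (suc i) (suc t)) (a (suc i)) (b (suc i) ∸ a (suc i))
    ... | no ¬l = ≤-trans (+-monoˡ-≤ (e i t) (≮⇒≥ ¬l)) (inside i t i< t<)
    ... | yes l = subst (λ z → z + e i t ≤ g i t) (g≡ (suc i) (suc t) i′<) (go (e-cases i t))
      where
      j : ℕ
      j = g (suc i) (suc t)
      a<j : a i < j
      a<j = <-≤-trans l (≤-reflexive (sym (g≡ (suc i) (suc t) i′<)))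
      j≤b : j ≤ b i
      j≤b = ≤-trans (g≤b (suc i) (suc t) i′<) (b-dec i i′<)
      a′<j : a (suc i) < j
      a′<j = ≤-<-trans (a-dec i i′<) a<j
      entry : ∃ λ y → y ∈ X (suc i) j × y ≤ suc t
      entry = find (g⁻ (suc i) (suc t) j i′< a′<j ≤-refl)
      small : ∀ x → x ∈ X i j → x ≤ t
      small x x∈ = let y , y∈ , y≤ = entry in ≤-pred
        (≤-trans (proj₂ (semi _ _ _ _ (X∈ i j i< a<j j≤b) (X∈ (suc i) j i′< a′<j (g≤b (suc i) (suc t) i′<))) refl ≤-refl x y
          x∈ y∈) y≤)
      j≤g : j ≤ g i t
      j≤g = let x , x∈ = some i j i< a<j j≤b in g⁺ i t j i< a<j j≤b (lose x∈ (small x x∈))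
      go : (e i t ≡ 0) ⊎ (e i t ≡ 1 × a i < g i t × suc t ∈ X i (g i t)) → j + e i t ≤ g i t
      go (inj₁ z) = ≤-trans (≤-reflexive (trans (cong (j +_) z) (+-identityʳ j))) j≤g
      go (inj₂ (z , _ , m)) = ≤-trans (≤-reflexive (trans (cong (j +_) z) (+-comm j 1))) (≤∧≢⇒< j≤g λ j≡g → <-irrefl refl
        (small (suc t) (subst (λ k → suc t ∈ X i k) (sym j≡g) m)))

    X≡labels : ∀ i j → i < R → a i < j → j ≤ b i → X i j ≡ labels L (g i) (e i) j
    X≡labels i j i< l u = sorted-ext (sortedN⁻ (proj₁ (proj₂ (valid _ _ (X∈ i j i< l u))))) (labels-sorted L (g i) (e i) j)
      to from
      where
      to : ∀ x → x ∈ X i j → x ∈ labels L (g i) (e i) j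
      to x x∈ with x | proj₂ (proj₂ (valid _ _ (X∈ i j i< l u))) x x∈ | upto-≤L i j x i< l u x∈ | x∈
      ... | suc t | _ | t< | x∈ = labels⁺ {L} {g i} {e i} t< (low , g⁺ i (suc t) j i< l u (lose x∈ ≤-refl))
        where
        -- If j ≤ g i t, then t + 1 sits in a box that also has a label at most t. Strictly left of
        -- column g i t this contradicts the label at most t in that column, so j = g i t and the
        -- bit is set.
        low : g i t < j + e i t
        low with j ≤? g i t
        ... | no ¬j≤ = <-≤-trans (≰⇒> ¬j≤) (m≤m+n j _)
        ... | yes j≤ with m≤n⇒m<n∨m≡n j≤
        ... | inj₁ j<g = let y , y∈ , y≤ = find (g⁻ i t (g i t) i< (<-trans l j<g) ≤-refl) in contradiction
          (≤-trans (row-≤ i j (g i t) (suc t) y i< l j<g (g≤b i t i<) x∈ y∈) y≤) (<-irrefl refl)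
        ... | inj₂ j≡g = ≤-trans (≤-reflexive (cong suc (sym j≡g))) (≤-trans (≤-reflexive (+-comm 1 j))
          (+-monoʳ-≤ j (≤-reflexive (sym (e-one i t (subst (a i <_) j≡g l) (subst (λ k → suc t ∈ X i k) j≡g x∈))))))
      from : ∀ x → x ∈ labels L (g i) (e i) j → x ∈ X i j
      from x x∈ with labels⁻ {L} {g i} {e i} x∈
      ... | t , refl , t< , low , up with find (g⁻ i (suc t) j i< l up)
      ... | y , y∈ , y≤ with j ≤? g i t
      ... | no ¬j≤ = [ (λ y≤t → contradiction (g⁺ i t j i< l u (lose y∈ (≤-pred y≤t))) ¬j≤) , (λ { refl → y∈ }) ]′
        (m≤n⇒m<n∨m≡n y≤)
      ... | yes j≤ with e-cases i t
      ... | inj₁ z = contradiction (<-≤-trans low (≤-trans (≤-reflexive (trans (cong (j +_) z) (+-identityʳ j))) j≤))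
        (<-irrefl refl)
      ... | inj₂ (z , _ , m) = subst (λ k → suc t ∈ X i k)
        (≤-antisym (≤-pred (≤-trans low (≤-reflexive (trans (cong (j +_) z) (+-comm j 1))))) j≤) m

    T≡decode : T ≡ decode g e
    T≡decode = fill-canonical R a b _ dom S⇒ λ i j i< l u → subst (λ Y → ((suc i , j) , Y) ∈ T) (X≡labels i j i< l u)
      (X∈ i j i< l u)

    facts : Facts g e
    facts = record
      { start = start ; stop = stop ; past = past ; small = λ i t i< _ → ≤-trans (g≤b i (suc t) i<) (b≤W i i<)
      ; bit = bit ; mono = mono ; inside = inside ; first = λ t _ → first t ; below = below
      ; total = λ i i< → +-cancelˡ-≡ (b i ∸ a i) _ _ (trans (sym (Chains.rowLabels-decode chains i i<))
        (trans (cong (rowLabels (suc i)) (sym T≡decode))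
          (trans (proj₂ (proj₂ (proj₂ (proj₂ ss))) (suc i) (s≤s z≤n)) (cong (_+ e₀ (suc i))
            (trans (cong (rowBoxes (suc i)) T≡decode) (rowBoxes-fill i i< _))))))
      ; content = λ t t< → trans (sym (Chains.content-decode chains t t<)) (trans (cong (contentSV (suc t)) (sym T≡decode))
        (proj₁ (proj₂ (proj₂ (proj₂ ss))) (suc t) (s≤s z≤n))) }
      where
      past : ∀ t → g R t ≡ β
      past t with R <? R
      ... | yes R<R = contradiction R<R (<-irrefl refl)
      ... | no _    = refl
      first : ∀ t → g 0 (suc t) ≤ W
      first t with 0 <? R
      ... | yes 0< = ≤-trans (≤-reflexive (sym (g≡ 0 (suc t) 0<))) (≤-trans (g≤b 0 (suc t) 0<) (b≤W 0 0<))
      ... | no _   = β≤W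

  rowsᵀ : Vec Row R
  rowsᵀ = rowsOf R a b (e₀ ∘ suc)

  levelsᵀ : Vec Level L
  levelsᵀ = levels L (λ _ → W) (λ _ → 0) (c ∘ suc)

  tableau : Vec (RowCode L) R → Filling (List ℕ)
  tableau ρs = decode (rowEnds a ρs) (extras ρs)

  tableau-sound : ∀ ρs → CodeOK rowsᵀ levelsᵀ ρs → IsSS S c e₀ (tableau ρs)
  tableau-sound ρs ok = decode-sound (codeFacts L a b (e₀ ∘ suc) (λ _ → W) (λ _ → 0) (c ∘ suc) ρs ok)

  tableau-complete : ∀ T → IsSS S c e₀ T → ∃ λ ρs → CodeOK rowsᵀ levelsᵀ ρs × T ≡ tableau ρs
  tableau-complete T ss = codesOf R L g e , codeOK-codesOf R L a b _ _ _ _ g e facts , trans T≡decode (fill-cong R a b _ _ λ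
    i j i< _ _ →
      labels-cong L j (λ t t≤ → sym (rowEnds-codesOf R L a g e i t i< t≤ (Chains.start chains)))
        (λ t t< → sym (extras-codesOf R L g e i t i< t<)))
    where open Encode T ss

  tableau-injective : ∀ ρs σs → CodeOK rowsᵀ levelsᵀ ρs → CodeOK rowsᵀ levelsᵀ σs → tableau ρs ≡ tableau σs → ρs ≡ σs
  tableau-injective ρs σs ok ok′ eq = let p , q = decode-injective (C ρs ok) (C σs ok′) eq in codes-ext a ρs σs p q
    where
    C : ∀ ρs → CodeOK rowsᵀ levelsᵀ ρs → Chains (rowEnds a ρs) (extras ρs)
    C ρs ok = facts⇒chains (codeFacts L a b (e₀ ∘ suc) (λ _ → W) (λ _ → 0) (c ∘ suc) ρs ok)

-- The pairs (T′ , T″) as chains of shapes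

module StripSemantics (β W : ℕ) (β≤W : β ≤ W) where
  open Shapes β W
  open Paths β W
  open Pieri β W β≤W
  open Rows β W β≤W
  open Codes β W β≤W

  at : ∀ {n} → Vec ℕ n → ℕ → ℕ
  at []      i       = β
  at (x ∷ v) zero    = x
  at (x ∷ v) (suc i) = at v i

  vecOf : ∀ n → (ℕ → ℕ) → Vec ℕ n
  vecOf zero    f = []
  vecOf (suc n) f = f 0 ∷ vecOf n (f ∘ suc)

  at-0 : ∀ {n} (v : Vec ℕ n) → at v 0 ≡ hd v
  at-0 []      = refl
  at-0 (x ∷ v) = refl

  at-past : ∀ {n} (v : Vec ℕ n) i → n ≤ i → at v i ≡ β
  at-past []      i       _        = refl
  at-past (x ∷ v) (suc i) (s≤s n≤) = at-past v i n≤

  at-vecOf : ∀ n f i → i < n → at (vecOf n f) i ≡ f i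
  at-vecOf (suc n) f zero    _        = refl
  at-vecOf (suc n) f (suc i) (s≤s i<) = at-vecOf n (f ∘ suc) i i<

  at-replicate : ∀ M i → at (Vec.replicate M β) i ≡ β
  at-replicate zero    i       = refl
  at-replicate (suc M) zero    = refl
  at-replicate (suc M) (suc i) = at-replicate M i

  at-ext : ∀ {n} (v w : Vec ℕ n) → (∀ i → i < n → at v i ≡ at w i) → v ≡ w
  at-ext []      []      _  = refl
  at-ext (x ∷ v) (y ∷ w) eq = cong₂ _∷_ (eq 0 (s≤s z≤n)) (at-ext v w (λ i i< → eq (suc i) (s≤s i<)))

  hor-at⁻ : ∀ {n} (p q : Vec ℕ n) → Hor p q → ∀ i → at p i ≤ at q i × (i < n → at q (suc i) ≤ at p i)
  hor-at⁻ []       []       _           i       = ≤-refl , λ ()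
  hor-at⁻ (p ∷ ps) (q ∷ qs) (a , b , _) zero    = a , λ _ → ≤-trans (≤-reflexive (at-0 qs)) b
  hor-at⁻ (p ∷ ps) (q ∷ qs) (_ , _ , h) (suc i) = let x , y = hor-at⁻ ps qs h i in x , y ∘ ≤-pred

  hor-at⁺ : ∀ {n} (p q : Vec ℕ n) → (∀ i → i < n → at p i ≤ at q i × at q (suc i) ≤ at p i) → Hor p q
  hor-at⁺ []       []       _ = tt
  hor-at⁺ (p ∷ ps) (q ∷ qs) h = proj₁ (h 0 (s≤s z≤n)) , ≤-trans (≤-reflexive (sym (at-0 qs))) (proj₂ (h 0 (s≤s z≤n))) ,
    hor-at⁺ ps qs (λ i i< → h (suc i) (s≤s i<))

  ver-at⁻ : ∀ {n} (q r : Vec ℕ n) → Ver q r → ∀ i → at r i ≤ at q i × at q i ≤ suc (at r i)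
  ver-at⁻ []       []       _            i       = ≤-refl , n≤1+n β
  ver-at⁻ (q ∷ qs) (r ∷ rs) (inj₁ refl , v) zero = ≤-refl , n≤1+n q
  ver-at⁻ (q ∷ qs) (r ∷ rs) (inj₂ refl , v) zero = n≤1+n r , ≤-refl
  ver-at⁻ (q ∷ qs) (r ∷ rs) (_ , v)      (suc i) = ver-at⁻ qs rs v i

  ver-at⁺ : ∀ {n} (q r : Vec ℕ n) → (∀ i → i < n → at r i ≤ at q i × at q i ≤ suc (at r i)) → Ver q r
  ver-at⁺ []       []       _ = tt
  ver-at⁺ (q ∷ qs) (r ∷ rs) h = [ (λ l → inj₁ (≤-antisym (≤-pred l) (proj₁ (h 0 (s≤s z≤n))))) , inj₂ ]′
    (m≤n⇒m<n∨m≡n (proj₂ (h 0 (s≤s z≤n)))) , ver-at⁺ qs rs (λ i i< → h (suc i) (s≤s i<))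

  part-at⁻ : ∀ {n} (v : Vec ℕ n) → Part v → ∀ i → at v (suc i) ≤ at v i
  part-at⁻ []      _       i       = ≤-refl
  part-at⁻ (x ∷ v) (h , _) zero    = ≤-trans (≤-reflexive (at-0 v)) h
  part-at⁻ (x ∷ v) (_ , P) (suc i) = part-at⁻ v P i

  part-at⁺ : ∀ {n} (v : Vec ℕ n) → (∀ i → i < n → at v (suc i) ≤ at v i) → Part v
  part-at⁺ []      _ = tt
  part-at⁺ (x ∷ v) h = ≤-trans (≤-reflexive (sym (at-0 v))) (h 0 (s≤s z≤n)) , part-at⁺ v (λ i i< → h (suc i) (s≤s i<))

  diff-at : ∀ {n} (q r : Vec ℕ n) → diff q r ≡ sum< n (λ i → at q i ∸ at r i)
  diff-at []       []       = refl
  diff-at (q ∷ qs) (r ∷ rs) = cong (q ∸ r +_) (diff-at qs rs)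

  -- After the labels ≤ t: the rows of index < t are back to their ends in σ.
  innerAt outerAt : ∀ n M → (ℕ → ℕ) → Strips n M → ℕ → ℕ → ℕ
  innerAt zero    M κ s           t       i       = β
  innerAt (suc n) M κ (s , a , b) zero    i       = at a i
  innerAt (suc n) M κ (s , a , b) (suc t) zero    = κ 0
  innerAt (suc n) M κ (s , a , b) (suc t) (suc i) = innerAt n M (κ ∘ suc) s t i
  outerAt zero    M ν s           t       i       = β
  outerAt (suc n) M ν (s , a , b) zero    i       = at b i
  outerAt (suc n) M ν (s , a , b) (suc t) zero    = ν 0
  outerAt (suc n) M ν (s , a , b) (suc t) (suc i) = outerAt n M (ν ∘ suc) s t i

  at-inner : ∀ n M κ s i → at (inner n M s) i ≡ innerAt n M κ s 0 i
  at-inner zero    M κ s           i = at-replicate M i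
  at-inner (suc n) M κ (_ , a , _) i = refl

  at-outer : ∀ n M ν s i → at (outer n M s) i ≡ outerAt n M ν s 0 i
  at-outer zero    M ν s           i = at-replicate M i
  at-outer (suc n) M ν (_ , _ , b) i = refl

  at-κinner : ∀ n M κ s {a b} i → at (κ 0 ∷ inner n M s) i ≡ innerAt (suc n) M κ (s , a , b) 1 i
  at-κinner n M κ s zero    = refl
  at-κinner n M κ s (suc i) = at-inner n M (κ ∘ suc) s i

  at-νouter : ∀ n M ν s {a b} i → at (ν 0 ∷ outer n M s) i ≡ outerAt (suc n) M ν (s , a , b) 1 i
  at-νouter n M ν s zero    = refl
  at-νouter n M ν s (suc i) = at-outer n M (ν ∘ suc) s i

  -- K t i is the last column of row i with T′ ≤ t on the inner side, O t i the last one with T″ > t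
  -- on the outer side. Row i has number i + 1, so the row bounds T′ ≤ i + 1 and T″ < i + 1 become
  -- `K-fix` and `O-fix`. `K-strip` is strictness of T′ down columns, `O-strip` strictness of T″
  -- along rows, `O-dec` its weak decrease down columns.
  record StripFacts (n M : ℕ) (κ ν k : ℕ → ℕ) (K O : ℕ → ℕ → ℕ) : Set where
    field
      K-fix   : ∀ t i → i < n → i < t → t ≤ n → K t i ≡ κ i
      K-end   : ∀ i → n ≤ i → K n i ≡ β
      K-mono  : ∀ t i → t < n → K t i ≤ K (suc t) i
      K-strip : ∀ t i → t < n → K (suc t) (suc i) ≤ K t i
      K-≥β    : ∀ t i → t ≤ n → β ≤ K t i
      O-fix   : ∀ t i → i < n → i ≤ t → t ≤ n → O t i ≡ ν i
      O-end   : ∀ i → n ≤ i → O n i ≡ β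
      O-past  : ∀ t i → n + M ≤ i → O t i ≡ β
      O-mono  : ∀ t i → t < n → O (suc t) i ≤ O t i
      O-strip : ∀ t i → t < n → O t i ≤ suc (O (suc t) i)
      O-dec   : ∀ t i → t < n → O t (suc i) ≤ O t i
      K-≤W    : ∀ t i → t < n → K t i ≤ W
      O-≤W    : ∀ t i → t < n → O t i ≤ W
      size    : ∀ t → t < n → sum< (n + M) (λ i → K (suc t) i ∸ K t i) + sum< (n + M) (λ i → O t i ∸ O (suc t) i) ≡ k t

  at-≤ : ∀ {n} (v : Vec ℕ n) → (∀ i → at v (suc i) ≤ at v i) → ∀ i → at v i ≤ at v 0
  at-≤ v dec zero    = ≤-refl
  at-≤ v dec (suc i) = ≤-trans (dec i) (at-≤ v dec i)

  -- The outermost pair of strips supplies level 0; the facts for the rows below reappear with both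
  -- the level t and the row index i shifted by one, and the first row is constant from level 1 on.
  stripFacts : ∀ n M κ ν k s → (∀ i → suc i < n → κ (suc i) ≤ κ i) → (∀ i → suc i < n → ν (suc i) ≤ ν i) →
    (∀ i → i < n → β ≤ κ i) → (∀ i → i < n → β ≤ ν i) → (∀ i → i < n → κ i ≤ W) → (∀ i → i < n → ν i ≤ W) →
    StripsOK M (rowsOf n κ ν k) s → StripFacts n M κ ν k (innerAt n M κ s) (outerAt n M ν s)
  stripFacts zero M κ ν k s _ _ _ _ _ _ _ = record
    { K-fix = λ _ _ () ; K-end = λ _ _ → refl ; K-mono = λ _ _ () ; K-strip = λ _ _ () ; K-≥β = λ _ _ _ → ≤-refl
    ; O-fix = λ _ _ () ; O-end = λ _ _ → refl ; O-past = λ _ _ _ → refl ; O-mono = λ _ _ () ; O-strip = λ _ _ () ; O-dec = λ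
      _ _ ()
    ; K-≤W = λ _ _ () ; O-≤W = λ _ _ () ; size = λ _ () }
  stripFacts (suc n) M κ ν k (s , a , b@(y ∷ q)) κ-dec ν-dec β≤κ β≤ν κ≤W ν≤W (ok , (ha , hb) , H , (refl , V , Pb) , sz) =
    record
    { K-fix = λ { (suc t) zero _ _ _ → refl ; (suc t) (suc i) (s≤s i<) (s≤s i<t) (s≤s t≤) → F.K-fix t i i< i<t t≤ }
    ; K-end = λ { (suc i) (s≤s n≤) → F.K-end i n≤ }
    ; K-mono = λ { zero i _ → subst (at a i ≤_) (at-κinner n M κ s {a} {b} i) (proj₁ (hor-at⁻ a A H i)) ; (suc t) zero _ →
      ≤-refl ; (suc t) (suc i) (s≤s t<) → F.K-mono t i t< }
    ; K-strip = λ { zero i _ → subst (_≤ at a i) (at-κinner n M κ s {a} {b} (suc i)) (strip₀ i) ; (suc t) zero (s≤s t<) →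
      K0≤ t t< ; (suc t) (suc i) (s≤s t<) → F.K-strip t i t< }
    ; K-≥β = λ { zero i _ → a≥β i ; (suc t) zero _ → β≤κ 0 (s≤s z≤n) ; (suc t) (suc i) (s≤s t≤) → F.K-≥β t i t≤ }
    ; O-fix = λ { zero zero _ _ _ → refl ; (suc t) zero _ _ _ → refl ; (suc t) (suc i) (s≤s i<) (s≤s i≤) (s≤s t≤) → F.O-fix
      t i i< i≤ t≤ }
    ; O-end = λ { (suc i) (s≤s n≤) → F.O-end i n≤ }
    ; O-past = λ { zero i R≤ → at-past b i R≤ ; (suc t) (suc i) (s≤s R≤) → F.O-past t i R≤ }
    ; O-mono = λ { zero zero _ → ≤-refl ; zero (suc i) _ → subst (_≤ at q i) (at-outer n M (ν ∘ suc) s i)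
      (proj₁ (ver-at⁻ q (outer n M s) V i)) ; (suc t) zero _ → ≤-refl ; (suc t) (suc i) (s≤s t<) → F.O-mono t i t< }
    ; O-strip = λ { zero zero _ → n≤1+n y ; zero (suc i) _ → subst (λ z → at q i ≤ suc z) (at-outer n M (ν ∘ suc) s i)
      (proj₂ (ver-at⁻ q (outer n M s) V i)) ; (suc t) zero _ → n≤1+n y ; (suc t) (suc i) (s≤s t<) → F.O-strip t i t< }
    ; O-dec = λ { zero i _ → part-at⁻ b Pb i ; (suc t) zero (s≤s t<) → O0≤ t t< ; (suc t) (suc i) (s≤s t<) → F.O-dec t i t< }
    ; K-≤W = λ { zero i _ → ≤-trans (at-≤ a (part-at⁻ a (hor-part′ a A H)) i) (≤-trans (≤-reflexive (at-0 a)) ha) ; (suc t)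
      zero _ → κ≤W 0 (s≤s z≤n) ; (suc t) (suc i) (s≤s t<) → F.K-≤W t i t< }
    ; O-≤W = λ { zero i _ → ≤-trans (at-≤ b (part-at⁻ b Pb) i) hb ; (suc t) zero _ → ν≤W 0 (s≤s z≤n) ; (suc t) (suc i)
      (s≤s t<) → F.O-≤W t i t< }
    ; size = λ { zero _ → trans (sym (cong₂ _+_ (trans (diff-at A a) (sum<-cong (suc n + M) λ i _ → cong (_∸ at a i)
      (at-κinner n M κ s {a} {b} i)))
                                  (trans (diff-at b (y ∷ outer n M s)) (sum<-cong (suc n + M) λ i _ → cong (at b i ∸_)
                                    (at-νouter n M ν s {a} {b} i))))) sz
               ; (suc t) (s≤s t<) → trans (cong₂ _+_ (cong (_+ sum< (n + M) (λ i → innerAt n M (κ ∘ suc) s (suc t) i ∸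
                 innerAt n M (κ ∘ suc) s t i)) (n∸n≡0 (κ 0)))
                                                (cong (_+ sum< (n + M) (λ i → outerAt n M (ν ∘ suc) s t i ∸ outerAt n M
                                                  (ν ∘ suc) s (suc t) i)) (n∸n≡0 (ν 0)))) (F.size t t<) } }
    where
    A : Vec ℕ (suc n + M)
    A = κ 0 ∷ inner n M s
    module F = StripFacts (stripFacts n M (κ ∘ suc) (ν ∘ suc) (k ∘ suc) s (λ i i< → κ-dec (suc i) (s≤s i<))
      (λ i i< → ν-dec (suc i) (s≤s i<))
      (λ i i< → β≤κ (suc i) (s≤s i<)) (λ i i< → β≤ν (suc i) (s≤s i<)) (λ i i< → κ≤W (suc i) (s≤s i<)) (λ i i< → ν≤W (suc i)
        (s≤s i<)) ok)
    a≥β : ∀ i → β ≤ at a i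
    a≥β i with i <? suc n + M
    ... | no ¬i<   = ≤-reflexive (sym (at-past a i (≮⇒≥ ¬i<)))
    ... | yes i< = ≤-trans (F.K-≥β 0 i z≤n) (subst (_≤ at a i) (at-κinner n M κ s {a} {b} (suc i)) (proj₂ (hor-at⁻ a A H i)
      i<))
    strip₀ : ∀ i → at A (suc i) ≤ at a i
    strip₀ i with i <? suc n + M
    ... | yes i< = proj₂ (hor-at⁻ a A H i) i<
    ... | no ¬i< = ≤-trans (≤-reflexive (at-past A (suc i) (≤-trans (≮⇒≥ ¬i<) (n≤1+n i)))) (a≥β i)
    K0≤ : ∀ t → t < n → innerAt n M (κ ∘ suc) s (suc t) 0 ≤ κ 0
    K0≤ t t< = ≤-trans (≤-reflexive (F.K-fix (suc t) 0 (≤-<-trans z≤n t<) (s≤s z≤n) t<)) (κ-dec 0 (s≤s (≤-<-trans z≤n t<)))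
    O0≤ : ∀ t → t < n → outerAt n M (ν ∘ suc) s t 0 ≤ ν 0
    O0≤ t t< = ≤-trans (≤-reflexive (F.O-fix t 0 (≤-<-trans z≤n t<) z≤n (<⇒≤ t<))) (ν-dec 0 (s≤s (≤-<-trans z≤n t<)))

  stripsOf : ∀ n M → (K O : ℕ → ℕ → ℕ) → Strips n M
  stripsOf zero    M K O = tt
  stripsOf (suc n) M K O = stripsOf n M (λ t i → K (suc t) (suc i)) (λ t i → O (suc t) (suc i)) , vecOf (suc n + M) (K 0) ,
    vecOf (suc n + M) (O 0)

  facts-tail : ∀ {n M κ ν k K O} → StripFacts (suc n) M κ ν k K O →
    StripFacts n M (κ ∘ suc) (ν ∘ suc) (k ∘ suc) (λ t i → K (suc t) (suc i)) (λ t i → O (suc t) (suc i))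
  facts-tail {n} {M} {κ} {ν} {k} {K} {O} Fs = record
    { K-fix = λ t i i< i<t t≤ → K-fix (suc t) (suc i) (s≤s i<) (s≤s i<t) (s≤s t≤) ; K-end = λ i n≤ → K-end (suc i) (s≤s n≤)
    ; K-mono = λ t i t< → K-mono (suc t) (suc i) (s≤s t<) ; K-strip = λ t i t< → K-strip (suc t) (suc i) (s≤s t<) ; K-≥β = λ
      t i t≤ → K-≥β (suc t) (suc i) (s≤s t≤)
    ; O-fix = λ t i i< i≤ t≤ → O-fix (suc t) (suc i) (s≤s i<) (s≤s i≤) (s≤s t≤) ; O-end = λ i n≤ → O-end (suc i) (s≤s n≤) ;
      O-past = λ t i R≤ → O-past (suc t) (suc i) (s≤s R≤)
    ; O-mono = λ t i t< → O-mono (suc t) (suc i) (s≤s t<) ; O-strip = λ t i t< → O-strip (suc t) (suc i) (s≤s t<) ; O-dec =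
      λ t i t< → O-dec (suc t) (suc i) (s≤s t<)
    ; K-≤W = λ t i t< → K-≤W (suc t) (suc i) (s≤s t<) ; O-≤W = λ t i t< → O-≤W (suc t) (suc i) (s≤s t<)
    ; size = λ t t< → trans (sym (cong₂ _+_
        (cong (_+ sum< (n + M) (λ i → K (suc (suc t)) (suc i) ∸ K (suc t) (suc i)))
          (trans (cong₂ _∸_ (K-fix (suc (suc t)) 0 (s≤s z≤n) (s≤s z≤n) (s≤s t<)) (K-fix (suc t) 0 (s≤s z≤n) (s≤s z≤n)
            (<⇒≤ (s≤s t<)))) (n∸n≡0 (κ 0))))
        (cong (_+ sum< (n + M) (λ i → O (suc t) (suc i) ∸ O (suc (suc t)) (suc i)))
          (trans (cong₂ _∸_ (O-fix (suc t) 0 (s≤s z≤n) z≤n (<⇒≤ (s≤s t<))) (O-fix (suc (suc t)) 0 (s≤s z≤n) z≤n (s≤s t<)))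
            (n∸n≡0 (ν 0)))))) (size (suc t) (s≤s t<)) }
    where open StripFacts Fs

  -- Squeezed between β and K n i = β, since K increases with the level.
  K-past : ∀ {n M κ ν k K O} → StripFacts n M κ ν k K O → ∀ t i → t ≤ n → n ≤ i → K t i ≡ β
  K-past {n} {K = K} Fs t i t≤ n≤ = ≤-antisym (go (n ∸ t) t (m∸n+n≡m t≤)) (K-≥β t i t≤)
    where
    open StripFacts Fs
    go : ∀ d t → d + t ≡ n → K t i ≤ β
    go zero    t refl = ≤-reflexive (K-end i n≤)
    go (suc d) t e    = ≤-trans (K-mono t i (≤-trans (s≤s (m≤n+m t d)) (≤-reflexive e))) (go d (suc t) (trans (+-suc d t) e))

  innerAt-stripsOf : ∀ {n M κ ν k K O} → StripFacts n M κ ν k K O → ∀ t i → t ≤ n → innerAt n M κ (stripsOf n M K O) t i ≡ K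
    t i
  innerAt-stripsOf {zero} Fs zero i _ = sym (StripFacts.K-end Fs i z≤n)
  innerAt-stripsOf {suc n} {M} {K = K} Fs zero i _ with i <? suc n + M
  ... | yes i< = at-vecOf (suc n + M) (K 0) i i<
  ... | no ¬i< = trans (at-past (vecOf (suc n + M) (K 0)) i (≮⇒≥ ¬i<))
    (sym (K-past Fs 0 i z≤n (≤-trans (m≤m+n (suc n) M) (≮⇒≥ ¬i<))))
  innerAt-stripsOf {suc n} Fs (suc t) zero    t≤       = sym (StripFacts.K-fix Fs (suc t) 0 (s≤s z≤n) (s≤s z≤n) t≤)
  innerAt-stripsOf {suc n} Fs (suc t) (suc i) (s≤s t≤) = innerAt-stripsOf (facts-tail Fs) t i t≤

  outerAt-stripsOf : ∀ {n M κ ν k K O} → StripFacts n M κ ν k K O → ∀ t i → t ≤ n → outerAt n M ν (stripsOf n M K O) t i ≡ O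
    t i
  outerAt-stripsOf {zero} Fs zero i _ = sym (StripFacts.O-end Fs i z≤n)
  outerAt-stripsOf {suc n} {M} {O = O} Fs zero i _ with i <? suc n + M
  ... | yes i< = at-vecOf (suc n + M) (O 0) i i<
  ... | no ¬i< = trans (at-past (vecOf (suc n + M) (O 0)) i (≮⇒≥ ¬i<)) (sym (StripFacts.O-past Fs 0 i (≮⇒≥ ¬i<)))
  outerAt-stripsOf {suc n} Fs (suc t) zero    t≤       = sym (StripFacts.O-fix Fs (suc t) 0 (s≤s z≤n) z≤n t≤)
  outerAt-stripsOf {suc n} Fs (suc t) (suc i) (s≤s t≤) = outerAt-stripsOf (facts-tail Fs) t i t≤

  stripsOK : ∀ n M κ ν k K O → StripFacts n M κ ν k K O → StripsOK M (rowsOf n κ ν k) (stripsOf n M K O)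
  stripsOK zero    M κ ν k K O Fs = tt
  stripsOK (suc n) M κ ν k K O Fs = stripsOK n M _ _ _ _ _ F′ , (K-≤W 0 0 (s≤s z≤n) , O-≤W 0 0 (s≤s z≤n)) ,
      hor-at⁺ a A (λ i i< → subst₂ _≤_ (sym (a≡ i)) (sym (A≡ i)) (K-mono 0 i (s≤s z≤n)) , subst₂ _≤_ (sym (A≡ (suc i)))
        (sym (a≡ i)) (K-strip 0 i (s≤s z≤n))) ,
      (O-fix 0 0 (s≤s z≤n) z≤n z≤n , ver-at⁺ _ _ (λ i i< → subst₂ _≤_ (sym (B≡ (suc i))) (sym (b≡ (suc i)))
        (O-mono 0 (suc i) (s≤s z≤n)) , subst₂ (λ x y → x ≤ suc y) (sym (b≡ (suc i))) (sym (B≡ (suc i))) (O-strip 0 (suc i)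
          (s≤s z≤n))) ,
        part-at⁺ b (λ i i< → subst₂ _≤_ (sym (b≡ (suc i))) (sym (b≡ i)) (O-dec 0 i (s≤s z≤n)))) ,
      trans (cong₂ _+_ (trans (diff-at A a) (sum<-cong (suc n + M) λ i _ → cong₂ _∸_ (A≡ i) (a≡ i))) (trans (diff-at b B)
        (sum<-cong (suc n + M) λ i _ → cong₂ _∸_ (b≡ i) (B≡ i)))) (size 0 (s≤s z≤n))
    where
    open StripFacts Fs
    F′ : StripFacts n M (κ ∘ suc) (ν ∘ suc) (k ∘ suc) (λ t i → K (suc t) (suc i)) (λ t i → O (suc t) (suc i))
    F′ = facts-tail Fs
    s : Strips n M
    s = stripsOf n M (λ t i → K (suc t) (suc i)) (λ t i → O (suc t) (suc i))
    a b A B : Vec ℕ (suc n + M)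
    a = vecOf (suc n + M) (K 0)
    b = vecOf (suc n + M) (O 0)
    A = κ 0 ∷ inner n M s
    B = ν 0 ∷ outer n M s
    a≡ : ∀ i → at a i ≡ K 0 i
    a≡ i = innerAt-stripsOf Fs 0 i z≤n
    b≡ : ∀ i → at b i ≡ O 0 i
    b≡ i = outerAt-stripsOf Fs 0 i z≤n
    A≡ : ∀ i → at A i ≡ K 1 i
    A≡ zero    = sym (K-fix 1 0 (s≤s z≤n) (s≤s z≤n) (s≤s z≤n))
    A≡ (suc i) = trans (at-inner n M (κ ∘ suc) s i) (innerAt-stripsOf F′ 0 i z≤n)
    B≡ : ∀ i → at B i ≡ O 1 i
    B≡ zero    = sym (O-fix 1 0 (s≤s z≤n) z≤n (s≤s z≤n))
    B≡ (suc i) = trans (at-outer n M (ν ∘ suc) s i) (outerAt-stripsOf F′ 0 i z≤n)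

  strips-ext : ∀ n M κ ν (s s′ : Strips n M) → (∀ t i → t ≤ n → innerAt n M κ s t i ≡ innerAt n M κ s′ t i) →
    (∀ t i → t ≤ n → outerAt n M ν s t i ≡ outerAt n M ν s′ t i) → s ≡ s′
  strips-ext zero    M κ ν _           _              _  _   = refl
  strips-ext (suc n) M κ ν (s , a , b) (s′ , a′ , b′) eq eq′ = cong₂ _,_
    (strips-ext n M (κ ∘ suc) (ν ∘ suc) s s′ (λ t i t≤ → eq (suc t) (suc i) (s≤s t≤)) (λ t i t≤ → eq′ (suc t) (suc i)
      (s≤s t≤)))
    (cong₂ _,_ (at-ext a a′ (λ i _ → eq 0 i z≤n)) (at-ext b b′ (λ i _ → eq′ 0 i z≤n)))

  -- The strips for successive labels are stacked on each other, so in each row their sizes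
  -- telescope.
  removed-sum : ∀ n M κ ν k s → StripFacts n M κ ν k (innerAt n M κ s) (outerAt n M ν s) →
    removed M (rowsOf n κ ν k) s ≡ sum< (n + M) (λ i → innerAt n M κ s n i ∸ innerAt n M κ s 0 i)
  removed-sum zero    M κ ν k s Fs = sym (trans (sum<-cong M λ _ _ → n∸n≡0 β) (sum<-0 M))
  removed-sum (suc n) M κ ν k (s , a , b) Fs = begin
    removed M (rowsOf n (κ ∘ suc) (ν ∘ suc) (k ∘ suc)) s + diff (κ 0 ∷ inner n M s) a
      ≡⟨ cong₂ _+_ (removed-sum n M (κ ∘ suc) (ν ∘ suc) (k ∘ suc) s (facts-tail Fs)) (diff-at (κ 0 ∷ inner n M s) a) ⟩
    sum< (n + M) (λ i → K n i ∸ K 0 i) + (κ 0 ∸ at a 0 + sum< (n + M) (λ i → at (inner n M s) i ∸ at a (suc i)))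
      ≡⟨ trans (lem (sum< (n + M) (λ i → K n i ∸ K 0 i)) (κ 0 ∸ at a 0) _) (cong (κ 0 ∸ at a 0 +_)
        (sym (sum<-+ (n + M) (λ i → K n i ∸ K 0 i) (λ i → at (inner n M s) i ∸ at a (suc i))))) ⟩
    κ 0 ∸ at a 0 + sum< (n + M) (λ i → K n i ∸ K 0 i + (at (inner n M s) i ∸ at a (suc i)))
      ≡⟨ cong (κ 0 ∸ at a 0 +_) (sum<-cong (n + M) λ i _ → trans (cong (λ z → K n i ∸ K 0 i + (z ∸ at a (suc i)))
        (at-inner n M (κ ∘ suc) s i))
            (trans (sym (+-∸-assoc (K n i ∸ K 0 i) (StripFacts.K-mono Fs 0 (suc i) (s≤s z≤n)))) (cong (_∸ at a (suc i))
              (m∸n+n≡m (stepwise-mono (λ t → K t i) (λ t t< → StripFacts.K-mono Fs (suc t) (suc i) (s≤s t<)) z≤n ≤-refl)))))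
                ⟩
    κ 0 ∸ at a 0 + sum< (n + M) (λ i → K n i ∸ at a (suc i)) ∎
    where
    open ≡-Reasoning
    K : ℕ → ℕ → ℕ
    K = innerAt n M (κ ∘ suc) s
    lem : ∀ x y z → x + (y + z) ≡ y + (x + z)
    lem = solve-∀

-- The rows of σ and of the shapes containing it

antitone : ∀ {f : ℕ → ℕ} → (∀ i → f (suc i) ≤ f i) → ∀ {i i′} → i ≤ i′ → f i′ ≤ f i
antitone {f} dec {i} {zero}   z≤n = ≤-refl
antitone {f} dec {i} {suc i′} i≤  = [ (λ l → ≤-trans (dec i′) (antitone dec (≤-pred l))) , (λ { refl → ≤-refl }) ]′
  (m≤n⇒m<n∨m≡n i≤)

-- A discrete intermediate value along a border; it locates a row of σ that meets column j.
descent : ∀ (f : ℕ → ℕ) j i d → j ≤ f i → f (d + i) < j → ∃ λ m → i ≤ m × m < d + i × j ≤ f m × f (suc m) < j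
descent f j i zero    j≤ f< = contradiction (<-≤-trans f< j≤) (<-irrefl refl)
descent f j i (suc d) j≤ f< with j ≤? f (d + i)
... | yes j≤′ = d + i , m≤n+m i d , ≤-refl , j≤′ , f<
... | no ¬j≤ = let m , i≤ , m< , p = descent f j i d j≤ (≰⇒> ¬j≤) in m , i≤ , m≤n⇒m≤1+n m< , p

_≟ᴮ_ : DecidableEquality Box
_≟ᴮ_ = Data.Product.Properties.≡-dec _≟_ _≟_

-- The boxes of row i + 1 of σ are the columns κ i < j ≤ ν i.
record SkewRows (σ : List Box) (n β : ℕ) (κ ν : ℕ → ℕ) : Set where
  field
    0<n     : 0 < n
    κ-dec   : ∀ i → κ (suc i) ≤ κ i
    ν-dec   : ∀ i → ν (suc i) ≤ ν i
    κ<ν     : ∀ i → i < n → κ i < ν i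
    κ-end   : ∀ i → n ≤ i → κ i ≡ β
    ν-end   : ∀ i → n ≤ i → ν i ≡ β
    κ-last  : ∀ i → suc i ≡ n → κ i ≡ β
    meets : ∀ i → suc i < n → κ i < ν (suc i)
    σ⇒      : ∀ x → x ∈ σ → Region n κ ν x
    ⇒σ      : ∀ x → Region n κ ν x → x ∈ σ

  W : ℕ
  W = ν 0

  β≤κ : ∀ i → β ≤ κ i
  β≤κ i with i ≤? n
  ... | yes i≤ = ≤-trans (≤-reflexive (sym (κ-end n ≤-refl))) (antitone κ-dec i≤)
  ... | no ¬i≤ = ≤-reflexive (sym (κ-end i (<⇒≤ (≰⇒> ¬i≤))))

  κ≤ν : ∀ i → κ i ≤ ν i
  κ≤ν i with i <? n
  ... | yes i< = <⇒≤ (κ<ν i i<)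
  ... | no ¬i< = ≤-reflexive (trans (κ-end i (≮⇒≥ ¬i<)) (sym (ν-end i (≮⇒≥ ¬i<))))

  β≤ν : ∀ i → β ≤ ν i
  β≤ν i = ≤-trans (β≤κ i) (κ≤ν i)

  β≤W : β ≤ W
  β≤W = β≤ν 0

  ν≤W : ∀ i → ν i ≤ W
  ν≤W i = antitone ν-dec z≤n

  κ≤W : ∀ i → κ i ≤ W
  κ≤W i = ≤-trans (κ≤ν i) (ν≤W i)

  in-σ : ∀ i j → κ i < j → j ≤ ν i → i < n
  in-σ i j l u = ≰⇒> λ n≤ → <⇒≱ l (≤-trans u (≤-reflexive (trans (ν-end i n≤) (sym (κ-end i n≤)))))

  -- When the border κ steps back past column j between rows m and m + 1, `meets` gives ν (m + 1) >
  -- κ m ≥ j, so row m + 1 contains column j. `box-above` is the same argument along ν. Hence a box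
  -- of μ to the left of σ lies above a box of σ, and one to the right lies below.
  box-below : ∀ i j → β < j → j ≤ κ i → ∃ λ m → i < m × m < n × κ m < j × j ≤ ν m
  box-below i j β<j j≤ with i ≤? n
  ... | no ¬i≤ = contradiction (<-≤-trans β<j (≤-trans j≤ (≤-reflexive (κ-end i (<⇒≤ (≰⇒> ¬i≤)))))) (<-irrefl refl)
  ... | yes i≤ with descent κ j i (n ∸ i) j≤ (≤-<-trans (≤-reflexive (trans (cong κ (m∸n+n≡m i≤)) (κ-end n ≤-refl))) β<j)
  ... | m , i≤m , m< , j≤κ , κ<j = [ (λ l → suc m , s≤s i≤m , l , κ<j , ≤-trans j≤κ (<⇒≤ (meets m l)))
                                   , (λ e → contradiction (<-≤-trans β<j (≤-trans j≤κ (≤-reflexive (κ-last m e))))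
                                     (<-irrefl refl)) ]′ (m≤n⇒m<n∨m≡n (≤-trans m< (≤-reflexive (m∸n+n≡m i≤))))

  box-above : ∀ i j → j ≤ W → ν i < j → ∃ λ m → m < i × m < n × κ m < j × j ≤ ν m
  box-above i j j≤W ν<j with descent ν j 0 i j≤W (subst (λ z → ν z < j) (sym (+-identityʳ i)) ν<j)
  ... | m , _ , m< , j≤ν , ν<j′ with m≤n⇒m<n∨m≡n (in-σ m j (κ<j m ν<j′) j≤ν)
    where
    κ<j : ∀ m → ν (suc m) < j → κ m < j
    κ<j m ν<j′ with <-cmp (suc m) n
    ... | tri< l _ _ = <-trans (meets m l) ν<j′
    ... | tri≈ _ e _ = ≤-<-trans (≤-trans (≤-reflexive (κ-last m e)) (β≤ν (suc m))) ν<j′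
    ... | tri> _ _ g = ≤-<-trans (≤-trans (≤-reflexive (κ-end m (≤-pred g))) (β≤ν (suc m))) ν<j′
  ... | inj₁ l = m , ≤-trans m< (≤-reflexive (+-identityʳ i)) , <⇒≤ l , <-trans (meets m l) ν<j′ , j≤ν
  ... | inj₂ e = m , ≤-trans m< (≤-reflexive (+-identityʳ i)) , ≤-reflexive e , ≤-<-trans
    (≤-trans (≤-reflexive (κ-last m e)) (β≤ν (suc m))) ν<j′ , j≤ν

  σ⁺ : ∀ i j → i < n → κ i < j → j ≤ ν i → (suc i , j) ∈ σ
  σ⁺ i j i< l u = ⇒σ _ (i , i< , refl , l , u)

boxes : ℕ → (ℕ → ℕ) → (ℕ → ℕ) → List Box
boxes R a b = keys (fill R a b (λ _ _ → 0))

boxes⁺ : ∀ {R a b i j} → i < R → a i < j → j ≤ b i → (suc i , j) ∈ boxes R a b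
boxes⁺ {R} {a} {b} i< l u = ∈-map⁺ proj₁ (fill⁺ {R = R} {a} {b} (λ _ _ → 0) i< l u)

boxes⁻ : ∀ {R a b} x → x ∈ boxes R a b → Region R a b x
boxes⁻ {R} {a} {b} (r , j) m with ∈-map⁻ proj₁ m
... | _ , m , refl = let i , i< , e , l , u , _ = fill⁻ {R = R} {a} {b} (λ _ _ → 0) m in i , i< , e , l , u

boxes⁺′ : ∀ {R a b} x → Region R a b x → x ∈ boxes R a b
boxes⁺′ (r , j) (i , i< , refl , l , u) = boxes⁺ i< l u

boxes-sorted : ∀ R a b → AllPairs _<ᴮ_ (boxes R a b)
boxes-sorted R a b = AllPairsₚ.map⁺ (fill-sorted R a b _)

module Between {σ n β κ ν} (sk : SkewRows σ n β κ ν) (R : ℕ) (n≤R : n ≤ R) where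
  open SkewRows sk

  -- The row ends of a shape μ containing σ. That the first row does not grow to the right and that
  -- no row starts before column β + 1 expresses that μ uses only the columns of σ.
  record Bounds (κ′ ν′ : ℕ → ℕ) : Set where
    field
      κ′-dec : ∀ i → κ′ (suc i) ≤ κ′ i
      ν′-dec : ∀ i → ν′ (suc i) ≤ ν′ i
      κ′≤κ   : ∀ i → κ′ i ≤ κ i
      ν≤ν′   : ∀ i → ν i ≤ ν′ i
      β≤κ′   : ∀ i → β ≤ κ′ i
      ν′-0   : ν′ 0 ≡ ν 0
      ν′-end : ∀ i → R ≤ i → ν′ i ≡ β

  module Outside {κ′ ν′} (bd : Bounds κ′ ν′) where
    open Bounds bd

    μ : List Box
    μ = boxes R κ′ ν′

    ν′≤W : ∀ i → ν′ i ≤ W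
    ν′≤W i = ≤-trans (antitone ν′-dec z≤n) (≤-reflexive ν′-0)

    A⇒ : ∀ x → InA μ σ x → Region R κ′ κ x
    A⇒ (r , j) (m , x∉ , (r₂ , _) , d∈ , refl , r<) with boxes⁻ {R} {κ′} {ν′} (r , j) m | σ⇒ _ d∈
    ... | i , i< , refl , l , u | i₂ , i₂< , refl , l₂ , u₂ = i , i< , refl , l , ≮⇒≥ λ κ<j → x∉
      (σ⁺ i j (<-trans (≤-pred r<) i₂<) κ<j (≤-trans u₂ (antitone ν-dec (<⇒≤ (≤-pred r<)))))

    ⇒A : ∀ x → Region R κ′ κ x → InA μ σ x
    ⇒A (r , j) (i , i< , refl , l , u) = boxes⁺ {R} {κ′} {ν′} i< l (≤-trans u (≤-trans (κ≤ν i) (ν≤ν′ i))) , ∉σ (r , j) refl ,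
      let m , i<m , m<n , lm , um = box-below i j (≤-<-trans (β≤κ′ i) l) u in (suc m , j) , σ⁺ m j m<n lm um , refl , s≤s i<m
      where
      ∉σ : ∀ x → x ≡ (suc i , j) → x ∉ σ
      ∉σ x e x∈ with σ⇒ x x∈ | e
      ... | i , _ , refl , l′ , _ | refl = <⇒≱ l′ u

    B⇒ : ∀ x → InB μ σ x → Region R ν ν′ x
    B⇒ (r , j) (m , x∉ , (r₂ , _) , d∈ , refl , r<) with boxes⁻ {R} {κ′} {ν′} (r , j) m | σ⇒ _ d∈
    ... | i , i< , refl , l , u | i₂ , i₂< , refl , l₂ , u₂ = i , i< , refl , ≰⇒> (λ j≤ → x∉ (σ⁺ i j (in-σ i j (κ<j j≤) j≤)
      (κ<j j≤) j≤)) , u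
      where
      κ<j : j ≤ ν i → κ i < j
      κ<j _ = ≤-<-trans (antitone κ-dec (<⇒≤ (≤-pred r<))) l₂

    ⇒B : ∀ x → Region R ν ν′ x → InB μ σ x
    ⇒B (r , j) (i , i< , refl , l , u) = boxes⁺ {R} {κ′} {ν′} i< (≤-<-trans (≤-trans (κ′≤κ i) (κ≤ν i)) l) u , ∉σ (r , j)
      refl ,
      let m , m<i , m<n , lm , um = box-above i j (≤-trans u (ν′≤W i)) l in (suc m , j) , σ⁺ m j m<n lm um , refl , s≤s m<i
      where
      ∉σ : ∀ x → x ≡ (suc i , j) → x ∉ σ
      ∉σ x e x∈ with σ⇒ x x∈ | e
      ... | i , _ , refl , _ , u′ | refl = <⇒≱ l u′

    μ-sorted : SortedB μ
    μ-sorted = sortedB⁺ (boxes-sorted R κ′ ν′)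

    μ-skew : IsSkew μ
    μ-skew = (λ { (r , j) m → let i , _ , e , l , _ = boxes⁻ {R} {κ′} {ν′} (r , j) m in subst (1 ≤_) (sym e) (s≤s z≤n) ,
      ≤-trans (s≤s z≤n) l }) , interv
      where
      interv : ∀ b d x → b ∈ μ → d ∈ μ → b ⪯ x → x ⪯ d → x ∈ μ
      interv (r₁ , j₁) (r₂ , j₂) x m₁ m₂ p q with boxes⁻ {R} {κ′} {ν′} (r₁ , j₁) m₁ | boxes⁻ {R} {κ′} {ν′} (r₂ , j₂) m₂
      interv _ _ (suc r , j) m₁ m₂ (s≤s r≤ , j≤) (s≤s ≤r , ≤j) | i₁ , _ , refl , l , _ | i₂ , i₂< , refl , _ , u =
        boxes⁺ {R} {κ′} {ν′} (≤-<-trans ≤r i₂<) (≤-<-trans (antitone κ′-dec r≤) (<-≤-trans l j≤))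
          (≤-trans ≤j (≤-trans u (antitone ν′-dec ≤r)))

    μ-contains : Contains μ σ
    μ-contains = (λ { (r , j) m → σ⊆ (r , j) (σ⇒ _ m) }) , λ { (r , j) m → column-of (r , j) (boxes⁻ {R} {κ′} {ν′} (r , j)
      m) }
      where
      σ⊆ : ∀ x → Region n κ ν x → x ∈ μ
      σ⊆ (r , j) (i , i< , refl , l , u) = boxes⁺ {R} {κ′} {ν′} (<-≤-trans i< n≤R) (≤-<-trans (κ′≤κ i) l)
        (≤-trans u (ν≤ν′ i))
      column-of : ∀ x → Region R κ′ ν′ x → ∃ λ d → d ∈ σ × col d ≡ col x
      column-of (r , j) (i , i< , refl , l , u) with j ≤? κ i | j ≤? ν i
      ... | yes j≤ | _ = let _ , _ , d , d∈ , e , _ = ⇒A (suc i , j) (i , i< , refl , l , j≤) in d , d∈ , e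
      ... | no ¬j≤ | yes j≤ = (suc i , j) , σ⁺ i j (in-σ i j (≰⇒> ¬j≤) j≤) (≰⇒> ¬j≤) j≤ , refl
      ... | no _ | no ¬j≤ = let _ , _ , d , d∈ , e , _ = ⇒B (suc i , j) (i , i< , refl , ≰⇒> ¬j≤ , u) in d , d∈ , e

  module Recover (μ : List Box) (sorted : SortedB μ) (skew : IsSkew μ) (cont : Contains μ σ)
    (rows≤R : ∀ i j → (suc i , j) ∈ μ → i < R) where

    open DecMembership _≟ᴮ_ using (_∈?_)

    notIn? : ∀ i j → Dec ((suc i , j) ∉ μ)
    notIn? i j with (suc i , j) ∈? μ
    ... | yes m = no (λ ¬m → ¬m m)
    ... | no ¬m = yes ¬m

    -- Only the columns from β + 1 to κ i and from ν i + 1 to W are searched: in between, μ contains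
    -- σ, and other columns do not meet σ.
    κ′ ν′ : ℕ → ℕ
    κ′ i = cut (notIn? i) β (κ i ∸ β)
    ν′ i = cut (λ j → (suc i , j) ∈? μ) (ν i) (W ∸ ν i)

    between : ∀ i₁ j₁ i₂ j₂ i j → (suc i₁ , j₁) ∈ μ → (suc i₂ , j₂) ∈ μ → i₁ ≤ i → i ≤ i₂ → j₁ ≤ j → j ≤ j₂ → (suc i , j) ∈ μ
    between i₁ j₁ i₂ j₂ i j m₁ m₂ a b c d = proj₂ skew _ _ (suc i , j) m₁ m₂ (s≤s a , c) (s≤s b , d)

    σ⊆μ : ∀ i j → i < n → κ i < j → j ≤ ν i → (suc i , j) ∈ μ
    σ⊆μ i j i< l u = proj₁ cont _ (σ⁺ i j i< l u)

    κ-range : ∀ i → β + (κ i ∸ β) ≡ κ i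
    κ-range i = m+[n∸m]≡n (β≤κ i)

    ν-range : ∀ i → ν i + (W ∸ ν i) ≡ W
    ν-range i = m+[n∸m]≡n (ν≤W i)

    κ-nonempty : ∀ i j → β < j → j ≤ κ i → i < n
    κ-nonempty i j l u = ≰⇒> λ n≤ → <⇒≱ l (≤-trans u (≤-reflexive (κ-end i n≤)))

    κ-down : ∀ i j j′ → β < j → j ≤ j′ → j′ ≤ β + (κ i ∸ β) → (suc i , j′) ∉ μ → (suc i , j) ∉ μ
    κ-down i j j′ l j≤j′ u ∉ m = ∉ (between i j i (suc (κ i)) i j′ m (σ⊆μ i (suc (κ i)) i< ≤-refl (κ<ν i i<)) ≤-refl ≤-refl
      j≤j′ (m≤n⇒m≤1+n j′≤κ))
      where
      j′≤κ : j′ ≤ κ i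
      j′≤κ = ≤-trans u (≤-reflexive (κ-range i))
      i< : i < n
      i< = κ-nonempty i j l (≤-trans j≤j′ j′≤κ)

    -- Supplies the upper left corner for the convexity of μ: in a row of σ its own last box, below
    -- σ the first box of the last row, which lies in the leftmost column β + 1.
    left : ∀ i j → ν i < j → ∃ λ i₁ → ∃ λ j₁ → (suc i₁ , j₁) ∈ μ × i₁ ≤ i × j₁ ≤ j
    left i j l with i <? n
    ... | yes i< = i , ν i , σ⊆μ i (ν i) i< (κ<ν i i<) ≤-refl , ≤-refl , <⇒≤ l
    ... | no ¬i< = pred n , suc β , σ⊆μ (pred n) (suc β) p< (≤-reflexive (cong suc (κ-last (pred n) sp)))
      (≤-trans (≤-reflexive (cong suc (sym (κ-last (pred n) sp)))) (κ<ν (pred n) p<)) ,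
                   ≤-trans (<⇒≤ p<) (≮⇒≥ ¬i<) , ≤-trans (s≤s (β≤ν i)) l
      where
      sp : suc (pred n) ≡ n
      sp = suc-pred n {{>-nonZero 0<n}}
      p< : pred n < n
      p< = ≤-reflexive sp

    ν-down : ∀ i j j′ → ν i < j → j ≤ j′ → j′ ≤ ν i + (W ∸ ν i) → (suc i , j′) ∈ μ → (suc i , j) ∈ μ
    ν-down i j j′ l j≤j′ _ m = let i₁ , j₁ , m₁ , a , b = left i j l in between i₁ j₁ i j′ i j m₁ m a ≤-refl b j≤j′

    κ′≤κ : ∀ i → κ′ i ≤ κ i
    κ′≤κ i = ≤-trans (cut-≤ (notIn? i) β (κ i ∸ β)) (≤-reflexive (κ-range i))

    ν≤ν′ : ∀ i → ν i ≤ ν′ i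
    ν≤ν′ i = cut-≥ (λ j → (suc i , j) ∈? μ) (ν i) (W ∸ ν i)

    ν′⁻ : ∀ i j → ν i < j → j ≤ ν′ i → (suc i , j) ∈ μ
    ν′⁻ i = cut⁻ (λ j → (suc i , j) ∈? μ) (ν i) (W ∸ ν i)

    ν′⁺ : ∀ i j → ν i < j → j ≤ W → (suc i , j) ∈ μ → j ≤ ν′ i
    ν′⁺ i j l u = cut⁺ (λ j → (suc i , j) ∈? μ) (ν i) (W ∸ ν i) (ν-down i) j l (≤-trans u (≤-reflexive (sym (ν-range i))))

    κ′⁺ : ∀ i j → κ′ i < j → j ≤ κ i → (suc i , j) ∈ μ
    κ′⁺ i j l u with (suc i , j) ∈? μ
    ... | yes m = m
    ... | no ¬m = contradiction (cut⁺ (notIn? i) β (κ i ∸ β) (κ-down i) j (≤-<-trans (cut-≥ (notIn? i) β (κ i ∸ β)) l)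
      (≤-trans u (≤-reflexive (sym (κ-range i)))) ¬m) (<⇒≱ l)

    κ′⁻ : ∀ i j → β < j → j ≤ κ′ i → (suc i , j) ∉ μ
    κ′⁻ i = cut⁻ (notIn? i) β (κ i ∸ β)

    columns : ∀ r j → (r , j) ∈ μ → β < j × j ≤ W
    columns r j m with proj₂ cont (r , j) m
    ... | (r₂ , _) , d∈ , refl = let i , _ , _ , l , u = σ⇒ _ d∈ in ≤-<-trans (β≤κ i) l , ≤-trans u (ν≤W i)

    μ⇒ : ∀ i j → (suc i , j) ∈ μ → κ′ i < j × j ≤ ν′ i
    μ⇒ i j m = let β<j , j≤W = columns (suc i) j m in
      ≰⇒> (λ j≤ → κ′⁻ i j β<j j≤ m) , [ (λ l → ν′⁺ i j l j≤W m) , (λ u → ≤-trans u (ν≤ν′ i)) ]′ (<-≤-connex (ν i) j)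

    ⇒μ : ∀ i j → κ′ i < j → j ≤ ν′ i → (suc i , j) ∈ μ
    ⇒μ i j l u with j ≤? κ i | j ≤? ν i
    ... | yes j≤ | _      = κ′⁺ i j l j≤
    ... | no ¬j≤ | yes j≤ = σ⊆μ i j (in-σ i j (≰⇒> ¬j≤) j≤) (≰⇒> ¬j≤) j≤
    ... | no _   | no ¬j≤ = ν′⁻ i j (≰⇒> ¬j≤) u

    μ≡boxes : μ ≡ boxes R κ′ ν′
    μ≡boxes = sorted-unique (λ {x} {y} → <ᴮ-asym {x} {y}) (sortedB⁻ sorted) (boxes-sorted R κ′ ν′)
      (λ { (zero , j) m → contradiction (proj₁ (proj₁ skew _ m)) λ () ; (suc i , j) m → let l , u = μ⇒ i j m in boxes⁺ {R}
        {κ′} {ν′} (rows≤R i j m) l u })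
      (λ { (r , j) m → back (r , j) (boxes⁻ {R} {κ′} {ν′} (r , j) m) })
      where
      back : ∀ x → Region R κ′ ν′ x → x ∈ μ
      back (r , j) (i , _ , refl , l , u) = ⇒μ i j l u

    bounds : Bounds κ′ ν′
    bounds = record
      { κ′-dec = λ i → ≮⇒≥ λ l → let j = κ′ (suc i) ; β<j = ≤-<-trans (cut-≥ (notIn? i) β (κ i ∸ β)) l ; si< = κ-nonempty (suc i) j β<j (κ′≤κ (suc i)) in
          κ′⁻ (suc i) j β<j ≤-refl (between i j (suc i) (suc (κ (suc i))) (suc i) j
            (κ′⁺ i j l (≤-trans (κ′≤κ (suc i)) (κ-dec i)))
            (σ⊆μ (suc i) (suc (κ (suc i))) si< ≤-refl (κ<ν (suc i) si<)) (n≤1+n i) ≤-refl ≤-refl (m≤n⇒m≤1+n (κ′≤κ (suc i))))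
      ; ν′-dec = λ i → [ (λ l → let j = ν′ (suc i) ; m = ν′⁻ (suc i) j (≤-<-trans (ν-dec i) l) ≤-refl ; i₁ , j₁ , m₁ , a , b = left i j l in
            ν′⁺ i j l (proj₂ (columns _ _ m)) (between i₁ j₁ (suc i) j i j m₁ m a (n≤1+n i) b ≤-refl)) ,
              (λ u → ≤-trans u (ν≤ν′ i)) ]′ (<-≤-connex (ν i) (ν′ (suc i)))
      ; κ′≤κ = κ′≤κ ; ν≤ν′ = ν≤ν′ ; β≤κ′ = λ i → cut-≥ (notIn? i) β (κ i ∸ β)
      ; ν′-0 = ≤-antisym (≤-trans (cut-≤ (λ j → (1 , j) ∈? μ) (ν 0) (W ∸ ν 0)) (≤-reflexive (ν-range 0))) (ν≤ν′ 0)
      ; ν′-end = λ i R≤ → trans (≤-antisym (≮⇒≥ λ l → <⇒≱ (rows≤R i (ν′ i) (ν′⁻ i (ν′ i) l ≤-refl)) R≤) (ν≤ν′ i))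
        (ν-end i (≤-trans n≤R R≤)) }

  bounds-unique : ∀ {κ₁ ν₁ κ₂ ν₂} → Bounds κ₁ ν₁ → Bounds κ₂ ν₂ → boxes R κ₁ ν₁ ≡ boxes R κ₂ ν₂ → (∀ i → κ₁ i ≡ κ₂ i) ×
    (∀ i → ν₁ i ≡ ν₂ i)
  bounds-unique {κ₁} {ν₁} {κ₂} {ν₂} b₁ b₂ eq =
    (λ i → ≤-antisym (κ-half b₁ b₂ (λ x → subst (x ∈_) (sym eq)) i) (κ-half b₂ b₁ (λ x → subst (x ∈_) eq) i)) ,
    (λ i → ≤-antisym (ν-half b₁ b₂ (λ x → subst (x ∈_) eq) i) (ν-half b₂ b₁ (λ x → subst (x ∈_) (sym eq)) i))
    where
    row-of : ∀ {a b i j} → Region R a b (suc i , j) → a i < j × j ≤ b i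
    row-of (_ , _ , refl , l , u) = l , u
    κ-half : ∀ {κ₁ ν₁ κ₂ ν₂} → Bounds κ₁ ν₁ → Bounds κ₂ ν₂ → (∀ x → x ∈ boxes R κ₂ ν₂ → x ∈ boxes R κ₁ ν₁) → ∀ i → κ₁ i ≤ κ₂
      i
    κ-half {κ₁} {ν₁} {κ₂} {ν₂} b₁ b₂ sub i = ≮⇒≥ λ l → let u = Bounds.κ′≤κ b₁ i in
      <-irrefl refl (proj₁ (row-of (boxes⁻ {R} {κ₁} {ν₁} (suc i , κ₁ i) (sub _ (boxes⁺ {R} {κ₂} {ν₂}
        (≰⇒> λ R≤ → <⇒≱ (≤-<-trans (Bounds.β≤κ′ b₂ i) l) (≤-trans u (≤-reflexive (κ-end i (≤-trans n≤R R≤))))) l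
          (≤-trans u (≤-trans (κ≤ν i) (Bounds.ν≤ν′ b₂ i))))))))
    ν-half : ∀ {κ₁ ν₁ κ₂ ν₂} → Bounds κ₁ ν₁ → Bounds κ₂ ν₂ → (∀ x → x ∈ boxes R κ₁ ν₁ → x ∈ boxes R κ₂ ν₂) → ∀ i → ν₁ i ≤ ν₂
      i
    ν-half {κ₁} {ν₁} {κ₂} {ν₂} b₁ b₂ sub i = ≮⇒≥ λ l → <⇒≱ l
      (proj₂ (row-of (boxes⁻ {R} {κ₂} {ν₂} (suc i , ν₁ i) (sub _ (boxes⁺ {R} {κ₁} {ν₁}
        (≰⇒> λ R≤ → <⇒≱ l (≤-trans (≤-reflexive (Bounds.ν′-end b₁ i R≤)) (≤-trans (β≤ν i) (Bounds.ν≤ν′ b₂ i))))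
        (≤-<-trans (≤-trans (Bounds.κ′≤κ b₁ i) (≤-trans (κ≤ν i) (Bounds.ν≤ν′ b₂ i))) l) ≤-refl)))))

-- T′ and T″ from their level sets

sum<-≤ : ∀ n {P : ℕ → Set} (P? : ∀ t → Dec (P t)) → sum< n (λ t → ind (P? t)) ≤ n
sum<-≤ zero    P? = z≤n
sum<-≤ (suc n) P? = +-mono-≤ (ind≤1 (P? 0)) (sum<-≤ n (P? ∘ suc))

sum<-none : ∀ n {P : ℕ → Set} (P? : ∀ t → Dec (P t)) → (∀ t → t < n → ¬ P t) → sum< n (λ t → ind (P? t)) ≡ 0
sum<-none n P? h = trans (sum<-cong n λ t t< → ind-cong (P? t) ⊥? (h t t<) λ ()) (sum<-0 n)

module _ (n : ℕ) (h : ℕ → ℕ) (j : ℕ) where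

  -- the least level t with j ≤ h t, for h increasing
  rank : ℕ
  rank = sum< n (λ t → ind (h t <? j))

  -- the number of levels t with j ≤ h t
  depth : ℕ
  depth = sum< n (λ t → ind (j ≤? h t))

-- Together with `rank⁻` an adjunction: rank ≤ t exactly when j ≤ h t. For decreasing h, `depth⁺`
-- and `depth⁻` say likewise that t < depth exactly when j ≤ h t.
rank⁺ : ∀ n h j → (∀ t → t < n → h t ≤ h (suc t)) → ∀ t → t ≤ n → j ≤ h t → rank n h j ≤ t
rank⁺ n h j mono zero _ j≤ = ≤-reflexive (sum<-none n (λ t → h t <? j)
  (λ t t< l → <⇒≱ l (≤-trans j≤ (stepwise-mono h mono z≤n (<⇒≤ t<)))))
rank⁺ (suc n) h j mono (suc t) (s≤s t≤) j≤ = +-mono-≤ (ind≤1 (h 0 <? j)) (rank⁺ n (h ∘ suc) j (λ t t< → mono (suc t)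
  (s≤s t<)) t t≤ j≤)

rank⁻ : ∀ n h j → j ≤ h n → (∀ t → t < n → h t ≤ h (suc t)) → ∀ t → t ≤ n → rank n h j ≤ t → j ≤ h t
rank⁻ zero    h j j≤ mono zero _ _ = j≤
rank⁻ (suc n) h j j≤ mono t t≤ r with h 0 <? j
... | no ¬l = ≤-trans (≮⇒≥ ¬l) (stepwise-mono h mono z≤n t≤)
rank⁻ (suc n) h j j≤ mono (suc t) (s≤s t≤) (s≤s r) | yes _ = rank⁻ n (h ∘ suc) j j≤ (λ t t< → mono (suc t) (s≤s t<)) t t≤ r

depth⁺ : ∀ n h j → (∀ t → t < n → h (suc t) ≤ h t) → ∀ t → t < n → j ≤ h t → t < depth n h j
depth⁺ (suc n) h j anti t t< j≤ with j ≤? h 0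
... | no ¬j≤ = contradiction (≤-trans j≤ (stepwise-anti h anti z≤n (<⇒≤ t<))) ¬j≤
depth⁺ (suc n) h j anti zero    t<       j≤ | yes _ = s≤s z≤n
depth⁺ (suc n) h j anti (suc t) (s≤s t<) j≤ | yes _ = s≤s (depth⁺ n (h ∘ suc) j (λ t t< → anti (suc t) (s≤s t<)) t t< j≤)

depth⁻ : ∀ n h j → (∀ t → t < n → h (suc t) ≤ h t) → ∀ t → t < n → t < depth n h j → j ≤ h t
depth⁻ (suc n) h j anti t t< d with j ≤? h 0
depth⁻ (suc n) h j anti zero    _        _       | yes j≤ = j≤
depth⁻ (suc n) h j anti (suc t) (s≤s t<) (s≤s d) | yes _  = depth⁻ n (h ∘ suc) j (λ t t< → anti (suc t) (s≤s t<)) t t< d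
... | no ¬j≤ = contradiction (subst (t <_) (sum<-none n (λ t → j ≤? h (suc t))
  (λ t t< j≤ → ¬j≤ (≤-trans j≤ (stepwise-anti h anti z≤n (m≤n⇒m≤1+n t<))))) d) λ ()

contentT-fill : ∀ R a b val k → contentT k (fill R a b val) ≡ sum< R (λ i → sumI (a i) (b i) (λ j → ind (val i j ≟ k)))
contentT-fill R a b val k = trans (length-filter (_≟ k) (map proj₂ (fill R a b val)))
  (trans (sumL-map proj₂ (fill R a b val) _) (sum-fill R a b val (λ p → ind (proj₂ p ≟ k))))

fill-cong₂ : ∀ {V : Set} R {a b a′ b′} {val val′ : ℕ → ℕ → V} → (∀ i → a i ≡ a′ i) → (∀ i → b i ≡ b′ i) →
  (∀ i j → i < R → a i < j → j ≤ b i → val i j ≡ val′ i j) → fill R a b val ≡ fill R a′ b′ val′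
fill-cong₂ R {a} {b} {a′} {b′} {val} {val′} ea eb ev = fill-canonical R a′ b′ val′ {D = Region R a b} (fill-domain R a b val
  (λ _ x → x) (λ _ x → x))
  (λ { _ (i , i< , e , l , u) → i , i< , e , subst (_< _) (ea i) l , subst (_ ≤_) (eb i) u })
  λ i j i< l u → let l′ = subst (_< j) (sym (ea i)) l ; u′ = subst (j ≤_) (sym (eb i)) u in
    subst (λ v → ((suc i , j) , v) ∈ fill R a b val) (ev i j i< l′ u′) (fill⁺ {R = R} {a} {b} val i< l′ u′)

module StripFillings {σ n β κ ν} (sk : SkewRows σ n β κ ν) (L : ℕ) (e₀ : ℕ → ℕ) (e-zero : ∀ k → n < k → e₀ k ≡ 0) where
  open SkewRows sk
  open StripSemantics β W β≤W

  R : ℕ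
  R = n + L

  n≤R : n ≤ R
  n≤R = m≤m+n n L

  open Between sk R n≤R

  Facts : (K O : ℕ → ℕ → ℕ) → Set
  Facts = StripFacts n L κ ν (e₀ ∘ suc)

  -- T′ and T″ are recovered from their level sets: T′ ≤ t is the region j ≤ K t i, and T″ > t is the region j ≤ O t i.
  innerFill outerFill : (ℕ → ℕ → ℕ) → Filling ℕ
  innerFill K = fill R (K 0) κ (λ i j → rank n (λ t → K t i) j)
  outerFill O = fill R ν (O 0) (λ i j → depth n (λ t → O t i) j)

  module _ (K : ℕ → ℕ → ℕ) (K-mono : ∀ t i → t < n → K t i ≤ K (suc t) i) (K-top : ∀ i → K n i ≡ κ i) where

    K-mono* : ∀ {t t′} i → t ≤ t′ → t′ ≤ n → K t i ≤ K t′ i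
    K-mono* i = stepwise-mono (λ t → K t i) (λ t → K-mono t i)

    rankK⁺ : ∀ i j t → t ≤ n → j ≤ K t i → rank n (λ t → K t i) j ≤ t
    rankK⁺ i j = rank⁺ n (λ t → K t i) j (λ t → K-mono t i)

    rankK⁻ : ∀ i j t → j ≤ κ i → t ≤ n → rank n (λ t → K t i) j ≤ t → j ≤ K t i
    rankK⁻ i j t u = rank⁻ n (λ t → K t i) j (≤-trans u (≤-reflexive (sym (K-top i)))) (λ t → K-mono t i) t

    content-inner : ∀ t → t < n → contentT (suc t) (innerFill K) ≡ sum< R (λ i → K (suc t) i ∸ K t i)
    content-inner t t< = trans (contentT-fill R (K 0) κ _ (suc t)) (sum<-cong R λ i _ → sumI-count
      (λ j → rank n (λ t → K t i) j ≟ suc t)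
      (K-mono* i z≤n (<⇒≤ t<)) (≤-trans (K-mono* i t< ≤-refl) (≤-reflexive (K-top i))) (K-mono t i t<)
      (λ j _ u e → ≰⇒> (λ j≤ → <⇒≱ (≤-reflexive (sym e)) (rankK⁺ i j t (<⇒≤ t<) j≤)) , rankK⁻ i j (suc t) u t<
        (≤-reflexive e))
      (λ j _ u l r → ≤-antisym (rankK⁺ i j (suc t) t< r) (≰⇒> λ e → <⇒≱ l (rankK⁻ i j t u (<⇒≤ t<) e))))

    content-inner-0 : ∀ k → n < k → contentT k (innerFill K) ≡ 0
    content-inner-0 k n<k = trans (contentT-fill R (K 0) κ _ k) (trans (sum<-cong R λ i _ → trans (sumI-cong (K 0 i) (κ i) λ
      j _ _ →
      ind-cong (rank n (λ t → K t i) j ≟ k) ⊥? (λ e → <⇒≱ n<k (≤-trans (≤-reflexive (sym e)) (sum<-≤ n (λ t → K t i <? j))))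
        λ ()) (sum<-0 (κ i ∸ K 0 i))) (sum<-0 R))

  module _ (O : ℕ → ℕ → ℕ) (O-mono : ∀ t i → t < n → O (suc t) i ≤ O t i) (O-bot : ∀ i → O n i ≡ ν i) where

    O-mono* : ∀ {t t′} i → t ≤ t′ → t′ ≤ n → O t′ i ≤ O t i
    O-mono* i = stepwise-anti (λ t → O t i) (λ t → O-mono t i)

    depthO⁺ : ∀ i j t → t < n → j ≤ O t i → t < depth n (λ t → O t i) j
    depthO⁺ i j = depth⁺ n (λ t → O t i) j (λ t → O-mono t i)

    depthO⁻ : ∀ i j t → t < n → t < depth n (λ t → O t i) j → j ≤ O t i
    depthO⁻ i j = depth⁻ n (λ t → O t i) j (λ t → O-mono t i)

    depth≤n : ∀ i j → depth n (λ t → O t i) j ≤ n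
    depth≤n i j = sum<-≤ n (λ t → j ≤? O t i)

    content-outer : ∀ t → t < n → contentT (suc t) (outerFill O) ≡ sum< R (λ i → O t i ∸ O (suc t) i)
    content-outer t t< = trans (contentT-fill R ν (O 0) _ (suc t)) (sum<-cong R λ i _ → sumI-count
      (λ j → depth n (λ t → O t i) j ≟ suc t)
      (≤-trans (≤-reflexive (sym (O-bot i))) (O-mono* i t< ≤-refl)) (O-mono* i z≤n (<⇒≤ t<)) (O-mono t i t<)
      (λ j l _ e → ≰⇒> (λ j≤ → beyond i j l j≤ (≤-reflexive e)) , depthO⁻ i j t t< (≤-reflexive (sym e)))
      (λ j l _ g h → ≤-antisym (≮⇒≥ λ d → <⇒≱ g (depthO⁻ i j (suc t) (<-≤-trans d (depth≤n i j)) d)) (depthO⁺ i j t t< h)))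
      where
      beyond : ∀ i j → ν i < j → j ≤ O (suc t) i → depth n (λ t → O t i) j ≤ suc t → ⊥
      beyond i j l j≤ d with m≤n⇒m<n∨m≡n t<
      ... | inj₁ st< = <⇒≱ (depthO⁺ i j (suc t) st< j≤) d
      ... | inj₂ refl = <⇒≱ l (≤-trans j≤ (≤-reflexive (O-bot i)))

    content-outer-0 : ∀ k → n < k → contentT k (outerFill O) ≡ 0
    content-outer-0 k n<k = trans (contentT-fill R ν (O 0) _ k) (trans (sum<-cong R λ i _ → trans (sumI-cong (ν i) (O 0 i) λ
      j _ _ →
      ind-cong (depth n (λ t → O t i) j ≟ k) ⊥? (λ e → <⇒≱ n<k (≤-trans (≤-reflexive (sym e)) (depth≤n i j))) λ ())
        (sum<-0 (O 0 i ∸ ν i))) (sum<-0 R))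

  facts-top : ∀ {K O} → Facts K O → ∀ i → K n i ≡ κ i
  facts-top Fs i with i <? n
  ... | yes i< = StripFacts.K-fix Fs n i i< i< ≤-refl
  ... | no ¬i< = trans (StripFacts.K-end Fs i (≮⇒≥ ¬i<)) (sym (κ-end i (≮⇒≥ ¬i<)))

  facts-bot : ∀ {K O} → Facts K O → ∀ i → O n i ≡ ν i
  facts-bot Fs i with i <? n
  ... | yes i< = StripFacts.O-fix Fs n i i< (<⇒≤ i<) ≤-refl
  ... | no ¬i< = trans (StripFacts.O-end Fs i (≮⇒≥ ¬i<)) (sym (ν-end i (≮⇒≥ ¬i<)))

  facts-bounds : ∀ {K O} → Facts K O → Bounds (K 0) (O 0)
  facts-bounds {K} {O} Fs = record
    { κ′-dec = λ i → ≤-trans (K-mono 0 (suc i) 0<n) (K-strip 0 i 0<n) ; ν′-dec = λ i → O-dec 0 i 0<n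
    ; κ′≤κ = λ i → ≤-trans (K-mono* K K-mono (facts-top Fs) i z≤n ≤-refl) (≤-reflexive (facts-top Fs i))
    ; ν≤ν′ = λ i → ≤-trans (≤-reflexive (sym (facts-bot Fs i))) (O-mono* O O-mono (facts-bot Fs) i z≤n ≤-refl)
    ; β≤κ′ = λ i → K-≥β 0 i z≤n ; ν′-0 = O-fix 0 0 0<n z≤n z≤n ; ν′-end = λ i R≤ → O-past 0 i R≤ }
    where open StripFacts Fs

  Shape : (ℕ → ℕ → ℕ) → (ℕ → ℕ → ℕ) → List Box
  Shape K O = boxes R (K 0) (O 0)

  InnerOK OuterOK : List Box → Filling ℕ → Set
  InnerOK μ T = OnDomain T (InA μ σ) × PositiveT T × SemistandardT T × RowWeaklyBoundedT T
  OuterOK μ T = OnDomain T (InB μ σ) × PositiveT T × ReverseRowStrictT T × RowBoundedT T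

  module Sound {K O} (Fs : Facts K O) where
    open StripFacts Fs
    open Outside (facts-bounds Fs)

    private
      f′ f″ : ℕ → ℕ → ℕ
      f′ i j = rank n (λ t → K t i) j
      f″ i j = depth n (λ t → O t i) j
      r⁺ : ∀ i j t → t ≤ n → j ≤ K t i → f′ i j ≤ t
      r⁺ = rankK⁺ K K-mono (facts-top Fs)
      r⁻ : ∀ i j t → j ≤ κ i → t ≤ n → f′ i j ≤ t → j ≤ K t i
      r⁻ = rankK⁻ K K-mono (facts-top Fs)
      d⁺ : ∀ i j t → t < n → j ≤ O t i → t < f″ i j
      d⁺ = depthO⁺ O O-mono (facts-bot Fs)
      d⁻ : ∀ i j t → t < n → t < f″ i j → j ≤ O t i
      d⁻ = depthO⁻ O O-mono (facts-bot Fs)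
      f′≤n : ∀ i j → f′ i j ≤ n
      f′≤n i j = sum<-≤ n (λ t → K t i <? j)
      f″≤n : ∀ i j → f″ i j ≤ n
      f″≤n = depth≤n O O-mono (facts-bot Fs)

    f′-pos : ∀ i j → K 0 i < j → j ≤ κ i → 1 ≤ f′ i j
    f′-pos i j l u = ≰⇒> λ e → <⇒≱ l (r⁻ i j 0 u z≤n e)

    f″-pos : ∀ i j → j ≤ O 0 i → 1 ≤ f″ i j
    f″-pos i j u = d⁺ i j 0 0<n u

    K-dec : ∀ t i → t ≤ n → K t (suc i) ≤ K t i
    K-dec t i t≤ = [ (λ l → ≤-trans (K-mono t (suc i) l) (K-strip t i l)) ,
      (λ { refl → ≤-trans (≤-reflexive (facts-top Fs (suc i))) (≤-trans (κ-dec i) (≤-reflexive (sym (facts-top Fs i)))) })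
        ]′ (m≤n⇒m<n∨m≡n t≤)

    -- A label w + 1 puts its column into level w + 1 of its row, and `K-strip` puts the box above
    -- into level w, so columns increase strictly. The row bound is `K-fix` at t = i + 1, where row
    -- i is complete.
    innerOK : InnerOK μ (innerFill K)
    innerOK = fill-domain R (K 0) κ f′ A⇒ ⇒A , pos , semi , bounded
      where
      pos : PositiveT (innerFill K)
      pos (r , j) v m with fill⁻ {R = R} {K 0} {κ} f′ m
      ... | i , _ , refl , l , u , refl = f′-pos i j l u
      bounded : RowWeaklyBoundedT (innerFill K)
      bounded (r , j) v m with fill⁻ {R = R} {K 0} {κ} f′ m
      ... | i , _ , refl , l , u , refl = let i< = in-σ′ i j (≤-<-trans (K-≥β 0 i z≤n) l) u in
        r⁺ i j (suc i) i< (≤-trans u (≤-reflexive (sym (K-fix (suc i) i i< ≤-refl i<))))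
        where
        in-σ′ : ∀ i j → β < j → j ≤ κ i → i < n
        in-σ′ i j l u = ≰⇒> λ n≤ → <⇒≱ l (≤-trans u (≤-reflexive (κ-end i n≤)))
      semi : SemistandardT (innerFill K)
      semi (r , j) v (r₂ , j₂) w m m₂ with fill⁻ {R = R} {K 0} {κ} f′ m | fill⁻ {R = R} {K 0} {κ} f′ m₂
      ... | i , _ , refl , l , u , refl | i₂ , _ , refl , l₂ , u₂ , refl =
        (λ { refl j<j₂ → r⁺ i j (f′ i j₂) (f′≤n i j₂) (≤-trans (<⇒≤ j<j₂) (r⁻ i j₂ (f′ i j₂) u₂ (f′≤n i j₂) ≤-refl)) }) ,
        (λ { refl (s≤s i<i₂) → cols i<i₂ (f′ i₂ j) refl (f′-pos i₂ j l₂ u₂) })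
        where
        cols : i < i₂ → ∀ w → f′ i₂ j₂ ≡ w → 1 ≤ w → f′ i j₂ < w
        cols i<i₂ (suc w) e _ = s≤s (r⁺ i j₂ w (<⇒≤ w<n) (≤-trans (r⁻ i₂ j₂ (suc w) u₂ w<n (≤-reflexive e))
          (≤-trans (antitone′ (suc w) w<n i<i₂) (K-strip w i w<n))))
          where
          w<n : w < n
          w<n = ≤-trans (≤-reflexive (sym e)) (f′≤n i₂ j₂)
          antitone′ : ∀ t → t ≤ n → ∀ {i i′} → i ≤ i′ → K t i′ ≤ K t i
          antitone′ t t≤ = antitone (λ i → K-dec t i t≤)

    -- `O-strip` lets a row lose at most one column from one level to the next. A box left of one
    -- with label w + 1 is thus still in level w + 1 and has a larger label. The row bound is
    -- `O-fix` at t = i for the rows of σ, and the bound n on all labels further down.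
    outerOK : OuterOK μ (outerFill O)
    outerOK = fill-domain R ν (O 0) f″ B⇒ ⇒B , pos , rev , bounded
      where
      pos : PositiveT (outerFill O)
      pos (r , j) v m with fill⁻ {R = R} {ν} {O 0} f″ m
      ... | i , _ , refl , l , u , refl = f″-pos i j u
      bounded : RowBoundedT (outerFill O)
      bounded (r , j) v m with fill⁻ {R = R} {ν} {O 0} f″ m
      ... | i , _ , refl , l , u , refl with i <? n
      ... | no ¬i< = s≤s (≤-trans (f″≤n i j) (≮⇒≥ ¬i<))
      ... | yes i< = s≤s (≮⇒≥ λ i<f → <⇒≱ l (≤-trans (d⁻ i j i i< i<f) (≤-reflexive (O-fix i i i< ≤-refl (<⇒≤ i<)))))
      rev : ReverseRowStrictT (outerFill O)
      rev (r , j) v (r₂ , j₂) w m m₂ with fill⁻ {R = R} {ν} {O 0} f″ m | fill⁻ {R = R} {ν} {O 0} f″ m₂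
      ... | i , _ , refl , l , u , refl | i₂ , _ , refl , l₂ , u₂ , refl =
        (λ { refl j<j₂ → rows j<j₂ (f″ i j₂) refl (f″-pos i j₂ u₂) }) ,
        (λ { refl (s≤s i<i₂) → cols i<i₂ (f″ i₂ j) refl (f″-pos i₂ j u₂) })
        where
        rows : j < j₂ → ∀ w → f″ i j₂ ≡ w → 1 ≤ w → w < f″ i j
        rows j<j₂ (suc w) e _ with suc w <? n
        ... | yes sw< = d⁺ i j (suc w) sw< (≤-pred (≤-trans j<j₂ (≤-trans (d⁻ i j₂ w (<⇒≤ sw<) (≤-reflexive (sym e)))
          (O-strip w i (<⇒≤ sw<)))))
        -- When w + 1 = n the next level is ν itself, so only the first column after ν i can carry
        -- the label n.
        ... | no ¬sw< = contradiction (≤-pred (≤-trans j<j₂ (≤-trans (d⁻ i j₂ w w<n (≤-reflexive (sym e)))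
          (≤-trans (O-strip w i w<n) (s≤s (≤-reflexive (trans (cong (λ z → O z i) (≤-antisym w<n (≮⇒≥ ¬sw<)))
            (facts-bot Fs i)))))))) (<⇒≱ l)
          where
          w<n : w < n
          w<n = ≤-trans (≤-reflexive (sym e)) (f″≤n i j₂)
        cols : i < i₂ → ∀ w → f″ i₂ j₂ ≡ w → 1 ≤ w → w ≤ f″ i j₂
        cols i<i₂ (suc w) e _ = d⁺ i j₂ w w<n (≤-trans (d⁻ i₂ j₂ w w<n (≤-reflexive (sym e)))
          (antitone (λ i → O-dec w i w<n) (<⇒≤ i<i₂)))
          where
          w<n : w < n
          w<n = ≤-trans (≤-reflexive (sym e)) (f″≤n i₂ j₂)

    contents : ∀ k → 1 ≤ k → contentT k (innerFill K) + contentT k (outerFill O) ≡ e₀ k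
    contents (suc t) _ with t <? n
    ... | yes t< = trans (cong₂ _+_ (content-inner K K-mono (facts-top Fs) t t<) (content-outer O O-mono (facts-bot Fs) t
      t<)) (size t t<)
    ... | no ¬t< = trans (cong₂ _+_ (content-inner-0 K K-mono (facts-top Fs) (suc t) (s≤s (≮⇒≥ ¬t<))) (content-outer-0 O
      O-mono (facts-bot Fs) (suc t) (s≤s (≮⇒≥ ¬t<)))) (sym (e-zero (suc t) (s≤s (≮⇒≥ ¬t<))))

    length-inner : length (innerFill K) ≡ sum< R (λ i → K n i ∸ K 0 i)
    length-inner = trans (length-sumL (innerFill K)) (trans (sum-fill R (K 0) κ f′ _) (sum<-cong R λ i _ → trans
      (sum<-1 (κ i ∸ K 0 i)) (cong (_∸ K 0 i) (sym (facts-top Fs i)))))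

  module _ {K O K₂ O₂} (F₁ : Facts K O) (F₂ : Facts K₂ O₂) (eqμ : Shape K O ≡ Shape K₂ O₂) where

    private
      K0≡ : ∀ i → K 0 i ≡ K₂ 0 i
      K0≡ = proj₁ (bounds-unique (facts-bounds F₁) (facts-bounds F₂) eqμ)
      O0≡ : ∀ i → O 0 i ≡ O₂ 0 i
      O0≡ = proj₂ (bounds-unique (facts-bounds F₁) (facts-bounds F₂) eqμ)

    private
      fillₖ : (ℕ → ℕ → ℕ) → ℕ → ℕ → ℕ
      fillₖ K i j = rank n (λ t → K t i) j
      fillₒ : (ℕ → ℕ → ℕ) → ℕ → ℕ → ℕ
      fillₒ O i j = depth n (λ t → O t i) j

    inner-same : innerFill K ≡ innerFill K₂ → ∀ i j → i < R → K 0 i < j → j ≤ κ i → fillₖ K i j ≡ fillₖ K₂ i j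
    inner-same eq = fill-injective R (K 0) κ (fillₖ K) (fillₖ K₂) (trans eq (fill-cong₂ R (sym ∘ K0≡) (λ _ → refl)
      (λ _ _ _ _ _ → refl)))

    outer-same : outerFill O ≡ outerFill O₂ → ∀ i j → i < R → ν i < j → j ≤ O 0 i → fillₒ O i j ≡ fillₒ O₂ i j
    outer-same eq = fill-injective R ν (O 0) (fillₒ O) (fillₒ O₂) (trans eq (fill-cong₂ R (λ _ → refl) (sym ∘ O0≡)
      (λ _ _ _ _ _ → refl)))

    inner-≤ : innerFill K ≡ innerFill K₂ → ∀ t i → t ≤ n → K t i ≤ K₂ t i
    inner-≤ eq t i t≤ with K 0 i <? K t i
    ... | no ¬l = ≤-trans (≮⇒≥ ¬l) (≤-trans (≤-reflexive (K0≡ i)) (K-mono* K₂ (StripFacts.K-mono F₂) (facts-top F₂) i z≤n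
      t≤))
    ... | yes l = rankK⁻ K₂ (StripFacts.K-mono F₂) (facts-top F₂) i (K t i) t Kt≤κ t≤
                    (≤-trans (≤-reflexive (sym (inner-same eq i (K t i) i<R l Kt≤κ))) (rankK⁺ K (StripFacts.K-mono F₁)
                      (facts-top F₁) i (K t i) t t≤ ≤-refl))
      where
      Kt≤κ : K t i ≤ κ i
      Kt≤κ = ≤-trans (K-mono* K (StripFacts.K-mono F₁) (facts-top F₁) i t≤ ≤-refl) (≤-reflexive (facts-top F₁ i))
      i<R : i < R
      i<R = ≰⇒> λ R≤ → <⇒≱ (≤-<-trans (StripFacts.K-≥β F₁ 0 i z≤n) l) (≤-trans Kt≤κ (≤-reflexive (κ-end i (≤-trans n≤R R≤))))

    outer-≤ : outerFill O ≡ outerFill O₂ → ∀ t i → t ≤ n → O t i ≤ O₂ t i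
    outer-≤ eq t i t≤ with ν i <? O t i
    ... | no ¬l = ≤-trans (≮⇒≥ ¬l) (≤-trans (≤-reflexive (sym (facts-bot F₂ i))) (O-mono* O₂ (StripFacts.O-mono F₂)
      (facts-bot F₂) i t≤ ≤-refl))
    ... | yes l = depthO⁻ O₂ (StripFacts.O-mono F₂) (facts-bot F₂) i (O t i) t t<n
                    (≤-trans (depthO⁺ O (StripFacts.O-mono F₁) (facts-bot F₁) i (O t i) t t<n ≤-refl)
                      (≤-reflexive (outer-same eq i (O t i) i<R l Ot≤)))
      where
      Ot≤ : O t i ≤ O 0 i
      Ot≤ = O-mono* O (StripFacts.O-mono F₁) (facts-bot F₁) i z≤n t≤
      t<n : t < n
      t<n = ≤∧≢⇒< t≤ λ { refl → <⇒≱ l (≤-reflexive (facts-bot F₁ i)) }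
      i<R : i < R
      i<R = ≰⇒> λ R≤ → <⇒≱ l (≤-trans Ot≤ (≤-trans (≤-reflexive (StripFacts.O-past F₁ 0 i R≤)) (β≤ν i)))

  -- The fillings determine their level sets: K t i is the last column with label at most t, and O t
  -- i the last one with label above t.
  strips-injective : ∀ {K O K₂ O₂} → Facts K O → Facts K₂ O₂ → Shape K O ≡ Shape K₂ O₂ → innerFill K ≡ innerFill K₂ →
    outerFill O ≡ outerFill O₂ →
    (∀ t i → t ≤ n → K t i ≡ K₂ t i) × (∀ t i → t ≤ n → O t i ≡ O₂ t i)
  strips-injective F₁ F₂ eqμ eq′ eq″ =
    (λ t i t≤ → ≤-antisym (inner-≤ F₁ F₂ eqμ eq′ t i t≤) (inner-≤ F₂ F₁ (sym eqμ) (sym eq′) t i t≤)) ,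
    (λ t i t≤ → ≤-antisym (outer-≤ F₁ F₂ eqμ eq″ t i t≤) (outer-≤ F₂ F₁ (sym eqμ) (sym eq″) t i t≤))

module StripRecover {σ n β κ ν} (sk : SkewRows σ n β κ ν) (L : ℕ) (e₀ : ℕ → ℕ) (e-zero : ∀ k → n < k → e₀ k ≡ 0) where
  open SkewRows sk
  open StripFillings sk L e₀ e-zero
  open StripSemantics β W β≤W using (StripFacts)
  open Between sk R n≤R

  module Recovered {κ′ ν′} (bd : Bounds κ′ ν′) (T′ T″ : Filling ℕ)
    (in-ok : InnerOK (boxes R κ′ ν′) T′) (out-ok : OuterOK (boxes R κ′ ν′) T″)
    (contents : ∀ k → 1 ≤ k → contentT k T′ + contentT k T″ ≡ e₀ k) where
    open Bounds bd
    open Outside bd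

    v′ v″ : ℕ → ℕ → ℕ
    v′ i j = lookupF 0 T′ (suc i , j)
    v″ i j = lookupF 0 T″ (suc i , j)

    -- Level sets of the given fillings. `cut` finds their ends because T′ weakly increases and T″
    -- decreases along rows.
    K O : ℕ → ℕ → ℕ
    K t i = cut (λ j → v′ i j ≤? t) (κ′ i) (κ i ∸ κ′ i)
    O t i = cut (λ j → t <? v″ i j) (ν i) (ν′ i ∸ ν i)

    κ-range : ∀ i → κ′ i + (κ i ∸ κ′ i) ≡ κ i
    κ-range i = m+[n∸m]≡n (κ′≤κ i)

    ν-range : ∀ i → ν i + (ν′ i ∸ ν i) ≡ ν′ i
    ν-range i = m+[n∸m]≡n (ν≤ν′ i)

    inner-row : ∀ i j → κ′ i < j → j ≤ κ i → i < n
    inner-row i j l u = ≰⇒> λ n≤ → <⇒≱ (≤-<-trans (β≤κ′ i) l) (≤-trans u (≤-reflexive (κ-end i n≤)))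

    outer-row : ∀ i j → ν i < j → j ≤ ν′ i → i < R
    outer-row i j l u = ≰⇒> λ R≤ → <⇒≱ (≤-<-trans (β≤ν i) l) (≤-trans u (≤-reflexive (ν′-end i R≤)))

    v′∈ : ∀ i j → κ′ i < j → j ≤ κ i → ((suc i , j) , v′ i j) ∈ T′
    v′∈ i j l u = lookupF-∈ 0 T′ (suc i , j) (proj₂ (proj₂ (proj₁ in-ok)) _ (⇒A _ (i , <-≤-trans (inner-row i j l u) n≤R ,
      refl , l , u)))

    v″∈ : ∀ i j → ν i < j → j ≤ ν′ i → ((suc i , j) , v″ i j) ∈ T″
    v″∈ i j l u = lookupF-∈ 0 T″ (suc i , j) (proj₂ (proj₂ (proj₁ out-ok)) _ (⇒B _ (i , outer-row i j l u , refl , l , u)))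

    v′-pos : ∀ i j → κ′ i < j → j ≤ κ i → 1 ≤ v′ i j
    v′-pos i j l u = proj₁ (proj₂ in-ok) _ _ (v′∈ i j l u)

    v″-pos : ∀ i j → ν i < j → j ≤ ν′ i → 1 ≤ v″ i j
    v″-pos i j l u = proj₁ (proj₂ out-ok) _ _ (v″∈ i j l u)

    v′-bound : ∀ i j → κ′ i < j → j ≤ κ i → v′ i j ≤ suc i
    v′-bound i j l u = proj₂ (proj₂ (proj₂ in-ok)) _ _ (v′∈ i j l u)

    v″-bound : ∀ i j → ν i < j → j ≤ ν′ i → v″ i j ≤ i
    v″-bound i j l u = ≤-pred (proj₂ (proj₂ (proj₂ out-ok)) _ _ (v″∈ i j l u))

    v′≤n : ∀ i j → κ′ i < j → j ≤ κ i → v′ i j ≤ n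
    v′≤n i j l u = ≤-trans (v′-bound i j l u) (inner-row i j l u)

    -- In a row below σ the row bound admits labels beyond n; they are excluded by the content,
    -- since e vanishes there.
    v″≤n : ∀ i j → ν i < j → j ≤ ν′ i → v″ i j ≤ n
    v″≤n i j l u = ≮⇒≥ λ n< → length≡0 (m+n≡0⇒n≡0 (contentT (v″ i j) T′) (trans (contents (v″ i j) (v″-pos i j l u))
      (e-zero (v″ i j) n<)))
        (∈-filter⁺ (_≟ v″ i j) {xs = map proj₂ T″} (∈-map⁺ proj₂ (v″∈ i j l u)) refl)

    v′-row : ∀ i j j′ → κ′ i < j → j ≤ j′ → j′ ≤ κ i → v′ i j ≤ v′ i j′
    v′-row i j j′ l j≤ u = [ (λ j< → proj₁ (proj₁ (proj₂ (proj₂ in-ok)) _ _ _ _ (v′∈ i j l (≤-trans j≤ u))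
      (v′∈ i j′ (<-≤-trans l j≤) u)) refl j<) , (λ { refl → ≤-refl }) ]′ (m≤n⇒m<n∨m≡n j≤)

    v″-row : ∀ i j j′ → ν i < j → j < j′ → j′ ≤ ν′ i → v″ i j′ < v″ i j
    v″-row i j j′ l j< u = proj₁ (proj₁ (proj₂ (proj₂ out-ok)) _ _ _ _ (v″∈ i j l (≤-trans (<⇒≤ j<) u))
      (v″∈ i j′ (<-trans l j<) u)) refl j<

    K⁻ : ∀ t i j → κ′ i < j → j ≤ K t i → v′ i j ≤ t
    K⁻ t i = cut⁻ (λ j → v′ i j ≤? t) (κ′ i) (κ i ∸ κ′ i)

    K⁺ : ∀ t i j → κ′ i < j → j ≤ κ i → v′ i j ≤ t → j ≤ K t i
    K⁺ t i j l u = cut⁺ (λ j → v′ i j ≤? t) (κ′ i) (κ i ∸ κ′ i) (λ j j′ l j≤ u p → ≤-trans (v′-row i j j′ l j≤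
      (≤-trans u (≤-reflexive (κ-range i)))) p) j l (≤-trans u (≤-reflexive (sym (κ-range i))))

    O⁻ : ∀ t i j → ν i < j → j ≤ O t i → t < v″ i j
    O⁻ t i = cut⁻ (λ j → t <? v″ i j) (ν i) (ν′ i ∸ ν i)

    O⁺ : ∀ t i j → ν i < j → j ≤ ν′ i → t < v″ i j → j ≤ O t i
    O⁺ t i j l u = cut⁺ (λ j → t <? v″ i j) (ν i) (ν′ i ∸ ν i)
      (λ j j′ l j≤ u p → [ (λ j< → <-trans p (v″-row i j j′ l j< (≤-trans u (≤-reflexive (ν-range i))))) , (λ { refl → p })
        ]′ (m≤n⇒m<n∨m≡n j≤)) j l (≤-trans u (≤-reflexive (sym (ν-range i))))

    κ′≤K : ∀ t i → κ′ i ≤ K t i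
    κ′≤K t i = cut-≥ (λ j → v′ i j ≤? t) (κ′ i) (κ i ∸ κ′ i)

    K≤κ : ∀ t i → K t i ≤ κ i
    K≤κ t i = ≤-trans (cut-≤ (λ j → v′ i j ≤? t) (κ′ i) (κ i ∸ κ′ i)) (≤-reflexive (κ-range i))

    ν≤O : ∀ t i → ν i ≤ O t i
    ν≤O t i = cut-≥ (λ j → t <? v″ i j) (ν i) (ν′ i ∸ ν i)

    O≤ν′ : ∀ t i → O t i ≤ ν′ i
    O≤ν′ t i = ≤-trans (cut-≤ (λ j → t <? v″ i j) (ν i) (ν′ i ∸ ν i)) (≤-reflexive (ν-range i))

    K-full : ∀ t i → (∀ j → κ′ i < j → j ≤ κ i → v′ i j ≤ t) → K t i ≡ κ i
    K-full t i h = ≤-antisym (K≤κ t i) ([ (λ l → K⁺ t i (κ i) l ≤-refl (h (κ i) l ≤-refl)) ,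
      (λ e → ≤-trans (≤-reflexive (sym e)) (κ′≤K t i)) ]′ (m≤n⇒m<n∨m≡n (κ′≤κ i)))

    O-empty : ∀ t i → (∀ j → ν i < j → j ≤ ν′ i → v″ i j ≤ t) → O t i ≡ ν i
    O-empty t i h = ≤-antisym (≮⇒≥ λ l → <⇒≱ (O⁻ t i (O t i) l ≤-refl) (h (O t i) l (O≤ν′ t i))) (ν≤O t i)

    K0≡ : ∀ i → K 0 i ≡ κ′ i
    K0≡ i = ≤-antisym (≮⇒≥ λ l → <⇒≱ (v′-pos i (K 0 i) l (K≤κ 0 i)) (K⁻ 0 i (K 0 i) l ≤-refl)) (κ′≤K 0 i)

    O0≡ : ∀ i → O 0 i ≡ ν′ i
    O0≡ i = ≤-antisym (O≤ν′ 0 i) ([ (λ l → O⁺ 0 i (ν′ i) l ≤-refl (v″-pos i (ν′ i) l ≤-refl)) ,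
      (λ e → ≤-trans (≤-reflexive (sym e)) (ν≤O 0 i)) ]′ (m≤n⇒m<n∨m≡n (ν≤ν′ i)))

    K-top : ∀ i → K n i ≡ κ i
    K-top i = K-full n i (v′≤n i)

    O-bot : ∀ i → O n i ≡ ν i
    O-bot i = O-empty n i (v″≤n i)

    K-mono : ∀ t i → K t i ≤ K (suc t) i
    K-mono t i = [ (λ l → K⁺ (suc t) i (K t i) l (K≤κ t i) (m≤n⇒m≤1+n (K⁻ t i (K t i) l ≤-refl))) ,
      (λ e → ≤-trans (≤-reflexive (sym e)) (κ′≤K (suc t) i)) ]′ (m≤n⇒m<n∨m≡n (κ′≤K t i))

    O-mono : ∀ t i → O (suc t) i ≤ O t i
    O-mono t i = [ (λ l → O⁺ t i (O (suc t) i) l (O≤ν′ (suc t) i) (<⇒≤ (O⁻ (suc t) i (O (suc t) i) l ≤-refl))) ,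
      (λ e → ≤-trans (≤-reflexive (sym e)) (ν≤O t i)) ]′ (m≤n⇒m<n∨m≡n (ν≤O (suc t) i))

    K-strip : ∀ t i → K (suc t) (suc i) ≤ K t i
    K-strip t i with κ′ i <? K (suc t) (suc i)
    ... | no ¬l = ≤-trans (≮⇒≥ ¬l) (κ′≤K t i)
    ... | yes l = K⁺ t i j l j≤κ (≤-pred (≤-trans (proj₂ (proj₁ (proj₂ (proj₂ in-ok)) _ _ _ _ (v′∈ i j l j≤κ)
      (v′∈ (suc i) j l′ (K≤κ (suc t) (suc i)))) refl ≤-refl) (K⁻ (suc t) (suc i) j l′ ≤-refl)))
      where
      j : ℕ
      j = K (suc t) (suc i)
      j≤κ : j ≤ κ i
      j≤κ = ≤-trans (K≤κ (suc t) (suc i)) (κ-dec i)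
      l′ : κ′ (suc i) < j
      l′ = ≤-<-trans (κ′-dec i) l

    O-strip : ∀ t i → O t i ≤ suc (O (suc t) i)
    O-strip t i with suc (ν i) <? O t i
    ... | no ¬l = ≤-trans (≮⇒≥ ¬l) (s≤s (ν≤O (suc t) i))
    -- The column before the last one of level t has a strictly larger label, hence belongs to level
    -- t + 1.
    ... | yes l = ≤-trans (≤-reflexive (sym sj))
      (s≤s (O⁺ (suc t) i j ν<j (≤-trans (n≤1+n j) (≤-trans (≤-reflexive sj) (O≤ν′ t i)))
          (≤-<-trans (O⁻ t i (O t i) (<⇒≤ l) ≤-refl) (v″-row i j (O t i) ν<j (≤-reflexive sj) (O≤ν′ t i)))))
      where
      j : ℕ
      j = pred (O t i)
      sj : suc j ≡ O t i
      sj = suc-pred (O t i) {{>-nonZero (≤-<-trans z≤n l)}}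
      ν<j : ν i < j
      ν<j = ≤-pred (≤-trans l (≤-reflexive (sym sj)))

    O-dec : ∀ t i → O t (suc i) ≤ O t i
    O-dec t i with ν i <? O t (suc i)
    ... | no ¬l = ≤-trans (≮⇒≥ ¬l) (ν≤O t i)
    ... | yes l = O⁺ t i j l j≤ (<-≤-trans (O⁻ t (suc i) j l′ ≤-refl) (proj₂ (proj₁ (proj₂ (proj₂ out-ok)) _ _ _ _
      (v″∈ i j l j≤) (v″∈ (suc i) j l′ (O≤ν′ t (suc i)))) refl ≤-refl))
      where
      j : ℕ
      j = O t (suc i)
      j≤ : j ≤ ν′ i
      j≤ = ≤-trans (O≤ν′ t (suc i)) (ν′-dec i)
      l′ : ν (suc i) < j
      l′ = ≤-<-trans (ν-dec i) l

    T′≡ : T′ ≡ innerFill K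
    T′≡ = fill-canonical R (K 0) κ _ (proj₁ in-ok) (λ x a → reg x (A⇒ x a)) λ i j _ l u → let l′ = subst (_< j) (K0≡ i) l in
        subst (λ v → ((suc i , j) , v) ∈ T′) (≤-antisym
          (K⁻ _ i j l′ (rankK⁻ K (λ t i _ → K-mono t i) K-top i j _ u (sum<-≤ n (λ t → K t i <? j)) ≤-refl))
          (rankK⁺ K (λ t i _ → K-mono t i) K-top i j _ (v′≤n i j l′ u) (K⁺ _ i j l′ u ≤-refl)))
          (v′∈ i j l′ u)
      where
      reg : ∀ x → Region R κ′ κ x → Region R (K 0) κ x
      reg x (i , i< , e , l , u) = i , i< , e , subst (_< _) (sym (K0≡ i)) l , u

    T″≡ : T″ ≡ outerFill O
    T″≡ = fill-canonical R ν (O 0) _ (proj₁ out-ok) (λ x b → reg x (B⇒ x b)) λ i j _ l u → let u′ = subst (j ≤_) (O0≡ i) u in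
        subst (λ v → ((suc i , j) , v) ∈ T″) (≤-antisym
          (≮⇒≥ λ d → <-irrefl refl (depthO⁺ O (λ t i _ → O-mono t i) O-bot i j _ (<-≤-trans d (v″≤n i j l u′))
            (O⁺ _ i j l u′ d)))
          (≮⇒≥ λ d → <-irrefl refl (O⁻ _ i j l (depthO⁻ O (λ t i _ → O-mono t i) O-bot i j _
            (<-≤-trans d (depth≤n O (λ t i _ → O-mono t i) O-bot i j)) d))))
          (v″∈ i j l u′)
      where
      reg : ∀ x → Region R ν ν′ x → Region R ν (O 0) x
      reg x (i , i< , e , l , u) = i , i< , e , l , subst (_ ≤_) (sym (O0≡ i)) u

    facts : Facts K O
    facts = record
      { K-fix = λ t i i< i<t t≤ → K-full t i λ j l u → ≤-trans (v′-bound i j l u) i<t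
      ; K-end = λ i n≤ → trans (K-top i) (κ-end i n≤)
      ; K-mono = λ t i _ → K-mono t i ; K-strip = λ t i _ → K-strip t i ; K-≥β = λ t i _ → ≤-trans (β≤κ′ i) (κ′≤K t i)
      ; O-fix = λ t i i< i≤t t≤ → O-empty t i λ j l u → ≤-trans (v″-bound i j l u) i≤t
      ; O-end = λ i n≤ → trans (O-bot i) (ν-end i n≤)
      ; O-past = λ t i R≤ → ≤-antisym (≤-trans (O≤ν′ t i) (≤-reflexive (ν′-end i R≤))) (≤-trans (β≤ν i) (ν≤O t i))
      ; O-mono = λ t i _ → O-mono t i ; O-strip = λ t i _ → O-strip t i ; O-dec = λ t i _ → O-dec t i
      ; K-≤W = λ t i _ → ≤-trans (K≤κ t i) (κ≤W i) ; O-≤W = λ t i _ → ≤-trans (O≤ν′ t i) (ν′≤W i)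
      ; size = λ t t< → trans (sym (cong₂ _+_ (trans (cong (contentT (suc t)) T′≡) (content-inner K (λ t i _ → K-mono t i)
        K-top t t<))
                                             (trans (cong (contentT (suc t)) T″≡) (content-outer O (λ t i _ → O-mono t i)
                                               O-bot t t<)))) (contents (suc t) (s≤s z≤n)) }

-- Row ends of a connected skew shape

choose-yes : ∀ {P : Set} (d : Dec P) {x y} → P → choose d x y ≡ x
choose-yes (yes _) p = refl
choose-yes (no ¬p) p = contradiction p ¬p

choose-no : ∀ {P : Set} (d : Dec P) {x y} → ¬ P → choose d x y ≡ y
choose-no (yes p) ¬p = contradiction p ¬p
choose-no (no _)  ¬p = refl

maximum : List ℕ → ℕ
maximum []       = 0
maximum (x ∷ xs) = x ⊔ maximum xs

minimum : ℕ → List ℕ → ℕ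
minimum b []       = b
minimum b (x ∷ xs) = x ⊓ minimum b xs

maximum-≥ : ∀ {x} xs → x ∈ xs → x ≤ maximum xs
maximum-≥ (x ∷ xs) (here refl) = m≤m⊔n x (maximum xs)
maximum-≥ (y ∷ xs) (there x∈)  = ≤-trans (maximum-≥ xs x∈) (m≤n⊔m y (maximum xs))

maximum-∈ : ∀ {x} xs → x ∈ xs → maximum xs ∈ xs
maximum-∈ (x ∷ xs) _ = go x xs
  where
  go : ∀ x xs → maximum (x ∷ xs) ∈ x ∷ xs
  go x []       = here (⊔-identityʳ x)
  go x (y ∷ xs) = [ (λ x≤ → there (subst (_∈ y ∷ xs) (sym (m≤n⇒m⊔n≡n x≤)) (go y xs))) , (λ ≤x → here (m≥n⇒m⊔n≡m ≤x)) ]′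
    (≤-total x (maximum (y ∷ xs)))

minimum-≤ : ∀ {x} b xs → x ∈ xs → minimum b xs ≤ x
minimum-≤ b (x ∷ xs) (here refl) = m⊓n≤m x (minimum b xs)
minimum-≤ b (y ∷ xs) (there x∈)  = ≤-trans (m⊓n≤n y (minimum b xs)) (minimum-≤ b xs x∈)

minimum-∈ : ∀ {x} b xs → x ∈ xs → x ≤ b → minimum b xs ∈ xs
minimum-∈ {x} b xs x∈ x≤b = [ id , (λ e → subst (_∈ xs) (≤-antisym (≤-trans x≤b (≤-reflexive (sym e))) (minimum-≤ b xs x∈))
  x∈) ]′ (go xs)
  where
  go : ∀ xs → minimum b xs ∈ xs ⊎ minimum b xs ≡ b
  go []       = inj₂ refl
  go (y ∷ xs) with ≤-total y (minimum b xs)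
  ... | inj₁ y≤ = inj₁ (here (m≤n⇒m⊓n≡m y≤))
  ... | inj₂ ≤y = [ (λ m → inj₁ (there (subst (_∈ xs) (sym (m≥n⇒m⊓n≡n ≤y)) m))) , (λ e → inj₂ (trans (m≥n⇒m⊓n≡n ≤y) e)) ]′
    (go xs)

module FromConnected (σ : List Box) (skew : IsSkew σ) (conn : Connected σ) (top : TopRow1 σ) where

  open DecMembership _≟ᴮ_ using (_∈?_)

  n : ℕ
  n = maximum (map row σ)

  bottom : ∃ λ j → (n , j) ∈ σ
  bottom with ∈-map⁻ row (maximum-∈ (map row σ) (∈-map⁺ row (proj₂ top)))
  ... | (_ , j) , m , refl = j , m

  0<n : 0 < n
  0<n = maximum-≥ (map row σ) (∈-map⁺ row (proj₂ top))

  -- Some cover on a path from row 1 to row n leads from a row ≤ i to a row > i. The corner of a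
  -- cover, in its upper row and right column, lies in σ by convexity, so it is one of the two ends
  -- and the cover is horizontal or vertical. A crossing cover is vertical, and by convexity its
  -- column has boxes in rows i and i + 1.
  shared-column : ∀ i → 1 ≤ i → i < n → ∃ λ j → (i , j) ∈ σ × (suc i , j) ∈ σ
  shared-column i 1≤i i<n with Any.any? (λ b → row b ≟ i ×-dec (suc i , col b) ∈? σ) σ
  ... | yes found with find found
  ...   | (_ , j) , m , refl , m′ = j , m , m′
  shared-column i 1≤i i<n | no none = contradiction (stay (conn (1 , proj₁ top) (n , proj₁ bottom) (proj₂ top)
    (proj₂ bottom)) 1≤i) (<⇒≱ i<n)
    where
    step : ∀ b d → Cover σ b d → row b ≤ i → row d ≤ i
    step (r , j) (r′ , j′) (b∈ , d∈ , (r≤ , j≤) , b≢d , cov) r≤i = ≮⇒≥ λ i<r′ → [ same-column i<r′ ,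
      (λ e → <⇒≱ i<r′ (≤-trans (≤-reflexive (sym (cong row e))) r≤i)) ]′
        (cov (r , j′) (proj₂ skew _ _ (r , j′) b∈ d∈ (≤-refl , j≤) (r≤ , ≤-refl)) (≤-refl , j≤) (r≤ , ≤-refl))
      where
      same-column : i < r′ → (r , j′) ≡ (r , j) → ⊥
      same-column i<r′ refl = none (lose (proj₂ skew _ _ (i , j) b∈ d∈ (r≤i , ≤-refl) (<⇒≤ i<r′ , ≤-refl)) (refl ,
        proj₂ skew _ _ (suc i , j) b∈ d∈ (m≤n⇒m≤1+n r≤i , ≤-refl) (i<r′ , ≤-refl)))
    stay : ∀ {b d} → EqClosure (Cover σ) b d → row b ≤ i → row d ≤ i
    stay refl⋆            h = h
    stay (fwd c ◅ s)      h = stay s (step _ _ c h)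
    stay (bwd c@(_ , _ , (r≤ , _) , _) ◅ s) h = stay s (≤-trans r≤ h)

  cols : ℕ → List ℕ
  cols i = map col (filter (λ b → row b ≟ suc i) σ)

  cols⁺ : ∀ {i j} → (suc i , j) ∈ σ → j ∈ cols i
  cols⁺ m = ∈-map⁺ col (∈-filter⁺ (λ b → row b ≟ _) m refl)

  cols⁻ : ∀ {i j} → j ∈ cols i → (suc i , j) ∈ σ
  cols⁻ {i} m with ∈-map⁻ col m
  ... | b , b∈ , refl with ∈-filter⁻ (λ b → row b ≟ suc i) {xs = σ} b∈
  ... | b∈σ , refl = b∈σ

  last first : ℕ → ℕ
  last i  = maximum (cols i)
  first i = minimum (last i) (cols i)

  nonempty : ∀ i → i < n → ∃ λ j → (suc i , j) ∈ σ
  nonempty i i<n with m≤n⇒m<n∨m≡n i<n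
  ... | inj₁ l = let j , m , _ = shared-column (suc i) (s≤s z≤n) l in j , m
  ... | inj₂ e = proj₁ bottom , subst (λ r → (r , proj₁ bottom) ∈ σ) (sym e) (proj₂ bottom)

  last∈ : ∀ i → i < n → (suc i , last i) ∈ σ
  last∈ i i< = cols⁻ (maximum-∈ (cols i) (cols⁺ (proj₂ (nonempty i i<))))

  first∈ : ∀ i → i < n → (suc i , first i) ∈ σ
  first∈ i i< = let m = cols⁺ (proj₂ (nonempty i i<)) in cols⁻ (minimum-∈ (last i) (cols i) m (maximum-≥ (cols i) m))

  ≤last : ∀ i j → (suc i , j) ∈ σ → j ≤ last i
  ≤last i j m = maximum-≥ (cols i) (cols⁺ m)

  first≤ : ∀ i j → (suc i , j) ∈ σ → first i ≤ j
  first≤ i j m = minimum-≤ (last i) (cols i) (cols⁺ m)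

  suc-first : ∀ i → i < n → suc (pred (first i)) ≡ first i
  suc-first i i< = suc-pred (first i) {{>-nonZero (proj₂ (proj₁ skew _ (first∈ i i<)))}}

  -- The left end of the last row. Since κ decreases, every column of σ lies to the right of it.
  β : ℕ
  β = pred (first (pred n))

  κ ν : ℕ → ℕ
  κ i = choose (i <? n) (pred (first i)) β
  ν i = choose (i <? n) (last i) β

  κ≡ : ∀ i → i < n → κ i ≡ pred (first i)
  κ≡ i i< = choose-yes (i <? n) i<

  ν≡ : ∀ i → i < n → ν i ≡ last i
  ν≡ i i< = choose-yes (i <? n) i<

  κ-out : ∀ i → n ≤ i → κ i ≡ β
  κ-out i n≤ = choose-no (i <? n) (≤⇒≯ n≤)

  ν-out : ∀ i → n ≤ i → ν i ≡ β
  ν-out i n≤ = choose-no (i <? n) (≤⇒≯ n≤)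

  κ-bottom : ∀ i → suc i ≡ n → κ i ≡ β
  κ-bottom i e = trans (κ≡ i (≤-reflexive e)) (cong (λ m → pred (first (pred m))) e)

  κ<j : ∀ i j → i < n → (suc i , j) ∈ σ → κ i < j
  κ<j i j i< m = ≤-trans (≤-reflexive (trans (cong suc (κ≡ i i<)) (suc-first i i<))) (first≤ i j m)

  j≤ν : ∀ i j → i < n → (suc i , j) ∈ σ → j ≤ ν i
  j≤ν i j i< m = ≤-trans (≤last i j m) (≤-reflexive (sym (ν≡ i i<)))

  inside : ∀ i j → i < n → κ i < j → j ≤ ν i → (suc i , j) ∈ σ
  inside i j i< l u = proj₂ skew _ _ (suc i , j) (first∈ i i<) (last∈ i i<)
    (≤-refl , ≤-trans (≤-reflexive (sym (trans (cong suc (κ≡ i i<)) (suc-first i i<)))) l) (≤-refl , ≤-trans u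
      (≤-reflexive (ν≡ i i<)))

  skewRows : SkewRows σ n β κ ν
  skewRows = record
    { 0<n = 0<n ; κ-dec = κ-dec ; ν-dec = ν-dec
    ; κ<ν = λ i i< → let j , m = nonempty i i< in <-≤-trans (κ<j i j i< m) (j≤ν i j i< m)
    ; κ-end = κ-out ; ν-end = ν-out ; κ-last = κ-bottom
    ; meets = λ i si< → let j , m , m′ = shared-column (suc i) (s≤s z≤n) si< in <-≤-trans (κ<j i j (<⇒≤ si<) m)
      (j≤ν (suc i) j si< m′)
    ; σ⇒ = λ { (zero , j) m → contradiction (proj₁ (proj₁ skew _ m)) λ () ; (suc i , j) m →
      let i< = maximum-≥ (map row σ) (∈-map⁺ row m) in i , i< , refl , κ<j i j i< m , j≤ν i j i< m }
    ; ⇒σ = λ { (r , j) (i , i< , refl , l , u) → inside i j i< l u } }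
    where
    κ-dec : ∀ i → κ (suc i) ≤ κ i
    κ-dec i with <-cmp (suc i) n
    ... | tri≈ _ e _ = ≤-reflexive (trans (κ-out (suc i) (≤-reflexive (sym e))) (sym (κ-bottom i e)))
    ... | tri> _ _ g = ≤-reflexive (trans (κ-out (suc i) (<⇒≤ g)) (sym (κ-out i (≤-pred g))))
    ... | tri< l _ _ = ≤-trans (≤-reflexive (κ≡ (suc i) l))
      (≤-trans (pred-mono-≤ (first≤ (suc i) (first i) (proj₂ skew _ _ (suc (suc i) , first i) (first∈ i (<⇒≤ l))
        (proj₂ (proj₂ (shared-column (suc i) (s≤s z≤n) l)))
            (n≤1+n _ , ≤-refl) (≤-refl , first≤ i _ (proj₁ (proj₂ (shared-column (suc i) (s≤s z≤n) l)))))))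
              (≤-reflexive (sym (κ≡ i (<⇒≤ l)))))
    ν-dec : ∀ i → ν (suc i) ≤ ν i
    ν-dec i with <-cmp (suc i) n
    ... | tri≈ _ e _ = let j , m = nonempty i (≤-reflexive e) in ≤-trans
      (≤-reflexive (trans (ν-out (suc i) (≤-reflexive (sym e))) (sym (κ-bottom i e))))
        (≤-trans (<⇒≤ (κ<j i j (≤-reflexive e) m)) (j≤ν i j (≤-reflexive e) m))
    ... | tri> _ _ g = ≤-reflexive (trans (ν-out (suc i) (<⇒≤ g)) (sym (ν-out i (≤-pred g))))
    ... | tri< l _ _ = ≤-trans (≤-reflexive (ν≡ (suc i) l))
      (≤-trans (≤last i (last (suc i)) (proj₂ skew _ _ (suc i , last (suc i))
        (proj₁ (proj₂ (shared-column (suc i) (s≤s z≤n) l))) (last∈ (suc i) l)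
            (≤-refl , ≤last (suc i) _ (proj₂ (proj₂ (shared-column (suc i) (s≤s z≤n) l)))) (n≤1+n _ , ≤-refl)))
              (≤-reflexive (sym (ν≡ i (<⇒≤ l)))))

-- Counting

-- Distinct strips are known to give distinct terms only if they satisfy `StripsOK`, so the pairwise
-- relation has to remember that its members come from the list.
withMembership : ∀ {A : Set} {_~_ : A → A → Set} {xs} → AllPairs _~_ xs → AllPairs (λ x y → x ∈ xs × y ∈ xs × x ~ y) xs
withMembership []       = []
withMembership (r ∷ rs) = ListAll.tabulate (λ y∈ → here refl , there y∈ , ListAll.lookup r y∈) ∷
  AllPairs.map (λ (x∈ , y∈ , s) → there x∈ , there y∈ , s) (withMembership rs)

_≟ᶠ_ : DecidableEquality (Filling ℕ)
_≟ᶠ_ = Listₚ.≡-dec (Data.Product.Properties.≡-dec _≟ᴮ_ _≟_)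

_≟ˢ_ : DecidableEquality (Filling (List ℕ))
_≟ˢ_ = Listₚ.≡-dec (Data.Product.Properties.≡-dec _≟ᴮ_ (Listₚ.≡-dec _≟_))

Term : Set
Term = List Box × Filling ℕ × Filling ℕ × Filling (List ℕ)

_≟ᵀ_ : DecidableEquality Term
_≟ᵀ_ = Data.Product.Properties.≡-dec (Listₚ.≡-dec _≟ᴮ_) (Data.Product.Properties.≡-dec _≟ᶠ_ (Data.Product.Properties.≡-dec
  _≟ᶠ_ _≟ˢ_))

_≟ᴾ_ : DecidableEquality Parity
even ≟ᴾ even = yes refl
even ≟ᴾ odd  = no λ ()
odd  ≟ᴾ even = no λ ()
odd  ≟ᴾ odd  = yes refl

sg-parity : ∀ k → (parity k ≡ even × sg k 1ℤ ≡ 1ℤ) ⊎ (parity k ≡ odd × sg k 1ℤ ≡ -ᶻ 1ℤ)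
sg-parity zero          = inj₁ (refl , refl)
sg-parity (suc zero)    = inj₂ (refl , refl)
sg-parity (suc (suc k)) with sg-parity k
... | inj₁ (p , e) = inj₁ (p , trans (ℤₚ.neg-involutive _) e)
... | inj₂ (p , e) = inj₂ (p , trans (ℤₚ.neg-involutive _) e)

∑-parity : ∀ {A : Set} (f : A → ℕ) xs → ∑ xs (λ x → sg (f x) 1ℤ) ≡
  ℤ.pos (length (filter (λ x → parity (f x) ≟ᴾ even) xs)) +ᶻ (-ᶻ ℤ.pos (length (filter (λ x → parity (f x) ≟ᴾ odd) xs)))
∑-parity f [] = ∑-[] _
∑-parity {A} f (x ∷ xs) = trans (∑-∷ x xs _) (trans (cong (sg (f x) 1ℤ +ᶻ_) (∑-parity f xs)) ([ even-step , odd-step ]′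
  (sg-parity (f x))))
  where
  open ≡-Reasoning
  E? : ∀ (y : A) → Dec (parity (f y) ≡ even)
  E? y = parity (f y) ≟ᴾ even
  O? : ∀ (y : A) → Dec (parity (f y) ≡ odd)
  O? y = parity (f y) ≟ᴾ odd
  p q : ℤ
  p = ℤ.pos (length (filter E? xs))
  q = -ᶻ ℤ.pos (length (filter O? xs))
  Goal : Set
  Goal = sg (f x) 1ℤ +ᶻ (p +ᶻ q) ≡ ℤ.pos (length (filter E? (x ∷ xs))) +ᶻ (-ᶻ ℤ.pos (length (filter O? (x ∷ xs))))
  even-step : parity (f x) ≡ even × sg (f x) 1ℤ ≡ 1ℤ → Goal
  even-step (e , s) = begin
    sg (f x) 1ℤ +ᶻ (p +ᶻ q) ≡⟨ cong (_+ᶻ (p +ᶻ q)) s ⟩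
    1ℤ +ᶻ (p +ᶻ q)          ≡⟨ sym (ℤₚ.+-assoc 1ℤ p q) ⟩
    (1ℤ +ᶻ p) +ᶻ q          ≡⟨ cong₂ (λ u v → ℤ.pos (length u) +ᶻ (-ᶻ ℤ.pos (length v))) (sym (Listₚ.filter-accept E? e))
      (sym (Listₚ.filter-reject O? {x} {xs} (λ o → contradiction (trans (sym e) o) λ ()))) ⟩
    ℤ.pos (length (filter E? (x ∷ xs))) +ᶻ (-ᶻ ℤ.pos (length (filter O? (x ∷ xs)))) ∎
  odd-step : parity (f x) ≡ odd × sg (f x) 1ℤ ≡ -ᶻ 1ℤ → Goal
  odd-step (o , s) = begin
    sg (f x) 1ℤ +ᶻ (p +ᶻ q) ≡⟨ cong (_+ᶻ (p +ᶻ q)) s ⟩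
    (-ᶻ 1ℤ) +ᶻ (p +ᶻ q)     ≡⟨ ℤₚ.+-comm (-ᶻ 1ℤ) (p +ᶻ q) ⟩
    (p +ᶻ q) +ᶻ (-ᶻ 1ℤ)     ≡⟨ ℤₚ.+-assoc p q (-ᶻ 1ℤ) ⟩
    p +ᶻ (q +ᶻ (-ᶻ 1ℤ))     ≡⟨ cong (p +ᶻ_) (trans (ℤₚ.+-comm q (-ᶻ 1ℤ))
      (sym (ℤₚ.neg-distrib-+ 1ℤ (ℤ.pos (length (filter O? xs)))))) ⟩
    p +ᶻ (-ᶻ (1ℤ +ᶻ ℤ.pos (length (filter O? xs))))
      ≡⟨ cong₂ (λ u v → ℤ.pos (length u) +ᶻ (-ᶻ ℤ.pos (length v))) (sym (Listₚ.filter-reject E? {x} {xs}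
        (λ e → contradiction (trans (sym o) e) λ ()))) (sym (Listₚ.filter-accept O? o)) ⟩
    ℤ.pos (length (filter E? (x ∷ xs))) +ᶻ (-ᶻ ℤ.pos (length (filter O? (x ∷ xs)))) ∎

rowsOf-cong : ∀ n {a a′ b b′} k → (∀ i → a i ≡ a′ i) → (∀ i → b i ≡ b′ i) → rowsOf n a b k ≡ rowsOf n a′ b′ k
rowsOf-cong zero    k ea eb = refl
rowsOf-cong (suc n) k ea eb = cong₂ _∷_ (cong₂ _,_ (ea 0) (cong (_, k 0) (eb 0))) (rowsOf-cong n (k ∘ suc) (ea ∘ suc)
  (eb ∘ suc))

allLevels : ∀ L u w c α → (∀ t → α ≤ u t) → All (λ l → α ≤ proj₁ l) (levels L u w c)
allLevels zero    u w c α h = []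
allLevels (suc L) u w c α h = h 0 ∷ allLevels L (u ∘ suc) (w ∘ suc) (c ∘ suc) α (h ∘ suc)

module Assembly {σ n β κ ν} (sk : SkewRows σ n β κ ν) (L : ℕ) (c e₀ : ℕ → ℕ)
  (c-zero : ∀ k → L < k → c k ≡ 0) (e-zero : ∀ k → n < k → e₀ k ≡ 0) where
  open SkewRows sk
  open StripFillings sk L e₀ e-zero
  open StripSemantics β W β≤W
  open Rows β W β≤W
  open Codes β W β≤W
  open Between sk R n≤R

  σ⇒′ : ∀ x → x ∈ σ → Region R κ ν x
  σ⇒′ x x∈ = let i , i< , rest = σ⇒ x x∈ in i , <-≤-trans i< n≤R , rest

  ⇒σ′ : ∀ x → Region R κ ν x → x ∈ σ
  ⇒σ′ (r , j) (i , _ , e , l , u) = ⇒σ _ (i , in-σ i j l u , e , l , u)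

  module LHS = TableauCount β W β≤W R L κ ν σ c e₀ σ⇒′ ⇒σ′ c-zero (λ k R<k → e-zero k (≤-<-trans n≤R R<k))
    (λ i _ → κ-dec i) (λ i _ → ν-dec i) (λ i _ → κ≤ν i) (λ i _ → ν≤W i) (λ i _ → β≤κ i)

  rows : Vec Row n
  rows = rowsOf n κ ν (e₀ ∘ suc)

  ls : Vec Level L
  ls = levels L (λ _ → W) (λ _ → 0) (c ∘ suc)

  rows-padded : ∀ n a b k M → (∀ i → n ≤ i → a i ≡ β) → (∀ i → n ≤ i → b i ≡ β) → (∀ i → n ≤ i → k i ≡ 0) →
    rowsOf (n + M) a b k ≡ padded M (rowsOf n a b k)
  rows-padded zero a b k zero ha hb hk = refl
  rows-padded zero a b k (suc M) ha hb hk = cong₂ _∷_ (cong₂ _,_ (ha 0 z≤n) (cong₂ _,_ (hb 0 z≤n) (hk 0 z≤n)))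
    (rows-padded zero (a ∘ suc) (b ∘ suc) (k ∘ suc) M (λ i _ → ha (suc i) z≤n) (λ i _ → hb (suc i) z≤n) (λ i _ → hk (suc i)
      z≤n))
  rows-padded (suc n) a b k M ha hb hk = cong (_ ∷_) (rows-padded n (a ∘ suc) (b ∘ suc) (k ∘ suc) M
    (λ i n≤ → ha (suc i) (s≤s n≤)) (λ i n≤ → hb (suc i) (s≤s n≤)) (λ i n≤ → hk (suc i) (s≤s n≤)))

  plain≡rowsOf : ∀ {m} (a b : Vec ℕ m) → plain a b ≡ rowsOf m (at a) (at b) (λ _ → 0)
  plain≡rowsOf []      []      = refl
  plain≡rowsOf (x ∷ a) (y ∷ b) = cong ((x , y , 0) ∷_) (plain≡rowsOf a b)

  goodRows : ∀ m a b k → (∀ i → a (suc i) ≤ a i) → (∀ i → b (suc i) ≤ b i) → (∀ i → β ≤ a i) → (∀ i → β ≤ b i) →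
    (∀ i → i < m → a i < b i) → (∀ i → b i ≤ W) → GoodRows (rowsOf m a b k)
  goodRows zero    a b k _ _ _ _ _ _ = tt
  goodRows (suc m) a b k da db βa βb ab bW = (hdα≤ m , hdν≤ m , ab 0 (s≤s z≤n) , bW 0) ,
    goodRows m (a ∘ suc) (b ∘ suc) (k ∘ suc) (da ∘ suc) (db ∘ suc) (βa ∘ suc) (βb ∘ suc) (λ i i< → ab (suc i) (s≤s i<))
      (bW ∘ suc)
    where
    hdα≤ : ∀ m → hdα (rowsOf m (a ∘ suc) (b ∘ suc) (k ∘ suc)) ≤ a 0
    hdα≤ zero    = βa 0
    hdα≤ (suc m) = da 0
    hdν≤ : ∀ m → hdν (rowsOf m (a ∘ suc) (b ∘ suc) (k ∘ suc)) ≤ b 0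
    hdν≤ zero    = βb 0
    hdν≤ (suc m) = db 0

  ssList : List (Filling (List ℕ))
  ssList = map LHS.tableau (codeList LHS.rowsᵀ LHS.levelsᵀ)

  ssCard : HasCard (SS σ c e₀) (length ssList)
  ssCard = hasCard _≟ˢ_ ssList (unique-map LHS.tableau (codeList-unique LHS.rowsᵀ LHS.levelsᵀ)
    (λ ρs σs m m′ → LHS.tableau-injective ρs σs (codeList⁻ LHS.rowsᵀ LHS.levelsᵀ ρs m) (codeList⁻ LHS.rowsᵀ LHS.levelsᵀ σs
      m′)))
    (λ T T∈ → let ρs , m , e = ∈-map⁻ LHS.tableau T∈ in subst (IsSS σ c e₀) (sym e) (LHS.tableau-sound ρs
      (codeList⁻ LHS.rowsᵀ LHS.levelsᵀ ρs m)))
    (λ T ss → let ρs , ok , e = LHS.tableau-complete T ss in subst (_∈ ssList) (sym e) (∈-map⁺ LHS.tableau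
      (codeList⁺ LHS.rowsᵀ LHS.levelsᵀ ρs ok)))

  ssCount : ℤ.pos (length ssList) ≡ cnt 0 (padded L rows) ls
  ssCount = trans (sym (∑-length ssList)) (trans (∑-map LHS.tableau (codeList LHS.rowsᵀ LHS.levelsᵀ) _)
    (trans (codeList-count LHS.rowsᵀ LHS.levelsᵀ)
    (cong (λ r → cnt 0 r ls) (rows-padded n κ ν (e₀ ∘ suc) L κ-end ν-end (λ i n≤ → e-zero (suc i) (s≤s n≤))))))

  K O : Strips n L → ℕ → ℕ → ℕ
  K = innerAt n L κ
  O = outerAt n L ν

  facts : ∀ s → StripsOK L rows s → Facts (K s) (O s)
  facts s ok = stripFacts n L κ ν (e₀ ∘ suc) s (λ i _ → κ-dec i) (λ i _ → ν-dec i) (λ i _ → β≤κ i) (λ i _ → β≤ν i)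
    (λ i _ → κ≤W i) (λ i _ → ν≤W i) ok

  termRows : Strips n L → Vec Row R
  termRows s = rowsOf R (K s 0) (O s 0) (λ _ → 0)

  term : Strips n L → Vec (RowCode L) R → Term
  term s ρs = Shape (K s) (O s) , innerFill (K s) , outerFill (O s) , SetValued.decode β W β≤W R L (K s 0) (O s 0)
    (Semantics.rowEnds β W β≤W (K s 0) ρs) (Semantics.extras β W β≤W ρs)

  module RHS (s : Strips n L) (ok : StripsOK L rows s) where
    open Sound (facts s ok) public
    open Outside (facts-bounds (facts s ok)) public
    open Bounds (facts-bounds (facts s ok)) public
    open TableauCount β W β≤W R L (K s 0) (O s 0) μ c zeroSeq boxes⁻ boxes⁺′ c-zero (λ _ _ → refl)
      (λ i _ → κ′-dec i) (λ i _ → ν′-dec i) (λ i _ → ≤-trans (κ′≤κ i) (≤-trans (κ≤ν i) (ν≤ν′ i))) (λ i _ → ν′≤W i)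
        (λ i _ → β≤κ′ i) public

  terms : Strips n L → List Term
  terms s = map (term s) (codeList (termRows s) ls)

  termList : List Term
  termList = concatMap terms (stripsList L rows)

  terms⁻ : ∀ s q → q ∈ terms s → ∃ λ ρs → CodeOK (termRows s) ls ρs × q ≡ term s ρs
  terms⁻ s q q∈ = let ρs , m , e = ∈-map⁻ (term s) q∈ in ρs , codeList⁻ (termRows s) ls ρs m , e

  termList-unique : Unique termList
  termList-unique = pairs-concatMap terms (withMembership (stripsList-unique L rows))
    (λ s s∈ → unique-map (term s) (codeList-unique (termRows s) ls) λ ρs σs m m′ e →
      RHS.tableau-injective s (stripsList⁻ L rows s s∈) ρs σs (codeList⁻ (termRows s) ls ρs m) (codeList⁻ (termRows s) ls σs
        m′) (cong (λ q → proj₂ (proj₂ (proj₂ q))) e))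
    λ { (s∈ , s′∈ , s≢) u v u∈ v∈ refl → s≢ (same _ _ s∈ s′∈ (proj₁ (terms⁻ _ u u∈)) (proj₁ (terms⁻ _ v v∈))
      (proj₂ (proj₂ (terms⁻ _ u u∈))) (proj₂ (proj₂ (terms⁻ _ v v∈)))) }
    where
    same : ∀ s s′ → s ∈ stripsList L rows → s′ ∈ stripsList L rows → ∀ ρs σs {q} → q ≡ term s ρs → q ≡ term s′ σs → s ≡ s′
    same s s′ s∈ s′∈ ρs σs e e′ = strips-ext n L κ ν s s′ (proj₁ both) (proj₂ both)
      where
      eq : term s ρs ≡ term s′ σs
      eq = trans (sym e) e′
      both : (∀ t i → t ≤ n → K s t i ≡ K s′ t i) × (∀ t i → t ≤ n → O s t i ≡ O s′ t i)
      both = strips-injective (facts s (stripsList⁻ L rows s s∈)) (facts s′ (stripsList⁻ L rows s′ s′∈)) (cong proj₁ eq)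
        (cong (proj₁ ∘ proj₂) eq) (cong (proj₁ ∘ proj₂ ∘ proj₂) eq)

  term-sound : ∀ q → q ∈ termList → IsTerm σ c e₀ q
  term-sound q q∈ with concatMap⁻ terms (stripsList L rows) q∈
  ... | s , s∈ , q∈ with terms⁻ s q q∈
  ... | ρs , ok , refl = (μ-sorted , μ-skew , μ-contains) , innerOK , outerOK , contents , tableau-sound ρs ok
    where open RHS s (stripsList⁻ L rows s s∈)

  innerFill-cong : ∀ K K₂ → (∀ t i → t ≤ n → K t i ≡ K₂ t i) → innerFill K ≡ innerFill K₂
  innerFill-cong K K₂ eq = fill-cong₂ R (λ i → eq 0 i z≤n) (λ _ → refl) λ i j _ _ _ → sum<-cong n λ t t< →
    ind-cong (K t i <? j) (K₂ t i <? j) (subst (_< j) (eq t i (<⇒≤ t<))) (subst (_< j) (sym (eq t i (<⇒≤ t<))))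

  outerFill-cong : ∀ O O₂ → (∀ t i → t ≤ n → O t i ≡ O₂ t i) → outerFill O ≡ outerFill O₂
  outerFill-cong O O₂ eq = fill-cong₂ R (λ _ → refl) (λ i → eq 0 i z≤n) λ i j _ _ _ → sum<-cong n λ t t< →
    ind-cong (j ≤? O t i) (j ≤? O₂ t i) (subst (j ≤_) (eq t i (<⇒≤ t<))) (subst (j ≤_) (sym (eq t i (<⇒≤ t<))))

  -- A column of T strictly increases and its labels are at most L.
  rows≤R : ∀ μ T → IsSkew μ → Contains μ σ → IsSS μ c zeroSeq T → ∀ i j → (suc i , j) ∈ μ → i < R
  rows≤R μ T skew cont (dom , valid , semi , content , _) i j m with proj₂ cont (suc i , j) m
  ... | (r , _) , d∈ , refl with σ⇒ _ d∈
  ... | i₀ , i₀<n , refl , _ , _ = ≰⇒> λ R≤i →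
    let x , y , X , y∈ , m , x≤ = climb L (≤-trans (≤-reflexive (+-suc i₀ L)) (≤-trans (+-monoˡ-≤ L i₀<n) (m≤n⇒m≤1+n R≤i)))
                                   in length≡0 (trans (content y (≤-trans (s≤s z≤n) x≤)) (c-zero y x≤))
                                     (∈-filter⁺ (_≟ y) {xs = concatMap proj₂ T} (concatMap⁺ proj₂ m y∈) refl)
    where
    entry : ∀ i₁ → i₀ ≤ i₁ → i₁ ≤ i → ∃ λ X → ((suc i₁ , j) , X) ∈ T
    entry i₁ a b = lookupF [] T (suc i₁ , j) , lookupF-∈ [] T (suc i₁ , j) (proj₂ (proj₂ dom) _ (proj₂ skew _ _ (suc i₁ , j)
      (proj₁ cont _ d∈) m (s≤s a , ≤-refl) (s≤s b , ≤-refl)))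
    climb : ∀ k → i₀ + suc k ≤ suc i → ∃ λ i₁ → ∃ λ y → ∃ λ X → y ∈ X × ((suc i₁ , j) , X) ∈ T × suc k ≤ y
    climb k h = i₀ + k , go k (≤-pred (≤-trans (≤-reflexive (sym (+-suc i₀ k))) h))
      where
      go : ∀ k → i₀ + k ≤ i → ∃ λ y → ∃ λ X → y ∈ X × ((suc (i₀ + k) , j) , X) ∈ T × suc k ≤ y
      go zero h = let X , X∈ = entry (i₀ + 0) (m≤m+n i₀ 0) h ; v = valid _ X X∈ ; y , y∈ = nonEmpty⁻ X (proj₁ v) in y , X ,
        y∈ , X∈ , proj₂ (proj₂ v) y y∈
      go (suc k) h = let y , X , y∈ , X∈ , k≤ = go k (≤-trans (+-monoʳ-≤ i₀ (n≤1+n k)) h)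
                         Y , Y∈ = entry (i₀ + suc k) (m≤m+n i₀ (suc k)) h ; z , z∈ = nonEmpty⁻ Y (proj₁ (valid _ Y Y∈))
                     in z , Y , z∈ , Y∈ , ≤-<-trans k≤ (proj₂ (semi _ X _ Y X∈ Y∈) refl
                       (s≤s (≤-reflexive (sym (+-suc i₀ k)))) y z y∈ z∈)

  -- The order of reconstruction: T bounds the number of rows, so μ has row ends κ′ and ν′; between
  -- these and σ the level sets of T′ and T″ give K and O and hence the strips s; then T is decoded
  -- from a code for the rows of s.
  term-complete : ∀ q → IsTerm σ c e₀ q → q ∈ termList
  term-complete (μ , T′ , T″ , T) ((sorted , skew , cont) , in-ok , out-ok , conts , ss) =
    subst (_∈ termList) (sym q≡) (concatMap⁺ terms (stripsList⁺ L rows s ok) (∈-map⁺ (term s) (codeList⁺ (termRows s) ls ρs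
      okρ)))
    where
    open Recover μ sorted skew cont (rows≤R μ T skew cont ss) using (κ′; ν′; bounds; μ≡boxes)
    module C = StripRecover.Recovered sk L e₀ e-zero bounds T′ T″ (subst (λ m → InnerOK m T′) μ≡boxes in-ok)
      (subst (λ m → OuterOK m T″) μ≡boxes out-ok) conts
    s : Strips n L
    s = stripsOf n L C.K C.O
    ok : StripsOK L rows s
    ok = stripsOK n L κ ν (e₀ ∘ suc) C.K C.O C.facts
    K≡ : ∀ t i → t ≤ n → C.K t i ≡ K s t i
    K≡ t i t≤ = sym (innerAt-stripsOf C.facts t i t≤)
    O≡ : ∀ t i → t ≤ n → C.O t i ≡ O s t i
    O≡ t i t≤ = sym (outerAt-stripsOf C.facts t i t≤)
    μ≡ : μ ≡ Shape (K s) (O s)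
    μ≡ = trans μ≡boxes (cong keys (fill-cong₂ R (λ i → trans (sym (C.K0≡ i)) (K≡ 0 i z≤n)) (λ i → trans (sym (C.O0≡ i))
      (O≡ 0 i z≤n)) λ _ _ _ _ _ → refl))
    open RHS s ok using (tableau-complete)
    found : ∃ λ ρs → CodeOK (termRows s) ls ρs × T ≡ proj₂ (proj₂ (proj₂ (term s ρs)))
    found = tableau-complete T (subst (λ m → IsSS m c zeroSeq T) μ≡ ss)
    ρs : Vec (RowCode L) R
    ρs = proj₁ found
    okρ : CodeOK (termRows s) ls ρs
    okρ = proj₁ (proj₂ found)
    q≡ : (μ , T′ , T″ , T) ≡ term s ρs
    q≡ = cong₂ _,_ μ≡ (cong₂ _,_ (trans C.T′≡ (innerFill-cong C.K (K s) K≡))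
      (cong₂ _,_ (trans C.T″≡ (outerFill-cong C.O (O s) O≡)) (proj₂ (proj₂ found))))

  termsOf : Parity → List Term
  termsOf p = filter (λ q → parity (length (proj₁ (proj₂ q))) ≟ᴾ p) termList

  termsCard : ∀ p → HasCard (Terms p σ c e₀) (length (termsOf p))
  termsCard p = hasCard _≟ᵀ_ (termsOf p) (Uniqueₚ.filter⁺ P? termList-unique)
    (λ q q∈ → let m , e = ∈-filter⁻ P? {xs = termList} q∈ in term-sound q m , e)
    (λ q (t , e) → ∈-filter⁺ P? (term-complete q t) e)
    where
    P? : ∀ (q : Term) → Dec (parity (length (proj₁ (proj₂ q))) ≡ p)
    P? q = parity (length (proj₁ (proj₂ q))) ≟ᴾ p

  -- For fixed strips the sign is constant, because T′ has as many boxes as were removed, and T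
  -- ranges over the codes counted by `cnt`.
  termCount : ∑ termList (λ q → sg (length (proj₁ (proj₂ q))) 1ℤ) ≡ strips L rows (λ a b → cnt 0 (plain a b) ls)
  termCount = begin
    ∑ termList (λ q → sg (length (proj₁ (proj₂ q))) 1ℤ)
      ≡⟨ ∑-concatMap terms (stripsList L rows) _ ⟩
    ∑ (stripsList L rows) (λ s → ∑ (terms s) (λ q → sg (length (proj₁ (proj₂ q))) 1ℤ))
      ≡⟨ (∑-cong∈ (stripsList L rows) λ s s∈ → count s (stripsList⁻ L rows s s∈)) ⟩
    ∑ (stripsList L rows) (λ s → sg (removed L rows s) (cnt 0 (plain (inner n L s) (outer n L s)) ls))
      ≡⟨ stripsList-sum L rows (λ a b → cnt 0 (plain a b) ls) ⟩
    strips L rows (λ a b → cnt 0 (plain a b) ls) ∎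
    where
    open ≡-Reasoning
    count : ∀ s → StripsOK L rows s → ∑ (terms s) (λ q → sg (length (proj₁ (proj₂ q))) 1ℤ) ≡ sg (removed L rows s)
      (cnt 0 (plain (inner n L s) (outer n L s)) ls)
    count s ok = begin
      ∑ (terms s) (λ q → sg (length (proj₁ (proj₂ q))) 1ℤ)
        ≡⟨ ∑-map (term s) (codeList (termRows s) ls) _ ⟩
      ∑ (codeList (termRows s) ls) (λ _ → sg (length (innerFill (K s))) 1ℤ)
        ≡⟨ sym (sg-∑ (length (innerFill (K s))) (codeList (termRows s) ls) (λ _ → 1ℤ)) ⟩
      sg (length (innerFill (K s))) (∑ (codeList (termRows s) ls) (λ _ → 1ℤ))
        ≡⟨ cong₂ sg (trans (RHS.length-inner s ok) (sym (removed-sum n L κ ν (e₀ ∘ suc) s (facts s ok))))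
          (trans (codeList-count (termRows s) ls) (cong (λ r → cnt 0 r ls) (sym same-rows))) ⟩
      sg (removed L rows s) (cnt 0 (plain (inner n L s) (outer n L s)) ls) ∎
      where
      same-rows : plain (inner n L s) (outer n L s) ≡ termRows s
      same-rows = trans (plain≡rowsOf (inner n L s) (outer n L s)) (rowsOf-cong R (λ _ → 0) (at-inner n L κ s)
        (at-outer n L ν s))

  count : ℤ.pos (length ssList) ≡ ℤ.pos (length (termsOf even)) +ᶻ (-ᶻ ℤ.pos (length (termsOf odd)))
  count = begin
    ℤ.pos (length ssList) ≡⟨ ssCount ⟩
    cnt 0 (padded L rows) ls
      ≡⟨ expansion L rows ls ≤-refl (goodRows n κ ν (e₀ ∘ suc) κ-dec ν-dec β≤κ β≤ν κ<ν ν≤W) (allLevels L _ _ _ _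
        (λ _ → hdα≤W n κ ν (e₀ ∘ suc) (κ≤W 0))) ⟩
    strips L rows (λ a b → cnt 0 (plain a b) ls) ≡⟨ sym termCount ⟩
    ∑ termList (λ q → sg (length (proj₁ (proj₂ q))) 1ℤ) ≡⟨ ∑-parity (λ q → length (proj₁ (proj₂ q))) termList ⟩
    ℤ.pos (length (termsOf even)) +ᶻ (-ᶻ ℤ.pos (length (termsOf odd))) ∎
    where
    open ≡-Reasoning
    hdα≤W : ∀ n a b k → a 0 ≤ W → hdα (rowsOf n a b k) ≤ W
    hdα≤W zero    a b k _ = β≤W
    hdα≤W (suc n) a b k h = h

-- If e k ≠ 0 for some k below the last row n, then neither side has any tableau:
-- a label k of T″ in row r > k would force a larger or equal label into the box of row k above it.
module BelowLastRow {σ n β κ ν} (sk : SkewRows σ n β κ ν) (c e : ℕ → ℕ) (k : ℕ) (n<k : n < k) (ek≢0 : e k ≢ 0) where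
  open SkewRows sk

  row≤n : ∀ {r j} → (r , j) ∈ σ → r ≤ n
  row≤n {r} {j} m with σ⇒ (r , j) m
  ... | i , i< , refl , _ = i<

  occurs : ∀ (xs : List ℕ) {k} → length (filter (_≟ k) xs) ≢ 0 → k ∈ xs
  occurs xs {k} ne with filter (_≟ k) xs in eq
  ... | []    = contradiction refl ne
  ... | y ∷ _ with ∈-filter⁻ (_≟ k) {xs = xs} (subst (y ∈_) (sym eq) (here refl))
  ...   | y∈ , refl = y∈

  no-ss : ∀ T → ¬ IsSS σ c e T
  no-ss T ((_ , dom , _) , _ , _ , _ , rows) = ek≢0
    (trans (sym (+-cancelˡ-≡ 0 _ _ (trans (rows k (≤-trans (s≤s z≤n) n<k)) (cong (λ F → length F + e k) none))))
      (cong (length ∘ concatMap proj₂) none))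
    where
    none : rowPart k T ≡ []
    none = no-member λ { ((r , j) , v) m → let m′ , r≡k = ∈-filter⁻ (λ p → row (proj₁ p) ≟ k) {xs = T} m in
        <⇒≱ n<k (subst (_≤ n) r≡k (row≤n (dom (r , j) (∈-map⁺ proj₁ m′)))) }

  no-term : ∀ q → ¬ IsTerm σ c e q
  no-term (μ , T′ , T″ , T) ((_ , (_ , skew) , cont , _) , ((_ , dom′ , _) , _ , _ , bound′) , ((_ , dom″ , dom″⁺) , _ , rev
    , bound″) , contents , _)
    with contentT k T′ ≟ 0
  -- A label k in T′ would need a row of number at least k > n, but T′ lies above boxes of σ.
  ... | no ne with ∈-map⁻ proj₂ (occurs (map proj₂ T′) ne)
  ...   | (b , _) , m , refl = let _ , _ , _ , d∈ , _ , r< = dom′ b (∈-map⁺ proj₁ m) in <⇒≱ n<k (≤-trans (bound′ b k m)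
    (≤-trans (<⇒≤ r<) (row≤n d∈)))
  no-term (μ , T′ , T″ , T) ((_ , (_ , skew) , cont , _) , ((_ , dom′ , _) , _ , _ , bound′) , ((_ , dom″ , dom″⁺) , _ , rev
    , bound″) , contents , _)
      | yes e′ with ∈-map⁻ proj₂ (occurs (map proj₂ T″) (λ e″ → ek≢0 (trans (sym (contents k (≤-trans (s≤s z≤n) n<k)))
        (cong₂ _+_ e′ e″))))
  ...   | ((r , j) , _) , m , refl with dom″ (r , j) (∈-map⁺ proj₁ m)
  ...   | b∈ , _ , (r₂ , _) , d∈ , refl , r₂<r = <⇒≱ (bound″ (k , j) w w∈) (proj₂ (rev (k , j) w (r , j) k w∈ m) refl
    (bound″ (r , j) k m))
    where
    r₂<k : r₂ < k
    r₂<k = ≤-<-trans (row≤n d∈) n<k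
    above∈ : InB μ σ (k , j)
    above∈ = skew (r₂ , j) (r , j) (k , j) (cont (r₂ , j) d∈) b∈ (<⇒≤ r₂<k , ≤-refl) (<⇒≤ (bound″ (r , j) k m) , ≤-refl) ,
      (λ k∈ → <⇒≱ n<k (row≤n k∈)) , (r₂ , j) , d∈ , refl , r₂<k
    w : ℕ
    w = lookupF 0 T″ (k , j)
    w∈ : ((k , j) , w) ∈ T″
    w∈ = lookupF-∈ 0 T″ (k , j) (dom″⁺ (k , j) above∈)

  none : ∀ {A : Set} {P : A → Set} → DecidableEquality A → (∀ x → ¬ P x) → HasCard (Refinement A P) 0
  none _≟_ h = hasCard _≟_ [] [] (λ _ ()) (λ x p → contradiction p (h x))

open import Data.Integer using (+_; _-_)

theorem3p5 : (σ : List Box) → IsSkew σ → Connected σ → TopRow1 σ →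
    (c e : ℕ → ℕ) → EventuallyZero c → EventuallyZero e →
    Σ ℕ λ N → Σ ℕ λ P → Σ ℕ λ M →
    HasCard (SS σ c e) N × HasCard (Terms even σ c e) P × HasCard (Terms odd σ c e) M
    × (+ N) ≡ (+ P) - (+ M)
-- The expansion prescribes one excess per row of σ, so it needs e to vanish beyond the last row. If
-- e does not, there is neither a tableau nor a term, and the identity reads 0 = 0 - 0. The bound E
-- makes the search for such a k finite.
theorem3p5 σ skew conn top c e (L , c-zero) (E , e-zero) with anyUpTo? (λ k → FromConnected.n σ skew conn top <? k ×-dec ¬?
  (e k ≟ 0)) E
... | yes (k , _ , n<k , ek≢0) = 0 , 0 , 0 , none _≟ˢ_ no-ss , none _≟ᵀ_ (λ q t → no-term q (proj₁ t)) , none _≟ᵀ_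
  (λ q t → no-term q (proj₁ t)) , refl
  where open BelowLastRow (FromConnected.skewRows σ skew conn top) c e k n<k ek≢0
... | no ¬big = length ssList , length (termsOf even) , length (termsOf odd) , ssCard , termsCard even , termsCard odd ,
  count
  where
  open Assembly (FromConnected.skewRows σ skew conn top) L c e (λ k L<k → c-zero k (<⇒≤ L<k))
    (λ k n<k → decidable-stable (e k ≟ 0) λ ek≢0 → ¬big (k , ≰⇒> (λ E≤k → ek≢0 (e-zero k E≤k)) , n<k , ek≢0))
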